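{- Let $s\ge 2$ be a fixed integer. For $i=1,\ldots,s$ let $E_i$ be an elliptic curve over $\mathbb{Q}$ (not necessarily distinct) given by a short Weierstrass equation $y^2=x^3+a_ix+b_i$ with $a_i,b_i\in\mathbb{Z}$, let $P_i\in E_i(\mathbb{Q})$ be a non-torsion point and let $Q_i\in E_i(\mathbb{Q})$ be an arbitrary point. For $M\ge 0$ and $N\ge 1$ let $X^*_{\mathsf P,\mathsf Q}(M,N)$ be the number of integer $s$-tuples $(n_1,\ldots,n_s)\in(M,M+N]^s$ such that $x(n_1P_1+Q_1),\ldots,x(n_sP_s+Q_s)$ are multiplicatively dependent of maximal rank. Then, uniformly over $M\ge 0$, \[ X^*_{\mathsf P,\mathsf Q}(M,N)\ll N^{\,s-\lceil s/2\rceil/(\lceil s/2\rceil+3)}, \] where the implied constant depends only on $s$ and on the points $P_1,\ldots,P_s,Q_1,\ldots,Q_s$ (hence on the curves), and not on $M$ or $N$.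
   Context: For an elliptic curve $E$ over $\mathbb{Q}$ given by $y^2=x^3+ax+b$ with $a,b\in\mathbb{Z}$, every point $R\in E(\mathbb{Q})$ other than the point at infinity is written in lowest form as $R=(a_R/d_R^2,\; b_R/d_R^3)$ with $d_R\in\mathbb{N}$, $a_R,b_R\in\mathbb{Z}$ and $\gcd(a_Rb_R,d_R)=1$; $x(R)=a_R/d_R^2$ is its $x$-coordinate. Nonzero complex numbers $\gamma_1,\ldots,\gamma_s$ are multiplicatively dependent if there are integers $k_1,\ldots,k_s$, not all zero, with $\gamma_1^{k_1}\cdots\gamma_s^{k_s}=1$; they are multiplicatively dependent of maximal rank if they are multiplicatively dependent and no proper sub-tuple of $(\gamma_1,\ldots,\gamma_s)$ is multiplicatively dependent. The notation $U\ll V$ means $|U|\le cV$ for some constant $c>0$. -}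

module Defs where

open import Data.Nat as ℕ using (ℕ; zero; suc; _≤_; _<_; _+_; _∸_; ⌈_/2⌉)
open import Data.Integer as ℤ using (ℤ; +_; -[1+_])
open import Data.Rational using (ℚ; 0ℚ; 1ℚ; _/_; _÷_; 1/_; NonZero; ≢-nonZero)
  renaming (_+_ to _+ℚ_; _-_ to _-ℚ_; _*_ to _*ℚ_)
open import Data.Rational.Properties using (_≟_)
open import Data.Fin as Fin using (Fin)
open import Data.Vec using (Vec; lookup)
open import Data.Maybe using (Maybe; just; nothing)
open import Data.Unit using (⊤)
open import Data.Product using (Σ; ∃; ∃-syntax; _×_; _,_)
open import Relation.Binary.PropositionalEquality using (_≡_; _≢_)
open import Relation.Nullary using (¬_; yes; no)

record Curve : Set where
  field
    a : ℤ
    b : ℤ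
    nonsingular : (ℤ.+ 4 ℤ.* a ℤ.* a ℤ.* a) ℤ.+ (ℤ.+ 27 ℤ.* b ℤ.* b) ≢ ℤ.+ 0

ι : ℤ → ℚ
ι z = z / 1

data Pt : Set where
  ∞   : Pt
  aff : ℚ → ℚ → Pt

OnCurve : Curve → Pt → Set
OnCurve E ∞ = ⊤
OnCurve E (aff x y) = y *ℚ y ≡ ((x *ℚ x) *ℚ x +ℚ ι (Curve.a E) *ℚ x) +ℚ ι (Curve.b E)

-- Chord-and-tangent group law (formulas valid for points on the curve
-- y² = x³ + a x + b).  For P₁ = (x,y₁), P₂ = (x,y₂) on the curve with equal
-- x-coordinate, y₂ = ± y₁; if y₁ + y₂ = 0 the sum is ∞, otherwise y₁ = y₂
-- and the tangent slope is (3x² + a)/(2y₁) = (3x² + a)/(y₁ + y₂).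
add : Curve → Pt → Pt → Pt
add E ∞ Q = Q
add E (aff x₁ y₁) ∞ = aff x₁ y₁
add E (aff x₁ y₁) (aff x₂ y₂) with (x₂ -ℚ x₁) ≟ 0ℚ | (y₁ +ℚ y₂) ≟ 0ℚ
... | no dx≢0 | _ =
  let instance _ = ≢-nonZero dx≢0
      λ' = (y₂ -ℚ y₁) ÷ (x₂ -ℚ x₁)
      x₃ = (λ' *ℚ λ' -ℚ x₁) -ℚ x₂
  in aff x₃ (λ' *ℚ (x₁ -ℚ x₃) -ℚ y₁)
... | yes _ | yes _ = ∞
... | yes _ | no dy≢0 =
  let instance _ = ≢-nonZero dy≢0
      λ' = (ι (+ 3) *ℚ x₁ *ℚ x₁ +ℚ ι (Curve.a E)) ÷ (y₁ +ℚ y₂)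
      x₃ = (λ' *ℚ λ' -ℚ x₁) -ℚ x₂
  in aff x₃ (λ' *ℚ (x₁ -ℚ x₃) -ℚ y₁)

mul : Curve → ℕ → Pt → Pt
mul E zero P = ∞
mul E (suc n) P = add E P (mul E n P)

NonTorsion : Curve → Pt → Set
NonTorsion E P = ∀ (n : ℕ) → 1 ≤ n → mul E n P ≢ ∞

xcoord : Pt → Maybe ℚ
xcoord ∞ = nothing
xcoord (aff x y) = just x

pow : ℚ → ℕ → ℚ
pow x zero = 1ℚ
pow x (suc n) = x *ℚ pow x n

zpow : (x : ℚ) → .{{NonZero x}} → ℤ → ℚ
zpow x (+ n) = pow x n
zpow x -[1+ n ] = pow (1/ x) (suc n)

prod : ∀ {m} → (Fin m → ℚ) → ℚ
prod {zero} f = 1ℚ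
prod {suc m} f = f Fin.zero *ℚ prod (λ i → f (Fin.suc i))

MultDep : ∀ {m} (γ : Fin m → ℚ) → (nz : ∀ i → NonZero (γ i)) → Set
MultDep {m} γ nz =
  Σ (Fin m → ℤ) λ k → (∃[ i ] k i ≢ + 0) × (prod (λ i → zpow (γ i) {{nz i}} (k i)) ≡ 1ℚ)

-- proper sub-tuple: (γ (f 1), …, γ (f m)) with f : Fin m → Fin s strictly
-- increasing and m < s.
StrictMono : ∀ {m s} → (Fin m → Fin s) → Set
StrictMono f = ∀ i j → i Fin.< j → f i Fin.< f j

MaxRankDep : ∀ {s} (γ : Fin s → ℚ) → (nz : ∀ i → NonZero (γ i)) → Set
MaxRankDep {s} γ nz =
  MultDep γ nz ×
  (∀ (m : ℕ) → m < s → (f : Fin m → Fin s) → StrictMono f →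
     ¬ MultDep (λ i → γ (f i)) (λ i → nz (f i)))

Good : ∀ {s} → (Fin s → Curve) → (P Q : Fin s → Pt) → Vec ℕ s → Set
Good {s} E P Q n =
  Σ (Fin s → ℚ) λ γ →
    (∀ i → xcoord (add (E i) (mul (E i) (lookup n i) (P i)) (Q i)) ≡ just (γ i)) ×
    Σ (∀ i → NonZero (γ i)) λ nz → MaxRankDep γ nz

InBox : ∀ {s} → ℕ → ℕ → Vec ℕ s → Set
InBox {s} M N n = ∀ (i : Fin s) → M < lookup n i × lookup n i ≤ M + N

{-# OPTIONS --safe #-}
-- Write x_i = x(n_i P_i + Q_i).  Fix T and call a prime p typical if p > T², p divides no
-- discriminant, and p divides no denominator of x(d P_i) with 1 ≤ d ≤ T.  Points reducing to
-- O modulo p form a group, so for typical p only O(N/T) values n_i make p divide the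
-- numerator or the denominator of x_i.
--
-- A relation of maximal rank reads Σ k_i v_p(x_i) = 0 with all k_i ≠ 0.  Reveal the n_i one
-- by one.  If the revealed part of the sum does not vanish at all typical p, then it does not
-- vanish at one of at most s pivot primes, which depend on the revealed coordinates only;
-- this prime divides some x_j not yet revealed, and n_j has O(N/T) values.  If it vanishes,
-- start afresh with the remaining indices.  A fresh start is always followed by a restricted
-- choice, so O(N^s T^(-⌈s/2⌉)) tuples occur in which every denominator has a typical prime.
--
-- Otherwise some denominator is composed of the O(T³ / log T) other primes.  Heights grow
-- quadratically, while at each of these primes and at infinity two points n, n′ can be close
-- to O only to the extent that the height c (n - n′)² of their difference permits; over a
-- dyadic interval of n this leaves O(T³ / log T) possibilities.  Finally T^(⌈s/2⌉ + 3) ≈ N.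
module Submission where

open import Defs
open import Data.Nat using (ℕ)
open import Data.Fin using (Fin)
open import Data.Integer using (ℤ)

-- No reduction map, canonical height or real topology occurs. Local and global facts alike come
-- from one relation: the abscissas of A + B and A - B are the roots of a binary quadratic form with
-- coefficients biquadratic in those of A and B. In coprime integer coordinates it holds up to a
-- nonzero integer factor `ν`; subgroups of points near O and the parallelogram law for the naive
-- height result from cancelling or bounding `ν`.
--
-- Where T³ comes from: the denominator of x(dP) is exp(O(d²)), so the product over d ≤ T is
-- exp(O(T³)). A prime factor above T² contributes at least log T to the exponent, which leaves O(T³
-- / log T) of them; the primes up to T² are few enough to be given away. The logarithm saved here
-- pays for the O(log N) dyadic blocks met by the box, log N and log T being comparable when T is a
-- fixed power of N. Uniformity in M is free, since a box that starts far enough out lies in one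
-- block and any other box lies in an initial segment of length O(N).

-- Field arithmetic in ℚ

module RationalField where
  open import Data.Rational using (ℚ; 0ℚ; 1ℚ; _+_; _-_; _*_; -_; _÷_; 1/_; NonZero; ≢-nonZero)
  open import Data.Rational.Properties as ℚP using (_≟_)
  open import Data.Maybe using (Maybe; just; nothing)
  open import Data.Sum using (_⊎_; inj₁; inj₂)
  open import Data.List using (_∷_; [])
  open import Level using (0ℓ)
  open import Relation.Nullary using (yes; no)
  open import Relation.Binary.PropositionalEquality
  open import Tactic.RingSolver.Core.AlmostCommutativeRing using (AlmostCommutativeRing; fromCommutativeRing)
  open import Tactic.RingSolver using (solve)

  ℚ-ring : AlmostCommutativeRing 0ℓ 0ℓ
  ℚ-ring = fromCommutativeRing ℚP.+-*-commutativeRing isZero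
    where
    isZero : ∀ x → Maybe (0ℚ ≡ x)
    isZero x with 0ℚ ≟ x
    ... | yes p = just p
    ... | no _  = nothing

  infixr 4 _⊹_
  infix 5 _·_

  sub≡0 : ∀ {x y : ℚ} → x ≡ y → x - y ≡ 0ℚ
  sub≡0 {x} refl = ℚP.+-inverseʳ x

  -- Linear combinations of hypotheses: linear (c₁ · h₁ ⊹ … ⊹ cₙ · hₙ) proves
  -- u ≡ v from the ring identity u - v ≡ Σ cᵢ * (lᵢ - rᵢ), where hᵢ : lᵢ ≡ rᵢ.
  _·_ : ∀ c {l r : ℚ} → l ≡ r → c * (l - r) ≡ 0ℚ
  c · h = trans (cong (c *_) (sub≡0 h)) (ℚP.*-zeroʳ c)

  _⊹_ : ∀ {u v : ℚ} → u ≡ 0ℚ → v ≡ 0ℚ → u + v ≡ 0ℚ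
  refl ⊹ refl = refl

  sub≡0⇒≡ : ∀ {u v : ℚ} → u - v ≡ 0ℚ → u ≡ v
  sub≡0⇒≡ {u} {v} h = trans (id₁ u v) (trans (cong (_+ v) h) (ℚP.+-identityˡ v))
    where
    id₁ : ∀ u v → u ≡ (u - v) + v
    id₁ u v = solve (u ∷ v ∷ []) ℚ-ring

  linear : ∀ {u v w : ℚ} → w ≡ 0ℚ → u - v ≡ w → u ≡ v
  linear w≡0 h = sub≡0⇒≡ (trans h w≡0)

  *-cancel : ∀ {c x y : ℚ} → c ≢ 0ℚ → c * x ≡ c * y → x ≡ y
  *-cancel {c} {x} {y} c≢0 h =
    trans (sym (lem x)) (trans (cong (1/ c *_) h) (lem y))
    where
    instance _ = ≢-nonZero c≢0
    lem : ∀ z → 1/ c * (c * z) ≡ z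
    lem z = trans (sym (ℚP.*-assoc (1/ c) c z))
              (trans (cong (_* z) (ℚP.*-inverseˡ c)) (ℚP.*-identityˡ z))

  zero-product : ∀ {x y : ℚ} → x * y ≡ 0ℚ → x ≡ 0ℚ ⊎ y ≡ 0ℚ
  zero-product {x} {y} h with x ≟ 0ℚ
  ... | yes x≡0 = inj₁ x≡0
  ... | no x≢0 = inj₂ (*-cancel x≢0 (trans h (sym (ℚP.*-zeroʳ x))))

  double≡0 : ∀ {x : ℚ} → x + x ≡ 0ℚ → x ≡ 0ℚ
  double≡0 {x} h = *-cancel {1ℚ + 1ℚ} (λ ()) (trans (id₂ x) (trans h (sym (ℚP.*-zeroʳ (1ℚ + 1ℚ)))))
    where
    id₂ : ∀ x → (1ℚ + 1ℚ) * x ≡ x + x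
    id₂ x = solve (x ∷ []) ℚ-ring

  ÷-* : ∀ p q .{{_ : NonZero q}} → (p ÷ q) * q ≡ p
  ÷-* p q = trans (ℚP.*-assoc p (1/ q) q) (trans (cong (p *_) (ℚP.*-inverseˡ q)) (ℚP.*-identityʳ p))

-- The embedding of ℤ in ℚ

module Embedding where
  open import Data.Rational using (_+_; _*_; toℚᵘ; ↥_; ↧_)
  open import Data.Rational.Unnormalised using (mkℚᵘ; *≡*; _≃_)
  open import Data.Rational.Unnormalised.Properties as ℚᵘP using (≃-trans; ≃-sym)
  open import Data.Rational.Properties as ℚP using (toℚᵘ-injective; toℚᵘ-fromℚᵘ; toℚᵘ-homo-+; toℚᵘ-homo-*)
  open import Data.Integer as ℤ using (ℤ)
  import Data.Integer.Properties as ℤP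
  open import Data.Integer.Tactic.RingSolver using (solve-∀)
  open import Relation.Binary.PropositionalEquality

  toℚᵘ-ι : ∀ z → toℚᵘ (ι z) ≃ mkℚᵘ z 0
  toℚᵘ-ι z = toℚᵘ-fromℚᵘ (mkℚᵘ z 0)

  ι-+ : ∀ x y → ι (x ℤ.+ y) ≡ ι x + ι y
  ι-+ x y = toℚᵘ-injective (≃-trans (toℚᵘ-ι (x ℤ.+ y)) (≃-trans (*≡* (id x y))
    (≃-sym (≃-trans (toℚᵘ-homo-+ (ι x) (ι y)) (ℚᵘP.+-cong (toℚᵘ-ι x) (toℚᵘ-ι y))))))
    where
    id : ∀ x y → (x ℤ.+ y) ℤ.* ℤ.+ 1 ≡ (x ℤ.* ℤ.+ 1 ℤ.+ y ℤ.* ℤ.+ 1) ℤ.* ℤ.+ 1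
    id = solve-∀

  ι-* : ∀ x y → ι (x ℤ.* y) ≡ ι x * ι y
  ι-* x y = toℚᵘ-injective (≃-trans (toℚᵘ-ι (x ℤ.* y))
    (≃-sym (≃-trans (toℚᵘ-homo-* (ι x) (ι y)) (ℚᵘP.*-cong (toℚᵘ-ι x) (toℚᵘ-ι y)))))

  ι-injective : ∀ {x y} → ι x ≡ ι y → x ≡ y
  ι-injective {x} {y} h with ≃-trans (≃-sym (toℚᵘ-ι x)) (≃-trans (ℚP.toℚᵘ-cong h) (toℚᵘ-ι y))
  ... | *≡* e = trans (sym (ℤP.*-identityʳ x)) (trans e (ℤP.*-identityʳ y))

  *-ι↧ : ∀ x → x * ι (↧ x) ≡ ι (↥ x)
  *-ι↧ x@record{} = toℚᵘ-injective (≃-trans (toℚᵘ-homo-* x (ι (↧ x)))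
    (≃-trans (ℚᵘP.*-cong (*≡* {toℚᵘ x} {toℚᵘ x} refl) (toℚᵘ-ι (↧ x)))
      (≃-trans (*≡* (id (↥ x) (↧ x))) (≃-sym (toℚᵘ-ι (↥ x))))))
    where
    id : ∀ n d → n ℤ.* d ℤ.* ℤ.+ 1 ≡ n ℤ.* (d ℤ.* ℤ.+ 1)
    id = solve-∀

-- The chord-and-tangent group law over ℚ

module GroupLaw where
  open RationalField
  open Embedding
  open import Data.Rational using (ℚ; 0ℚ; 1ℚ; _+_; _-_; _*_; -_; _÷_; ≢-nonZero)
  open import Data.Rational.Properties as ℚP using (_≟_)
  open import Data.Integer as ℤ using (ℤ)
  open import Data.Unit using (tt)
  open import Data.Product using (Σ; ∃; _×_; _,_; proj₁)
  open import Data.Sum using (_⊎_; inj₁; inj₂)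
  open import Data.List using (_∷_; [])
  open import Relation.Nullary using (¬_; Dec; yes; no; contradiction)
  open import Relation.Nullary.Decidable using (_×-dec_)
  open import Relation.Binary.PropositionalEquality
  open import Tactic.RingSolver using (solve)

  -- (x₁,y₁), (x₂,y₂), (x₃,y₃) are, with multiplicity, the intersections of the
  -- line y = l x + n with the curve: x³ + a x + b - (l x + n)² = ∏ (x - xᵢ).
  record Col (a b x₁ y₁ x₂ y₂ x₃ y₃ l n : ℚ) : Set where
    constructor col
    field
      on₁ : y₁ ≡ l * x₁ + n
      on₂ : y₂ ≡ l * x₂ + n
      on₃ : y₃ ≡ l * x₃ + n
      e₁ : x₁ + x₂ + x₃ ≡ l * l
      e₂ : x₁ * x₂ + x₁ * x₃ + x₂ * x₃ ≡ a - (l * n + l * n)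
      e₃ : x₁ * x₂ * x₃ ≡ n * n - b

  module _ {a b x₁ y₁ x₂ y₂ x₃ y₃ l n : ℚ} where
    swap₁₂ : Col a b x₁ y₁ x₂ y₂ x₃ y₃ l n → Col a b x₂ y₂ x₁ y₁ x₃ y₃ l n
    swap₁₂ (col o₁ o₂ o₃ e₁ e₂ e₃) = col o₂ o₁ o₃
      (linear (1ℚ · e₁) (solve (x₁ ∷ x₂ ∷ x₃ ∷ l ∷ []) ℚ-ring))
      (linear (1ℚ · e₂) (solve (x₁ ∷ x₂ ∷ x₃ ∷ l ∷ a ∷ n ∷ []) ℚ-ring))
      (linear (1ℚ · e₃) (solve (x₁ ∷ x₂ ∷ x₃ ∷ n ∷ b ∷ []) ℚ-ring))

    swap₂₃ : Col a b x₁ y₁ x₂ y₂ x₃ y₃ l n → Col a b x₁ y₁ x₃ y₃ x₂ y₂ l n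
    swap₂₃ (col o₁ o₂ o₃ e₁ e₂ e₃) = col o₁ o₃ o₂
      (linear (1ℚ · e₁) (solve (x₁ ∷ x₂ ∷ x₃ ∷ l ∷ []) ℚ-ring))
      (linear (1ℚ · e₂) (solve (x₁ ∷ x₂ ∷ x₃ ∷ l ∷ a ∷ n ∷ []) ℚ-ring))
      (linear (1ℚ · e₃) (solve (x₁ ∷ x₂ ∷ x₃ ∷ n ∷ b ∷ []) ℚ-ring))

    negCol : Col a b x₁ y₁ x₂ y₂ x₃ y₃ l n → Col a b x₁ (- y₁) x₂ (- y₂) x₃ (- y₃) (- l) (- n)
    negCol (col o₁ o₂ o₃ e₁ e₂ e₃) = col (neg o₁) (neg o₂) (neg o₃)
      (linear (1ℚ · e₁) (solve (x₁ ∷ x₂ ∷ x₃ ∷ l ∷ []) ℚ-ring))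
      (linear (1ℚ · e₂) (solve (x₁ ∷ x₂ ∷ x₃ ∷ l ∷ a ∷ n ∷ []) ℚ-ring))
      (linear (1ℚ · e₃) (solve (x₁ ∷ x₂ ∷ x₃ ∷ n ∷ b ∷ []) ℚ-ring))
      where
      neg : ∀ {x y} → y ≡ l * x + n → - y ≡ - l * x + - n
      neg {x} {y} o = linear ((- 1ℚ) · o) (solve (x ∷ y ∷ l ∷ n ∷ []) ℚ-ring)

    Col⇒on₁ : Col a b x₁ y₁ x₂ y₂ x₃ y₃ l n → y₁ * y₁ ≡ x₁ * x₁ * x₁ + a * x₁ + b
    Col⇒on₁ (col o₁ o₂ o₃ e₁ e₂ e₃) =
      linear ((y₁ + (l * x₁ + n)) · o₁ ⊹ (- (x₁ * x₁)) · e₁ ⊹ x₁ · e₂ ⊹ (- 1ℚ) · e₃)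
        (solve (x₁ ∷ x₂ ∷ x₃ ∷ y₁ ∷ l ∷ a ∷ n ∷ b ∷ []) ℚ-ring)

    -- Two monic cubics that agree in the coefficients of x² and x differ by a constant, and this
    -- constant is zero because both vanish at `x₁`. Hence `e₃` comes for free.
    mkCol : y₁ * y₁ ≡ x₁ * x₁ * x₁ + a * x₁ + b →
      y₁ ≡ l * x₁ + n → y₂ ≡ l * x₂ + n → y₃ ≡ l * x₃ + n →
      x₁ + x₂ + x₃ ≡ l * l → x₁ * x₂ + x₁ * x₃ + x₂ * x₃ ≡ a - (l * n + l * n) →
      Col a b x₁ y₁ x₂ y₂ x₃ y₃ l n
    mkCol c o₁ o₂ o₃ e₁ e₂ = col o₁ o₂ o₃ e₁ e₂
      (linear (x₁ · e₂ ⊹ (- (x₁ * x₁)) · e₁ ⊹ (- 1ℚ) · c ⊹ (y₁ + (l * x₁ + n)) · o₁)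
        (solve (x₁ ∷ x₂ ∷ x₃ ∷ y₁ ∷ l ∷ a ∷ n ∷ b ∷ []) ℚ-ring))

    -- The derivatives of both sides of the factorisation agree at the double root `x₁`. The sum
    -- `y₁ + y₂` stands for `2 y₁`, as in the tangent branch of `add`.
    tangent : Col a b x₁ y₁ x₂ y₂ x₃ y₃ l n → x₁ ≡ x₂ →
      l * (y₁ + y₂) ≡ ι (ℤ.+ 3) * x₁ * x₁ + a
    tangent (col o₁ o₂ o₃ e₁ e₂ e₃) refl =
      linear (l · o₁ ⊹ l · o₂ ⊹ (- (x₁ + x₁)) · e₁ ⊹ 1ℚ · e₂)
        (solve (x₁ ∷ x₃ ∷ y₁ ∷ y₂ ∷ l ∷ a ∷ n ∷ []) ℚ-ring)

  neg : Pt → Pt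
  neg ∞ = ∞
  neg (aff x y) = aff x (- y)

  aff-cong : ∀ {x y x′ y′} → x ≡ x′ → y ≡ y′ → aff x y ≡ aff x′ y′
  aff-cong = cong₂ aff

  module Add (E : Curve) where
    a = ι (Curve.a E)
    b = ι (Curve.b E)

    -- Replaces the decisions and divisions inside `add` by multiplied-out equations for the slope,
    -- so that all later reasoning is polynomial.
    data AddView (x₁ y₁ x₂ y₂ : ℚ) : Pt → Set where
      vertical : x₂ - x₁ ≡ 0ℚ → y₁ + y₂ ≡ 0ℚ → AddView x₁ y₁ x₂ y₂ ∞
      slope : ∀ l →
        (x₂ - x₁ ≢ 0ℚ × l * (x₂ - x₁) ≡ y₂ - y₁) ⊎
        (x₂ - x₁ ≡ 0ℚ × y₁ + y₂ ≢ 0ℚ × l * (y₁ + y₂) ≡ ι (ℤ.+ 3) * x₁ * x₁ + a) →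
        AddView x₁ y₁ x₂ y₂ (aff (l * l - x₁ - x₂) (l * (x₁ - (l * l - x₁ - x₂)) - y₁))

    addView : ∀ x₁ y₁ x₂ y₂ → AddView x₁ y₁ x₂ y₂ (add E (aff x₁ y₁) (aff x₂ y₂))
    addView x₁ y₁ x₂ y₂ with (x₂ - x₁) ≟ 0ℚ | (y₁ + y₂) ≟ 0ℚ
    ... | no dx≢0 | _ = let instance _ = ≢-nonZero dx≢0 in
      slope ((y₂ - y₁) ÷ (x₂ - x₁)) (inj₁ (dx≢0 , ÷-* (y₂ - y₁) (x₂ - x₁)))
    ... | yes dx | yes dy = vertical dx dy
    ... | yes dx | no dy≢0 = let instance _ = ≢-nonZero dy≢0 in
      slope ((ι (ℤ.+ 3) * x₁ * x₁ + a) ÷ (y₁ + y₂))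
        (inj₂ (dx , dy≢0 , ÷-* (ι (ℤ.+ 3) * x₁ * x₁ + a) (y₁ + y₂)))

    On : ℚ → ℚ → Set
    On x y = y * y ≡ x * x * x + a * x + b

    -- The relation for `a` results from subtracting the two curve equations, which yields it
    -- multiplied by `x₂ - x₁`.
    chordCol : ∀ {x₁ y₁ x₂ y₂} l → On x₁ y₁ → On x₂ y₂ → x₂ - x₁ ≢ 0ℚ → l * (x₂ - x₁) ≡ y₂ - y₁ →
      let x₃ = l * l - x₁ - x₂ in
      Col a b x₁ y₁ x₂ y₂ x₃ (- (l * (x₁ - x₃) - y₁)) l (y₁ - l * x₁)
    chordCol {x₁} {y₁} {x₂} {y₂} l c₁ c₂ dx h = mkCol c₁
      (solve (x₁ ∷ y₁ ∷ l ∷ []) ℚ-ring)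
      (linear ((- 1ℚ) · h) (solve (x₁ ∷ x₂ ∷ y₁ ∷ y₂ ∷ l ∷ []) ℚ-ring))
      (solve (x₁ ∷ x₂ ∷ y₁ ∷ l ∷ []) ℚ-ring)
      (solve (x₁ ∷ x₂ ∷ l ∷ []) ℚ-ring)
      (*-cancel dx (linear ((l * (x₂ - x₁) + (y₂ + y₁)) · h ⊹ 1ℚ · c₂ ⊹ (- 1ℚ) · c₁) (id a b)))
      where
      id : ∀ a b → (x₂ - x₁) * (x₁ * x₂ + x₁ * (l * l - x₁ - x₂) + x₂ * (l * l - x₁ - x₂))
          - (x₂ - x₁) * (a - (l * (y₁ - l * x₁) + l * (y₁ - l * x₁)))
          ≡ (l * (x₂ - x₁) + (y₂ + y₁)) * (l * (x₂ - x₁) - (y₂ - y₁))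
            + (1ℚ * (y₂ * y₂ - (x₂ * x₂ * x₂ + a * x₂ + b))
              + (- 1ℚ) * (y₁ * y₁ - (x₁ * x₁ * x₁ + a * x₁ + b)))
      id a b = solve (a ∷ b ∷ x₁ ∷ x₂ ∷ y₁ ∷ y₂ ∷ l ∷ []) ℚ-ring

    equal-ordinates : ∀ {x y₁ y₂} → On x y₁ → On x y₂ → y₁ + y₂ ≢ 0ℚ → y₁ ≡ y₂
    equal-ordinates {x} {y₁} {y₂} c₁ c₂ ne = *-cancel ne
      (linear (1ℚ · c₁ ⊹ (- 1ℚ) · c₂) (id a b))
      where
      id : ∀ a b → (y₁ + y₂) * y₁ - (y₁ + y₂) * y₂ ≡
        1ℚ * (y₁ * y₁ - (x * x * x + a * x + b)) + (- 1ℚ) * (y₂ * y₂ - (x * x * x + a * x + b))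
      id a b = solve (a ∷ b ∷ x ∷ y₁ ∷ y₂ ∷ []) ℚ-ring

    tangentCol : ∀ {x y} l → On x y → l * (y + y) ≡ ι (ℤ.+ 3) * x * x + a →
      let x₃ = l * l - x - x in
      Col a b x y x y x₃ (- (l * (x - x₃) - y)) l (y - l * x)
    tangentCol {x} {y} l c h = mkCol c
      (solve (x ∷ y ∷ l ∷ []) ℚ-ring)
      (solve (x ∷ y ∷ l ∷ []) ℚ-ring)
      (solve (x ∷ y ∷ l ∷ []) ℚ-ring)
      (solve (x ∷ l ∷ []) ℚ-ring)
      (linear (1ℚ · h) (id a))
      where
      id : ∀ a → x * x + x * (l * l - x - x) + x * (l * l - x - x)
        - (a - (l * (y - l * x) + l * (y - l * x)))
        ≡ 1ℚ * (l * (y + y) - (ι (ℤ.+ 3) * x * x + a))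
      id a = solve (a ∷ x ∷ y ∷ l ∷ []) ℚ-ring

    Vertical : ℚ → ℚ → ℚ → ℚ → Set
    Vertical x₁ y₁ x₂ y₂ = x₁ ≡ x₂ × y₁ + y₂ ≡ 0ℚ

    data Sum (x₁ y₁ x₂ y₂ : ℚ) (R : Pt) : Set where
      opposite : Vertical x₁ y₁ x₂ y₂ → R ≡ ∞ → Sum x₁ y₁ x₂ y₂ R
      secant : ¬ Vertical x₁ y₁ x₂ y₂ → ∀ {x₃ y₃ l n} → Col a b x₁ y₁ x₂ y₂ x₃ y₃ l n →
        R ≡ aff x₃ (- y₃) → Sum x₁ y₁ x₂ y₂ R

    neg-neg : ∀ y → - (- y) ≡ y
    neg-neg y = solve (y ∷ []) ℚ-ring

    addView⇒Sum : ∀ {x₁ y₁ x₂ y₂ R} → On x₁ y₁ → On x₂ y₂ → AddView x₁ y₁ x₂ y₂ R → Sum x₁ y₁ x₂ y₂ R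
    addView⇒Sum _ _ (vertical dx dy) = opposite (sym (sub≡0⇒≡ dx) , dy) refl
    addView⇒Sum {x₁} {y₁} {x₂} {y₂} c₁ c₂ (slope l (inj₁ (dx , h))) =
      secant (λ (e , _) → dx (sub≡0 (sym e))) (chordCol l c₁ c₂ dx h)
        (cong (aff (l * l - x₁ - x₂)) (sym (neg-neg (l * (x₁ - (l * l - x₁ - x₂)) - y₁))))
    addView⇒Sum {x₁} {y₁} {x₂} {y₂} c₁ c₂ (slope l (inj₂ (dx , dy , h))) =
      tangent-case (sym (sub≡0⇒≡ dx)) c₂ h
      where
      tangent-case : ∀ {x₂} → x₁ ≡ x₂ → On x₂ y₂ → l * (y₁ + y₂) ≡ ι (ℤ.+ 3) * x₁ * x₁ + a →
        Sum x₁ y₁ x₂ y₂ (aff (l * l - x₁ - x₂) (l * (x₁ - (l * l - x₁ - x₂)) - y₁))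
      tangent-case refl c₂ h = double (equal-ordinates {x₁} {y₁} {y₂} c₁ c₂ dy) dy h
        where
        double : ∀ {y₂} → y₁ ≡ y₂ → y₁ + y₂ ≢ 0ℚ → l * (y₁ + y₂) ≡ ι (ℤ.+ 3) * x₁ * x₁ + a →
          Sum x₁ y₁ x₁ y₂ (aff (l * l - x₁ - x₁) (l * (x₁ - (l * l - x₁ - x₁)) - y₁))
        double refl dy h = secant (λ (_ , e) → dy e) (tangentCol l c₁ h)
          (cong (aff (l * l - x₁ - x₁)) (sym (neg-neg (l * (x₁ - (l * l - x₁ - x₁)) - y₁))))

    sum : ∀ {x₁ y₁ x₂ y₂} → On x₁ y₁ → On x₂ y₂ → Sum x₁ y₁ x₂ y₂ (add E (aff x₁ y₁) (aff x₂ y₂))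
    sum {x₁} {y₁} {x₂} {y₂} c₁ c₂ = addView⇒Sum c₁ c₂ (addView x₁ y₁ x₂ y₂)

    same-slope : ∀ {x₁ y₁ x₂ y₂ x₃ y₃ l n l′} → Col a b x₁ y₁ x₂ y₂ x₃ y₃ l n →
      (x₂ - x₁ ≢ 0ℚ × l′ * (x₂ - x₁) ≡ y₂ - y₁) ⊎
      (x₂ - x₁ ≡ 0ℚ × y₁ + y₂ ≢ 0ℚ × l′ * (y₁ + y₂) ≡ ι (ℤ.+ 3) * x₁ * x₁ + a) → l ≡ l′
    same-slope {x₁} {y₁} {x₂} {y₂} {l = l} {n} {l′} (col o₁ o₂ _ _ _ _) (inj₁ (dx , h)) = *-cancel dx
      (linear (1ℚ · o₁ ⊹ (- 1ℚ) · o₂ ⊹ (- 1ℚ) · h) (solve (x₁ ∷ x₂ ∷ y₁ ∷ y₂ ∷ l ∷ l′ ∷ n ∷ []) ℚ-ring))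
    same-slope {x₁} {y₁} {x₂} {y₂} {l = l} {n} {l′} c (inj₂ (dx , dy , h)) = *-cancel dy
      (trans (ℚP.*-comm (y₁ + y₂) l) (trans (tangent c (sym (sub≡0⇒≡ dx))) (trans (sym h) (ℚP.*-comm l′ (y₁ + y₂)))))

    -- Converse of `sum`: a sum may be evaluated by exhibiting three collinear points, by whatever
    -- formula they were found.
    Col⇒add : ∀ {x₁ y₁ x₂ y₂ x₃ y₃ l n} → Col a b x₁ y₁ x₂ y₂ x₃ y₃ l n → ¬ Vertical x₁ y₁ x₂ y₂ →
      add E (aff x₁ y₁) (aff x₂ y₂) ≡ aff x₃ (- y₃)
    Col⇒add {x₁} {y₁} {x₂} {y₂} {x₃} {y₃} {l} {n} c@(col o₁ o₂ o₃ e₁ _ _) nv = view (addView x₁ y₁ x₂ y₂)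
      where
      same : ∀ {l′} → l ≡ l′ →
        aff (l′ * l′ - x₁ - x₂) (l′ * (x₁ - (l′ * l′ - x₁ - x₂)) - y₁) ≡ aff x₃ (- y₃)
      same refl = aff-cong
        (linear ((- 1ℚ) · e₁) (solve (x₁ ∷ x₂ ∷ x₃ ∷ l ∷ []) ℚ-ring))
        (linear (l · e₁ ⊹ (- 1ℚ) · o₁ ⊹ 1ℚ · o₃) (solve (x₁ ∷ x₂ ∷ x₃ ∷ y₁ ∷ y₃ ∷ l ∷ n ∷ []) ℚ-ring))
      view : ∀ {R} → AddView x₁ y₁ x₂ y₂ R → R ≡ aff x₃ (- y₃)
      view (vertical dx dy) = contradiction (sym (sub≡0⇒≡ dx) , dy) nv
      view (slope l′ s) = same {l′} (same-slope {l′ = l′} c s)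

    opposite⇒add : ∀ {x₁ y₁ x₂ y₂} → Vertical x₁ y₁ x₂ y₂ → add E (aff x₁ y₁) (aff x₂ y₂) ≡ ∞
    opposite⇒add {x₁} {y₁} {x₂} {y₂} (e , f) = view (addView x₁ y₁ x₂ y₂)
      where
      view : ∀ {R} → AddView x₁ y₁ x₂ y₂ R → R ≡ ∞
      view (vertical _ _) = refl
      view (slope _ (inj₁ (dx , _))) = contradiction (sub≡0 (sym e)) dx
      view (slope _ (inj₂ (_ , dy , _))) = contradiction f dy

    add-neg : ∀ A → add E A (neg A) ≡ ∞
    add-neg ∞ = refl
    add-neg (aff x y) = opposite⇒add (refl , ℚP.+-inverseʳ y)

    neg-add : ∀ A → add E (neg A) A ≡ ∞
    neg-add ∞ = refl
    neg-add (aff x y) = opposite⇒add (refl , ℚP.+-inverseˡ y)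

    add-∞ : ∀ A → add E A ∞ ≡ A
    add-∞ ∞ = refl
    add-∞ (aff x y) = refl

    neg-on : ∀ A → OnCurve E A → OnCurve E (neg A)
    neg-on ∞ _ = tt
    neg-on (aff x y) c = trans square c
      where
      square : - y * - y ≡ y * y
      square = solve (y ∷ []) ℚ-ring

    add-on : ∀ A B → OnCurve E A → OnCurve E B → OnCurve E (add E A B)
    add-on ∞ B _ cB = cB
    add-on (aff x y) ∞ cA _ = cA
    add-on (aff x₁ y₁) (aff x₂ y₂) cA cB = view (sum cA cB)
      where
      view : ∀ {R} → Sum x₁ y₁ x₂ y₂ R → OnCurve E R
      view (opposite _ refl) = tt
      view (secant _ {x₃} {y₃} c refl) = neg-on (aff x₃ y₃) (Col⇒on₁ (swap₁₂ (swap₂₃ c)))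

    vertical-sym : ∀ x₁ y₁ x₂ y₂ → Vertical x₁ y₁ x₂ y₂ → Vertical x₂ y₂ x₁ y₁
    vertical-sym _ y₁ _ y₂ (e , f) = sym e , trans (ℚP.+-comm y₂ y₁) f

    add-comm : ∀ A B → OnCurve E A → OnCurve E B → add E A B ≡ add E B A
    add-comm ∞ B _ _ = sym (add-∞ B)
    add-comm (aff x y) ∞ _ _ = refl
    add-comm (aff x₁ y₁) (aff x₂ y₂) cA cB = view (sum cA cB)
      where
      view : ∀ {R} → Sum x₁ y₁ x₂ y₂ R → R ≡ add E (aff x₂ y₂) (aff x₁ y₁)
      view (opposite v refl) = sym (opposite⇒add (vertical-sym x₁ y₁ x₂ y₂ v))
      view (secant nv c refl) = sym (Col⇒add (swap₁₂ c) (λ v → nv (vertical-sym x₂ y₂ x₁ y₁ v)))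

    nonsingularℚ : ι (ℤ.+ 4) * a * a * a + ι (ℤ.+ 27) * b * b ≢ 0ℚ
    nonsingularℚ h = Curve.nonsingular E (ι-injective (trans lhs h))
      where
      A = Curve.a E
      B = Curve.b E
      lhs : ι ((ℤ.+ 4 ℤ.* A ℤ.* A ℤ.* A) ℤ.+ (ℤ.+ 27 ℤ.* B ℤ.* B)) ≡ ι (ℤ.+ 4) * a * a * a + ι (ℤ.+ 27) * b * b
      lhs = trans (ι-+ (ℤ.+ 4 ℤ.* A ℤ.* A ℤ.* A) (ℤ.+ 27 ℤ.* B ℤ.* B)) (cong₂ _+_
        (trans (ι-* (ℤ.+ 4 ℤ.* A ℤ.* A) A) (cong (_* a) (trans (ι-* (ℤ.+ 4 ℤ.* A) A) (cong (_* a) (ι-* (ℤ.+ 4) A)))))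
        (trans (ι-* (ℤ.+ 27 ℤ.* B) B) (cong (_* b) (ι-* (ℤ.+ 27) B))))

    -- A common zero of the cubic and its derivative gives `a = -3x²` and `b = 2x³`, for which
    -- `4a³ + 27b²` vanishes identically.
    no-singular-point : ∀ {x} → ι (ℤ.+ 3) * x * x + a ≡ 0ℚ → x * x * x + a * x + b ≢ 0ℚ
    no-singular-point {x} a₀ b₀ = nonsingularℚ
      (trans (cong₂ (λ u v → ι (ℤ.+ 4) * u * u * u + ι (ℤ.+ 27) * v * v) a≡ b≡) (solve (x ∷ []) ℚ-ring))
      where
      a≡ : a ≡ - (ι (ℤ.+ 3) * x * x)
      a≡ = linear (1ℚ · a₀) (id a)
        where
        id : ∀ a → a - - (ι (ℤ.+ 3) * x * x) ≡ 1ℚ * (ι (ℤ.+ 3) * x * x + a - 0ℚ)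
        id a = solve (a ∷ x ∷ []) ℚ-ring
      b≡ : b ≡ ι (ℤ.+ 2) * x * x * x
      b≡ = linear (1ℚ · b₀ ⊹ (- x) · a≡) (id a b)
        where
        id : ∀ a b → b - ι (ℤ.+ 2) * x * x * x ≡ 1ℚ * (x * x * x + a * x + b - 0ℚ) + (- x) * (a - - (ι (ℤ.+ 3) * x * x))
        id a b = solve (a ∷ b ∷ x ∷ []) ℚ-ring

    -- At a point of order two the tangent is vertical, whereas `Col` describes lines with a slope:
    -- `tangent` would give `3x² + a = 0`.
    no-double-root : ∀ {x x₃ y₃ l n} → ¬ Col a b x 0ℚ x 0ℚ x₃ y₃ l n
    no-double-root {x} {l = l} c = no-singular-point {x}
      (trans (sym (tangent c refl)) (ℚP.*-zeroʳ l)) (sym (Col⇒on₁ c))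

    -- Reflecting the line through B, C and -(B + C) gives the line through -B, B + C and -C. This
    -- instance of associativity is proved in advance because it settles every configuration in
    -- which A + B or B + C is O.
    cancelˡ : ∀ B C → OnCurve E B → OnCurve E C → add E (neg B) (add E B C) ≡ C
    cancelˡ ∞ C _ _ = refl
    cancelˡ (aff x y) ∞ cB cC = neg-add (aff x y)
    cancelˡ (aff x₁ y₁) (aff x₂ y₂) cB cC = view (sum cB cC)
      where
      view : ∀ {R} → Sum x₁ y₁ x₂ y₂ R → add E (aff x₁ (- y₁)) R ≡ aff x₂ y₂
      view (opposite (e , f) refl) = aff-cong e (linear ((- 1ℚ) · f) (solve (y₁ ∷ y₂ ∷ []) ℚ-ring))
      view (secant _ {x₃} {y₃} {l} {n} c@(col o₁ o₂ o₃ _ _ _) refl) =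
        trans (Col⇒add (swap₂₃ (negCol c)) nv) (aff-cong refl (neg-neg y₂))
        where
        nv : ¬ Vertical x₁ (- y₁) x₃ (- y₃)
        nv (e , f) = no-double-root (double-root (sym e) (trans (sym y₁≡y₃) y₁≡0) y₁≡0 (swap₂₃ c))
          where
          y₁≡y₃ : y₁ ≡ y₃
          y₁≡y₃ = trans o₁ (trans (cong (λ x → l * x + n) e) (sym o₃))
          y₁≡0 : y₁ ≡ 0ℚ
          y₁≡0 = double≡0 (linear ((- 1ℚ) · f ⊹ 1ℚ · y₁≡y₃) (solve (y₁ ∷ y₃ ∷ []) ℚ-ring))
          double-root : ∀ {x y x′ y′ x₂ y₂} → x′ ≡ x → y′ ≡ 0ℚ → y ≡ 0ℚ →
            Col a b x y x′ y′ x₂ y₂ l n → Col a b x 0ℚ x 0ℚ x₂ y₂ l n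
          double-root refl refl refl c = c

    -- With `l` and `m` the slopes of AB and BC and `κ = (xC - xA) / (m - l)`, the line through A
    -- and B + C has slope `κ - m`, and its third point `(xE, yE)` is symmetric under the exchange
    -- of A with C and `l` with `m`. That symmetry is associativity. The formulas need no division
    -- by `xA - xF`, so they remain valid when A equals B + C.
    module Assoc {xA yA xB yB xC yC xD yD xF yF l n m k : ℚ}
      (cAB : Col a b xA yA xB yB xD yD l n) (cBC : Col a b xB yB xC yC xF yF m k)
      (nvAB : ¬ Vertical xA yA xB yB) (l≢m : l ≢ m)
      (κ : ℚ) (hκ : (m - l) * κ ≡ xC - xA) where
      open Col cAB renaming (on₁ to A-on; on₂ to B-on; on₃ to D-on; e₁ to e₁l; e₂ to e₂l)
      open Col cBC renaming (on₁ to B-on′; on₂ to C-on; on₃ to F-on; e₁ to e₁m; e₂ to e₂m)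

      xD≡ : xD - xB ≡ (xF - xB) + (m - l) * (κ - l - m)
      xD≡ = linear (1ℚ · e₁l ⊹ (- 1ℚ) · e₁m ⊹ (- 1ℚ) · hκ)
        (solve (xA ∷ xB ∷ xC ∷ xD ∷ xF ∷ l ∷ m ∷ κ ∷ []) ℚ-ring)

      m-l≢0 : m - l ≢ 0ℚ
      m-l≢0 h = l≢m (sym (sub≡0⇒≡ h))

      2yB≡ : yB + yB ≡ (xA - xB) * (κ - l - m) - κ * (xF - xB)
      2yB≡ = *-cancel m-l≢0 (linear
        ((xA - xB) · xD≡ ⊹ (xF - xB) · hκ ⊹ (- 1ℚ) · e₂l ⊹ 1ℚ · e₂m ⊹ (- (l + l)) · B-on ⊹ (m + m) · B-on′
          ⊹ (xB + xB) · e₁l ⊹ (- (xB + xB)) · e₁m) (id a))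
        where
        id : ∀ a → (m - l) * (yB + yB) - (m - l) * ((xA - xB) * (κ - l - m) - κ * (xF - xB)) ≡
          (xA - xB) * ((xD - xB) - ((xF - xB) + (m - l) * (κ - l - m))) +
          ((xF - xB) * ((m - l) * κ - (xC - xA)) +
          ((- 1ℚ) * ((xA * xB + xA * xD + xB * xD) - (a - (l * n + l * n))) +
          (1ℚ * ((xB * xC + xB * xF + xC * xF) - (a - (m * k + m * k))) +
          ((- (l + l)) * (yB - (l * xB + n)) +
          ((m + m) * (yB - (m * xB + k)) +
          ((xB + xB) * ((xA + xB + xD) - l * l) +
          (- (xB + xB)) * ((xB + xC + xF) - m * m)))))))
        id a = solve (a ∷ xA ∷ xB ∷ xC ∷ xD ∷ xF ∷ yB ∷ l ∷ m ∷ n ∷ k ∷ κ ∷ []) ℚ-ring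

      xE = xB + κ * (κ - l - m)
      yE = yB + (κ - l - m) * (κ * (κ - m) - (xA - xB))

      third : Col a b xA yA xF (- yF) xE yE (κ - m) (yA - (κ - m) * xA)
      third = mkCol (Col⇒on₁ cAB)
        (solve (xA ∷ yA ∷ κ ∷ m ∷ []) ℚ-ring)
        (linear ((- 1ℚ) · 2yB≡ ⊹ (- 1ℚ) · F-on ⊹ (- 1ℚ) · A-on ⊹ 1ℚ · B-on′ ⊹ 1ℚ · B-on)
          (solve (xA ∷ xB ∷ xF ∷ yA ∷ yB ∷ yF ∷ l ∷ m ∷ n ∷ k ∷ κ ∷ []) ℚ-ring))
        (linear (1ℚ · B-on ⊹ (- 1ℚ) · A-on) id₃)
        (linear (1ℚ · e₁l ⊹ (- 1ℚ) · xD≡) id₁)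
        (linear (1ℚ · e₂l ⊹ (κ - m + (κ - m)) · A-on ⊹ (l + l - (κ - m + (κ - m))) · B-on ⊹ (κ - m - l) · 2yB≡ ⊹ (- (xB + xA)) · xD≡) (id a))
        where
        id₃ : yB + (κ - l - m) * (κ * (κ - m) - (xA - xB)) - ((κ - m) * (xB + κ * (κ - l - m)) + (yA - (κ - m) * xA)) ≡
          1ℚ * (yB - (l * xB + n)) + (- 1ℚ) * (yA - (l * xA + n))
        id₃ = solve (xA ∷ xB ∷ yA ∷ yB ∷ l ∷ m ∷ n ∷ κ ∷ []) ℚ-ring
        id₁ : xA + xF + (xB + κ * (κ - l - m)) - (κ - m) * (κ - m) ≡
          1ℚ * (xA + xB + xD - l * l) + (- 1ℚ) * (xD - xB - ((xF - xB) + (m - l) * (κ - l - m)))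
        id₁ = solve (xA ∷ xB ∷ xD ∷ xF ∷ l ∷ m ∷ κ ∷ []) ℚ-ring
        id : ∀ a → xA * xF + xA * (xB + κ * (κ - l - m)) + xF * (xB + κ * (κ - l - m)) - (a - ((κ - m) * (yA - (κ - m) * xA) + (κ - m) * (yA - (κ - m) * xA))) ≡
          1ℚ * ((xA * xB + xA * xD + xB * xD) - (a - (l * n + l * n))) +
          (((κ - m) + (κ - m)) * (yA - (l * xA + n)) +
          ((l + l - ((κ - m) + (κ - m))) * (yB - (l * xB + n)) +
          (((κ - m) - l) * (yB + yB - ((xA - xB) * (κ - l - m) - κ * (xF - xB))) +
          (- (xB + xA)) * ((xD - xB) - ((xF - xB) + (m - l) * (κ - l - m))))))
        id a = solve (a ∷ xA ∷ xB ∷ xD ∷ xF ∷ yA ∷ yB ∷ l ∷ m ∷ n ∷ κ ∷ []) ℚ-ring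

      -- If A + (B + C) were O, then A = F would lie on both lines, which meet only above `xB`.
      -- There the two tangent relations have the same right-hand side, so their difference is
      -- `(m - l)(yA + yB) = 0`, and A, B would be opposite.
      nv : ¬ Vertical xA yA xF (- yF)
      nv (e , f) = nvAB (xA≡xB , *-cancel m-l≢0
        (linear (1ℚ · tangent (swap₂₃ cBC) (trans (sym xA≡xB) e) ⊹ (- 1ℚ) · tangent cAB xA≡xB ⊹ m · f
            ⊹ (- (ι (ℤ.+ 3) * (xA + xB))) · xA≡xB) (id a)))
        where
        xA≡xB : xA ≡ xB
        xA≡xB = *-cancel m-l≢0
          (linear (m · e ⊹ (- 1ℚ) · F-on ⊹ 1ℚ · A-on ⊹ 1ℚ · B-on′ ⊹ (- 1ℚ) · B-on ⊹ (- 1ℚ) · f)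
            (solve (xA ∷ xB ∷ xF ∷ yA ∷ yB ∷ yF ∷ l ∷ m ∷ n ∷ k ∷ []) ℚ-ring))
        id : ∀ a → (m - l) * (yA + yB) - (m - l) * 0ℚ ≡
          1ℚ * (m * (yB + yF) - (ι (ℤ.+ 3) * xB * xB + a)) +
          ((- 1ℚ) * (l * (yA + yB) - (ι (ℤ.+ 3) * xA * xA + a)) +
          (m * (yA + - yF - 0ℚ) +
          (- (ι (ℤ.+ 3) * (xA + xB))) * (xA - xB)))
        id a = solve (a ∷ xA ∷ xB ∷ yA ∷ yB ∷ yF ∷ l ∷ m ∷ []) ℚ-ring

      sum≡ : add E (aff xA yA) (aff xF (- yF)) ≡ aff xE (- yE)
      sum≡ = Col⇒add third nv

    vertical? : ∀ x₁ y₁ x₂ y₂ → Dec (Vertical x₁ y₁ x₂ y₂)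
    vertical? x₁ y₁ x₂ y₂ = (x₁ ≟ x₂) ×-dec ((y₁ + y₂) ≟ 0ℚ)

    same-intercept : ∀ {x y l n k : ℚ} → y ≡ l * x + n → y ≡ l * x + k → n ≡ k
    same-intercept {x} {y} {l} {n} {k} o o′ = linear (1ℚ · o′ ⊹ (- 1ℚ) · o) (solve (x ∷ y ∷ l ∷ n ∷ k ∷ []) ℚ-ring)

    -- All five points lie on one line, whose intersection with the cubic is A, B, D and also B, C,
    -- F. Removing B leaves the same pair, so A is C or F.
    assoc-collinear : ∀ {xA yA xB yB xC yC xD yD xF yF l n} →
      Col a b xA yA xB yB xD yD l n → Col a b xB yB xC yC xF yF l n →
      add E (aff xD (- yD)) (aff xC yC) ≡ add E (aff xA yA) (aff xF (- yF))
    assoc-collinear {xA} {yA} {xB} {yB} {xC} {yC} {xD} {yD} {xF} {yF} {l} {n}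
      cAB@(col A-on B-on D-on e₁l e₂l _) cBC@(col B-on′ C-on F-on e₁m e₂m _) = collinear (zero-product roots)
      where
      sums : xA + xD ≡ xC + xF
      sums = linear (1ℚ · e₁l ⊹ (- 1ℚ) · e₁m) (solve (xA ∷ xB ∷ xC ∷ xD ∷ xF ∷ l ∷ []) ℚ-ring)
      roots : (xA - xC) * (xA - xF) ≡ 0ℚ
      roots = linear ((xA + xB) · sums ⊹ (- 1ℚ) · e₂l ⊹ 1ℚ · e₂m) (id a)
        where
        id : ∀ a → (xA - xC) * (xA - xF) - 0ℚ ≡ (xA + xB) * (xA + xD - (xC + xF)) +
          ((- 1ℚ) * (xA * xB + xA * xD + xB * xD - (a - (l * n + l * n))) +
          1ℚ * (xB * xC + xB * xF + xC * xF - (a - (l * n + l * n))))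
        id a = solve (a ∷ xA ∷ xB ∷ xC ∷ xD ∷ xF ∷ l ∷ n ∷ []) ℚ-ring
      same-y : ∀ {x y x′ y′} → y ≡ l * x + n → y′ ≡ l * x′ + n → x ≡ x′ → y ≡ y′
      same-y o o′ refl = trans o (sym o′)
      collinear : xA - xC ≡ 0ℚ ⊎ xA - xF ≡ 0ℚ → add E (aff xD (- yD)) (aff xC yC) ≡ add E (aff xA yA) (aff xF (- yF))
      collinear (inj₁ z) = trans
        (cong₂ (add E) (aff-cong xD≡xF (cong -_ (same-y D-on F-on xD≡xF))) (aff-cong (sym xA≡xC) (same-y C-on A-on (sym xA≡xC))))
        (add-comm (aff xF (- yF)) (aff xA yA) (neg-on (aff xF yF) (Col⇒on₁ (swap₁₂ (swap₂₃ cBC)))) (Col⇒on₁ cAB))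
        where
        xA≡xC : xA ≡ xC
        xA≡xC = sub≡0⇒≡ z
        xD≡xF : xD ≡ xF
        xD≡xF = linear (1ℚ · sums ⊹ (- 1ℚ) · xA≡xC) (solve (xA ∷ xC ∷ xD ∷ xF ∷ []) ℚ-ring)
      collinear (inj₂ z) = trans
        (opposite⇒add (xD≡xC , trans (cong (_+ yC) (cong -_ (same-y D-on C-on xD≡xC))) (ℚP.+-inverseˡ yC)))
        (sym (opposite⇒add (xA≡xF , trans (cong (_+ - yF) (same-y A-on F-on xA≡xF)) (ℚP.+-inverseʳ yF))))
        where
        xA≡xF : xA ≡ xF
        xA≡xF = sub≡0⇒≡ z
        xD≡xC : xD ≡ xC
        xD≡xC = linear (1ℚ · sums ⊹ (- 1ℚ) · xA≡xF) (solve (xA ∷ xC ∷ xD ∷ xF ∷ []) ℚ-ring)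

    -- The formula of `Assoc` is used twice, the second time with A and C exchanged; `κ` is
    -- unchanged because its numerator and denominator both change sign.
    assoc-distinct : ∀ {xA yA xB yB xC yC xD yD xF yF l n m k} →
      Col a b xA yA xB yB xD yD l n → Col a b xB yB xC yC xF yF m k →
      ¬ Vertical xA yA xB yB → ¬ Vertical xB yB xC yC → l ≢ m →
      ∀ κ → (m - l) * κ ≡ xC - xA →
      add E (aff xC yC) (aff xD (- yD)) ≡ add E (aff xA yA) (aff xF (- yF))
    assoc-distinct {xA} {yA} {xB} {yB} {xC} {yC} {xD} {yD} {xF} {yF} {l} {n} {m} {k} cAB cBC nvAB nvBC l≢m κ hκ =
      trans CD.sum≡ (trans (aff-cong x≡ (cong -_ y≡)) (sym AF.sum≡))
      where
      hκ′ : (l - m) * κ ≡ xA - xC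
      hκ′ = linear ((- 1ℚ) · hκ) (solve (κ ∷ l ∷ m ∷ xA ∷ xC ∷ []) ℚ-ring)
      module AF = Assoc cAB cBC nvAB l≢m κ hκ
      module CD = Assoc (swap₁₂ cBC) (swap₁₂ cAB) (λ v → nvBC (vertical-sym xC yC xB yB v)) (λ e → l≢m (sym e)) κ hκ′
      x≡ : CD.xE ≡ AF.xE
      x≡ = idx
        where
        idx : xB + κ * (κ - m - l) ≡ xB + κ * (κ - l - m)
        idx = solve (κ ∷ l ∷ m ∷ xB ∷ []) ℚ-ring
      y≡ : CD.yE ≡ AF.yE
      y≡ = linear ((κ - l - m) · hκ) idy
        where
        idy : (yB + (κ - m - l) * (κ * (κ - l) - (xC - xB))) - (yB + (κ - l - m) * (κ * (κ - m) - (xA - xB)))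
          ≡ (κ - l - m) * ((m - l) * κ - (xC - xA))
        idy = solve (κ ∷ l ∷ m ∷ xA ∷ xB ∷ xC ∷ yB ∷ []) ℚ-ring

    assoc-secant : ∀ {xA yA xB yB xC yC xD yD xF yF l n m k} →
      Col a b xA yA xB yB xD yD l n → Col a b xB yB xC yC xF yF m k →
      ¬ Vertical xA yA xB yB → ¬ Vertical xB yB xC yC →
      add E (aff xD (- yD)) (aff xC yC) ≡ add E (aff xA yA) (aff xF (- yF))
    assoc-secant {xA} {yA} {xB} {yB} {xC} {yC} {xD} {yD} {xF} {yF} {l} {n} {m} {k} cAB cBC nvAB nvBC = cases (l ≟ m)
      where
      cases : Dec (l ≡ m) → add E (aff xD (- yD)) (aff xC yC) ≡ add E (aff xA yA) (aff xF (- yF))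
      cases (no l≢m) = trans
        (add-comm (aff xD (- yD)) (aff xC yC) (neg-on (aff xD yD) (Col⇒on₁ (swap₁₂ (swap₂₃ cAB)))) (Col⇒on₁ (swap₁₂ cBC)))
        (assoc-distinct cAB cBC nvAB nvBC l≢m κ hκ)
        where
        instance _ = ≢-nonZero {m - l} (λ h → l≢m (sym (sub≡0⇒≡ h)))
        κ : ℚ
        κ = (xC - xA) ÷ (m - l)
        hκ : (m - l) * κ ≡ xC - xA
        hκ = trans (ℚP.*-comm (m - l) κ) (÷-* (xC - xA) (m - l))
      cases (yes e) = assoc-collinear cAB (relabel (sym e) (sym n≡k) cBC)
        where
        n≡k : n ≡ k
        n≡k = same-intercept {xB} {yB} {l} (Col.on₂ cAB) (subst (λ m → yB ≡ m * xB + k) (sym e) (Col.on₁ cBC))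
        relabel : ∀ {m l k n} → m ≡ l → k ≡ n → Col a b xB yB xC yC xF yF m k → Col a b xB yB xC yC xF yF l n
        relabel refl refl c = c

    secant-of : ∀ {x₁ y₁ x₂ y₂} → On x₁ y₁ → On x₂ y₂ → ¬ Vertical x₁ y₁ x₂ y₂ →
      ∃ λ x₃ → ∃ λ y₃ → ∃ λ l → ∃ λ n → Col a b x₁ y₁ x₂ y₂ x₃ y₃ l n ×
        add E (aff x₁ y₁) (aff x₂ y₂) ≡ aff x₃ (- y₃)
    secant-of {x₁} {y₁} {x₂} {y₂} c₁ c₂ nv = view (sum c₁ c₂)
      where
      view : ∀ {R} → Sum x₁ y₁ x₂ y₂ R →
        ∃ λ x₃ → ∃ λ y₃ → ∃ λ l → ∃ λ n → Col a b x₁ y₁ x₂ y₂ x₃ y₃ l n × R ≡ aff x₃ (- y₃)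
      view (opposite v _) = contradiction v nv
      view (secant _ c e) = _ , _ , _ , _ , c , e

    opposite-eq : ∀ {x₁ y₁ x₂ y₂} → Vertical x₁ y₁ x₂ y₂ → aff x₁ y₁ ≡ neg (aff x₂ y₂)
    opposite-eq {y₁ = y₁} {y₂ = y₂} (e , f) = aff-cong e (linear (1ℚ · f) (solve (y₁ ∷ y₂ ∷ []) ℚ-ring))

    assoc : ∀ A B C → OnCurve E A → OnCurve E B → OnCurve E C → add E (add E A B) C ≡ add E A (add E B C)
    assoc ∞ B C _ _ _ = refl
    assoc (aff _ _) ∞ C _ _ _ = refl
    assoc (aff xA yA) (aff xB yB) ∞ cA cB _ = add-∞ (add E (aff xA yA) (aff xB yB))
    assoc A@(aff xA yA) B@(aff xB yB) C@(aff xC yC) cA cB cC = cases (vertical? xA yA xB yB) (vertical? xB yB xC yC)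
      where
      cases : Dec (Vertical xA yA xB yB) → Dec (Vertical xB yB xC yC) →
        add E (add E A B) C ≡ add E A (add E B C)
      cases (yes v) _ = trans (cong (λ Z → add E Z C) (opposite⇒add v))
        (sym (trans (cong (λ Z → add E Z (add E B C)) (opposite-eq v)) (cancelˡ B C cB cC)))
      cases (no _) (yes v) = trans (add-comm (add E A B) C (add-on A B cA cB) cC)
        (trans (cong₂ (add E) (opposite-eq (vertical-sym xB yB xC yC v)) (add-comm A B cA cB))
          (trans (cancelˡ B A cB cA) (sym (cong (add E A) (opposite⇒add v)))))
      cases (no nvAB) (no nvBC) =
        let _ , _ , _ , _ , cAB , e = secant-of cA cB nvAB
            _ , _ , _ , _ , cBC , f = secant-of cB cC nvBC
        in trans (cong (λ Z → add E Z C) e) (trans (assoc-secant cAB cBC nvAB nvBC) (sym (cong (add E A) f)))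

    open import Algebra.Bundles using (AbelianGroup)
    open import Level using (0ℓ)

    Point : Set
    Point = Σ Pt (OnCurve E)

    OnCurve-irrelevant : ∀ A (c d : OnCurve E A) → c ≡ d
    OnCurve-irrelevant ∞ _ _ = refl
    OnCurve-irrelevant (aff x y) c d = uip c d
      where
      uip : ∀ {u v : ℚ} (p q : u ≡ v) → p ≡ q
      uip refl refl = refl

    Point-≡ : ∀ {A B : Point} → proj₁ A ≡ proj₁ B → A ≡ B
    Point-≡ {A , c} {.A , d} refl = cong (A ,_) (OnCurve-irrelevant A c d)

    pointGroup : AbelianGroup 0ℓ 0ℓ
    pointGroup = record
      { Carrier = Point
      ; _≈_ = _≡_
      ; _∙_ = λ (A , c) (B , d) → add E A B , add-on A B c d
      ; ε = ∞ , tt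
      ; _⁻¹ = λ (A , c) → neg A , neg-on A c
      ; isAbelianGroup = record
        { isGroup = record
          { isMonoid = record
            { isSemigroup = record
              { isMagma = record { isEquivalence = isEquivalence ; ∙-cong = λ { refl refl → refl } }
              ; assoc = λ (A , c) (B , d) (C , e) → Point-≡ (assoc A B C c d e)
              }
            ; identity = (λ _ → Point-≡ refl) , (λ (A , _) → Point-≡ (add-∞ A))
            }
          ; inverse = (λ (A , _) → Point-≡ (neg-add A)) , (λ (A , _) → Point-≡ (add-neg A))
          ; ⁻¹-cong = λ { refl → refl }
          }
        ; comm = λ (A , c) (B , d) → Point-≡ (add-comm A B c d)
        }
      }

-- The Kummer relation between the abscissas of A, B, A + B and A - B

module KummerRational (E : Curve) where
  open RationalField
  open Embedding
  open GroupLaw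
  open Add E
  open import Data.Rational using (ℚ; 0ℚ; 1ℚ; _+_; _-_; _*_; -_)
  open import Data.Rational.Properties as ℚP using (_≟_)
  open import Data.Integer as ℤ using (ℤ)
  open import Data.Empty using (⊥-elim)
  open import Data.Product using (_,_)
  open import Data.Sum using (_⊎_; inj₁; inj₂)
  open import Data.List using (_∷_; [])
  open import Relation.Nullary using (¬_; Dec; yes; no; contradiction)
  open import Relation.Binary.PropositionalEquality
  open import Tactic.RingSolver using (solve)

  -- The point (u : u′) and (v : v′) of P¹ are the roots of a quadratic form
  -- whose coefficients are biquadratic in (x₁ : z₁) and (x₂ : z₂).
  record KummerRel (x₁ z₁ x₂ z₂ u u′ v v′ : ℚ) : Set where
    constructor kummerRel
    field
      μ : ℚ
      μ≢0 : μ ≢ 0ℚ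
      k-D : μ * (u′ * v′) ≡ (x₁ * z₂ - x₂ * z₁) * (x₁ * z₂ - x₂ * z₁)
      k-S : μ * (u * v′ + v * u′) ≡
        ((x₁ * z₂ + x₂ * z₁) * (a * (z₁ * z₂) + x₁ * x₂) + (b * (z₁ * z₂) * (z₁ * z₂) + b * (z₁ * z₂) * (z₁ * z₂))) +
        ((x₁ * z₂ + x₂ * z₁) * (a * (z₁ * z₂) + x₁ * x₂) + (b * (z₁ * z₂) * (z₁ * z₂) + b * (z₁ * z₂) * (z₁ * z₂)))
      k-U : μ * (u * v) ≡ (x₁ * x₂ - a * (z₁ * z₂)) * (x₁ * x₂ - a * (z₁ * z₂))
        - ι (ℤ.+ 4) * (b * (z₁ * z₂) * (x₁ * z₂ + x₂ * z₁))

  nx nz : Pt → ℚ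
  nx ∞ = 1ℚ
  nx (aff x y) = x
  nz ∞ = 0ℚ
  nz (aff x y) = 1ℚ

  Kummer : Pt → Pt → Pt → Pt → Set
  Kummer A B U V = KummerRel (nx A) (nz A) (nx B) (nz B) (nx U) (nz U) (nx V) (nz V)

  1≢0 : 1ℚ ≢ 0ℚ
  1≢0 ()

  kummer-∞ : ∀ x z → KummerRel 1ℚ 0ℚ x z x z x z
  kummer-∞ x z = kummerRel 1ℚ 1≢0 (solve (x ∷ z ∷ []) ℚ-ring) (S a b) (U a b)
    where
    S : ∀ a b → 1ℚ * (x * z + x * z) ≡
        ((1ℚ * z + x * 0ℚ) * (a * (0ℚ * z) + 1ℚ * x) + (b * (0ℚ * z) * (0ℚ * z) + b * (0ℚ * z) * (0ℚ * z))) +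
        ((1ℚ * z + x * 0ℚ) * (a * (0ℚ * z) + 1ℚ * x) + (b * (0ℚ * z) * (0ℚ * z) + b * (0ℚ * z) * (0ℚ * z)))
    S a b = solve (a ∷ b ∷ x ∷ z ∷ []) ℚ-ring
    U : ∀ a b → 1ℚ * (x * x) ≡ (1ℚ * x - a * (0ℚ * z)) * (1ℚ * x - a * (0ℚ * z))
        - ι (ℤ.+ 4) * (b * (0ℚ * z) * (1ℚ * z + x * 0ℚ))
    U a b = solve (a ∷ b ∷ x ∷ z ∷ []) ℚ-ring

  kummer-sym : ∀ {x₁ z₁ x₂ z₂ u u′ v v′} → KummerRel x₁ z₁ x₂ z₂ u u′ v v′ → KummerRel x₂ z₂ x₁ z₁ u u′ v v′
  kummer-sym {x₁} {z₁} {x₂} {z₂} (kummerRel μ μ≢0 d s u) = kummerRel μ μ≢0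
    (trans d (solve (x₁ ∷ z₁ ∷ x₂ ∷ z₂ ∷ []) ℚ-ring)) (trans s (S a b)) (trans u (U a b))
    where
    S : ∀ a b →
        ((x₁ * z₂ + x₂ * z₁) * (a * (z₁ * z₂) + x₁ * x₂) + (b * (z₁ * z₂) * (z₁ * z₂) + b * (z₁ * z₂) * (z₁ * z₂))) +
        ((x₁ * z₂ + x₂ * z₁) * (a * (z₁ * z₂) + x₁ * x₂) + (b * (z₁ * z₂) * (z₁ * z₂) + b * (z₁ * z₂) * (z₁ * z₂))) ≡
        ((x₂ * z₁ + x₁ * z₂) * (a * (z₂ * z₁) + x₂ * x₁) + (b * (z₂ * z₁) * (z₂ * z₁) + b * (z₂ * z₁) * (z₂ * z₁))) +
        ((x₂ * z₁ + x₁ * z₂) * (a * (z₂ * z₁) + x₂ * x₁) + (b * (z₂ * z₁) * (z₂ * z₁) + b * (z₂ * z₁) * (z₂ * z₁)))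
    S a b = solve (a ∷ b ∷ x₁ ∷ z₁ ∷ x₂ ∷ z₂ ∷ []) ℚ-ring
    U : ∀ a b → (x₁ * x₂ - a * (z₁ * z₂)) * (x₁ * x₂ - a * (z₁ * z₂)) - ι (ℤ.+ 4) * (b * (z₁ * z₂) * (x₁ * z₂ + x₂ * z₁)) ≡
       (x₂ * x₁ - a * (z₂ * z₁)) * (x₂ * x₁ - a * (z₂ * z₁)) - ι (ℤ.+ 4) * (b * (z₂ * z₁) * (x₂ * z₁ + x₁ * z₂))
    U a b = solve (a ∷ b ∷ x₁ ∷ z₁ ∷ x₂ ∷ z₂ ∷ []) ℚ-ring

  kummer-swap : ∀ {x₁ z₁ x₂ z₂ u u′ v v′} → KummerRel x₁ z₁ x₂ z₂ u u′ v v′ → KummerRel x₁ z₁ x₂ z₂ v v′ u u′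
  kummer-swap {u = u} {u′} {v} {v′} (kummerRel μ μ≢0 d s w) = kummerRel μ μ≢0
    (trans (cong (μ *_) (ℚP.*-comm v′ u′)) d)
    (trans (cong (μ *_) (ℚP.+-comm (v * u′) (u * v′))) s)
    (trans (cong (μ *_) (ℚP.*-comm v u)) w)

  -- For x₁ ≠ x₂ both A ± B come from chords, and μ = (x₂ - x₁)².
  kummer-chords : ∀ {x₁ y₁ x₂ y₂ u yu v yv l n l′ n′} → On x₁ y₁ → On x₂ y₂ → x₂ - x₁ ≢ 0ℚ →
    Col a b x₁ y₁ x₂ y₂ u yu l n → Col a b x₁ y₁ x₂ (- y₂) v yv l′ n′ →
    KummerRel x₁ 1ℚ x₂ 1ℚ u 1ℚ v 1ℚ
  kummer-chords {x₁} {y₁} {x₂} {y₂} {u} {_} {v} {_} {l} {n} {l′} {n′} c₁ c₂ dx cAB cAB′ =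
    kummerRel δ² δ²≢0 D
      (linear (1ℚ · δ²u ⊹ 1ℚ · δ²v ⊹ ι (ℤ.+ 2) · c₁ ⊹ ι (ℤ.+ 2) · c₂) (S a b))
      (*-cancel δ²≢0 (trans (uv₁ u v) (trans (cong₂ _*_ δ²u δ²v)
        (trans uv₂ (trans (cong₂ (λ Y₁ Y₂ → (Y₁ + Y₂ - (x₁ + x₂) * δ²) * (Y₁ + Y₂ - (x₁ + x₂) * δ²) - ι (ℤ.+ 4) * (Y₁ * Y₂)) c₁ c₂)
          (U a b))))))
    where
    open Col cAB renaming (on₁ to o₁; on₂ to o₂; e₁ to e)
    open Col cAB′ using () renaming (on₁ to o₁′; on₂ to o₂′; e₁ to e′)
    δ² = (x₂ - x₁) * (x₂ - x₁)
    δ²≢0 : δ² ≢ 0ℚ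
    δ²≢0 h with zero-product h
    ... | inj₁ z = dx z
    ... | inj₂ z = dx z
    D : (x₂ - x₁) * (x₂ - x₁) * (1ℚ * 1ℚ) ≡ (x₁ * 1ℚ - x₂ * 1ℚ) * (x₁ * 1ℚ - x₂ * 1ℚ)
    D = solve (x₁ ∷ x₂ ∷ []) ℚ-ring
    δ²u : (x₂ - x₁) * (x₂ - x₁) * u ≡ (y₂ - y₁) * (y₂ - y₁) - (x₁ + x₂) * ((x₂ - x₁) * (x₂ - x₁))
    δ²u = linear ((x₂ - x₁) * (x₂ - x₁) · e ⊹ (- (l * (x₂ - x₁) + (y₂ - y₁))) · o₂ ⊹ (l * (x₂ - x₁) + (y₂ - y₁)) · o₁)
      (solve (x₁ ∷ x₂ ∷ y₁ ∷ y₂ ∷ u ∷ l ∷ n ∷ []) ℚ-ring)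
    δ²v : (x₂ - x₁) * (x₂ - x₁) * v ≡ (y₂ + y₁) * (y₂ + y₁) - (x₁ + x₂) * ((x₂ - x₁) * (x₂ - x₁))
    δ²v = linear ((x₂ - x₁) * (x₂ - x₁) · e′ ⊹ (- (l′ * (x₂ - x₁) + (- y₂ - y₁))) · o₂′ ⊹ (l′ * (x₂ - x₁) + (- y₂ - y₁)) · o₁′)
      (solve (x₁ ∷ x₂ ∷ y₁ ∷ y₂ ∷ v ∷ l′ ∷ n′ ∷ []) ℚ-ring)
    S : ∀ a b → (x₂ - x₁) * (x₂ - x₁) * (u * 1ℚ + v * 1ℚ) -
        (((x₁ * 1ℚ + x₂ * 1ℚ) * (a * (1ℚ * 1ℚ) + x₁ * x₂) + (b * (1ℚ * 1ℚ) * (1ℚ * 1ℚ) + b * (1ℚ * 1ℚ) * (1ℚ * 1ℚ))) +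
        ((x₁ * 1ℚ + x₂ * 1ℚ) * (a * (1ℚ * 1ℚ) + x₁ * x₂) + (b * (1ℚ * 1ℚ) * (1ℚ * 1ℚ) + b * (1ℚ * 1ℚ) * (1ℚ * 1ℚ))))
      ≡ 1ℚ * ((x₂ - x₁) * (x₂ - x₁) * u - ((y₂ - y₁) * (y₂ - y₁) - (x₁ + x₂) * ((x₂ - x₁) * (x₂ - x₁)))) +
        (1ℚ * ((x₂ - x₁) * (x₂ - x₁) * v - ((y₂ + y₁) * (y₂ + y₁) - (x₁ + x₂) * ((x₂ - x₁) * (x₂ - x₁)))) +
        (ι (ℤ.+ 2) * (y₁ * y₁ - (x₁ * x₁ * x₁ + a * x₁ + b)) + ι (ℤ.+ 2) * (y₂ * y₂ - (x₂ * x₂ * x₂ + a * x₂ + b))))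
    S a b = solve (a ∷ b ∷ x₁ ∷ x₂ ∷ y₁ ∷ y₂ ∷ u ∷ v ∷ []) ℚ-ring
    uv₁ : ∀ u v → (x₂ - x₁) * (x₂ - x₁) * ((x₂ - x₁) * (x₂ - x₁) * (u * v)) ≡
      ((x₂ - x₁) * (x₂ - x₁) * u) * ((x₂ - x₁) * (x₂ - x₁) * v)
    uv₁ u v = solve (u ∷ v ∷ x₁ ∷ x₂ ∷ []) ℚ-ring
    uv₂ : ((y₂ - y₁) * (y₂ - y₁) - (x₁ + x₂) * ((x₂ - x₁) * (x₂ - x₁))) * ((y₂ + y₁) * (y₂ + y₁) - (x₁ + x₂) * ((x₂ - x₁) * (x₂ - x₁))) ≡
      (y₁ * y₁ + y₂ * y₂ - (x₁ + x₂) * ((x₂ - x₁) * (x₂ - x₁))) * (y₁ * y₁ + y₂ * y₂ - (x₁ + x₂) * ((x₂ - x₁) * (x₂ - x₁)))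
        - ι (ℤ.+ 4) * (y₁ * y₁ * (y₂ * y₂))
    uv₂ = solve (x₁ ∷ x₂ ∷ y₁ ∷ y₂ ∷ []) ℚ-ring
    U : ∀ a b →
      ((x₁ * x₁ * x₁ + a * x₁ + b) + (x₂ * x₂ * x₂ + a * x₂ + b) - (x₁ + x₂) * ((x₂ - x₁) * (x₂ - x₁))) *
      ((x₁ * x₁ * x₁ + a * x₁ + b) + (x₂ * x₂ * x₂ + a * x₂ + b) - (x₁ + x₂) * ((x₂ - x₁) * (x₂ - x₁)))
        - ι (ℤ.+ 4) * ((x₁ * x₁ * x₁ + a * x₁ + b) * (x₂ * x₂ * x₂ + a * x₂ + b)) ≡
      (x₂ - x₁) * (x₂ - x₁) * ((x₁ * x₂ - a * (1ℚ * 1ℚ)) * (x₁ * x₂ - a * (1ℚ * 1ℚ))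
        - ι (ℤ.+ 4) * (b * (1ℚ * 1ℚ) * (x₁ * 1ℚ + x₂ * 1ℚ)))
    U a b = solve (a ∷ b ∷ x₁ ∷ x₂ ∷ []) ℚ-ring

  -- For A = B the sum is the tangent double and μ = (2y)².
  kummer-double : ∀ {x y u yu l n} → On x y → y + y ≢ 0ℚ → Col a b x y x y u yu l n →
    KummerRel x 1ℚ x 1ℚ u 1ℚ 1ℚ 0ℚ
  kummer-double {x} {y} {u} {_} {l} {n} c 2y≢0 cAA =
    kummerRel ((y + y) * (y + y)) 4y²≢0 (solve (x ∷ y ∷ []) ℚ-ring)
      (linear (ι (ℤ.+ 4) · c) (S a b))
      (linear ((l * (y + y) + (ι (ℤ.+ 3) * x * x + a)) · tangent cAA refl ⊹ (y + y) * (y + y) · Col.e₁ cAA ⊹ (- (ι (ℤ.+ 8) * x)) · c) (U a b))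
    where
    4y²≢0 : (y + y) * (y + y) ≢ 0ℚ
    4y²≢0 h with zero-product h
    ... | inj₁ z = 2y≢0 z
    ... | inj₂ z = 2y≢0 z
    S : ∀ a b → (y + y) * (y + y) * (u * 0ℚ + 1ℚ * 1ℚ) -
        (((x * 1ℚ + x * 1ℚ) * (a * (1ℚ * 1ℚ) + x * x) + (b * (1ℚ * 1ℚ) * (1ℚ * 1ℚ) + b * (1ℚ * 1ℚ) * (1ℚ * 1ℚ))) +
        ((x * 1ℚ + x * 1ℚ) * (a * (1ℚ * 1ℚ) + x * x) + (b * (1ℚ * 1ℚ) * (1ℚ * 1ℚ) + b * (1ℚ * 1ℚ) * (1ℚ * 1ℚ))))
      ≡ ι (ℤ.+ 4) * (y * y - (x * x * x + a * x + b))
    S a b = solve (a ∷ b ∷ x ∷ y ∷ u ∷ []) ℚ-ring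
    U : ∀ a b → (y + y) * (y + y) * (u * 1ℚ) - ((x * x - a * (1ℚ * 1ℚ)) * (x * x - a * (1ℚ * 1ℚ))
        - ι (ℤ.+ 4) * (b * (1ℚ * 1ℚ) * (x * 1ℚ + x * 1ℚ))) ≡
      (l * (y + y) + (ι (ℤ.+ 3) * x * x + a)) * (l * (y + y) - (ι (ℤ.+ 3) * x * x + a)) +
      ((y + y) * (y + y) * (x + x + u - l * l) + (- (ι (ℤ.+ 8) * x)) * (y * y - (x * x * x + a * x + b)))
    U a b = solve (a ∷ b ∷ x ∷ y ∷ u ∷ l ∷ []) ℚ-ring

  -- Both A + B and A - B are O, so only the last coefficient survives. On the curve it is the
  -- square of the derivative `3x² + a`, nonzero by nonsingularity.
  kummer-2torsion : ∀ {x} → On x 0ℚ → KummerRel x 1ℚ x 1ℚ 1ℚ 0ℚ 1ℚ 0ℚ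
  kummer-2torsion {x} c = kummerRel (e * e) e²≢0 (D a)
      (linear (ι (ℤ.+ 4) · c) (S a b)) (linear ((- (ι (ℤ.+ 8) * x)) · c) (U a b))
    where
    e = ι (ℤ.+ 3) * x * x + a
    e²≢0 : e * e ≢ 0ℚ
    e²≢0 h with zero-product h
    ... | inj₁ z = no-singular-point {x} z (sym c)
    ... | inj₂ z = no-singular-point {x} z (sym c)
    D : ∀ a → (ι (ℤ.+ 3) * x * x + a) * (ι (ℤ.+ 3) * x * x + a) * (0ℚ * 0ℚ) ≡ (x * 1ℚ - x * 1ℚ) * (x * 1ℚ - x * 1ℚ)
    D a = solve (a ∷ x ∷ []) ℚ-ring
    S : ∀ a b → (ι (ℤ.+ 3) * x * x + a) * (ι (ℤ.+ 3) * x * x + a) * (1ℚ * 0ℚ + 1ℚ * 0ℚ) -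
        (((x * 1ℚ + x * 1ℚ) * (a * (1ℚ * 1ℚ) + x * x) + (b * (1ℚ * 1ℚ) * (1ℚ * 1ℚ) + b * (1ℚ * 1ℚ) * (1ℚ * 1ℚ))) +
        ((x * 1ℚ + x * 1ℚ) * (a * (1ℚ * 1ℚ) + x * x) + (b * (1ℚ * 1ℚ) * (1ℚ * 1ℚ) + b * (1ℚ * 1ℚ) * (1ℚ * 1ℚ))))
      ≡ ι (ℤ.+ 4) * (0ℚ * 0ℚ - (x * x * x + a * x + b))
    S a b = solve (a ∷ b ∷ x ∷ []) ℚ-ring
    U : ∀ a b → (ι (ℤ.+ 3) * x * x + a) * (ι (ℤ.+ 3) * x * x + a) * (1ℚ * 1ℚ) - ((x * x - a * (1ℚ * 1ℚ)) * (x * x - a * (1ℚ * 1ℚ))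
        - ι (ℤ.+ 4) * (b * (1ℚ * 1ℚ) * (x * 1ℚ + x * 1ℚ))) ≡
       (- (ι (ℤ.+ 8) * x)) * (0ℚ * 0ℚ - (x * x * x + a * x + b))
    U a b = solve (a ∷ b ∷ x ∷ []) ℚ-ring

  equal-or-opposite : ∀ {x₁ y₁ x₂ y₂} → x₁ ≡ x₂ → On x₁ y₁ → On x₂ y₂ → y₁ + y₂ ≡ 0ℚ ⊎ y₁ ≡ y₂
  equal-or-opposite {x₁} {y₁} {.x₁} {y₂} refl c₁ c₂ with (y₁ + y₂) ≟ 0ℚ
  ... | yes h = inj₁ h
  ... | no h = inj₂ (equal-ordinates {x₁} c₁ c₂ h)

  -- A single relation with nonzero scalar covers chords, tangents, points of order two and O, so
  -- that nothing later has to distinguish these cases.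
  kummer : ∀ A B → OnCurve E A → OnCurve E B → Kummer A B (add E A B) (add E A (neg B))
  kummer ∞ B _ _ = subst₂ (KummerRel 1ℚ 0ℚ (nx B) (nz B) (nx B) (nz B)) (sym (nx-neg B)) (sym (nz-neg B)) (kummer-∞ (nx B) (nz B))
    where
    nx-neg : ∀ B → nx (neg B) ≡ nx B
    nx-neg ∞ = refl
    nx-neg (aff _ _) = refl
    nz-neg : ∀ B → nz (neg B) ≡ nz B
    nz-neg ∞ = refl
    nz-neg (aff _ _) = refl
  kummer (aff x y) ∞ _ _ = kummer-sym (kummer-∞ x 1ℚ)
  kummer (aff x₁ y₁) (aff x₂ y₂) c₁ c₂ = views (x₁ ≟ x₂) (sum c₁ c₂) (sum c₁ c₂⁻)
    where
    c₂⁻ : On x₂ (- y₂)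
    c₂⁻ = neg-on (aff x₂ y₂) c₂
    doubling : ∀ {x₁ y₁ x₂ y₂ u yu l n} → x₁ ≡ x₂ → y₁ ≡ y₂ → ¬ Vertical x₁ y₁ x₂ y₂ → On x₁ y₁ →
      Col a b x₁ y₁ x₂ y₂ u yu l n → KummerRel x₁ 1ℚ x₂ 1ℚ u 1ℚ 1ℚ 0ℚ
    doubling refl refl nv c cAA = kummer-double c (λ h → nv (refl , h)) cAA
    views : ∀ {U V} → Dec (x₁ ≡ x₂) → Sum x₁ y₁ x₂ y₂ U → Sum x₁ y₁ x₂ (- y₂) V →
      Kummer (aff x₁ y₁) (aff x₂ y₂) U V
    views (no ne) (opposite (e , _) _) _ = contradiction e ne
    views (no ne) (secant _ _ _) (opposite (e , _) _) = contradiction e ne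
    views (no ne) (secant _ cAB refl) (secant _ cAB′ refl) =
      kummer-chords c₁ c₂ (λ h → ne (sym (sub≡0⇒≡ h))) cAB cAB′
    views (yes e) (opposite (_ , f) refl) (opposite (_ , g) refl) = torsion e y₁≡0 c₁
      where
      y₁≡0 : y₁ ≡ 0ℚ
      y₁≡0 = double≡0 (linear (1ℚ · f ⊹ 1ℚ · g) (solve (y₁ ∷ y₂ ∷ []) ℚ-ring))
      torsion : ∀ {x₁ x₂ y₁} → x₁ ≡ x₂ → y₁ ≡ 0ℚ → On x₁ y₁ → KummerRel x₁ 1ℚ x₂ 1ℚ 1ℚ 0ℚ 1ℚ 0ℚ
      torsion refl refl c = kummer-2torsion c
    views (yes e) (opposite (_ , f) refl) (secant nv cAB′ refl) = kummer-swap (doubling e y₂≡ nv c₁ cAB′)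
      where
      y₂≡ : y₁ ≡ - y₂
      y₂≡ = linear (1ℚ · f) (solve (y₁ ∷ y₂ ∷ []) ℚ-ring)
    views (yes e) (secant nv cAB refl) (opposite (_ , g) refl) = doubling e y₂≡ nv c₁ cAB
      where
      y₂≡ : y₁ ≡ y₂
      y₂≡ = linear (1ℚ · g) (solve (y₁ ∷ y₂ ∷ []) ℚ-ring)
    views (yes e) (secant nv _ _) (secant nv′ _ _) with equal-or-opposite {x₁} {y₁} {x₂} {y₂} e c₁ c₂
    ... | inj₁ h = ⊥-elim (nv (e , h))
    ... | inj₂ h = ⊥-elim (nv′ (e , trans (cong (_+ - y₂) h) (ℚP.+-inverseʳ y₂)))

-- Prime divisors of integers

module PrimeDivisors where
  open import Data.Nat
  open import Data.Nat.Properties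
  open import Data.Nat.Divisibility
  open import Data.Nat.Primality
  open import Data.Nat.Primality.Factorisation using (factorise)
  open import Data.Nat.Coprimality using (Coprime)
  open import Data.Integer as ℤ using (ℤ; ∣_∣)
  import Data.Integer.Properties as ℤP
  import Data.Integer.Divisibility.Signed as Signed
  open import Data.List using (List; []; _∷_)
  open import Data.List.Relation.Unary.All using ([]; _∷_)
  open import Data.Empty using (⊥-elim)
  open import Data.Sum using (_⊎_; inj₁; inj₂)
  open import Data.Product using (∃; _×_; _,_)
  open import Relation.Binary.PropositionalEquality
  open import Relation.Nullary using (¬_)

  prime-divisor : ∀ {n} → 2 ≤ n → ∃ λ p → Prime p × p ∣ n
  prime-divisor {n@(suc _)} 2≤n with factorise n
  ... | record { factors = [] ; isFactorisation = e } = ⊥-elim (1+n≰n (subst (2 ≤_) e 2≤n))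
  ... | record { factors = p ∷ ps ; isFactorisation = e ; factorsPrime = pp ∷ _ } =
    p , pp , subst (p ∣_) (sym e) (m∣m*n _)

  no-prime-divisor : ∀ {n} → n ≢ 0 → (∀ p → Prime p → ¬ p ∣ n) → n ≡ 1
  no-prime-divisor {zero} n≢0 _ = ⊥-elim (n≢0 refl)
  no-prime-divisor {suc zero} _ _ = refl
  no-prime-divisor {suc (suc n)} _ h with prime-divisor {suc (suc n)} (s≤s (s≤s z≤n))
  ... | p , pp , d = ⊥-elim (h p pp d)

  coprime-prime : ∀ {m n p} → Coprime m n → Prime p → p ∣ m → ¬ p ∣ n
  coprime-prime c pp d e with refl ← c (d , e) = ¬prime[1] pp

  infix 4 _∣ℤ_
  _∣ℤ_ : ℕ → ℤ → Set
  d ∣ℤ z = (ℤ.+ d) Signed.∣ z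

  ∣ℤ⇒∣ : ∀ {d z} → d ∣ℤ z → d ∣ ∣ z ∣
  ∣ℤ⇒∣ = Signed.∣⇒∣ᵤ

  ∣⇒∣ℤ : ∀ {d z} → d ∣ ∣ z ∣ → d ∣ℤ z
  ∣⇒∣ℤ {d} {z} = Signed.∣ᵤ⇒∣ {ℤ.+ d} {z}

  euclidℤ : ∀ {p} x y → Prime p → p ∣ℤ x ℤ.* y → p ∣ℤ x ⊎ p ∣ℤ y
  euclidℤ {p} x y pp h with euclidsLemma ∣ x ∣ ∣ y ∣ pp (subst (p ∣_) (ℤP.abs-* x y) (∣ℤ⇒∣ h))
  ... | inj₁ d = inj₁ (∣⇒∣ℤ d)
  ... | inj₂ d = inj₂ (∣⇒∣ℤ d)

-- The Kummer relation in coprime integer coordinates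

module KummerInteger (E : Curve) where
  open PrimeDivisors
  open RationalField
  open Embedding
  open GroupLaw
  open Add E using (a; b)
  open KummerRational E
  open import Data.Rational as ℚ using (ℚ; 1ℚ; ↧_; ↥_)
  import Data.Rational.Properties as ℚP
  open import Data.Integer as ℤ using (ℤ; _+_; _-_; _*_; -_; ∣_∣; +_)
  import Data.Integer.Properties as ℤP
  open import Data.Nat as ℕ using (ℕ; suc)
  import Data.Nat.Properties as ℕP
  import Data.Nat.Divisibility as ℕD
  import Data.Integer.Divisibility.Signed as Signed
  open import Data.Nat.Primality using (Prime)
  open import Data.Nat.Coprimality as Coprimality using (Coprime)
  open import Data.Nat.GCD using (gcd; gcd[m,n]∣m; gcd[m,n]∣n; gcd[m,n]≢0)
  import Data.Nat.DivMod as ℕDM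
  open import Data.Nat.Tactic.RingSolver using () renaming (solve-∀ to ℕ-solve-∀)
  open import Data.Fin using (Fin; zero; suc)
  open import Data.Vec using (Vec; lookup; map) renaming ([] to ⟨⟩; _∷_ to _◂_)
  open import Data.Vec.Properties using (lookup-map)
  open import Data.Empty using (⊥)
  open import Data.Product using (∃; _,_)
  open import Data.Sum using (inj₁; inj₂)
  open import Data.List using (_∷_; [])
  open import Relation.Binary.PropositionalEquality
  open import Tactic.RingSolver using (solve)
  open import Data.Integer.Tactic.RingSolver using (solve-∀)

  A′ B′ : ℤ
  A′ = Curve.a E
  B′ = Curve.b E

  -- `xc` is the factor that takes the rational coordinates `(nx : nz)` to the coprime integers
  -- `(xn : xd)`.
  xn xd xc : Pt → ℤ
  xn ∞ = + 1
  xn (aff x y) = ↥ x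
  xd ∞ = + 0
  xd (aff x y) = ↧ x
  xc ∞ = + 1
  xc (aff x y) = ↧ x

  record IntegralRel (X₁ Z₁ X₂ Z₂ U U′ V V′ : ℤ) : Set where
    field
      ν : ℤ
      ν≢0 : ν ≢ + 0
      k-D : ν * (U′ * V′) ≡ (X₁ * Z₂ - X₂ * Z₁) * (X₁ * Z₂ - X₂ * Z₁)
      k-S : ν * (U * V′ + V * U′) ≡
        ((X₁ * Z₂ + X₂ * Z₁) * (A′ * (Z₁ * Z₂) + X₁ * X₂) + (B′ * (Z₁ * Z₂) * (Z₁ * Z₂) + B′ * (Z₁ * Z₂) * (Z₁ * Z₂))) +
        ((X₁ * Z₂ + X₂ * Z₁) * (A′ * (Z₁ * Z₂) + X₁ * X₂) + (B′ * (Z₁ * Z₂) * (Z₁ * Z₂) + B′ * (Z₁ * Z₂) * (Z₁ * Z₂)))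
      k-U : ν * (U * V) ≡ (X₁ * X₂ - A′ * (Z₁ * Z₂)) * (X₁ * X₂ - A′ * (Z₁ * Z₂))
        - + 4 * (B′ * (Z₁ * Z₂) * (X₁ * Z₂ + X₂ * Z₁))

  Integral : Pt → Pt → Pt → Pt → Set
  Integral A B U V = IntegralRel (xn A) (xd A) (xn B) (xd B) (xn U) (xd U) (xn V) (xd V)

  infixl 6 _:+_ _:-_
  infixl 7 _:*_
  -- Polynomial expressions, evaluated in both rings: that `ι` respects the long coefficient
  -- formulas becomes one induction.
  data Ex (n : ℕ) : Set where
    var : Fin n → Ex n
    con : ℤ → Ex n
    _:+_ _:-_ _:*_ : Ex n → Ex n → Ex n

  ⟦_⟧ℤ : ∀ {n} → Ex n → Vec ℤ n → ℤ
  ⟦ var i ⟧ℤ ρ = lookup ρ i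
  ⟦ con c ⟧ℤ ρ = c
  ⟦ e :+ f ⟧ℤ ρ = ⟦ e ⟧ℤ ρ + ⟦ f ⟧ℤ ρ
  ⟦ e :- f ⟧ℤ ρ = ⟦ e ⟧ℤ ρ - ⟦ f ⟧ℤ ρ
  ⟦ e :* f ⟧ℤ ρ = ⟦ e ⟧ℤ ρ * ⟦ f ⟧ℤ ρ

  ⟦_⟧ℚ : ∀ {n} → Ex n → Vec ℚ n → ℚ
  ⟦ var i ⟧ℚ ρ = lookup ρ i
  ⟦ con c ⟧ℚ ρ = ι c
  ⟦ e :+ f ⟧ℚ ρ = ⟦ e ⟧ℚ ρ ℚ.+ ⟦ f ⟧ℚ ρ
  ⟦ e :- f ⟧ℚ ρ = ⟦ e ⟧ℚ ρ ℚ.- ⟦ f ⟧ℚ ρ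
  ⟦ e :* f ⟧ℚ ρ = ⟦ e ⟧ℚ ρ ℚ.* ⟦ f ⟧ℚ ρ

  ι-- : ∀ x y → ι (x - y) ≡ ι x ℚ.- ι y
  ι-- x y = linear (1ℚ · sym h) (idι (ι x) (ι y) (ι (x - y)))
    where
    sub-add : ∀ x y → x - y + y ≡ x
    sub-add = solve-∀
    h : ι x ≡ ι (x - y) ℚ.+ ι y
    h = trans (cong ι (sym (sub-add x y))) (ι-+ (x - y) y)
    idι : ∀ u v w → w ℚ.- (u ℚ.- v) ≡ 1ℚ ℚ.* ((w ℚ.+ v) ℚ.- u)
    idι u v w = solve (u ∷ v ∷ w ∷ []) ℚ-ring

  ι-eval : ∀ {n} (e : Ex n) ρ → ι (⟦ e ⟧ℤ ρ) ≡ ⟦ e ⟧ℚ (map ι ρ)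
  ι-eval (var i) ρ = sym (lookup-map i ι ρ)
  ι-eval (con c) ρ = refl
  ι-eval (e :+ f) ρ = trans (ι-+ (⟦ e ⟧ℤ ρ) (⟦ f ⟧ℤ ρ)) (cong₂ ℚ._+_ (ι-eval e ρ) (ι-eval f ρ))
  ι-eval (e :- f) ρ = trans (ι-- (⟦ e ⟧ℤ ρ) (⟦ f ⟧ℤ ρ)) (cong₂ ℚ._-_ (ι-eval e ρ) (ι-eval f ρ))
  ι-eval (e :* f) ρ = trans (ι-* (⟦ e ⟧ℤ ρ) (⟦ f ⟧ℤ ρ)) (cong₂ ℚ._*_ (ι-eval e ρ) (ι-eval f ρ))

  ι-xn : ∀ A → ι (xn A) ≡ nx A ℚ.* ι (xc A)
  ι-xn ∞ = refl
  ι-xn (aff x y) = sym (*-ι↧ x)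

  ι-xd : ∀ A → ι (xd A) ≡ nz A ℚ.* ι (xc A)
  ι-xd ∞ = refl
  ι-xd (aff x y) = sym (ℚP.*-identityˡ (ι (↧ x)))

  xc≢0 : ∀ A → xc A ≢ + 0
  xc≢0 ∞ ()
  xc≢0 (aff x y) ()

  coprime-xn-xd : ∀ A → Coprime ∣ xn A ∣ ∣ xd A ∣
  coprime-xn-xd ∞ (h , _) = ℕD.∣1⇒≡1 h
  coprime-xn-xd (aff (ℚ.mkℚ _ _ c) y) = Coprimality.recompute c

  -- Gauss's lemma for the product of two primitive linear forms.
  gauss : ∀ {X Z X′ Z′ d} → Coprime ∣ X ∣ ∣ Z ∣ → Coprime ∣ X′ ∣ ∣ Z′ ∣ → d ≢ 0 →
    d ∣ℤ Z * Z′ → d ∣ℤ X * Z′ + X′ * Z → d ∣ℤ X * X′ → d ≡ 1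
  gauss {X} {Z} {X′} {Z′} {d} c c′ d≢0 h₁ h₂ h₃ = no-prime-divisor d≢0 λ p pp p∣d →
    let w = ∣⇒∣ℤ {z = + d} p∣d in
    contra p pp (Signed.∣-trans w h₁) (Signed.∣-trans w h₂) (Signed.∣-trans w h₃)
    where
    half : ∀ {X Z X′ Z′} p → Prime p → Coprime ∣ X ∣ ∣ Z ∣ → Coprime ∣ X′ ∣ ∣ Z′ ∣ →
      p ∣ℤ Z → p ∣ℤ X * Z′ + X′ * Z → p ∣ℤ X * X′ → ⊥
    half {X} {Z} {X′} {Z′} p pp c c′ p∣Z h₂ h₃
      with euclidℤ X X′ pp h₃ | euclidℤ X Z′ pp (Signed.∣m+n∣n⇒∣m h₂ (Signed.∣n⇒∣m*n X′ p∣Z))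
    ... | inj₁ e | _ = coprime-prime c pp (∣ℤ⇒∣ e) (∣ℤ⇒∣ p∣Z)
    ... | inj₂ e | inj₁ f = coprime-prime c pp (∣ℤ⇒∣ f) (∣ℤ⇒∣ p∣Z)
    ... | inj₂ e | inj₂ f = coprime-prime c′ pp (∣ℤ⇒∣ e) (∣ℤ⇒∣ f)
    contra : ∀ p → Prime p → p ∣ℤ Z * Z′ → p ∣ℤ X * Z′ + X′ * Z → p ∣ℤ X * X′ → ⊥
    contra p pp h₁ h₂ h₃ with euclidℤ Z Z′ pp h₁
    ... | inj₁ e = half {X} {Z} {X′} {Z′} p pp c c′ e h₂ h₃
    ... | inj₂ e = half {X′} {Z′} {X} {Z} p pp c′ c e (subst (p ∣ℤ_) (ℤP.+-comm (X * Z′) (X′ * Z)) h₂)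
                     (subst (p ∣ℤ_) (ℤP.*-comm X X′) h₃)

  -- After division by g = gcd(M, N), the coprime quotient M/g divides every `t i`; primitivity of
  -- the family then forces M/g to be a unit.
  primitive-∣ : ∀ {I : Set} (M N : ℤ) (t w : I → ℤ) → M ≢ + 0 →
    (∀ {d} → d ≢ 0 → (∀ i → d ∣ℤ t i) → d ≡ 1) → (∀ i → N * t i ≡ M * w i) → ∃ λ ν → N ≡ ν * M
  primitive-∣ M N t w M≢0 prim h = Signed.quotient M∣N , Signed._∣_.equality M∣N
    where
    m n g : ℕ
    m = ∣ M ∣
    n = ∣ N ∣
    m≢0 : m ≢ 0
    m≢0 e = M≢0 (ℤP.∣i∣≡0⇒i≡0 e)
    instance
      _ : ℕ.NonZero m
      _ = ℕ.≢-nonZero m≢0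
    g = gcd m n
    instance
      g≢0 : ℕ.NonZero g
      g≢0 = ℕ.≢-nonZero (gcd[m,n]≢0 m n (inj₁ m≢0))
    m≡ : m ≡ m ℕ./ g ℕ.* g
    m≡ = sym (ℕDM.m/n*n≡m (gcd[m,n]∣m m n))
    n≡ : n ≡ n ℕ./ g ℕ.* g
    n≡ = sym (ℕDM.m/n*n≡m (gcd[m,n]∣n m n))
    m/g∣t : ∀ i → m ℕ./ g ℕD.∣ ∣ t i ∣
    m/g∣t i = Coprimality.coprime-divisor (Coprimality.coprime-/gcd m n)
      (ℕD.*-cancelʳ-∣ g (ℕD.divides ∣ w i ∣ (begin
        n ℕ./ g ℕ.* ∣ t i ∣ ℕ.* g ≡⟨ rearrange (n ℕ./ g) ∣ t i ∣ g ⟩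
        n ℕ./ g ℕ.* g ℕ.* ∣ t i ∣ ≡⟨ cong (ℕ._* ∣ t i ∣) (sym n≡) ⟩
        n ℕ.* ∣ t i ∣ ≡⟨ sym (ℤP.abs-* N (t i)) ⟩
        ∣ N * t i ∣ ≡⟨ cong ∣_∣ (h i) ⟩
        ∣ M * w i ∣ ≡⟨ ℤP.abs-* M (w i) ⟩
        m ℕ.* ∣ w i ∣ ≡⟨ ℕP.*-comm m ∣ w i ∣ ⟩
        ∣ w i ∣ ℕ.* m ≡⟨ cong (∣ w i ∣ ℕ.*_) m≡ ⟩
        ∣ w i ∣ ℕ.* (m ℕ./ g ℕ.* g) ∎)))
      where
      open ≡-Reasoning
      rearrange : ∀ x y z → x ℕ.* y ℕ.* z ≡ x ℕ.* z ℕ.* y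
      rearrange = ℕ-solve-∀
    m/g≡1 : m ℕ./ g ≡ 1
    m/g≡1 = prim (λ e → m≢0 (trans m≡ (cong (ℕ._* g) e))) (λ i → ∣⇒∣ℤ (m/g∣t i))
    M∣N : M Signed.∣ N
    M∣N = Signed.∣ᵤ⇒∣ (ℕD.divides (n ℕ./ g) (trans n≡ (cong (n ℕ./ g ℕ.*_)
      (sym (trans m≡ (trans (cong (ℕ._* g) m/g≡1) (ℕP.*-identityˡ g)))))))

  module _ (A B U V : Pt) where
    data Form : Set where ⟨D⟩ ⟨S⟩ ⟨U⟩ : Form

    product-form coefficient : Form → ℤ
    product-form ⟨D⟩ = xd U * xd V
    product-form ⟨S⟩ = xn U * xd V + xn V * xd U
    product-form ⟨U⟩ = xn U * xn V
    coefficient ⟨D⟩ = (xn A * xd B - xn B * xd A) * (xn A * xd B - xn B * xd A)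
    coefficient ⟨S⟩ =
      ((xn A * xd B + xn B * xd A) * (A′ * (xd A * xd B) + xn A * xn B) + (B′ * (xd A * xd B) * (xd A * xd B) + B′ * (xd A * xd B) * (xd A * xd B))) +
      ((xn A * xd B + xn B * xd A) * (A′ * (xd A * xd B) + xn A * xn B) + (B′ * (xd A * xd B) * (xd A * xd B) + B′ * (xd A * xd B) * (xd A * xd B)))
    coefficient ⟨U⟩ = (xn A * xn B - A′ * (xd A * xd B)) * (xn A * xn B - A′ * (xd A * xd B))
        - + 4 * (B′ * (xd A * xd B) * (xn A * xd B + xn B * xd A))

    module _ (K : Kummer A B U V) where
      open KummerRel K

      private
        cA cB cU cV : ℚ
        cA = ι (xc A)
        cB = ι (xc B)
        cU = ι (xc U)
        cV = ι (xc V)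

      formℚ coeffℚ : (u u′ v v′ : ℚ) → Form → ℚ
      formℚ u u′ v v′ ⟨D⟩ = u′ ℚ.* v′
      formℚ u u′ v v′ ⟨S⟩ = u ℚ.* v′ ℚ.+ v ℚ.* u′
      formℚ u u′ v v′ ⟨U⟩ = u ℚ.* v
      coeffℚ x₁ z₁ x₂ z₂ ⟨D⟩ = (x₁ ℚ.* z₂ ℚ.- x₂ ℚ.* z₁) ℚ.* (x₁ ℚ.* z₂ ℚ.- x₂ ℚ.* z₁)
      coeffℚ x₁ z₁ x₂ z₂ ⟨S⟩ =
        ((x₁ ℚ.* z₂ ℚ.+ x₂ ℚ.* z₁) ℚ.* (a ℚ.* (z₁ ℚ.* z₂) ℚ.+ x₁ ℚ.* x₂) ℚ.+ (b ℚ.* (z₁ ℚ.* z₂) ℚ.* (z₁ ℚ.* z₂) ℚ.+ b ℚ.* (z₁ ℚ.* z₂) ℚ.* (z₁ ℚ.* z₂))) ℚ.+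
        ((x₁ ℚ.* z₂ ℚ.+ x₂ ℚ.* z₁) ℚ.* (a ℚ.* (z₁ ℚ.* z₂) ℚ.+ x₁ ℚ.* x₂) ℚ.+ (b ℚ.* (z₁ ℚ.* z₂) ℚ.* (z₁ ℚ.* z₂) ℚ.+ b ℚ.* (z₁ ℚ.* z₂) ℚ.* (z₁ ℚ.* z₂)))
      coeffℚ x₁ z₁ x₂ z₂ ⟨U⟩ = (x₁ ℚ.* x₂ ℚ.- a ℚ.* (z₁ ℚ.* z₂)) ℚ.* (x₁ ℚ.* x₂ ℚ.- a ℚ.* (z₁ ℚ.* z₂))
        ℚ.- ι (+ 4) ℚ.* (b ℚ.* (z₁ ℚ.* z₂) ℚ.* (x₁ ℚ.* z₂ ℚ.+ x₂ ℚ.* z₁))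

      k-form : ∀ i → μ ℚ.* formℚ (nx U) (nz U) (nx V) (nz V) i ≡ coeffℚ (nx A) (nz A) (nx B) (nz B) i
      k-form ⟨D⟩ = k-D
      k-form ⟨S⟩ = k-S
      k-form ⟨U⟩ = k-U

      ι-form : ∀ i → ι (product-form i) ≡ formℚ (ι (xn U)) (ι (xd U)) (ι (xn V)) (ι (xd V)) i
      ι-form ⟨D⟩ = ι-eval (var zero :* var (suc zero)) (xd U ◂ xd V ◂ ⟨⟩)
      ι-form ⟨S⟩ = ι-eval (var zero :* var (suc zero) :+ var (suc (suc zero)) :* var (suc (suc (suc zero)))) (xn U ◂ xd V ◂ xn V ◂ xd U ◂ ⟨⟩)
      ι-form ⟨U⟩ = ι-eval (var zero :* var (suc zero)) (xn U ◂ xn V ◂ ⟨⟩)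

      ι-coeff : ∀ i → ι (coefficient i) ≡ coeffℚ (ι (xn A)) (ι (xd A)) (ι (xn B)) (ι (xd B)) i
      ι-coeff i = eval i
        where
        X₁ Z₁ X₂ Z₂ 𝐚 𝐛 : Ex 6
        X₁ = var zero
        Z₁ = var (suc zero)
        X₂ = var (suc (suc zero))
        Z₂ = var (suc (suc (suc zero)))
        𝐚 = var (suc (suc (suc (suc zero))))
        𝐛 = var (suc (suc (suc (suc (suc zero)))))
        eD eS eW : Ex 6
        eD = (X₁ :* Z₂ :- X₂ :* Z₁) :* (X₁ :* Z₂ :- X₂ :* Z₁)
        eS = (X₁ :* Z₂ :+ X₂ :* Z₁) :* (𝐚 :* (Z₁ :* Z₂) :+ X₁ :* X₂) :+ (𝐛 :* (Z₁ :* Z₂) :* (Z₁ :* Z₂) :+ 𝐛 :* (Z₁ :* Z₂) :* (Z₁ :* Z₂))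
        eW = (X₁ :* X₂ :- 𝐚 :* (Z₁ :* Z₂)) :* (X₁ :* X₂ :- 𝐚 :* (Z₁ :* Z₂)) :- con (+ 4) :* (𝐛 :* (Z₁ :* Z₂) :* (X₁ :* Z₂ :+ X₂ :* Z₁))
        ρ = xn A ◂ xd A ◂ xn B ◂ xd B ◂ A′ ◂ B′ ◂ ⟨⟩
        eval : ∀ i → ι (coefficient i) ≡ coeffℚ (ι (xn A)) (ι (xd A)) (ι (xn B)) (ι (xd B)) i
        eval ⟨D⟩ = ι-eval eD ρ
        eval ⟨S⟩ = ι-eval (eS :+ eS) ρ
        eval ⟨U⟩ = ι-eval eW ρ

      scale-form : ∀ i u u′ v v′ c d → formℚ (u ℚ.* c) (u′ ℚ.* c) (v ℚ.* d) (v′ ℚ.* d) i ≡ (c ℚ.* d) ℚ.* formℚ u u′ v v′ i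
      scale-form ⟨D⟩ u u′ v v′ c d = id
        where
        id : u′ ℚ.* c ℚ.* (v′ ℚ.* d) ≡ c ℚ.* d ℚ.* (u′ ℚ.* v′)
        id = solve (u′ ∷ v′ ∷ c ∷ d ∷ []) ℚ-ring
      scale-form ⟨S⟩ u u′ v v′ c d = id
        where
        id : u ℚ.* c ℚ.* (v′ ℚ.* d) ℚ.+ v ℚ.* d ℚ.* (u′ ℚ.* c) ≡ c ℚ.* d ℚ.* (u ℚ.* v′ ℚ.+ v ℚ.* u′)
        id = solve (u ∷ v ∷ u′ ∷ v′ ∷ c ∷ d ∷ []) ℚ-ring
      scale-form ⟨U⟩ u u′ v v′ c d = id
        where
        id : u ℚ.* c ℚ.* (v ℚ.* d) ≡ c ℚ.* d ℚ.* (u ℚ.* v)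
        id = solve (u ∷ v ∷ c ∷ d ∷ []) ℚ-ring

      scale-coeff : ∀ i x₁ z₁ x₂ z₂ c d → coeffℚ (x₁ ℚ.* c) (z₁ ℚ.* c) (x₂ ℚ.* d) (z₂ ℚ.* d) i ≡
        (c ℚ.* d) ℚ.* (c ℚ.* d) ℚ.* coeffℚ x₁ z₁ x₂ z₂ i
      scale-coeff ⟨D⟩ x₁ z₁ x₂ z₂ c d = id
        where
        id : ((x₁ ℚ.* c) ℚ.* (z₂ ℚ.* d) ℚ.- (x₂ ℚ.* d) ℚ.* (z₁ ℚ.* c)) ℚ.* ((x₁ ℚ.* c) ℚ.* (z₂ ℚ.* d) ℚ.- (x₂ ℚ.* d) ℚ.* (z₁ ℚ.* c)) ≡
          (c ℚ.* d) ℚ.* (c ℚ.* d) ℚ.* ((x₁ ℚ.* z₂ ℚ.- x₂ ℚ.* z₁) ℚ.* (x₁ ℚ.* z₂ ℚ.- x₂ ℚ.* z₁))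
        id = solve (x₁ ∷ z₁ ∷ x₂ ∷ z₂ ∷ c ∷ d ∷ []) ℚ-ring
      scale-coeff ⟨S⟩ x₁ z₁ x₂ z₂ c d = trans (cong₂ ℚ._+_ (id a b) (id a b)) (sym (ℚP.*-distribˡ-+ ((c ℚ.* d) ℚ.* (c ℚ.* d)) T T))
        where
        T = (x₁ ℚ.* z₂ ℚ.+ x₂ ℚ.* z₁) ℚ.* (a ℚ.* (z₁ ℚ.* z₂) ℚ.+ x₁ ℚ.* x₂) ℚ.+ (b ℚ.* (z₁ ℚ.* z₂) ℚ.* (z₁ ℚ.* z₂) ℚ.+ b ℚ.* (z₁ ℚ.* z₂) ℚ.* (z₁ ℚ.* z₂))
        id : ∀ a b → ((x₁ ℚ.* c) ℚ.* (z₂ ℚ.* d) ℚ.+ (x₂ ℚ.* d) ℚ.* (z₁ ℚ.* c)) ℚ.* (a ℚ.* ((z₁ ℚ.* c) ℚ.* (z₂ ℚ.* d)) ℚ.+ (x₁ ℚ.* c) ℚ.* (x₂ ℚ.* d)) ℚ.+ (b ℚ.* ((z₁ ℚ.* c) ℚ.* (z₂ ℚ.* d)) ℚ.* ((z₁ ℚ.* c) ℚ.* (z₂ ℚ.* d)) ℚ.+ b ℚ.* ((z₁ ℚ.* c) ℚ.* (z₂ ℚ.* d)) ℚ.* ((z₁ ℚ.* c) ℚ.* (z₂ ℚ.* d))) ≡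
          (c ℚ.* d) ℚ.* (c ℚ.* d) ℚ.* ((x₁ ℚ.* z₂ ℚ.+ x₂ ℚ.* z₁) ℚ.* (a ℚ.* (z₁ ℚ.* z₂) ℚ.+ x₁ ℚ.* x₂) ℚ.+ (b ℚ.* (z₁ ℚ.* z₂) ℚ.* (z₁ ℚ.* z₂) ℚ.+ b ℚ.* (z₁ ℚ.* z₂) ℚ.* (z₁ ℚ.* z₂)))
        id a b = solve (a ∷ b ∷ x₁ ∷ z₁ ∷ x₂ ∷ z₂ ∷ c ∷ d ∷ []) ℚ-ring
      scale-coeff ⟨U⟩ x₁ z₁ x₂ z₂ c d = id a b
        where
        id : ∀ a b → ((x₁ ℚ.* c) ℚ.* (x₂ ℚ.* d) ℚ.- a ℚ.* ((z₁ ℚ.* c) ℚ.* (z₂ ℚ.* d))) ℚ.* ((x₁ ℚ.* c) ℚ.* (x₂ ℚ.* d) ℚ.- a ℚ.* ((z₁ ℚ.* c) ℚ.* (z₂ ℚ.* d)))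
            ℚ.- ι (+ 4) ℚ.* (b ℚ.* ((z₁ ℚ.* c) ℚ.* (z₂ ℚ.* d)) ℚ.* ((x₁ ℚ.* c) ℚ.* (z₂ ℚ.* d) ℚ.+ (x₂ ℚ.* d) ℚ.* (z₁ ℚ.* c))) ≡
          (c ℚ.* d) ℚ.* (c ℚ.* d) ℚ.* ((x₁ ℚ.* x₂ ℚ.- a ℚ.* (z₁ ℚ.* z₂)) ℚ.* (x₁ ℚ.* x₂ ℚ.- a ℚ.* (z₁ ℚ.* z₂))
            ℚ.- ι (+ 4) ℚ.* (b ℚ.* (z₁ ℚ.* z₂) ℚ.* (x₁ ℚ.* z₂ ℚ.+ x₂ ℚ.* z₁)))
        id a b = solve (a ∷ b ∷ x₁ ∷ z₁ ∷ x₂ ∷ z₂ ∷ c ∷ d ∷ []) ℚ-ring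

      cong₄ : ∀ {P : Set} (f : ℚ → ℚ → ℚ → ℚ → P) {p p′ q q′ r r′ s s′} →
        p ≡ p′ → q ≡ q′ → r ≡ r′ → s ≡ s′ → f p q r s ≡ f p′ q′ r′ s′
      cong₄ f refl refl refl refl = refl

      private
        N M : ℤ
        -- Denominators are cleared by homogeneity: the product forms are linear in each of U and V,
        -- the coefficients quadratic in each of A and B.
        N = ↥ μ * ((xc A * xc B) * (xc A * xc B))
        M = ↧ μ * (xc U * xc V)

      integral-form : ∀ i → N * product-form i ≡ M * coefficient i
      integral-form i = ι-injective (begin
        ι (N * product-form i) ≡⟨ ι-* N (product-form i) ⟩
        ι N ℚ.* ι (product-form i) ≡⟨ cong₂ ℚ._*_ ιN (trans (ι-form i) (trans (cong₄ (λ p q r s → formℚ p q r s i) (ι-xn U) (ι-xd U) (ι-xn V) (ι-xd V)) (scale-form i (nx U) (nz U) (nx V) (nz V) cU cV))) ⟩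
        (μ ℚ.* ι (↧ μ) ℚ.* ((cA ℚ.* cB) ℚ.* (cA ℚ.* cB))) ℚ.* ((cU ℚ.* cV) ℚ.* formℚ (nx U) (nz U) (nx V) (nz V) i)
          ≡⟨ move μ (ι (↧ μ)) ((cA ℚ.* cB) ℚ.* (cA ℚ.* cB)) (cU ℚ.* cV) (formℚ (nx U) (nz U) (nx V) (nz V) i) ⟩
        (ι (↧ μ) ℚ.* (cU ℚ.* cV)) ℚ.* (((cA ℚ.* cB) ℚ.* (cA ℚ.* cB)) ℚ.* (μ ℚ.* formℚ (nx U) (nz U) (nx V) (nz V) i))
          ≡⟨ cong₂ ℚ._*_ (sym ιM) (trans (cong (((cA ℚ.* cB) ℚ.* (cA ℚ.* cB)) ℚ.*_) (k-form i)) (trans (sym (scale-coeff i (nx A) (nz A) (nx B) (nz B) cA cB))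
              (trans (cong₄ (λ p q r s → coeffℚ p q r s i) (sym (ι-xn A)) (sym (ι-xd A)) (sym (ι-xn B)) (sym (ι-xd B))) (sym (ι-coeff i))))) ⟩
        ι M ℚ.* ι (coefficient i) ≡⟨ sym (ι-* M (coefficient i)) ⟩
        ι (M * coefficient i) ∎)
        where
        open ≡-Reasoning
        move : ∀ p q r s t → (p ℚ.* q ℚ.* r) ℚ.* (s ℚ.* t) ≡ (q ℚ.* s) ℚ.* (r ℚ.* (p ℚ.* t))
        move p q r s t = solve (p ∷ q ∷ r ∷ s ∷ t ∷ []) ℚ-ring
        ιN : ι N ≡ μ ℚ.* ι (↧ μ) ℚ.* ((cA ℚ.* cB) ℚ.* (cA ℚ.* cB))
        ιN = trans (ι-eval (var zero :* ((var (suc zero) :* var (suc (suc zero))) :* (var (suc zero) :* var (suc (suc zero))))) (↥ μ ◂ xc A ◂ xc B ◂ ⟨⟩))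
          (cong (ℚ._* ((cA ℚ.* cB) ℚ.* (cA ℚ.* cB))) (sym (*-ι↧ μ)))
        ιM : ι M ≡ ι (↧ μ) ℚ.* (cU ℚ.* cV)
        ιM = ι-eval (var zero :* (var (suc zero) :* var (suc (suc zero)))) (↧ μ ◂ xc U ◂ xc V ◂ ⟨⟩)

      product≢0 : ∀ x y → x ≢ + 0 → y ≢ + 0 → x * y ≢ + 0
      product≢0 x y x≢0 y≢0 e with ℤP.i*j≡0⇒i≡0∨j≡0 x e
      ... | inj₁ z = x≢0 z
      ... | inj₂ z = y≢0 z

      N≢0 : N ≢ + 0
      N≢0 = product≢0 (↥ μ) ((xc A * xc B) * (xc A * xc B)) (λ e → μ≢0 (ℚP.↥p≡0⇒p≡0 μ e))
        (product≢0 (xc A * xc B) (xc A * xc B) AB≢0 AB≢0)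
        where
        AB≢0 : xc A * xc B ≢ + 0
        AB≢0 = product≢0 (xc A) (xc B) (xc≢0 A) (xc≢0 B)

      M≢0 : M ≢ + 0
      M≢0 = product≢0 (↧ μ) (xc U * xc V) (λ ()) (product≢0 (xc U) (xc V) (xc≢0 U) (xc≢0 V))

      cancel-ν : ∀ ν n m t w → m ≢ + 0 → n ≡ ν * m → n * t ≡ m * w → ν * t ≡ w
      cancel-ν ν n m t w m≢0 refl e = ℤP.*-cancelˡ-≡ m (ν * t) w (trans (swap ν m t) e)
        where
        instance _ = ℤ.≢-nonZero m≢0
        swap : ∀ n m t → m * (n * t) ≡ n * m * t
        swap = solve-∀

      -- By Gauss's lemma the form with roots U and V is primitive in coprime coordinates, so the
      -- scalar `N / M` is an integer. Everything about sizes and divisibility rests on this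
      -- integrality.
      integral : Integral A B U V
      integral = from (primitive-∣ M N product-form coefficient M≢0
        (λ d≢0 h → gauss {xn U} {xd U} {xn V} {xd V} (coprime-xn-xd U) (coprime-xn-xd V) d≢0 (h ⟨D⟩) (h ⟨S⟩) (h ⟨U⟩)) integral-form)
        where
        from : (∃ λ ν → N ≡ ν * M) → Integral A B U V
        from (ν , N≡) = record
          { ν = ν
          ; ν≢0 = λ e → N≢0 (trans N≡ (trans (cong (_* M) e) (ℤP.*-zeroˡ M)))
          ; k-D = eq ⟨D⟩
          ; k-S = eq ⟨S⟩
          ; k-U = eq ⟨U⟩
          }
          where
          eq : ∀ i → ν * product-form i ≡ coefficient i
          eq i = cancel-ν ν N M (product-form i) (coefficient i) M≢0 N≡ (integral-form i)

  integral-kummer : ∀ A B → OnCurve E A → OnCurve E B → Integral A B (add E A B) (add E A (neg B))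
  integral-kummer A B c d = integral A B (add E A B) (add E A (neg B)) (kummer A B c d)

-- Divisibility by prime powers

module PrimePowers where
  open PrimeDivisors
  open import Data.Nat as ℕ using (ℕ; zero; suc)
  import Data.Nat.Divisibility as ℕD
  open import Data.Nat.Primality using (Prime; prime⇒nonZero)
  open import Data.Integer using (+_; _+_; _-_; _*_; -_; ∣_∣)
  import Data.Integer.Properties as ℤP
  open import Data.Integer.Divisibility.Signed using (divides; *-cancelˡ-∣; *-monoʳ-∣; ∣m+n∣n⇒∣m; ∣m+n∣m⇒∣n; ∣m⇒∣m*n)
  open import Data.Integer.Tactic.RingSolver using (solve-∀)
  open import Data.Sum using (inj₁; inj₂)
  open import Data.Empty using (⊥-elim)
  open import Relation.Nullary using (¬_)
  open import Relation.Binary.PropositionalEquality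

  1∣ℤ : ∀ x → 1 ∣ℤ x
  1∣ℤ x = divides x (sym (ℤP.*-identityʳ x))

  p*-∣ : ∀ p q x → q ∣ℤ x → p ℕ.* q ∣ℤ + p * x
  p*-∣ p q x h rewrite ℤP.pos-* p q = *-monoʳ-∣ (+ p) h

  p*-∣⁻ : ∀ {p} q x → Prime p → p ℕ.* q ∣ℤ + p * x → q ∣ℤ x
  p*-∣⁻ {p} q x pp h rewrite ℤP.pos-* p q = *-cancelˡ-∣ (+ p) {{prime⇒nonZero pp}} h

  ∣-∣ℤ : ∀ {m n x} → m ℕD.∣ n → n ∣ℤ x → m ∣ℤ x
  ∣-∣ℤ {m} {n} {x} d h = ∣⇒∣ℤ (ℕD.∣-trans d (∣ℤ⇒∣ h))

  prime-power-cancel : ∀ {p} j x y → Prime p → ¬ p ∣ℤ y → p ℕ.^ j ∣ℤ x * y → p ℕ.^ j ∣ℤ x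
  prime-power-cancel zero x y pp p∤y h = 1∣ℤ x
  prime-power-cancel {p} (suc j) x y pp p∤y h with euclidℤ x y pp (∣-∣ℤ (ℕD.m∣m*n (p ℕ.^ j)) h)
  ... | inj₂ e = ⊥-elim (p∤y e)
  ... | inj₁ e@(divides q refl) = subst (p ℕ.* p ℕ.^ j ∣ℤ_) (ℤP.*-comm (+ p) q)
    (p*-∣ p (p ℕ.^ j) q (prime-power-cancel j q y pp p∤y
      (p*-∣⁻ (p ℕ.^ j) (q * y) pp (subst (p ℕ.* p ℕ.^ j ∣ℤ_) (move q (+ p) y) h))))
    where
    move : ∀ q p y → q * p * y ≡ p * (q * y)
    move = solve-∀

  -- Newton polygon of (t - α)(t - β).
  prime-power-root : ∀ {p} j α β → Prime p → p ℕ.^ j ℕ.* p ℕ.^ j ∣ℤ α * β → p ℕ.^ j ∣ℤ α + β → p ℕ.^ j ∣ℤ α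
  prime-power-root zero α β pp h k = 1∣ℤ α
  prime-power-root {p} (suc j) α β pp h k = both p∣α
    where
    q = p ℕ.^ j
    p∣sum : p ∣ℤ α + β
    p∣sum = ∣-∣ℤ (ℕD.m∣m*n q) k
    p∣α : p ∣ℤ α
    p∣α with euclidℤ α β pp (∣-∣ℤ (ℕD.∣m⇒∣m*n (p ℕ.* q) (ℕD.m∣m*n q)) h)
    ... | inj₁ e = e
    ... | inj₂ e = ∣m+n∣n⇒∣m p∣sum e
    both : p ∣ℤ α → p ℕ.* q ∣ℤ α
    both (divides α′ refl) with ∣m+n∣m⇒∣n {m = α′ * + p} {n = β} p∣sum (divides α′ refl)
    ... | divides β′ refl = subst (p ℕ.* q ∣ℤ_) (ℤP.*-comm (+ p) α′) (p*-∣ p q α′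
      (prime-power-root j α′ β′ pp
        (p*-∣⁻ (q ℕ.* q) (α′ * β′) pp (p*-∣⁻ (p ℕ.* (q ℕ.* q)) (+ p * (α′ * β′)) pp
          (subst₂ _∣ℤ_ (rearrange p q) (move α′ β′ (+ p)) h)))
        (p*-∣⁻ q (α′ + β′) pp (subst (p ℕ.* q ∣ℤ_) (move′ α′ β′ (+ p)) k))))
      where
      rearrange : ∀ p q → p ℕ.* q ℕ.* (p ℕ.* q) ≡ p ℕ.* (p ℕ.* (q ℕ.* q))
      rearrange = ℕ-solve-∀
        where open import Data.Nat.Tactic.RingSolver using () renaming (solve-∀ to ℕ-solve-∀)
      move : ∀ α β p → α * p * (β * p) ≡ p * (p * (α * β))
      move = solve-∀
      move′ : ∀ α β p → α * p + β * p ≡ p * (α + β)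
      move′ = solve-∀

  ∣ℤ-square : ∀ q x → q ∣ℤ x → q ℕ.* q ∣ℤ x * x
  ∣ℤ-square q .(y * + q) (divides y refl) = divides (y * y)
    (trans (move y (+ q)) (cong (y * y *_) (sym (ℤP.pos-* q q))))
    where
    move : ∀ y q → y * q * (y * q) ≡ y * y * (q * q)
    move = solve-∀

  ∣ℤ-- : ∀ {q} x y → q ∣ℤ x → q ∣ℤ y → q ∣ℤ x - y
  ∣ℤ-- x y = Data.Integer.Divisibility.Signed.∣m∣n⇒∣m-n


-- The Kummer relation modulo prime powers

module KummerLocal (E : Curve) {X₁ Z₁ X₂ Z₂ U U′ V V′ : ℤ}
  (K : KummerInteger.IntegralRel E X₁ Z₁ X₂ Z₂ U U′ V V′) where
  open KummerInteger E using (A′; B′; module IntegralRel)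
  open PrimeDivisors
  open PrimePowers
  open IntegralRel K
  open import Data.Nat as ℕ using (ℕ; zero; suc)
  import Data.Nat.Divisibility as ℕD
  open import Data.Nat.Primality using (Prime)
  open import Data.Nat.Coprimality using (Coprime)
  open import Data.Integer using (ℤ; +_; _+_; _-_; _*_; -_; ∣_∣)
  open import Data.Integer.Divisibility.Signed using (∣m∣n⇒∣m+n; ∣m+n∣n⇒∣m; ∣m⇒∣m*n; ∣n⇒∣m*n)
  open import Data.Integer.Tactic.RingSolver using (solve-∀)
  open import Data.Sum using (_⊎_; [_,_]′)
  open import Data.Product using (_×_; _,_)
  open import Data.Empty using (⊥; ⊥-elim)
  open import Relation.Nullary using (¬_)
  open import Relation.Binary.PropositionalEquality
  import Data.Integer.Properties as ℤP
  import Data.Nat.Properties as ℕP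

  -- Points reducing to O modulo q = p^j form a subgroup.
  denominators : ∀ {p} j → Prime p → Coprime ∣ X₁ ∣ ∣ Z₁ ∣ → Coprime ∣ X₂ ∣ ∣ Z₂ ∣ →
    p ℕ.^ j ∣ℤ Z₁ → p ℕ.^ j ∣ℤ Z₂ → p ℕ.^ j ∣ℤ U′ × p ℕ.^ j ∣ℤ V′
  denominators zero pp c₁ c₂ h₁ h₂ = 1∣ℤ U′ , 1∣ℤ V′
  denominators {p} (suc j) pp c₁ c₂ h₁ h₂ =
    -- The numbers `U′ V` and `V′ U` have product divisible by q² because of `k-D` and sum divisible
    -- by q because of `k-S`; hence q divides each of them, and the factors V and U are prime to p.
    prime-power-cancel (suc j) U′ V pp p∤V (prime-power-root (suc j) (U′ * V) (V′ * U) pp product₁ sum₁) ,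
    prime-power-cancel (suc j) V′ U pp p∤U (prime-power-root (suc j) (V′ * U) (U′ * V) pp product₂ sum₂)
    where
    q = p ℕ.* p ℕ.^ j
    p∣q : p ℕD.∣ q
    p∣q = ℕD.m∣m*n (p ℕ.^ j)
    p∤X₁ : ¬ p ∣ℤ X₁
    p∤X₁ h = coprime-prime c₁ pp (∣ℤ⇒∣ h) (∣ℤ⇒∣ (∣-∣ℤ p∣q h₁))
    p∤X₂ : ¬ p ∣ℤ X₂
    p∤X₂ h = coprime-prime c₂ pp (∣ℤ⇒∣ h) (∣ℤ⇒∣ (∣-∣ℤ p∣q h₂))
    -- Since p divides `Z₁`, the coefficient `k-U` is congruent to `(X₁ X₂)²`, a unit modulo p.
    -- Therefore `ν`, `U` and `V` are all units.
    p∤νUV : ¬ p ∣ℤ ν * (U * V)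
    p∤νUV h = [ both , both ]′ (euclidℤ (X₁ * X₂) (X₁ * X₂) pp
      (∣m+n∣n⇒∣m (subst (p ∣ℤ_) (trans k-U (split A′ B′ X₁ Z₁ X₂ Z₂)) h)
        (∣m⇒∣m*n (Z₂ * (A′ * (A′ * (Z₁ * Z₂)) - (+ 2) * (A′ * (X₁ * X₂)) - (+ 4) * (B′ * (X₁ * Z₂ + X₂ * Z₁))))
          (∣-∣ℤ p∣q h₁))))
      where
      both : p ∣ℤ X₁ * X₂ → ⊥
      both k = [ p∤X₁ , p∤X₂ ]′ (euclidℤ X₁ X₂ pp k)
      split : ∀ a b X₁ Z₁ X₂ Z₂ → (X₁ * X₂ - a * (Z₁ * Z₂)) * (X₁ * X₂ - a * (Z₁ * Z₂)) - + 4 * (b * (Z₁ * Z₂) * (X₁ * Z₂ + X₂ * Z₁))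
        ≡ X₁ * X₂ * (X₁ * X₂) + Z₁ * (Z₂ * (a * (a * (Z₁ * Z₂)) - (+ 2) * (a * (X₁ * X₂)) - (+ 4) * (b * (X₁ * Z₂ + X₂ * Z₁))))
      split = solve-∀
    p∤ν : ¬ p ∣ℤ ν
    p∤ν h = p∤νUV (∣m⇒∣m*n (U * V) h)
    p∤U : ¬ p ∣ℤ U
    p∤U h = p∤νUV (∣n⇒∣m*n ν (∣m⇒∣m*n V h))
    p∤V : ¬ p ∣ℤ V
    p∤V h = p∤νUV (∣n⇒∣m*n ν (∣n⇒∣m*n U h))
    q²∣ : q ℕ.* q ∣ℤ U′ * V′
    q²∣ = subst (_∣ℤ U′ * V′) (square p (suc j)) (prime-power-cancel (suc j ℕ.+ suc j) (U′ * V′) ν pp p∤ν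
      (subst₂ _∣ℤ_ (sym (square p (suc j))) (trans (sym k-D) (ℤP.*-comm ν (U′ * V′)))
        (∣ℤ-square q (X₁ * Z₂ - X₂ * Z₁) (∣ℤ-- (X₁ * Z₂) (X₂ * Z₁) (∣n⇒∣m*n X₁ h₂) (∣n⇒∣m*n X₂ h₁)))))
      where
      square : ∀ p k → p ℕ.^ (k ℕ.+ k) ≡ p ℕ.^ k ℕ.* p ℕ.^ k
      square p k = ℕP.^-distribˡ-+-* p k k
    product₁ : q ℕ.* q ∣ℤ U′ * V * (V′ * U)
    product₁ = subst (q ℕ.* q ∣ℤ_) (move U V U′ V′) (∣m⇒∣m*n (U * V) q²∣)
      where
      move : ∀ U V U′ V′ → U′ * V′ * (U * V) ≡ U′ * V * (V′ * U)
      move = solve-∀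
    product₂ : q ℕ.* q ∣ℤ V′ * U * (U′ * V)
    product₂ = subst (q ℕ.* q ∣ℤ_) (ℤP.*-comm (U′ * V) (V′ * U)) product₁
    sum₂ : q ∣ℤ V′ * U + U′ * V
    sum₂ = prime-power-cancel (suc j) (V′ * U + U′ * V) ν pp p∤ν (subst (q ∣ℤ_) (trans (sym k-S) (move ν U V U′ V′))
      (∣m∣n⇒∣m+n half half))
      where
      move : ∀ ν U V U′ V′ → ν * (U * V′ + V * U′) ≡ (V′ * U + U′ * V) * ν
      move = solve-∀
      half : q ∣ℤ (X₁ * Z₂ + X₂ * Z₁) * (A′ * (Z₁ * Z₂) + X₁ * X₂) + (B′ * (Z₁ * Z₂) * (Z₁ * Z₂) + B′ * (Z₁ * Z₂) * (Z₁ * Z₂))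
      half = ∣m∣n⇒∣m+n (∣m⇒∣m*n (A′ * (Z₁ * Z₂) + X₁ * X₂) (∣m∣n⇒∣m+n (∣n⇒∣m*n X₁ h₂) (∣n⇒∣m*n X₂ h₁)))
        (∣m∣n⇒∣m+n quarter quarter)
        where
        quarter : q ∣ℤ B′ * (Z₁ * Z₂) * (Z₁ * Z₂)
        quarter = ∣n⇒∣m*n (B′ * (Z₁ * Z₂)) (∣m⇒∣m*n Z₂ h₁)
    sum₁ : q ∣ℤ U′ * V + V′ * U
    sum₁ = subst (q ∣ℤ_) (ℤP.+-comm (V′ * U) (U′ * V)) sum₂

  -- The coefficient `k-D` vanishes modulo p, so p divides `ν U′ V′`. The other two reduce to
  -- `(a Z₁ Z₂)²` and `4 b (Z₁ Z₂)²`; if p divided `ν`, it would divide a and b, hence the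
  -- discriminant.
  numerators : ∀ {p} → Prime p → ¬ p ∣ℤ + 2 → ¬ p ∣ℤ (+ 4 * A′ * A′ * A′) + (+ 27 * B′ * B′) →
    Coprime ∣ X₁ ∣ ∣ Z₁ ∣ → Coprime ∣ X₂ ∣ ∣ Z₂ ∣ → p ∣ℤ X₁ → p ∣ℤ X₂ → p ∣ℤ U′ ⊎ p ∣ℤ V′
  numerators {p} pp p∤2 p∤Δ c₁ c₂ h₁ h₂ =
    [ (λ h → ⊥-elim (p∤ν h)) , euclidℤ U′ V′ pp ]′ (euclidℤ ν (U′ * V′) pp
      (subst (p ∣ℤ_) (sym k-D) (∣m⇒∣m*n (X₁ * Z₂ - X₂ * Z₁)
        (∣ℤ-- (X₁ * Z₂) (X₂ * Z₁) (∣m⇒∣m*n Z₂ h₁) (∣m⇒∣m*n Z₁ h₂)))))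
    where
    p∤Z₁Z₂ : ¬ p ∣ℤ Z₁ * Z₂
    p∤Z₁Z₂ h = [ (λ k → coprime-prime c₁ pp (∣ℤ⇒∣ h₁) (∣ℤ⇒∣ k)) , (λ k → coprime-prime c₂ pp (∣ℤ⇒∣ h₂) (∣ℤ⇒∣ k)) ]′ (euclidℤ Z₁ Z₂ pp h)
    p∤ν : ¬ p ∣ℤ ν
    p∤ν h = p∤Δ (∣m∣n⇒∣m+n (∣n⇒∣m*n (+ 4 * A′ * A′) p∣a) (∣n⇒∣m*n (+ 27 * B′) p∣b))
      where
      p∣a : p ∣ℤ A′
      p∣a = [ factor , factor ]′ (euclidℤ (A′ * (Z₁ * Z₂)) (A′ * (Z₁ * Z₂)) pp
        (∣m+n∣n⇒∣m (subst (p ∣ℤ_) (trans k-U (split A′ B′ X₁ Z₁ X₂ Z₂)) (∣m⇒∣m*n (U * V) h))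
          (∣m∣n⇒∣m+n (∣m⇒∣m*n (X₂ * (X₁ * X₂) - + 2 * (A′ * (Z₁ * Z₂) * X₂) - + 4 * (B′ * (Z₁ * Z₂) * Z₂)) h₁)
            (∣m⇒∣m*n (- (+ 4 * (B′ * (Z₁ * Z₂) * Z₁))) h₂))))
        where
        factor : p ∣ℤ A′ * (Z₁ * Z₂) → p ∣ℤ A′
        factor k = [ (λ x → x) , (λ x → ⊥-elim (p∤Z₁Z₂ x)) ]′ (euclidℤ A′ (Z₁ * Z₂) pp k)
        split : ∀ a b X₁ Z₁ X₂ Z₂ → (X₁ * X₂ - a * (Z₁ * Z₂)) * (X₁ * X₂ - a * (Z₁ * Z₂)) - + 4 * (b * (Z₁ * Z₂) * (X₁ * Z₂ + X₂ * Z₁))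
          ≡ a * (Z₁ * Z₂) * (a * (Z₁ * Z₂)) + (X₁ * (X₂ * (X₁ * X₂) - + 2 * (a * (Z₁ * Z₂) * X₂) - + 4 * (b * (Z₁ * Z₂) * Z₂)) + X₂ * - (+ 4 * (b * (Z₁ * Z₂) * Z₁)))
        split = solve-∀
      p∣b : p ∣ℤ B′
      p∣b = [ (λ x → ⊥-elim (p∤2 x)) , (λ x → [ (λ y → ⊥-elim (p∤2 y)) , (λ y → factor y) ]′ (euclidℤ (+ 2) (B′ * (Z₁ * Z₂) * (Z₁ * Z₂)) pp x)) ]′
          (euclidℤ (+ 2) (+ 2 * (B′ * (Z₁ * Z₂) * (Z₁ * Z₂))) pp
            (∣m+n∣n⇒∣m (subst (p ∣ℤ_) (trans k-S (split A′ B′ X₁ Z₁ X₂ Z₂)) (∣m⇒∣m*n (U * V′ + V * U′) h))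
              (∣m∣n⇒∣m+n (∣m⇒∣m*n (+ 2 * (Z₂ * (A′ * (Z₁ * Z₂) + X₁ * X₂))) h₁) (∣m⇒∣m*n (+ 2 * (Z₁ * (A′ * (Z₁ * Z₂) + X₁ * X₂))) h₂))))
        where
        factor : p ∣ℤ B′ * (Z₁ * Z₂) * (Z₁ * Z₂) → p ∣ℤ B′
        factor k = [ (λ x → [ (λ y → y) , (λ y → ⊥-elim (p∤Z₁Z₂ y)) ]′ (euclidℤ B′ (Z₁ * Z₂) pp x)) , (λ x → ⊥-elim (p∤Z₁Z₂ x)) ]′ (euclidℤ (B′ * (Z₁ * Z₂)) (Z₁ * Z₂) pp k)
        split : ∀ a b X₁ Z₁ X₂ Z₂ →
          ((X₁ * Z₂ + X₂ * Z₁) * (a * (Z₁ * Z₂) + X₁ * X₂) + (b * (Z₁ * Z₂) * (Z₁ * Z₂) + b * (Z₁ * Z₂) * (Z₁ * Z₂))) +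
          ((X₁ * Z₂ + X₂ * Z₁) * (a * (Z₁ * Z₂) + X₁ * X₂) + (b * (Z₁ * Z₂) * (Z₁ * Z₂) + b * (Z₁ * Z₂) * (Z₁ * Z₂))) ≡
          + 2 * (+ 2 * (b * (Z₁ * Z₂) * (Z₁ * Z₂))) + (X₁ * (+ 2 * (Z₂ * (a * (Z₁ * Z₂) + X₁ * X₂))) + X₂ * (+ 2 * (Z₁ * (a * (Z₁ * Z₂) + X₁ * X₂))))
        split = solve-∀

-- Sizes of the factors of a binary quadratic form

module Bounds where
  open import Data.Nat using (_+_; _*_; _≤_; _⊔_; _≤?_)
  open import Data.Nat.Properties
  open import Data.Nat.Tactic.RingSolver using (solve-∀)
  open import Data.Integer as ℤ using (ℤ; ∣_∣)
  import Data.Integer.Properties as ℤP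
  import Data.Integer.Tactic.RingSolver as ℤ-Solver
  open import Data.Sum using (inj₁; inj₂)
  open import Data.Empty using (⊥-elim)
  open import Relation.Nullary using (yes; no)
  open import Relation.Binary.PropositionalEquality

  bound-* : ∀ x y {m n} → ∣ x ∣ ≤ m → ∣ y ∣ ≤ n → ∣ x ℤ.* y ∣ ≤ m * n
  bound-* x y {m} {n} h k = subst (_≤ m * n) (sym (ℤP.abs-* x y)) (*-mono-≤ h k)

  bound-+ : ∀ x y {m n} → ∣ x ∣ ≤ m → ∣ y ∣ ≤ n → ∣ x ℤ.+ y ∣ ≤ m + n
  bound-+ x y h k = ≤-trans (ℤP.∣i+j∣≤∣i∣+∣j∣ x y) (+-mono-≤ h k)

  bound-- : ∀ x y {m n} → ∣ x ∣ ≤ m → ∣ y ∣ ≤ n → ∣ x ℤ.- y ∣ ≤ m + n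
  bound-- x y h k = ≤-trans (ℤP.∣i-j∣≤∣i∣+∣j∣ x y) (+-mono-≤ h k)

  reverse-triangle : ∀ x y → ∣ x ∣ ≤ ∣ x ℤ.+ y ∣ + ∣ y ∣
  reverse-triangle x y = subst (_≤ ∣ x ℤ.+ y ∣ + ∣ y ∣) (cong ∣_∣ (id x y)) (ℤP.∣i-j∣≤∣i∣+∣j∣ (x ℤ.+ y) y)
    where
    id : ∀ x y → x ℤ.+ y ℤ.- y ≡ x
    id = ℤ-Solver.solve-∀

  -- Archimedean counterpart of `prime-power-root`: if β exceeds t, the product bound keeps α below
  -- t; otherwise the first hypothesis suffices.
  dominant : ∀ {α β t} → α ≤ β + t → α * β ≤ t * t → α ≤ t + t
  dominant {α} {β} {t} h k with β ≤? t | α ≤? t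
  ... | yes p | _ = ≤-trans h (+-monoˡ-≤ t p)
  ... | no _ | yes q = ≤-trans q (m≤m+n t t)
  ... | no p | no q = ⊥-elim (<⇒≱ (*-mono-< (≰⇒> q) (≰⇒> p)) k)

  swap-product : ∀ U U′ V V′ → ∣ U ℤ.* V′ ∣ * ∣ V ℤ.* U′ ∣ ≡ ∣ U ℤ.* V ∣ * ∣ U′ ℤ.* V′ ∣
  swap-product U U′ V V′ rewrite ℤP.abs-* U V′ | ℤP.abs-* V U′ | ℤP.abs-* U V | ℤP.abs-* U′ V′ = id (∣ U ∣) (∣ U′ ∣) (∣ V ∣) (∣ V′ ∣)
    where
    id : ∀ u u′ v v′ → u * v′ * (v * u′) ≡ u * v * (u′ * v′)
    id = solve-∀

  -- Gelfond's inequality for two linear forms. Only the mixed maxima need an argument: `U V′` and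
  -- `V U′` are the two summands of the middle coefficient, with product bounded by the outer ones,
  -- so `dominant` applies.
  product-height : ∀ {U U′ V V′ t} → ∣ U′ ℤ.* V′ ∣ ≤ t → ∣ U ℤ.* V′ ℤ.+ V ℤ.* U′ ∣ ≤ t → ∣ U ℤ.* V ∣ ≤ t →
    (∣ U ∣ ⊔ ∣ U′ ∣) * (∣ V ∣ ⊔ ∣ V′ ∣) ≤ t + t
  product-height {U} {U′} {V} {V′} {t} h₁ h₂ h₃ with ⊔-sel (∣ U ∣) (∣ U′ ∣) | ⊔-sel (∣ V ∣) (∣ V′ ∣)
  ... | inj₁ e | inj₁ f rewrite e | f = ≤-trans (≤-reflexive (sym (ℤP.abs-* U V))) (≤-trans h₃ (m≤m+n t t))
  ... | inj₂ e | inj₂ f rewrite e | f = ≤-trans (≤-reflexive (sym (ℤP.abs-* U′ V′))) (≤-trans h₁ (m≤m+n t t))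
  ... | inj₁ e | inj₂ f rewrite e | f = ≤-trans (≤-reflexive (sym (ℤP.abs-* U V′)))
    (dominant (≤-trans (reverse-triangle (U ℤ.* V′) (V ℤ.* U′)) (≤-trans (≤-reflexive (+-comm (∣ U ℤ.* V′ ℤ.+ V ℤ.* U′ ∣) (∣ V ℤ.* U′ ∣))) (+-monoʳ-≤ ∣ V ℤ.* U′ ∣ h₂)))
      (≤-trans (≤-reflexive (swap-product U U′ V V′)) (*-mono-≤ h₃ h₁)))
  ... | inj₂ e | inj₁ f rewrite e | f = ≤-trans (≤-reflexive (trans (*-comm (∣ U′ ∣) (∣ V ∣)) (sym (ℤP.abs-* V U′))))
    (dominant (≤-trans (reverse-triangle (V ℤ.* U′) (U ℤ.* V′)) (≤-trans (≤-reflexive (trans (cong (λ z → ∣ z ∣ + ∣ U ℤ.* V′ ∣) (ℤP.+-comm (V ℤ.* U′) (U ℤ.* V′))) (+-comm (∣ U ℤ.* V′ ℤ.+ V ℤ.* U′ ∣) (∣ U ℤ.* V′ ∣)))) (+-monoʳ-≤ ∣ U ℤ.* V′ ∣ h₂)))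
      (≤-trans (≤-reflexive (trans (*-comm (∣ V ℤ.* U′ ∣) (∣ U ℤ.* V′ ∣)) (swap-product U U′ V V′))) (*-mono-≤ h₃ h₁)))


-- Archimedean consequences of the Kummer relation

module KummerSize (E : Curve) {X₁ Z₁ X₂ Z₂ U U′ V V′ : ℤ}
  (K : KummerInteger.IntegralRel E X₁ Z₁ X₂ Z₂ U U′ V V′) where
  open KummerInteger E using (A′; B′; module IntegralRel)
  open Bounds
  open IntegralRel K
  open import Data.Nat as ℕ using (ℕ; zero; suc; _≤_; _⊔_)
  open import Data.Nat.Properties
  import Data.Nat.Tactic.RingSolver as ℕ-Solver
  import Data.Integer.Tactic.RingSolver as ℤ-Solver
  open import Data.Integer using (ℤ; +_; _+_; _-_; _*_; -_; ∣_∣)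
  import Data.Integer.Properties as ℤP
  open import Data.Empty using (⊥-elim)
  open import Relation.Binary.PropositionalEquality

  α β : ℕ
  α = ∣ A′ ∣
  β = ∣ B′ ∣

  1≤ν : 1 ≤ ∣ ν ∣
  1≤ν with ∣ ν ∣ in eq
  ... | zero = ⊥-elim (ν≢0 (ℤP.∣i∣≡0⇒i≡0 eq))
  ... | suc _ = ℕ.s≤s ℕ.z≤n

  -- Upper bounds survive the removal of a nonzero integer factor; lower bounds will require an
  -- upper bound for `ν`.
  drop-ν : ∀ {t w} {m} → ν * t ≡ w → ∣ w ∣ ≤ m → ∣ t ∣ ≤ m
  drop-ν {t} {w} {m} e h = ≤-trans (≤-trans (≤-reflexive (sym (*-identityˡ ∣ t ∣))) (*-monoˡ-≤ ∣ t ∣ 1≤ν))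
    (≤-trans (≤-reflexive (trans (sym (ℤP.abs-* ν t)) (cong ∣_∣ e))) h)

  module _ {m : ℕ} (h₁ : ∣ X₁ * Z₂ ∣ ≤ m) (h₂ : ∣ X₂ * Z₁ ∣ ≤ m) (h₃ : ∣ X₁ * X₂ ∣ ≤ m) (h₄ : ∣ Z₁ * Z₂ ∣ ≤ m) where
    κ : ℕ
    -- Large enough for all three coefficients: each `id` below displays the slack as a polynomial
    -- with nonnegative coefficients.
    κ = 8 ℕ.* ((1 ℕ.+ α ℕ.+ β) ℕ.* (1 ℕ.+ α ℕ.+ β))

    D≤ : ∣ ν * (U′ * V′) ∣ ≤ κ ℕ.* (m ℕ.* m)
    D≤ = ≤-trans (≤-trans (≤-reflexive (cong ∣_∣ k-D)) (bound-* (X₁ * Z₂ - X₂ * Z₁) (X₁ * Z₂ - X₂ * Z₁) d d))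
      (≤-trans (m≤m+n _ _) (≤-reflexive (sym (id m α β))))
      where
      d : ∣ X₁ * Z₂ - X₂ * Z₁ ∣ ≤ m ℕ.+ m
      d = bound-- (X₁ * Z₂) (X₂ * Z₁) h₁ h₂
      id : ∀ m α β → 8 ℕ.* ((1 ℕ.+ α ℕ.+ β) ℕ.* (1 ℕ.+ α ℕ.+ β)) ℕ.* (m ℕ.* m) ≡
        (m ℕ.+ m) ℕ.* (m ℕ.+ m) ℕ.+ (4 ℕ.+ 16 ℕ.* (α ℕ.+ β) ℕ.+ 8 ℕ.* ((α ℕ.+ β) ℕ.* (α ℕ.+ β))) ℕ.* (m ℕ.* m)
      id = ℕ-Solver.solve-∀

    S≤ : ∣ ν * (U * V′ + V * U′) ∣ ≤ κ ℕ.* (m ℕ.* m)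
    S≤ = ≤-trans (≤-trans (≤-reflexive (cong ∣_∣ k-S)) (bound-+ T T t t))
      (≤-trans (m≤m+n _ _) (≤-reflexive (sym (id m α β))))
      where
      T = (X₁ * Z₂ + X₂ * Z₁) * (A′ * (Z₁ * Z₂) + X₁ * X₂) + (B′ * (Z₁ * Z₂) * (Z₁ * Z₂) + B′ * (Z₁ * Z₂) * (Z₁ * Z₂))
      bz : ∣ B′ * (Z₁ * Z₂) * (Z₁ * Z₂) ∣ ≤ β ℕ.* m ℕ.* m
      bz = bound-* (B′ * (Z₁ * Z₂)) (Z₁ * Z₂) (bound-* B′ (Z₁ * Z₂) ≤-refl h₄) h₄
      t : ∣ T ∣ ≤ (m ℕ.+ m) ℕ.* (α ℕ.* m ℕ.+ m) ℕ.+ (β ℕ.* m ℕ.* m ℕ.+ β ℕ.* m ℕ.* m)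
      t = bound-+ ((X₁ * Z₂ + X₂ * Z₁) * (A′ * (Z₁ * Z₂) + X₁ * X₂)) (B′ * (Z₁ * Z₂) * (Z₁ * Z₂) + B′ * (Z₁ * Z₂) * (Z₁ * Z₂))
        (bound-* (X₁ * Z₂ + X₂ * Z₁) (A′ * (Z₁ * Z₂) + X₁ * X₂) (bound-+ (X₁ * Z₂) (X₂ * Z₁) h₁ h₂) (bound-+ (A′ * (Z₁ * Z₂)) (X₁ * X₂) (bound-* A′ (Z₁ * Z₂) ≤-refl h₄) h₃))
        (bound-+ (B′ * (Z₁ * Z₂) * (Z₁ * Z₂)) (B′ * (Z₁ * Z₂) * (Z₁ * Z₂)) bz bz)
      id : ∀ m α β → 8 ℕ.* ((1 ℕ.+ α ℕ.+ β) ℕ.* (1 ℕ.+ α ℕ.+ β)) ℕ.* (m ℕ.* m) ≡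
        (((m ℕ.+ m) ℕ.* (α ℕ.* m ℕ.+ m) ℕ.+ (β ℕ.* m ℕ.* m ℕ.+ β ℕ.* m ℕ.* m)) ℕ.+ ((m ℕ.+ m) ℕ.* (α ℕ.* m ℕ.+ m) ℕ.+ (β ℕ.* m ℕ.* m ℕ.+ β ℕ.* m ℕ.* m)))
        ℕ.+ (4 ℕ.+ 12 ℕ.* (α ℕ.+ β) ℕ.+ 8 ℕ.* ((α ℕ.+ β) ℕ.* (α ℕ.+ β))) ℕ.* (m ℕ.* m)
      id = ℕ-Solver.solve-∀

    W≤ : ∣ ν * (U * V) ∣ ≤ κ ℕ.* (m ℕ.* m)
    W≤ = ≤-trans (≤-trans (≤-reflexive (cong ∣_∣ k-U)) (bound-- ((X₁ * X₂ - A′ * (Z₁ * Z₂)) * (X₁ * X₂ - A′ * (Z₁ * Z₂))) (+ 4 * (B′ * (Z₁ * Z₂) * (X₁ * Z₂ + X₂ * Z₁)))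
        (bound-* (X₁ * X₂ - A′ * (Z₁ * Z₂)) (X₁ * X₂ - A′ * (Z₁ * Z₂)) v v)
        (bound-* (+ 4) (B′ * (Z₁ * Z₂) * (X₁ * Z₂ + X₂ * Z₁)) ≤-refl (bound-* (B′ * (Z₁ * Z₂)) (X₁ * Z₂ + X₂ * Z₁) (bound-* B′ (Z₁ * Z₂) ≤-refl h₄) (bound-+ (X₁ * Z₂) (X₂ * Z₁) h₁ h₂)))))
      (≤-trans (m≤m+n _ _) (≤-reflexive (sym (id m α β))))
      where
      v : ∣ X₁ * X₂ - A′ * (Z₁ * Z₂) ∣ ≤ m ℕ.+ α ℕ.* m
      v = bound-- (X₁ * X₂) (A′ * (Z₁ * Z₂)) h₃ (bound-* A′ (Z₁ * Z₂) ≤-refl h₄)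
      id : ∀ m α β → 8 ℕ.* ((1 ℕ.+ α ℕ.+ β) ℕ.* (1 ℕ.+ α ℕ.+ β)) ℕ.* (m ℕ.* m) ≡
        ((m ℕ.+ α ℕ.* m) ℕ.* (m ℕ.+ α ℕ.* m) ℕ.+ 4 ℕ.* (β ℕ.* m ℕ.* (m ℕ.+ m))) ℕ.+
        (7 ℕ.+ 14 ℕ.* α ℕ.+ 7 ℕ.* (α ℕ.* α) ℕ.+ 8 ℕ.* β ℕ.+ 16 ℕ.* (α ℕ.* β) ℕ.+ 8 ℕ.* (β ℕ.* β)) ℕ.* (m ℕ.* m)
      id = ℕ-Solver.solve-∀

  -- One half of the parallelogram law for the multiplicative height.
  height-product : let h₁ = ∣ X₁ ∣ ⊔ ∣ Z₁ ∣ ; h₂ = ∣ X₂ ∣ ⊔ ∣ Z₂ ∣ ; κ = 8 ℕ.* ((1 ℕ.+ α ℕ.+ β) ℕ.* (1 ℕ.+ α ℕ.+ β)) in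
    (∣ U ∣ ⊔ ∣ U′ ∣) ℕ.* (∣ V ∣ ⊔ ∣ V′ ∣) ≤ κ ℕ.* ((h₁ ℕ.* h₂) ℕ.* (h₁ ℕ.* h₂)) ℕ.+ κ ℕ.* ((h₁ ℕ.* h₂) ℕ.* (h₁ ℕ.* h₂))
  height-product = product-height {U} {U′} {V} {V′}
    (drop-ν refl (D≤ i₁ i₂ i₃ i₄)) (drop-ν refl (S≤ i₁ i₂ i₃ i₄)) (drop-ν refl (W≤ i₁ i₂ i₃ i₄))
    where
    h₁ h₂ : ℕ
    h₁ = ∣ X₁ ∣ ⊔ ∣ Z₁ ∣
    h₂ = ∣ X₂ ∣ ⊔ ∣ Z₂ ∣
    i₁ : ∣ X₁ * Z₂ ∣ ≤ h₁ ℕ.* h₂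
    i₁ = bound-* X₁ Z₂ (m≤m⊔n (∣ X₁ ∣) (∣ Z₁ ∣)) (m≤n⊔m (∣ X₂ ∣) (∣ Z₂ ∣))
    i₂ : ∣ X₂ * Z₁ ∣ ≤ h₁ ℕ.* h₂
    i₂ = ≤-trans (bound-* X₂ Z₁ (m≤m⊔n (∣ X₂ ∣) (∣ Z₂ ∣)) (m≤n⊔m (∣ X₁ ∣) (∣ Z₁ ∣))) (≤-reflexive (*-comm h₂ h₁))
    i₃ : ∣ X₁ * X₂ ∣ ≤ h₁ ℕ.* h₂
    i₃ = bound-* X₁ X₂ (m≤m⊔n (∣ X₁ ∣) (∣ Z₁ ∣)) (m≤m⊔n (∣ X₂ ∣) (∣ Z₂ ∣))
    i₄ : ∣ Z₁ * Z₂ ∣ ≤ h₁ ℕ.* h₂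
    i₄ = bound-* Z₁ Z₂ (m≤n⊔m (∣ X₁ ∣) (∣ Z₁ ∣)) (m≤n⊔m (∣ X₂ ∣) (∣ Z₂ ∣))

  -- The archimedean analogue of `denominators`.
  archimedean : ∀ L → 8 ℕ.* (1 ℕ.+ α ℕ.+ β) ≤ L → 1 ≤ ∣ X₁ ∣ → 1 ≤ ∣ X₂ ∣ →
    L ℕ.* ∣ Z₁ ∣ ≤ ∣ X₁ ∣ → L ℕ.* ∣ Z₂ ∣ ≤ ∣ X₂ ∣ → L ℕ.* ∣ V′ ∣ ≤ 192 ℕ.* ∣ V ∣
  archimedean L L≥ 1≤x₁ 1≤x₂ h₁ h₂ = *-cancelʳ-≤ (L ℕ.* ∣ V′ ∣) (192 ℕ.* ∣ V ∣) ∣ U ∣ {{ℕ.>-nonZero 1≤U}}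
    (begin
      L ℕ.* ∣ V′ ∣ ℕ.* ∣ U ∣ ≡⟨ trans (*-assoc L (∣ V′ ∣) (∣ U ∣)) (cong (L ℕ.*_) (sym (ℤP.abs-* V′ U))) ⟩
      L ℕ.* ∣ V′ * U ∣ ≤⟨ dominant dom₁ dom₂ ⟩
      96 ℕ.* t₃ ℕ.+ 96 ℕ.* t₃ ≡⟨ double t₃ ⟩
      192 ℕ.* t₃ ≡⟨ cong (192 ℕ.*_) (trans (ℤP.abs-* U V) (*-comm (∣ U ∣) (∣ V ∣))) ⟩
      192 ℕ.* (∣ V ∣ ℕ.* ∣ U ∣) ≡⟨ sym (*-assoc 192 (∣ V ∣) (∣ U ∣)) ⟩
      192 ℕ.* ∣ V ∣ ℕ.* ∣ U ∣ ∎)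
    where
    open ≤-Reasoning
    M ζ y n t₁ t₂ t₃ : ℕ
    M = ∣ X₁ * X₂ ∣
    ζ = ∣ Z₁ * Z₂ ∣
    y = ∣ X₁ * Z₂ + X₂ * Z₁ ∣
    n = ∣ ν ∣
    t₁ = ∣ U′ * V′ ∣
    t₂ = ∣ U * V′ + V * U′ ∣
    t₃ = ∣ U * V ∣
    double : ∀ t → 96 ℕ.* t ℕ.+ 96 ℕ.* t ≡ 192 ℕ.* t
    double = ℕ-Solver.solve-∀
    M≡ : M ≡ ∣ X₁ ∣ ℕ.* ∣ X₂ ∣
    M≡ = ℤP.abs-* X₁ X₂
    1≤M : 1 ≤ M
    1≤M = subst (1 ≤_) (sym M≡) (*-mono-≤ 1≤x₁ 1≤x₂)
    1≤L : 1 ≤ L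
    1≤L = ≤-trans (ℕ.s≤s ℕ.z≤n) L≥
    Lζ : L ℕ.* ζ ≤ M
    Lζ = begin
      L ℕ.* ζ ≡⟨ cong (L ℕ.*_) (ℤP.abs-* Z₁ Z₂) ⟩
      L ℕ.* (∣ Z₁ ∣ ℕ.* ∣ Z₂ ∣) ≡⟨ sym (*-assoc L (∣ Z₁ ∣) (∣ Z₂ ∣)) ⟩
      L ℕ.* ∣ Z₁ ∣ ℕ.* ∣ Z₂ ∣ ≤⟨ *-mono-≤ h₁ (≤-trans (≤-trans (≤-reflexive (sym (*-identityˡ (∣ Z₂ ∣)))) (*-monoˡ-≤ (∣ Z₂ ∣) 1≤L)) h₂) ⟩
      ∣ X₁ ∣ ℕ.* ∣ X₂ ∣ ≡⟨ sym M≡ ⟩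
      M ∎
    L₁ : L ℕ.* ∣ X₁ * Z₂ ∣ ≤ M
    L₁ = begin
      L ℕ.* ∣ X₁ * Z₂ ∣ ≡⟨ cong (L ℕ.*_) (ℤP.abs-* X₁ Z₂) ⟩
      L ℕ.* (∣ X₁ ∣ ℕ.* ∣ Z₂ ∣) ≡⟨ swap L (∣ X₁ ∣) (∣ Z₂ ∣) ⟩
      ∣ X₁ ∣ ℕ.* (L ℕ.* ∣ Z₂ ∣) ≤⟨ *-monoʳ-≤ (∣ X₁ ∣) h₂ ⟩
      ∣ X₁ ∣ ℕ.* ∣ X₂ ∣ ≡⟨ sym M≡ ⟩
      M ∎
      where
      swap : ∀ a b c → a ℕ.* (b ℕ.* c) ≡ b ℕ.* (a ℕ.* c)
      swap = ℕ-Solver.solve-∀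
    L₂ : L ℕ.* ∣ X₂ * Z₁ ∣ ≤ M
    L₂ = begin
      L ℕ.* ∣ X₂ * Z₁ ∣ ≡⟨ cong (L ℕ.*_) (ℤP.abs-* X₂ Z₁) ⟩
      L ℕ.* (∣ X₂ ∣ ℕ.* ∣ Z₁ ∣) ≡⟨ swap L (∣ X₂ ∣) (∣ Z₁ ∣) ⟩
      L ℕ.* ∣ Z₁ ∣ ℕ.* ∣ X₂ ∣ ≤⟨ *-monoˡ-≤ (∣ X₂ ∣) h₁ ⟩
      ∣ X₁ ∣ ℕ.* ∣ X₂ ∣ ≡⟨ sym M≡ ⟩
      M ∎
      where
      swap : ∀ a b c → a ℕ.* (b ℕ.* c) ≡ a ℕ.* c ℕ.* b
      swap = ℕ-Solver.solve-∀
    -- The purpose of the lower bound on `L`: the terms `a Z₁ Z₂` and `b Z₁ Z₂` stay below an eighth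
    -- of `M = |X₁ X₂|`.
    Kζ : 8 ℕ.* ((1 ℕ.+ α ℕ.+ β) ℕ.* ζ) ≤ M
    Kζ = ≤-trans (≤-trans (≤-reflexive (sym (*-assoc 8 (1 ℕ.+ α ℕ.+ β) ζ))) (*-monoˡ-≤ ζ L≥)) Lζ
    αζ : 8 ℕ.* (α ℕ.* ζ) ≤ M
    αζ = ≤-trans (*-monoʳ-≤ 8 (*-monoˡ-≤ ζ (≤-trans (m≤n+m α 1) (m≤m+n (1 ℕ.+ α) β)))) Kζ
    βζ : 8 ℕ.* (β ℕ.* ζ) ≤ M
    βζ = ≤-trans (*-monoʳ-≤ 8 (*-monoˡ-≤ ζ (m≤n+m β (1 ℕ.+ α)))) Kζ
    Ly : L ℕ.* y ≤ M ℕ.+ M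
    Ly = ≤-trans (*-monoʳ-≤ L (ℤP.∣i+j∣≤∣i∣+∣j∣ (X₁ * Z₂) (X₂ * Z₁)))
      (≤-trans (≤-reflexive (*-distribˡ-+ L (∣ X₁ * Z₂ ∣) (∣ X₂ * Z₁ ∣))) (+-mono-≤ L₁ L₂))
    4y : 4 ℕ.* y ≤ M
    4y = *-cancelˡ-≤ 2 (≤-trans (≤-reflexive (eight y)) (≤-trans (*-monoˡ-≤ y 8≤L) (≤-trans Ly (≤-reflexive (two M)))))
      where
      eight : ∀ y → 2 ℕ.* (4 ℕ.* y) ≡ 8 ℕ.* y
      eight = ℕ-Solver.solve-∀
      two : ∀ m → m ℕ.+ m ≡ 2 ℕ.* m
      two = ℕ-Solver.solve-∀
      8≤L : 8 ≤ L
      8≤L = ≤-trans (*-monoʳ-≤ 8 {1} (ℕ.s≤s ℕ.z≤n)) L≥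
    n* : ∀ {t w} → ν * t ≡ w → n ℕ.* ∣ t ∣ ≡ ∣ w ∣
    n* {t} e = trans (sym (ℤP.abs-* ν t)) (cong ∣_∣ e)
    -- Relative to M², the coefficient `k-D` is O(1/L²) and `k-S` is O(1/L), while `k-U` is bounded
    -- below. Comparing the first two with the third eliminates both M and `ν`.
    Dn : L ℕ.* L ℕ.* (n ℕ.* t₁) ≤ 4 ℕ.* (M ℕ.* M)
    Dn = begin
      L ℕ.* L ℕ.* (n ℕ.* t₁) ≡⟨ cong (L ℕ.* L ℕ.*_) (trans (n* k-D) (ℤP.abs-* (X₁ * Z₂ - X₂ * Z₁) (X₁ * Z₂ - X₂ * Z₁))) ⟩
      L ℕ.* L ℕ.* (δ ℕ.* δ) ≡⟨ square L δ ⟩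
      (L ℕ.* δ) ℕ.* (L ℕ.* δ) ≤⟨ *-mono-≤ Lδ Lδ ⟩
      (M ℕ.+ M) ℕ.* (M ℕ.+ M) ≡⟨ four M ⟩
      4 ℕ.* (M ℕ.* M) ∎
      where
      δ = ∣ X₁ * Z₂ - X₂ * Z₁ ∣
      Lδ : L ℕ.* δ ≤ M ℕ.+ M
      Lδ = ≤-trans (*-monoʳ-≤ L (ℤP.∣i-j∣≤∣i∣+∣j∣ (X₁ * Z₂) (X₂ * Z₁)))
        (≤-trans (≤-reflexive (*-distribˡ-+ L (∣ X₁ * Z₂ ∣) (∣ X₂ * Z₁ ∣))) (+-mono-≤ L₁ L₂))
      square : ∀ L d → L ℕ.* L ℕ.* (d ℕ.* d) ≡ (L ℕ.* d) ℕ.* (L ℕ.* d)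
      square = ℕ-Solver.solve-∀
      four : ∀ M → (M ℕ.+ M) ℕ.* (M ℕ.+ M) ≡ 4 ℕ.* (M ℕ.* M)
      four = ℕ-Solver.solve-∀
    Sn : L ℕ.* (n ℕ.* t₂) ≤ 12 ℕ.* (M ℕ.* M)
    Sn = begin
      L ℕ.* (n ℕ.* t₂) ≡⟨ cong (L ℕ.*_) (n* k-S) ⟩
      L ℕ.* ∣ T + T ∣ ≤⟨ *-monoʳ-≤ L (bound-+ T T T≤ T≤) ⟩
      L ℕ.* ((y ℕ.* (α ℕ.* ζ ℕ.+ M) ℕ.+ (β ℕ.* ζ ℕ.* ζ ℕ.+ β ℕ.* ζ ℕ.* ζ)) ℕ.+ (y ℕ.* (α ℕ.* ζ ℕ.+ M) ℕ.+ (β ℕ.* ζ ℕ.* ζ ℕ.+ β ℕ.* ζ ℕ.* ζ)))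
        ≡⟨ expand L y (α ℕ.* ζ) (β ℕ.* ζ) ζ M ⟩
      2 ℕ.* ((L ℕ.* y) ℕ.* (α ℕ.* ζ ℕ.+ M)) ℕ.+ 4 ℕ.* ((β ℕ.* ζ) ℕ.* (L ℕ.* ζ))
        ≤⟨ +-mono-≤ (*-monoʳ-≤ 2 (*-mono-≤ Ly (+-monoˡ-≤ M (≤-trans (m≤n*m (α ℕ.* ζ) 8) αζ)))) (*-monoʳ-≤ 4 (*-mono-≤ (≤-trans (m≤n*m (β ℕ.* ζ) 8) βζ) Lζ)) ⟩
      2 ℕ.* ((M ℕ.+ M) ℕ.* (M ℕ.+ M)) ℕ.+ 4 ℕ.* (M ℕ.* M) ≡⟨ twelve M ⟩
      12 ℕ.* (M ℕ.* M) ∎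
      where
      T = (X₁ * Z₂ + X₂ * Z₁) * (A′ * (Z₁ * Z₂) + X₁ * X₂) + (B′ * (Z₁ * Z₂) * (Z₁ * Z₂) + B′ * (Z₁ * Z₂) * (Z₁ * Z₂))
      bz : ∣ B′ * (Z₁ * Z₂) * (Z₁ * Z₂) ∣ ≤ β ℕ.* ζ ℕ.* ζ
      bz = bound-* (B′ * (Z₁ * Z₂)) (Z₁ * Z₂) (bound-* B′ (Z₁ * Z₂) ≤-refl ≤-refl) ≤-refl
      T≤ : ∣ T ∣ ≤ y ℕ.* (α ℕ.* ζ ℕ.+ M) ℕ.+ (β ℕ.* ζ ℕ.* ζ ℕ.+ β ℕ.* ζ ℕ.* ζ)
      T≤ = bound-+ ((X₁ * Z₂ + X₂ * Z₁) * (A′ * (Z₁ * Z₂) + X₁ * X₂)) (B′ * (Z₁ * Z₂) * (Z₁ * Z₂) + B′ * (Z₁ * Z₂) * (Z₁ * Z₂))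
        (bound-* (X₁ * Z₂ + X₂ * Z₁) (A′ * (Z₁ * Z₂) + X₁ * X₂) ≤-refl (bound-+ (A′ * (Z₁ * Z₂)) (X₁ * X₂) (bound-* A′ (Z₁ * Z₂) ≤-refl ≤-refl) ≤-refl))
        (bound-+ (B′ * (Z₁ * Z₂) * (Z₁ * Z₂)) (B′ * (Z₁ * Z₂) * (Z₁ * Z₂)) bz bz)
      expand : ∀ L y p q ζ M → L ℕ.* ((y ℕ.* (p ℕ.+ M) ℕ.+ (q ℕ.* ζ ℕ.+ q ℕ.* ζ)) ℕ.+ (y ℕ.* (p ℕ.+ M) ℕ.+ (q ℕ.* ζ ℕ.+ q ℕ.* ζ)))
        ≡ 2 ℕ.* ((L ℕ.* y) ℕ.* (p ℕ.+ M)) ℕ.+ 4 ℕ.* (q ℕ.* (L ℕ.* ζ))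
      expand = ℕ-Solver.solve-∀
      twelve : ∀ M → 2 ℕ.* ((M ℕ.+ M) ℕ.* (M ℕ.+ M)) ℕ.+ 4 ℕ.* (M ℕ.* M) ≡ 12 ℕ.* (M ℕ.* M)
      twelve = ℕ-Solver.solve-∀
    -- The coefficient `k-U` is `V₀² - R₀` with `|V₀| ≥ M/2` and `|R₀| ≤ M²/8`, so its absolute
    -- value is at least M²/8.
    Wn : M ℕ.* M ≤ 8 ℕ.* (n ℕ.* t₃)
    Wn = +-cancelʳ-≤ (M ℕ.* M) (M ℕ.* M) (8 ℕ.* (n ℕ.* t₃)) (begin
      M ℕ.* M ℕ.+ M ℕ.* M ≤⟨ +-mono-≤ MM MM ⟩
      4 ℕ.* (v ℕ.* v) ℕ.+ 4 ℕ.* (v ℕ.* v) ≡⟨ eight (v ℕ.* v) ⟩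
      8 ℕ.* (v ℕ.* v) ≤⟨ *-monoʳ-≤ 8 vv ⟩
      8 ℕ.* (n ℕ.* t₃ ℕ.+ 4 ℕ.* (β ℕ.* ζ ℕ.* y)) ≡⟨ expand (n ℕ.* t₃) (β ℕ.* ζ) y ⟩
      8 ℕ.* (n ℕ.* t₃) ℕ.+ (8 ℕ.* (β ℕ.* ζ)) ℕ.* (4 ℕ.* y) ≤⟨ +-monoʳ-≤ (8 ℕ.* (n ℕ.* t₃)) (*-mono-≤ βζ 4y) ⟩
      8 ℕ.* (n ℕ.* t₃) ℕ.+ M ℕ.* M ∎)
      where
      V₀ = X₁ * X₂ - A′ * (Z₁ * Z₂)
      R₀ = + 4 * (B′ * (Z₁ * Z₂) * (X₁ * Z₂ + X₂ * Z₁))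
      v = ∣ V₀ ∣
      eight : ∀ x → 4 ℕ.* x ℕ.+ 4 ℕ.* x ≡ 8 ℕ.* x
      eight = ℕ-Solver.solve-∀
      expand : ∀ p q y → 8 ℕ.* (p ℕ.+ 4 ℕ.* (q ℕ.* y)) ≡ 8 ℕ.* p ℕ.+ (8 ℕ.* q) ℕ.* (4 ℕ.* y)
      expand = ℕ-Solver.solve-∀
      M≤v : M ≤ v ℕ.+ α ℕ.* ζ
      M≤v = subst (λ z → ∣ z ∣ ≤ v ℕ.+ α ℕ.* ζ) (cancel (X₁ * X₂) (A′ * (Z₁ * Z₂)))
        (bound-+ V₀ (A′ * (Z₁ * Z₂)) ≤-refl (bound-* A′ (Z₁ * Z₂) ≤-refl ≤-refl))
        where
        cancel : ∀ x y → x - y + y ≡ x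
        cancel = ℤ-Solver.solve-∀
      M≤2v : M ≤ 2 ℕ.* v
      M≤2v = +-cancelʳ-≤ M M (2 ℕ.* v) (begin
        M ℕ.+ M ≤⟨ +-mono-≤ M≤v M≤v ⟩
        (v ℕ.+ α ℕ.* ζ) ℕ.+ (v ℕ.+ α ℕ.* ζ) ≡⟨ rearrange v (α ℕ.* ζ) ⟩
        2 ℕ.* v ℕ.+ 2 ℕ.* (α ℕ.* ζ) ≤⟨ +-monoʳ-≤ (2 ℕ.* v) (≤-trans (*-monoˡ-≤ (α ℕ.* ζ) {2} {8} (ℕ.s≤s (ℕ.s≤s ℕ.z≤n))) αζ) ⟩
        2 ℕ.* v ℕ.+ M ∎)
        where
        rearrange : ∀ v x → (v ℕ.+ x) ℕ.+ (v ℕ.+ x) ≡ 2 ℕ.* v ℕ.+ 2 ℕ.* x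
        rearrange = ℕ-Solver.solve-∀
      MM : M ℕ.* M ≤ 4 ℕ.* (v ℕ.* v)
      MM = ≤-trans (*-mono-≤ M≤2v M≤2v) (≤-reflexive (four v))
        where
        four : ∀ v → 2 ℕ.* v ℕ.* (2 ℕ.* v) ≡ 4 ℕ.* (v ℕ.* v)
        four = ℕ-Solver.solve-∀
      vv : v ℕ.* v ≤ n ℕ.* t₃ ℕ.+ 4 ℕ.* (β ℕ.* ζ ℕ.* y)
      vv = begin
        v ℕ.* v ≡⟨ sym (ℤP.abs-* V₀ V₀) ⟩
        ∣ V₀ * V₀ ∣ ≡⟨ cong ∣_∣ (sym (trans (cong (_+ R₀) k-U) (cancel (V₀ * V₀) R₀))) ⟩
        ∣ ν * (U * V) + R₀ ∣ ≤⟨ bound-+ (ν * (U * V)) R₀ (≤-reflexive (ℤP.abs-* ν (U * V)))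
             (bound-* (+ 4) (B′ * (Z₁ * Z₂) * (X₁ * Z₂ + X₂ * Z₁)) ≤-refl (bound-* (B′ * (Z₁ * Z₂)) (X₁ * Z₂ + X₂ * Z₁) (bound-* B′ (Z₁ * Z₂) ≤-refl ≤-refl) ≤-refl)) ⟩
        n ℕ.* t₃ ℕ.+ 4 ℕ.* (β ℕ.* ζ ℕ.* y) ∎
        where
        cancel : ∀ x y → x - y + y ≡ x
        cancel = ℤ-Solver.solve-∀
    instance
      n≢0 : ℕ.NonZero n
      n≢0 = ℕ.>-nonZero 1≤ν
    D₃ : L ℕ.* L ℕ.* t₁ ≤ 32 ℕ.* t₃
    D₃ = *-cancelˡ-≤ n (begin
      n ℕ.* (L ℕ.* L ℕ.* t₁) ≡⟨ swap n (L ℕ.* L) t₁ ⟩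
      L ℕ.* L ℕ.* (n ℕ.* t₁) ≤⟨ Dn ⟩
      4 ℕ.* (M ℕ.* M) ≤⟨ *-monoʳ-≤ 4 Wn ⟩
      4 ℕ.* (8 ℕ.* (n ℕ.* t₃)) ≡⟨ assoc n t₃ ⟩
      n ℕ.* (32 ℕ.* t₃) ∎)
      where
      swap : ∀ a b c → a ℕ.* (b ℕ.* c) ≡ b ℕ.* (a ℕ.* c)
      swap = ℕ-Solver.solve-∀
      assoc : ∀ n t → 4 ℕ.* (8 ℕ.* (n ℕ.* t)) ≡ n ℕ.* (32 ℕ.* t)
      assoc = ℕ-Solver.solve-∀
    S₃ : L ℕ.* t₂ ≤ 96 ℕ.* t₃
    S₃ = *-cancelˡ-≤ n (begin
      n ℕ.* (L ℕ.* t₂) ≡⟨ swap n L t₂ ⟩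
      L ℕ.* (n ℕ.* t₂) ≤⟨ Sn ⟩
      12 ℕ.* (M ℕ.* M) ≤⟨ *-monoʳ-≤ 12 Wn ⟩
      12 ℕ.* (8 ℕ.* (n ℕ.* t₃)) ≡⟨ assoc n t₃ ⟩
      n ℕ.* (96 ℕ.* t₃) ∎)
      where
      swap : ∀ a b c → a ℕ.* (b ℕ.* c) ≡ b ℕ.* (a ℕ.* c)
      swap = ℕ-Solver.solve-∀
      assoc : ∀ n t → 12 ℕ.* (8 ℕ.* (n ℕ.* t)) ≡ n ℕ.* (96 ℕ.* t)
      assoc = ℕ-Solver.solve-∀
    1≤U : 1 ≤ ∣ U ∣
    1≤U with ∣ U ∣ in eq
    ... | suc _ = ℕ.s≤s ℕ.z≤n
    ... | zero = ⊥-elim (1+n≰n (≤-trans (*-mono-≤ 1≤M 1≤M) (≤-trans Wn (≤-reflexive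
      (trans (cong (λ z → 8 ℕ.* (n ℕ.* z)) (trans (ℤP.abs-* U V) (cong (ℕ._* ∣ V ∣) eq))) (trans (cong (8 ℕ.*_) (*-zeroʳ n)) refl))))))
    dom₁ : L ℕ.* ∣ V′ * U ∣ ≤ L ℕ.* ∣ U′ * V ∣ ℕ.+ 96 ℕ.* t₃
    dom₁ = begin
      L ℕ.* ∣ V′ * U ∣ ≡⟨ cong (λ z → L ℕ.* ∣ z ∣) (ℤP.*-comm V′ U) ⟩
      L ℕ.* ∣ U * V′ ∣ ≤⟨ *-monoʳ-≤ L (reverse-triangle (U * V′) (V * U′)) ⟩
      L ℕ.* (t₂ ℕ.+ ∣ V * U′ ∣) ≡⟨ trans (*-distribˡ-+ L t₂ (∣ V * U′ ∣)) (trans (+-comm (L ℕ.* t₂) _) (cong (λ z → L ℕ.* ∣ z ∣ ℕ.+ L ℕ.* t₂) (ℤP.*-comm V U′))) ⟩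
      L ℕ.* ∣ U′ * V ∣ ℕ.+ L ℕ.* t₂ ≤⟨ +-monoʳ-≤ (L ℕ.* ∣ U′ * V ∣) S₃ ⟩
      L ℕ.* ∣ U′ * V ∣ ℕ.+ 96 ℕ.* t₃ ∎
    dom₂ : L ℕ.* ∣ V′ * U ∣ ℕ.* (L ℕ.* ∣ U′ * V ∣) ≤ 96 ℕ.* t₃ ℕ.* (96 ℕ.* t₃)
    dom₂ = begin
      L ℕ.* ∣ V′ * U ∣ ℕ.* (L ℕ.* ∣ U′ * V ∣) ≡⟨ cong₂ (λ p q → L ℕ.* p ℕ.* (L ℕ.* q)) (ℤP.abs-* V′ U) (ℤP.abs-* U′ V) ⟩
      L ℕ.* (∣ V′ ∣ ℕ.* ∣ U ∣) ℕ.* (L ℕ.* (∣ U′ ∣ ℕ.* ∣ V ∣)) ≡⟨ rearrange L (∣ U ∣) (∣ U′ ∣) (∣ V ∣) (∣ V′ ∣) ⟩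
      L ℕ.* L ℕ.* (∣ U′ ∣ ℕ.* ∣ V′ ∣) ℕ.* (∣ U ∣ ℕ.* ∣ V ∣) ≡⟨ sym (cong₂ (λ p q → L ℕ.* L ℕ.* p ℕ.* q) (ℤP.abs-* U′ V′) (ℤP.abs-* U V)) ⟩
      L ℕ.* L ℕ.* t₁ ℕ.* t₃ ≤⟨ *-monoˡ-≤ t₃ D₃ ⟩
      32 ℕ.* t₃ ℕ.* t₃ ≤⟨ *-mono-≤ (*-monoˡ-≤ t₃ {32} {96} (m≤m+n 32 64)) (m≤n*m t₃ 96) ⟩
      96 ℕ.* t₃ ℕ.* (96 ℕ.* t₃) ∎
      where
      rearrange : ∀ L u u′ v v′ → L ℕ.* (v′ ℕ.* u) ℕ.* (L ℕ.* (u′ ℕ.* v)) ≡ L ℕ.* L ℕ.* (u′ ℕ.* v′) ℕ.* (u ℕ.* v)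
      rearrange = ℕ-Solver.solve-∀

-- Bezout identities for the duplication forms

module CubicForms where
  open import Data.Integer using (ℤ; +_; _+_; _-_; _*_; -_; ∣_∣)
  open import Data.Integer.Tactic.RingSolver using (solve-∀)
  open import Data.Nat as ℕ using (ℕ; _≤_; _⊔_)
  open import Data.Nat.Properties
  import Data.Nat.Tactic.RingSolver as ℕ-Solver
  open import Relation.Binary.PropositionalEquality
  open Bounds

  cubic : ℤ → ℤ → ℤ → ℤ → ℤ → ℤ → ℤ
  cubic c₃ c₂ c₁ c₀ X Z = c₃ * (X * X * X) + c₂ * (X * X * Z) + c₁ * (X * Z * Z) + c₀ * (Z * Z * Z)

  cubic-bound : ∀ c₃ c₂ c₁ c₀ X Z → let H = ∣ X ∣ ⊔ ∣ Z ∣ in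
    ∣ cubic c₃ c₂ c₁ c₀ X Z ∣ ≤ (∣ c₃ ∣ ℕ.+ ∣ c₂ ∣ ℕ.+ ∣ c₁ ∣ ℕ.+ ∣ c₀ ∣) ℕ.* (H ℕ.* H ℕ.* H)
  cubic-bound c₃ c₂ c₁ c₀ X Z = ≤-trans
    (bound-+ (c₃ * (X * X * X) + c₂ * (X * X * Z) + c₁ * (X * Z * Z)) (c₀ * (Z * Z * Z))
      (bound-+ (c₃ * (X * X * X) + c₂ * (X * X * Z)) (c₁ * (X * Z * Z))
        (bound-+ (c₃ * (X * X * X)) (c₂ * (X * X * Z))
          (bound-* c₃ (X * X * X) ≤-refl (bound-* (X * X) X (bound-* X X x≤ x≤) x≤))
          (bound-* c₂ (X * X * Z) ≤-refl (bound-* (X * X) Z (bound-* X X x≤ x≤) z≤)))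
        (bound-* c₁ (X * Z * Z) ≤-refl (bound-* (X * Z) Z (bound-* X Z x≤ z≤) z≤)))
      (bound-* c₀ (Z * Z * Z) ≤-refl (bound-* (Z * Z) Z (bound-* Z Z z≤ z≤) z≤)))
    (≤-reflexive (id (∣ c₃ ∣) (∣ c₂ ∣) (∣ c₁ ∣) (∣ c₀ ∣) _))
    where
    x≤ : ∣ X ∣ ≤ ∣ X ∣ ⊔ ∣ Z ∣
    x≤ = m≤m⊔n (∣ X ∣) (∣ Z ∣)
    z≤ : ∣ Z ∣ ≤ ∣ X ∣ ⊔ ∣ Z ∣
    z≤ = m≤n⊔m (∣ X ∣) (∣ Z ∣)
    id : ∀ a b c d h → a ℕ.* h ℕ.+ b ℕ.* h ℕ.+ c ℕ.* h ℕ.+ d ℕ.* h ≡ (a ℕ.+ b ℕ.+ c ℕ.+ d) ℕ.* h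
    id = ℕ-Solver.solve-∀

  -- The right-hand sides of `k-S` and `k-U` for A = B: denominator and numerator of the duplication
  -- formula before cancellation.
  doubleS doubleU : ℤ → ℤ → ℤ → ℤ → ℤ
  doubleS a b X Z =
    ((X * Z + X * Z) * (a * (Z * Z) + X * X) + (b * (Z * Z) * (Z * Z) + b * (Z * Z) * (Z * Z))) +
    ((X * Z + X * Z) * (a * (Z * Z) + X * X) + (b * (Z * Z) * (Z * Z) + b * (Z * Z) * (Z * Z)))
  doubleU a b X Z = (X * X - a * (Z * Z)) * (X * X - a * (Z * Z)) - + 4 * (b * (Z * Z) * (X * Z + X * Z))

  disc : ℤ → ℤ → ℤ
  disc a b = (+ 4 * a * a * a) + (+ 27 * b * b)

  pow7 : ℤ → ℤ
  pow7 X = X * X * X * X * X * X * X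

  -- Cofactors in the elimination of X, respectively Z, from the two quartic duplication forms.
  -- Quartic times cubic explains the seventh powers.
  f₁ g₁ f₂ g₂ : ℤ → ℤ → ℤ → ℤ → ℤ
  f₁ a b = cubic (+ 0) (+ 12) (+ 0) (+ 16 * a)
  g₁ a b = cubic (- + 3) (+ 0) (+ 5 * a) (+ 27 * b)
  f₂ a b = cubic (+ 4 * ((+ 4 * a * a * a) + (+ 27 * b * b))) (- (+ 4 * a * a * b)) (+ 4 * a * (+ 3 * a * a * a + + 22 * b * b)) (+ 12 * b * (a * a * a + + 8 * b * b))
  g₂ a b = cubic (a * a * b) (a * (+ 5 * a * a * a + + 32 * b * b)) (+ 2 * b * (+ 13 * a * a * a + + 96 * b * b)) (- (+ 3 * a * a * (a * a * a + + 8 * b * b)))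

  -- The duplication forms are coprime: Silverman, The Arithmetic of Elliptic Curves, VIII.4.3.
  resultant-Z : ∀ a b X Z → doubleU a b X Z * f₁ a b X Z + doubleS a b X Z * g₁ a b X Z ≡ + 4 * disc a b * pow7 Z
  resultant-Z = id
    where
    id : ∀ a b X Z →
      ((X * X - a * (Z * Z)) * (X * X - a * (Z * Z)) - + 4 * (b * (Z * Z) * (X * Z + X * Z))) *
      (+ 0 * (X * X * X) + + 12 * (X * X * Z) + + 0 * (X * Z * Z) + + 16 * a * (Z * Z * Z)) +
      (((X * Z + X * Z) * (a * (Z * Z) + X * X) + (b * (Z * Z) * (Z * Z) + b * (Z * Z) * (Z * Z))) +
      ((X * Z + X * Z) * (a * (Z * Z) + X * X) + (b * (Z * Z) * (Z * Z) + b * (Z * Z) * (Z * Z)))) *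
      (- + 3 * (X * X * X) + + 0 * (X * X * Z) + + 5 * a * (X * Z * Z) + + 27 * b * (Z * Z * Z)) ≡
      + 4 * ((+ 4 * a * a * a) + (+ 27 * b * b)) * (Z * Z * Z * Z * Z * Z * Z)
    id = solve-∀

  resultant-X : ∀ a b X Z → doubleU a b X Z * f₂ a b X Z + doubleS a b X Z * g₂ a b X Z ≡ + 4 * disc a b * pow7 X
  resultant-X = id
    where
    id : ∀ a b X Z →
      ((X * X - a * (Z * Z)) * (X * X - a * (Z * Z)) - + 4 * (b * (Z * Z) * (X * Z + X * Z))) *
      (+ 4 * ((+ 4 * a * a * a) + (+ 27 * b * b)) * (X * X * X) + (- (+ 4 * a * a * b)) * (X * X * Z) + + 4 * a * (+ 3 * a * a * a + + 22 * b * b) * (X * Z * Z) + + 12 * b * (a * a * a + + 8 * b * b) * (Z * Z * Z)) +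
      (((X * Z + X * Z) * (a * (Z * Z) + X * X) + (b * (Z * Z) * (Z * Z) + b * (Z * Z) * (Z * Z))) +
      ((X * Z + X * Z) * (a * (Z * Z) + X * X) + (b * (Z * Z) * (Z * Z) + b * (Z * Z) * (Z * Z)))) *
      (a * a * b * (X * X * X) + a * (+ 5 * a * a * a + + 32 * b * b) * (X * X * Z) + + 2 * b * (+ 13 * a * a * a + + 96 * b * b) * (X * Z * Z) + (- (+ 3 * a * a * (a * a * a + + 8 * b * b))) * (Z * Z * Z)) ≡
      + 4 * ((+ 4 * a * a * a) + (+ 27 * b * b)) * (X * X * X * X * X * X * X)
    id = solve-∀

-- A lower bound for the height of 2A

module KummerDouble (E : Curve) where
  open KummerInteger E using (A′; B′; IntegralRel; module IntegralRel)
  open CubicForms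
  open Bounds
  open PrimeDivisors
  open import Data.Nat as ℕ using (ℕ; zero; suc; _≤_; _⊔_; z≤n; s≤s)
  open import Data.Nat.Properties
  import Data.Nat.Divisibility as ℕD
  open import Data.Nat.Coprimality as Coprimality using (Coprime; coprime-factors)
  import Data.Nat.Tactic.RingSolver as ℕ-Solver
  open import Data.Integer using (ℤ; +_; _+_; _-_; _*_; -_; ∣_∣)
  open import Data.Integer.Divisibility.Signed using (divides)
  open import Data.Integer.Tactic.RingSolver using (solve-∀)
  import Data.Integer.Properties as ℤP
  open import Data.Product using (_,_)
  open import Data.Sum using (inj₁; inj₂)
  open import Data.Empty using (⊥-elim)
  open import Relation.Binary.PropositionalEquality
  open ≤-Reasoning

  coefficients : ℤ → ℤ → ℤ → ℤ → ℕ
  coefficients c₃ c₂ c₁ c₀ = ∣ c₃ ∣ ℕ.+ ∣ c₂ ∣ ℕ.+ ∣ c₁ ∣ ℕ.+ ∣ c₀ ∣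

  cf₁ cg₁ cf₂ cg₂ C₁ C₂ : ℕ
  cf₁ = coefficients (+ 0) (+ 12) (+ 0) (+ 16 * A′)
  cg₁ = coefficients (- + 3) (+ 0) (+ 5 * A′) (+ 27 * B′)
  cf₂ = coefficients (+ 4 * ((+ 4 * A′ * A′ * A′) + (+ 27 * B′ * B′))) (- (+ 4 * A′ * A′ * B′)) (+ 4 * A′ * (+ 3 * A′ * A′ * A′ + + 22 * B′ * B′)) (+ 12 * B′ * (A′ * A′ * A′ + + 8 * B′ * B′))
  cg₂ = coefficients (A′ * A′ * B′) (A′ * (+ 5 * A′ * A′ * A′ + + 32 * B′ * B′)) (+ 2 * B′ * (+ 13 * A′ * A′ * A′ + + 96 * B′ * B′)) (- (+ 3 * A′ * A′ * (A′ * A′ * A′ + + 8 * B′ * B′)))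
  C₁ = cf₁ ℕ.+ cg₁
  C₂ = cf₂ ℕ.+ cg₂

  Δ₄ : ℕ
  Δ₄ = ∣ + 4 * disc A′ B′ ∣

  1≤Δ₄ : 1 ≤ Δ₄
  1≤Δ₄ with ∣ + 4 * disc A′ B′ ∣ in eq
  ... | suc _ = s≤s z≤n
  ... | zero = ⊥-elim (nz (ℤP.i*j≡0⇒i≡0∨j≡0 (+ 4) (ℤP.∣i∣≡0⇒i≡0 eq)))
    where
    open import Data.Sum using (_⊎_)
    open import Data.Empty using (⊥)
    nz : + 4 ≡ + 0 ⊎ disc A′ B′ ≡ + 0 → ⊥
    nz (inj₂ e) = Curve.nonsingular E e

  coprime-* : ∀ {m n k} → Coprime m k → Coprime n k → Coprime (m ℕ.* n) k
  coprime-* {m} {n} {k} c d {e} (h , e∣k) = d (Coprimality.coprime-divisor (λ (u , v) → c (v , ℕD.∣-trans u e∣k)) h , e∣k)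

  coprime-7 : ∀ {x k} → Coprime ∣ x ∣ k → Coprime ∣ pow7 x ∣ k
  coprime-7 {x} {k} c = step (x * x * x * x * x * x) x (step (x * x * x * x * x) x (step (x * x * x * x) x (step (x * x * x) x (step (x * x) x (step x x c c) c) c) c) c) c
    where
    step : ∀ u v → Coprime ∣ u ∣ k → Coprime ∣ v ∣ k → Coprime ∣ u * v ∣ k
    step u v c d = subst (λ w → Coprime w k) (sym (ℤP.abs-* u v)) (coprime-* c d)

  module _ {X Z U U′ : ℤ} (c : Coprime ∣ X ∣ ∣ Z ∣) (K : IntegralRel X Z X Z U U′ (+ 1) (+ 0)) where
    open IntegralRel K

    H H₂ : ℕ
    H = ∣ X ∣ ⊔ ∣ Z ∣
    H₂ = ∣ U ∣ ⊔ ∣ U′ ∣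

    S≡ : doubleS A′ B′ X Z ≡ ν * U′
    S≡ = trans (sym k-S) (cong (ν *_) (id U U′))
      where
      id : ∀ U U′ → U * + 0 + + 1 * U′ ≡ U′
      id = solve-∀

    U≡ : doubleU A′ B′ X Z ≡ ν * U
    U≡ = trans (sym k-U) (cong (ν *_) (ℤP.*-identityʳ U))

    combine : ∀ {f g w} → doubleU A′ B′ X Z * f + doubleS A′ B′ X Z * g ≡ w → ν * (U * f + U′ * g) ≡ w
    combine {f} {g} e = trans (id ν U U′ f g) (trans (sym (cong₂ (λ u s → u * f + s * g) U≡ S≡)) e)
      where
      id : ∀ ν U U′ f g → ν * (U * f + U′ * g) ≡ ν * U * f + ν * U′ * g
      id = solve-∀

    ν∣ : ∀ {f g} P → doubleU A′ B′ X Z * f + doubleS A′ B′ X Z * g ≡ + 4 * disc A′ B′ * P → ∣ ν ∣ ℕD.∣ ∣ P ∣ ℕ.* Δ₄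
    ν∣ {f} {g} P e = ℕD.divides ∣ U * f + U′ * g ∣ (≡.begin
      ∣ P ∣ ℕ.* Δ₄ ≡.≡⟨ *-comm (∣ P ∣) Δ₄ ⟩
      Δ₄ ℕ.* ∣ P ∣ ≡.≡⟨ sym (ℤP.abs-* (+ 4 * disc A′ B′) P) ⟩
      ∣ + 4 * disc A′ B′ * P ∣ ≡.≡⟨ cong ∣_∣ (sym (combine {f} {g} e)) ⟩
      ∣ ν * (U * f + U′ * g) ∣ ≡.≡⟨ ℤP.abs-* ν (U * f + U′ * g) ⟩
      ∣ ν ∣ ℕ.* ∣ U * f + U′ * g ∣ ≡.≡⟨ *-comm (∣ ν ∣) (∣ U * f + U′ * g ∣) ⟩
      ∣ U * f + U′ * g ∣ ℕ.* ∣ ν ∣ ≡.∎)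
      where module ≡ = ≡-Reasoning

    -- `ν` measures the cancellation in the duplication formula. It divides both `4Δ X⁷` and
    -- `4Δ Z⁷`, and X, Z are coprime, so it divides `4Δ`.
    ν≤Δ₄ : ∣ ν ∣ ≤ Δ₄
    ν≤Δ₄ = ℕD.∣⇒≤ {{ℕ.>-nonZero 1≤Δ₄}} (coprime-factors
      (coprime-7 {X} (Coprimality.sym (coprime-7 {Z} (Coprimality.sym c))))
      (ν∣ {f₂ A′ B′ X Z} {g₂ A′ B′ X Z} (pow7 X) (resultant-X A′ B′ X Z) , ν∣ {f₁ A′ B′ X Z} {g₁ A′ B′ X Z} (pow7 Z) (resultant-Z A′ B′ X Z)))

    bound : ∀ {f g} C D P → doubleU A′ B′ X Z * f + doubleS A′ B′ X Z * g ≡ + 4 * disc A′ B′ * P →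
      ∣ f ∣ ≤ C ℕ.* (H ℕ.* H ℕ.* H) → ∣ g ∣ ≤ D ℕ.* (H ℕ.* H ℕ.* H) → ∣ P ∣ ≤ (C ℕ.+ D) ℕ.* (H ℕ.* H ℕ.* H) ℕ.* H₂
    bound {f} {g} C D P e hf hg = *-cancelˡ-≤ Δ₄ {{ℕ.>-nonZero 1≤Δ₄}} (begin
      Δ₄ ℕ.* ∣ P ∣ ≡⟨ trans (sym (ℤP.abs-* (+ 4 * disc A′ B′) P)) (trans (cong ∣_∣ (sym (combine {f} {g} e))) (ℤP.abs-* ν (U * f + U′ * g))) ⟩
      ∣ ν ∣ ℕ.* ∣ U * f + U′ * g ∣ ≤⟨ *-mono-≤ ν≤Δ₄ (bound-+ (U * f) (U′ * g) (bound-* U f (m≤m⊔n (∣ U ∣) (∣ U′ ∣)) hf) (bound-* U′ g (m≤n⊔m (∣ U ∣) (∣ U′ ∣)) hg)) ⟩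
      Δ₄ ℕ.* (H₂ ℕ.* (C ℕ.* (H ℕ.* H ℕ.* H)) ℕ.+ H₂ ℕ.* (D ℕ.* (H ℕ.* H ℕ.* H))) ≡⟨ cong (Δ₄ ℕ.*_) (id H₂ C D (H ℕ.* H ℕ.* H)) ⟩
      Δ₄ ℕ.* ((C ℕ.+ D) ℕ.* (H ℕ.* H ℕ.* H) ℕ.* H₂) ∎)
      where
      id : ∀ u c d h → u ℕ.* (c ℕ.* h) ℕ.+ u ℕ.* (d ℕ.* h) ≡ (c ℕ.+ d) ℕ.* h ℕ.* u
      id = ℕ-Solver.solve-∀

    abs-pow7 : ∀ x → ∣ pow7 x ∣ ≡ ∣ x ∣ ℕ.* ∣ x ∣ ℕ.* ∣ x ∣ ℕ.* ∣ x ∣ ℕ.* (∣ x ∣ ℕ.* ∣ x ∣ ℕ.* ∣ x ∣)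
    abs-pow7 x = trans (go (x * x * x * x * x * x) x (go (x * x * x * x * x) x (go (x * x * x * x) x (go (x * x * x) x (go (x * x) x (ℤP.abs-* x x)))))) (assoc ∣ x ∣)
      where
      go : ∀ u v {w} → ∣ u ∣ ≡ w → ∣ u * v ∣ ≡ w ℕ.* ∣ v ∣
      go u v refl = ℤP.abs-* u v
      assoc : ∀ x → x ℕ.* x ℕ.* x ℕ.* x ℕ.* x ℕ.* x ℕ.* x ≡ x ℕ.* x ℕ.* x ℕ.* x ℕ.* (x ℕ.* x ℕ.* x)
      assoc = ℕ-Solver.solve-∀

    -- The Bezout identity is taken for the larger coordinate. Its left side has degree seven in H
    -- and the cofactors have degree three; the factor `4Δ` cancels against the bound for `ν`.
    duplication : 1 ≤ H → H ℕ.* H ℕ.* H ℕ.* H ≤ (C₁ ℕ.+ C₂) ℕ.* H₂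
    duplication 1≤H = *-cancelʳ-≤ _ _ (H ℕ.* H ℕ.* H) {{ℕ.>-nonZero (*-mono-≤ (*-mono-≤ 1≤H 1≤H) 1≤H)}} (cases (⊔-sel (∣ X ∣) (∣ Z ∣)))
      where
      open import Data.Sum using (_⊎_)
      weaken : ∀ {p C} → C ≤ C₁ ℕ.+ C₂ → p ≤ C ℕ.* (H ℕ.* H ℕ.* H) ℕ.* H₂ → p ≤ (C₁ ℕ.+ C₂) ℕ.* H₂ ℕ.* (H ℕ.* H ℕ.* H)
      weaken {p} {C} h k = ≤-trans k (≤-trans (*-monoˡ-≤ H₂ (*-monoˡ-≤ (H ℕ.* H ℕ.* H) h)) (≤-reflexive (id (C₁ ℕ.+ C₂) (H ℕ.* H ℕ.* H) H₂)))
        where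
        id : ∀ a b c → a ℕ.* b ℕ.* c ≡ a ℕ.* c ℕ.* b
        id = ℕ-Solver.solve-∀
      from : ∀ {x} → H ≡ ∣ x ∣ → ∣ pow7 x ∣ ≡ H ℕ.* H ℕ.* H ℕ.* H ℕ.* (H ℕ.* H ℕ.* H)
      from {x} e = trans (abs-pow7 x) (cong (λ h → h ℕ.* h ℕ.* h ℕ.* h ℕ.* (h ℕ.* h ℕ.* h)) (sym e))
      cases : H ≡ ∣ X ∣ ⊎ H ≡ ∣ Z ∣ → H ℕ.* H ℕ.* H ℕ.* H ℕ.* (H ℕ.* H ℕ.* H) ≤ (C₁ ℕ.+ C₂) ℕ.* H₂ ℕ.* (H ℕ.* H ℕ.* H)
      cases (inj₁ e) = subst (_≤ (C₁ ℕ.+ C₂) ℕ.* H₂ ℕ.* (H ℕ.* H ℕ.* H)) (from {X} e) (weaken {∣ pow7 X ∣} {C₂} (m≤n+m C₂ C₁)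
        (bound {f₂ A′ B′ X Z} {g₂ A′ B′ X Z} cf₂ cg₂ (pow7 X) (resultant-X A′ B′ X Z)
          (cubic-bound (+ 4 * ((+ 4 * A′ * A′ * A′) + (+ 27 * B′ * B′))) (- (+ 4 * A′ * A′ * B′)) (+ 4 * A′ * (+ 3 * A′ * A′ * A′ + + 22 * B′ * B′)) (+ 12 * B′ * (A′ * A′ * A′ + + 8 * B′ * B′)) X Z)
          (cubic-bound (A′ * A′ * B′) (A′ * (+ 5 * A′ * A′ * A′ + + 32 * B′ * B′)) (+ 2 * B′ * (+ 13 * A′ * A′ * A′ + + 96 * B′ * B′)) (- (+ 3 * A′ * A′ * (A′ * A′ * A′ + + 8 * B′ * B′))) X Z)))
      cases (inj₂ e) = subst (_≤ (C₁ ℕ.+ C₂) ℕ.* H₂ ℕ.* (H ℕ.* H ℕ.* H)) (from {Z} e) (weaken {∣ pow7 Z ∣} {C₁} (m≤m+n C₁ C₂)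
        (bound {f₁ A′ B′ X Z} {g₁ A′ B′ X Z} cf₁ cg₁ (pow7 Z) (resultant-Z A′ B′ X Z)
          (cubic-bound (+ 0) (+ 12) (+ 0) (+ 16 * A′) X Z)
          (cubic-bound (- + 3) (+ 0) (+ 5 * A′) (+ 27 * B′) X Z)))

-- Integer binary logarithms

module Log where
  open import Data.Nat
  open import Data.Nat.Properties
  open import Data.Product using (∃; _×_; _,_; proj₁; proj₂)
  open import Data.Empty using (⊥-elim)
  open import Relation.Nullary using (yes; no)
  open import Relation.Binary.PropositionalEquality

  n<2^n : ∀ n → n < 2 ^ n
  n<2^n zero = s≤s z≤n
  n<2^n (suc n) = +-mono-≤ (≤-trans (s≤s z≤n) (n<2^n n)) (≤-trans (n<2^n n) (≤-reflexive (sym (+-identityʳ (2 ^ n)))))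

  1≤2^ : ∀ n → 1 ≤ 2 ^ n
  1≤2^ n = ≤-trans (s≤s z≤n) (n<2^n n)

  2^-mono : ∀ {m n} → m ≤ n → 2 ^ m ≤ 2 ^ n
  2^-mono = ^-monoʳ-≤ 2

  2^-cancel-< : ∀ {m n} → 2 ^ m < 2 ^ n → m < n
  2^-cancel-< {m} {n} h with n ≤? m
  ... | yes p = ⊥-elim (<⇒≱ h (2^-mono p))
  ... | no q = ≰⇒> q

  2^-cancel-≤ : ∀ {m n} → 2 ^ m ≤ 2 ^ n → m ≤ n
  2^-cancel-≤ {m} {n} h = ≤-pred (2^-cancel-< (≤-trans (s≤s h) (^-monoʳ-< 2 (s≤s (s≤s z≤n)) (n<1+n n))))

  -- The value at 0 is 0 by convention, hence the guard on the lower bound.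
  log : ∀ n → ∃ λ h → (1 ≤ n → 2 ^ h ≤ n) × n < 2 ^ suc h
  log zero = 0 , (λ ()) , s≤s z≤n
  log (suc zero) = 0 , (λ _ → ≤-refl) , s≤s (s≤s z≤n)
  log (suc n@(suc _)) with log n
  ... | h , l , u with suc n <? 2 ^ suc h
  ...   | yes p = h , (λ _ → m≤n⇒m≤1+n (l (s≤s z≤n))) , p
  ...   | no q = suc h , (λ _ → ≮⇒≥ q) , ≤-trans (s≤s u) (^-monoʳ-< 2 (s≤s (s≤s z≤n)) (n<1+n (suc h)))

  lg : ℕ → ℕ
  lg n = proj₁ (log n)

  2^lg≤ : ∀ {n} → 1 ≤ n → 2 ^ lg n ≤ n
  2^lg≤ {n} = proj₁ (proj₂ (log n))

  <2^lg : ∀ n → n < 2 ^ suc (lg n)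
  <2^lg n = proj₂ (proj₂ (log n))

  lg≤ : ∀ {n k} → 1 ≤ n → n ≤ 2 ^ k → lg n ≤ k
  lg≤ 1≤n h = 2^-cancel-≤ (≤-trans (2^lg≤ 1≤n) h)

-- Sequences with bounded second differences

module Sequences where
  open import Data.Nat
  open import Data.Nat.Properties
  open import Data.Nat.Tactic.RingSolver using (solve-∀)
  open import Relation.Binary.PropositionalEquality
  open ≤-Reasoning

  -- Second differences at most k make first differences grow at most linearly. Negative terms are
  -- moved across the inequality so that everything stays in ℕ.
  quadratic-upper : ∀ (f : ℕ → ℕ) k → (∀ m → f (2 + m) + f m ≤ 2 * f (1 + m) + k) →
    ∀ m → 1 ≤ m → f m ≤ (f 0 + f 1 + k) * (m * m)
  quadratic-upper f k hyp m 1≤m = begin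
    f m ≤⟨ sum m ⟩
    f 0 + m * f 1 + k * (m * m) ≤⟨ +-monoˡ-≤ (k * (m * m)) (+-mono-≤ (m≤m*n (f 0) (m * m)) (≤-trans (≤-reflexive (*-comm m (f 1))) (*-monoʳ-≤ (f 1) (m≤m*n m m)))) ⟩
    f 0 * (m * m) + f 1 * (m * m) + k * (m * m) ≡⟨ factor (f 0) (f 1) k (m * m) ⟩
    (f 0 + f 1 + k) * (m * m) ∎
    where
    instance
      _ : NonZero m
      _ = >-nonZero 1≤m
      _ : NonZero (m * m)
      _ = m*n≢0 m m
    factor : ∀ a b c x → a * x + b * x + c * x ≡ (a + b + c) * x
    factor = solve-∀
    step : ∀ m → f (1 + m) ≤ f m + (f 1 + k * m)
    step zero = ≤-trans (m≤m+n (f 1) (f 0 + k * 0)) (≤-reflexive (id₀ (f 0) (f 1) (k * 0)))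
      where
      id₀ : ∀ a b c → b + (a + c) ≡ a + (b + c)
      id₀ = solve-∀
    step (suc m) = +-cancelʳ-≤ (f m) (f (2 + m)) _ (begin
      f (2 + m) + f m ≤⟨ hyp m ⟩
      2 * f (1 + m) + k ≡⟨ id₁ (f (1 + m)) k ⟩
      f (1 + m) + (k + f (1 + m)) ≤⟨ +-monoʳ-≤ (f (1 + m)) (+-monoʳ-≤ k (step m)) ⟩
      f (1 + m) + (k + (f m + (f 1 + k * m))) ≡⟨ id₂ (f (1 + m)) (f m) (f 1) k m ⟩
      f (1 + m) + (f 1 + k * suc m) + f m ∎)
      where
      id₁ : ∀ a k → 2 * a + k ≡ a + (k + a)
      id₁ = solve-∀
      id₂ : ∀ a b c k m → a + (k + (b + (c + k * m))) ≡ a + (c + k * (1 + m)) + b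
      id₂ = solve-∀
    sum : ∀ m → f m ≤ f 0 + m * f 1 + k * (m * m)
    sum zero = ≤-trans (m≤m+n (f 0) _) (m≤m+n _ _)
    sum (suc m) = begin
      f (suc m) ≤⟨ step m ⟩
      f m + (f 1 + k * m) ≤⟨ +-monoˡ-≤ (f 1 + k * m) (sum m) ⟩
      f 0 + m * f 1 + k * (m * m) + (f 1 + k * m) ≤⟨ m≤m+n _ (k * (m + 1)) ⟩
      f 0 + m * f 1 + k * (m * m) + (f 1 + k * m) + k * (m + 1) ≡⟨ id₃ (f 0) (f 1) k m ⟩
      f 0 + suc m * f 1 + k * (suc m * suc m) ∎
      where
      id₃ : ∀ a b k m → a + m * b + k * (m * m) + (b + k * m) + k * (m + 1) ≡ a + (1 + m) * b + k * ((1 + m) * (1 + m))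
      id₃ = solve-∀

  -- Only `f 0` enters the linear error: since `f 1` is nonnegative, the initial slope is at least
  -- `- f 0`, and every later one gains at least 2.
  quadratic-lower : ∀ (f : ℕ → ℕ) → (∀ m → 2 * f (1 + m) + 2 ≤ f (2 + m) + f m) →
    ∀ m → m * m ≤ f m + m * (1 + f 0)
  quadratic-lower f hyp = sum
    where
    step : ∀ m → f m + 2 * m ≤ f (1 + m) + f 0
    step zero = ≤-trans (≤-reflexive (+-identityʳ (f 0))) (m≤n+m (f 0) (f 1))
    step (suc m) = +-cancelʳ-≤ (f m + f (1 + m)) _ _ (begin
      f (1 + m) + 2 * (1 + m) + (f m + f (1 + m)) ≡⟨ id₁ (f (1 + m)) (f m) m ⟩
      2 * f (1 + m) + 2 + (f m + 2 * m) ≤⟨ +-mono-≤ (hyp m) (step m) ⟩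
      f (2 + m) + f m + (f (1 + m) + f 0) ≡⟨ id₂ (f (2 + m)) (f m) (f (1 + m)) (f 0) ⟩
      f (2 + m) + f 0 + (f m + f (1 + m)) ∎)
      where
      id₁ : ∀ a b m → a + 2 * (1 + m) + (b + a) ≡ 2 * a + 2 + (b + 2 * m)
      id₁ = solve-∀
      id₂ : ∀ a b c d → a + b + (c + d) ≡ a + d + (b + c)
      id₂ = solve-∀
    sum : ∀ m → m * m ≤ f m + m * (1 + f 0)
    sum zero = z≤n
    sum (suc m) = begin
      suc m * suc m ≡⟨ id₃ m ⟩
      m * m + (2 * m + 1) ≤⟨ +-monoˡ-≤ (2 * m + 1) (sum m) ⟩
      f m + m * (1 + f 0) + (2 * m + 1) ≡⟨ id₄ (f m) (m * (1 + f 0)) m ⟩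
      f m + 2 * m + (m * (1 + f 0) + 1) ≤⟨ +-monoˡ-≤ (m * (1 + f 0) + 1) (step m) ⟩
      f (1 + m) + f 0 + (m * (1 + f 0) + 1) ≡⟨ id₅ (f (1 + m)) (f 0) m ⟩
      f (suc m) + suc m * (1 + f 0) ∎
      where
      id₃ : ∀ m → (1 + m) * (1 + m) ≡ m * m + (2 * m + 1)
      id₃ = solve-∀
      id₄ : ∀ a b m → a + b + (2 * m + 1) ≡ a + 2 * m + (b + 1)
      id₄ = solve-∀
      id₅ : ∀ a b m → a + b + (m * (1 + b) + 1) ≡ a + (1 + m) * (1 + b)
      id₅ = solve-∀

-- The interface between the curve and its heights

module XGroups where
  open import Algebra.Structures using (IsAbelianGroup)
  open import Data.Integer as ℤ using (ℤ; ∣_∣)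
  open import Data.Nat.Coprimality using (Coprime)
  open import Data.Sum using (_⊎_)
  open import Relation.Binary.PropositionalEquality

  -- The x-coordinate map of an elliptic curve, reduced to what heights need:
  -- a group with a map to P¹ which satisfies the Kummer relations.
  record XGroup (E : Curve) : Set₁ where
    infixl 6 _⊕_
    infix 8 ⊖_
    field
      Point : Set
      _⊕_ : Point → Point → Point
      O : Point
      ⊖_ : Point → Point
      isAbelianGroup : IsAbelianGroup _≡_ _⊕_ O ⊖_
      xnum xden : Point → ℤ
      kum : ∀ A B → KummerInteger.IntegralRel E (xnum A) (xden A) (xnum B) (xden B) (xnum (A ⊕ B)) (xden (A ⊕ B)) (xnum (A ⊕ ⊖ B)) (xden (A ⊕ ⊖ B))
      coprime : ∀ A → Coprime ∣ xnum A ∣ ∣ xden A ∣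
      xnum-O : xnum O ≡ ℤ.+ 1
      xden-O : xden O ≡ ℤ.+ 0
      xden≡0⇒O : ∀ A → xden A ≡ ℤ.+ 0 → A ≡ O
      same-abscissa : ∀ A B → xnum A ≡ xnum B → xden A ≡ xden B → A ≡ B ⊎ A ≡ ⊖ B

module EllipticXGroup (E : Curve) where
  open XGroups
  open GroupLaw
  open Add E
  open KummerInteger E
  open import Algebra.Bundles using (AbelianGroup)
  open import Data.Product using (_,_; proj₁)
  open import Data.Sum using (_⊎_; inj₁; inj₂)
  open import Data.Rational as ℚ using (ℚ; 0ℚ; *≡*)
  open import Data.Rational.Properties using (≃⇒≡)
  open import Data.Integer as ℤ using (ℤ)
  open import Relation.Binary.PropositionalEquality
  open RationalField

  same-x : ∀ A B → OnCurve E A → OnCurve E B → xn A ≡ xn B → xd A ≡ xd B → A ≡ B ⊎ A ≡ neg B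
  same-x ∞ ∞ _ _ _ _ = inj₁ refl
  same-x (aff x y) (aff x′ y′) c d e f = cases (KummerRational.equal-or-opposite E {x} {y} {x′} {y′} x≡x′ c d)
    where
    x≡x′ : x ≡ x′
    x≡x′ = ≃⇒≡ (*≡* (cong₂ ℤ._*_ e (sym f)))
    cases : y ℚ.+ y′ ≡ 0ℚ ⊎ y ≡ y′ → aff x y ≡ aff x′ y′ ⊎ aff x y ≡ aff x′ (ℚ.- y′)
    cases (inj₂ y≡) = inj₁ (aff-cong x≡x′ y≡)
    cases (inj₁ y+) = inj₂ (opposite-eq (x≡x′ , y+))

  xgroup : XGroup E
  xgroup = record
    { isAbelianGroup = AbelianGroup.isAbelianGroup pointGroup
    ; xnum = λ A → xn (proj₁ A)
    ; xden = λ A → xd (proj₁ A)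
    ; kum = λ (A , c) (B , d) → integral-kummer A B c d
    ; coprime = λ A → coprime-xn-xd (proj₁ A)
    ; xnum-O = refl
    ; xden-O = refl
    ; xden≡0⇒O = λ { (∞ , _) _ → Point-≡ refl ; (aff x y , _) () }
    ; same-abscissa = λ (A , c) (B , d) e f → lift A B c d (same-x A B c d e f)
    }
    where
    lift : ∀ A B (c : OnCurve E A) (d : OnCurve E B) → A ≡ B ⊎ A ≡ neg B → (A , c) ≡ (B , d) ⊎ (A , c) ≡ (neg B , neg-on B d)
    lift A B c d (inj₁ e) = inj₁ (Point-≡ e)
    lift A B c d (inj₂ e) = inj₂ (Point-≡ e)

-- The naive logarithmic height

module Height (E : Curve) (G : XGroups.XGroup E) where
  open XGroups.XGroup G
  open KummerInteger E
  open Log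
  open Sequences
  open import Algebra.Structures using (IsAbelianGroup)
  open import Algebra.Bundles using (Monoid)
  open IsAbelianGroup isAbelianGroup using (isMonoid; assoc; comm; identityʳ; inverseˡ; inverseʳ)
  open import Level using (0ℓ)

  monoid : Monoid 0ℓ 0ℓ
  monoid = record { isMonoid = isMonoid }

  open import Data.Nat using (ℕ; zero; suc; _+_; _*_; _^_; _≤_; _⊔_; z≤n; s≤s)
  open import Data.Nat.Properties
  open import Data.Nat.Tactic.RingSolver using (solve-∀)
  open import Data.Integer as ℤ using (ℤ; ∣_∣)
  open import Data.Nat.Coprimality using (Coprime)
  import Data.Nat.Divisibility as ℕD
  open import Data.Product using (_,_)
  open import Relation.Binary.PropositionalEquality

  H h : Point → ℕ
  H A = ∣ xnum A ∣ ⊔ ∣ xden A ∣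
  h A = lg (H A)

  1≤H : ∀ A → 1 ≤ H A
  1≤H A = pos (∣ xnum A ∣) (∣ xden A ∣) (coprime A)
    where
    pos : ∀ m n → Coprime m n → 1 ≤ m ⊔ n
    pos zero zero c with () ← c {2} (ℕD.divides 0 refl , ℕD.divides 0 refl)
    pos zero (suc n) c = s≤s z≤n
    pos (suc m) n c = ≤-trans (s≤s z≤n) (m≤m⊔n (suc m) n)

  ⊕-⊖ : ∀ A B → (A ⊕ B) ⊕ ⊖ B ≡ A
  ⊕-⊖ A B = trans (assoc A B (⊖ B)) (trans (cong (A ⊕_) (inverseʳ B)) (identityʳ A))

  ⊖-⊕ : ∀ A B → (A ⊕ ⊖ B) ⊕ B ≡ A
  ⊖-⊕ A B = trans (assoc A (⊖ B) B) (trans (cong (A ⊕_) (inverseˡ B)) (identityʳ A))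

  move-⊖ : ∀ {A B C} → C ⊕ B ≡ A → A ⊕ ⊖ B ≡ C
  move-⊖ {A} {B} {C} refl = ⊕-⊖ C B

  sum-of-sum-and-difference : ∀ A B → (A ⊕ B) ⊕ (A ⊕ ⊖ B) ≡ A ⊕ A
  sum-of-sum-and-difference A B = trans (assoc A B (A ⊕ ⊖ B)) (cong (A ⊕_) (trans (comm B (A ⊕ ⊖ B)) (⊖-⊕ A B)))

  difference-of-sum-and-difference : ∀ A B → (A ⊕ B) ⊕ ⊖ (A ⊕ ⊖ B) ≡ B ⊕ B
  difference-of-sum-and-difference A B = move-⊖ (trans (assoc B B (A ⊕ ⊖ B))
    (trans (cong (B ⊕_) (trans (comm B (A ⊕ ⊖ B)) (⊖-⊕ A B))) (comm B A)))

  H<2^ : ∀ A → H A ≤ 2 ^ suc (h A)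
  H<2^ A = <⇒≤ (<2^lg (H A))

  parallelogram-≤ : ∀ A B → h (A ⊕ B) + h (A ⊕ ⊖ B) ≤ 2 * h A + 2 * h B + (5 + 8 * ((1 + ∣ A′ ∣ + ∣ B′ ∣) * (1 + ∣ A′ ∣ + ∣ B′ ∣)))
  parallelogram-≤ A B = 2^-cancel-≤ (begin
    2 ^ (h (A ⊕ B) + h (A ⊕ ⊖ B)) ≡⟨ ^-distribˡ-+-* 2 (h (A ⊕ B)) (h (A ⊕ ⊖ B)) ⟩
    2 ^ h (A ⊕ B) * 2 ^ h (A ⊕ ⊖ B) ≤⟨ *-mono-≤ (2^lg≤ (1≤H (A ⊕ B))) (2^lg≤ (1≤H (A ⊕ ⊖ B))) ⟩
    H (A ⊕ B) * H (A ⊕ ⊖ B) ≤⟨ KummerSize.height-product E (kum A B) ⟩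
    κ * ((H A * H B) * (H A * H B)) + κ * ((H A * H B) * (H A * H B)) ≡⟨ double κ _ ⟩
    2 * κ * ((H A * H B) * (H A * H B)) ≤⟨ *-mono-≤ (*-monoʳ-≤ 2 (<⇒≤ (n<2^n κ))) (*-mono-≤ HH HH) ⟩
    2 ^ suc κ * ((2 ^ suc (h A) * 2 ^ suc (h B)) * (2 ^ suc (h A) * 2 ^ suc (h B))) ≡⟨ powers κ (h A) (h B) ⟩
    2 ^ (2 * h A + 2 * h B + (5 + κ)) ∎)
    where
    open ≤-Reasoning
    κ = 8 * ((1 + ∣ A′ ∣ + ∣ B′ ∣) * (1 + ∣ A′ ∣ + ∣ B′ ∣))
    double : ∀ k x → k * x + k * x ≡ 2 * k * x
    double = solve-∀
    HH : H A * H B ≤ 2 ^ suc (h A) * 2 ^ suc (h B)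
    HH = *-mono-≤ (H<2^ A) (H<2^ B)
    powers : ∀ k a b → 2 ^ suc k * ((2 ^ suc a * 2 ^ suc b) * (2 ^ suc a * 2 ^ suc b)) ≡ 2 ^ (2 * a + 2 * b + (5 + k))
    powers k a b = trans (cong (2 ^ suc k *_) (trans (cong (λ z → z * z) (sym (^-distribˡ-+-* 2 (suc a) (suc b)))) (sym (^-distribˡ-+-* 2 (suc a + suc b) (suc a + suc b)))))
      (trans (sym (^-distribˡ-+-* 2 (suc k) (suc a + suc b + (suc a + suc b)))) (cong (2 ^_) (id k a b)))
      where
      id : ∀ k a b → 1 + k + (1 + a + (1 + b) + (1 + a + (1 + b))) ≡ 2 * a + 2 * b + (5 + k)
      id = solve-∀

  duplication-≥ : ∀ A → 4 * h A ≤ h (A ⊕ A) + suc (KummerDouble.C₁ E + KummerDouble.C₂ E)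
  duplication-≥ A = 2^-cancel-≤ (begin
    2 ^ (4 * h A) ≡⟨ four (h A) ⟩
    2 ^ h A * 2 ^ h A * 2 ^ h A * 2 ^ h A ≤⟨ *-mono-≤ (*-mono-≤ (*-mono-≤ l l) l) l ⟩
    H A * H A * H A * H A ≤⟨ KummerDouble.duplication E {xnum A} {xden A} {xnum (A ⊕ A)} {xden (A ⊕ A)} (coprime A) kumAA (1≤H A) ⟩
    C * H (A ⊕ A) ≤⟨ *-mono-≤ (<⇒≤ (n<2^n C)) (H<2^ (A ⊕ A)) ⟩
    2 ^ C * 2 ^ suc (h (A ⊕ A)) ≡⟨ trans (sym (^-distribˡ-+-* 2 C (suc (h (A ⊕ A))))) (cong (2 ^_) (id C (h (A ⊕ A)))) ⟩
    2 ^ (h (A ⊕ A) + suc (KummerDouble.C₁ E + KummerDouble.C₂ E)) ∎)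
    where
    open ≤-Reasoning
    C = KummerDouble.C₁ E + KummerDouble.C₂ E
    l = 2^lg≤ (1≤H A)
    id : ∀ c x → c + suc x ≡ x + suc c
    id = solve-∀
    four : ∀ x → 2 ^ (4 * x) ≡ 2 ^ x * 2 ^ x * 2 ^ x * 2 ^ x
    four x = trans (cong (2 ^_) (id′ x)) (trans (^-distribˡ-+-* 2 (x + x + x) x) (cong (_* 2 ^ x)
      (trans (^-distribˡ-+-* 2 (x + x) x) (cong (_* 2 ^ x) (^-distribˡ-+-* 2 x x)))))
      where
      id′ : ∀ x → 4 * x ≡ x + x + x + x
      id′ = solve-∀
    kumAA : IntegralRel (xnum A) (xden A) (xnum A) (xden A) (xnum (A ⊕ A)) (xden (A ⊕ A)) (ℤ.+ 1) (ℤ.+ 0)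
    kumAA = subst₂ (λ V V′ → IntegralRel (xnum A) (xden A) (xnum A) (xden A) (xnum (A ⊕ A)) (xden (A ⊕ A)) V V′)
      (trans (cong xnum (inverseʳ A)) xnum-O) (trans (cong xden (inverseʳ A)) xden-O) (kum A A)

  -- What the growth argument knows of the height; the constants do not depend on the points.
  record HeightConstants : Set where
    field
      c₁ c₂ : ℕ
      upper : ∀ A B → h (A ⊕ B) + h (A ⊕ ⊖ B) ≤ 2 * h A + 2 * h B + c₁
      double : ∀ A → 4 * h A ≤ h (A ⊕ A) + c₂

  heightConstants : HeightConstants
  heightConstants = record { upper = parallelogram-≤ ; double = duplication-≥ }

-- Quadratic growth of the height of nP + Q

module Growth (E : Curve) (G : XGroups.XGroup E) (constants : Height.HeightConstants E G) where
  open XGroups.XGroup G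
  open Height E G
  open HeightConstants constants
  open Log
  open Sequences
  open import Algebra.Structures using (IsAbelianGroup)
  open IsAbelianGroup isAbelianGroup using (assoc; comm; inverseˡ; inverseʳ)
  open import Algebra.Properties.Monoid.Mult monoid using (_×_; ×-homo-+)
  open import Data.Nat as ℕ using (ℕ; zero; suc; _+_; _*_; _^_; _≤_; _<_; _⊔_; z≤n; s≤s)
  open import Data.Nat.Properties
  open import Data.Nat.Tactic.RingSolver using (solve-∀)
  open import Data.Integer as ℤ using (ℤ; ∣_∣)
  import Data.Integer.Properties as ℤP
  open import Data.Product using (∃; _,_; proj₁; proj₂) renaming (_×_ to _and_)
  open import Data.Empty using (⊥-elim)
  open import Relation.Binary.PropositionalEquality

  c₃ : ℕ
  c₃ = c₁ + c₂

  -- The upper half of the law is applied to A + B and A - B, whose sum and difference are 2A and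
  -- 2B; the duplication bound then returns to A and B.
  parallelogram-≥ : ∀ A B → 2 * h A + 2 * h B ≤ h (A ⊕ B) + h (A ⊕ ⊖ B) + c₃
  parallelogram-≥ A B = *-cancelˡ-≤ 2 (+-cancelʳ-≤ (c₁ + 2 * c₂) _ _ (begin
    2 * (2 * h A + 2 * h B) + (c₁ + 2 * c₂) ≡⟨ id₁ (h A) (h B) c₁ c₂ ⟩
    4 * h A + 4 * h B + (c₁ + 2 * c₂) ≤⟨ +-monoˡ-≤ (c₁ + 2 * c₂) (+-mono-≤ (double A) (double B)) ⟩
    h (A ⊕ A) + c₂ + (h (B ⊕ B) + c₂) + (c₁ + 2 * c₂) ≡⟨ id₂ (h (A ⊕ A)) (h (B ⊕ B)) c₁ c₂ ⟩
    h (A ⊕ A) + h (B ⊕ B) + (c₁ + 4 * c₂) ≤⟨ +-monoˡ-≤ (c₁ + 4 * c₂) par ⟩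
    2 * h (A ⊕ B) + 2 * h (A ⊕ ⊖ B) + c₁ + (c₁ + 4 * c₂) ≤⟨ m≤m+n _ c₁ ⟩
    2 * h (A ⊕ B) + 2 * h (A ⊕ ⊖ B) + c₁ + (c₁ + 4 * c₂) + c₁ ≡⟨ id₃ (h (A ⊕ B)) (h (A ⊕ ⊖ B)) c₁ c₂ ⟩
    2 * (h (A ⊕ B) + h (A ⊕ ⊖ B) + c₃) + (c₁ + 2 * c₂) ∎))
    where
    open ≤-Reasoning
    par : h (A ⊕ A) + h (B ⊕ B) ≤ 2 * h (A ⊕ B) + 2 * h (A ⊕ ⊖ B) + c₁
    par = subst₂ (λ P Q → h P + h Q ≤ 2 * h (A ⊕ B) + 2 * h (A ⊕ ⊖ B) + c₁) (sum-of-sum-and-difference A B) (difference-of-sum-and-difference A B)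
      (upper (A ⊕ B) (A ⊕ ⊖ B))
    id₁ : ∀ a b c d → 2 * (2 * a + 2 * b) + (c + 2 * d) ≡ 4 * a + 4 * b + (c + 2 * d)
    id₁ = solve-∀
    id₂ : ∀ a b c d → a + d + (b + d) + (c + 2 * d) ≡ a + b + (c + 4 * d)
    id₂ = solve-∀
    id₃ : ∀ a b c d → 2 * a + 2 * b + c + (c + 4 * d) + c ≡ 2 * (a + b + (c + d)) + (c + 2 * d)
    id₃ = solve-∀

  height-multiple : ∀ P → ∃ λ c → ∀ m → 1 ≤ m → h (m × P) ≤ c * (m * m)
  height-multiple P = h O + h (1 × P) + (2 * h P + c₁) , quadratic-upper (λ m → h (m × P)) (2 * h P + c₁) step
    where
    step : ∀ m → h ((2 + m) × P) + h (m × P) ≤ 2 * h ((1 + m) × P) + (2 * h P + c₁)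
    step m = subst₂ (λ A B → h A + h B ≤ 2 * h ((1 + m) × P) + (2 * h P + c₁)) (comm ((1 + m) × P) P) (move-⊖ {(1 + m) × P} {P} {m × P} (comm (m × P) P))
      (≤-trans (upper ((1 + m) × P) P) (≤-reflexive (+-assoc (2 * h ((1 + m) × P)) (2 * h P) c₁)))

  open import Data.Sum using (inj₁; inj₂)
  open import Data.Fin as Fin using (Fin; toℕ; fromℕ<; combine)
  open import Data.Fin.Properties as FinP using (pigeonhole; combine-injective; fromℕ<-injective)
  open import Data.Sign as Sign using (Sign)
  open import Relation.Nullary using (¬_; Dec; yes; no)
  open import Data.Nat.DivMod using (_/_; _%_; m≡m%n+[m/n]*n; m%n<n)

  multiples-distinct : ∀ {P} → (∀ n → 1 ≤ n → n × P ≢ O) → ∀ {i j} → 1 ≤ i → i < j →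
    ¬ (xnum (i × P) ≡ xnum (j × P) and xden (i × P) ≡ xden (j × P))
  multiples-distinct {P} nt {i} {j} 1≤i i<j (e , f) with same-abscissa (i × P) (j × P) e f
  ... | inj₁ i≡j = nt (j ℕ.∸ i) (m<n⇒0<n∸m i<j) (begin
      (j ℕ.∸ i) × P ≡⟨ sym (⊕-⊖ ((j ℕ.∸ i) × P) (i × P)) ⟩
      ((j ℕ.∸ i) × P ⊕ i × P) ⊕ ⊖ (i × P) ≡⟨ cong (_⊕ ⊖ (i × P)) (sym (×-homo-+ P (j ℕ.∸ i) i)) ⟩
      ((j ℕ.∸ i) + i) × P ⊕ ⊖ (i × P) ≡⟨ cong (λ m → m × P ⊕ ⊖ (i × P)) (m∸n+n≡m (<⇒≤ i<j)) ⟩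
      j × P ⊕ ⊖ (i × P) ≡⟨ cong (_⊕ ⊖ (i × P)) (sym i≡j) ⟩
      i × P ⊕ ⊖ (i × P) ≡⟨ inverseʳ (i × P) ⟩
      O ∎)
    where open ≡-Reasoning
  ... | inj₂ i≡-j = nt (i + j) (≤-trans 1≤i (m≤m+n i j)) (begin
      (i + j) × P ≡⟨ ×-homo-+ P i j ⟩
      i × P ⊕ j × P ≡⟨ cong (_⊕ j × P) i≡-j ⟩
      ⊖ (j × P) ⊕ j × P ≡⟨ inverseˡ (j × P) ⟩
      O ∎)
    where open ≡-Reasoning

  module Northcott (b : ℕ) where
    signCode : Sign → Fin 2
    signCode Sign.+ = Fin.zero
    signCode Sign.- = Fin.suc Fin.zero

    signCode-injective : ∀ s t → signCode s ≡ signCode t → s ≡ t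
    signCode-injective Sign.+ Sign.+ _ = refl
    signCode-injective Sign.- Sign.- _ = refl

    code : (z : ℤ) → ∣ z ∣ < b → Fin (2 * b)
    code z l = combine (signCode (ℤ.sign z)) (fromℕ< l)

    code-injective : ∀ z w (l : ∣ z ∣ < b) (m : ∣ w ∣ < b) → code z l ≡ code w m → z ≡ w
    code-injective z w l m e with combine-injective (signCode (ℤ.sign z)) (fromℕ< l) (signCode (ℤ.sign w)) (fromℕ< m) e
    ... | s , t = trans (sym (ℤP.◃-inverse z)) (trans
      (cong₂ ℤ._◃_ (signCode-injective (ℤ.sign z) (ℤ.sign w) s) (fromℕ<-injective (∣ z ∣) (∣ w ∣) l m t)) (ℤP.◃-inverse w))

    xl : ∀ A → H A < b → ∣ xnum A ∣ < b
    xl A l = ≤-trans (s≤s (m≤m⊔n (∣ xnum A ∣) (∣ xden A ∣))) l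

    zl : ∀ A → H A < b → ∣ xden A ∣ < b
    zl A l = ≤-trans (s≤s (m≤n⊔m (∣ xnum A ∣) (∣ xden A ∣))) l

    pointCode : ∀ A → H A < b → Fin (2 * b * (2 * b))
    pointCode A l = combine (code (xnum A) (xl A l)) (code (xden A) (zl A l))

    pointCode-injective : ∀ A B l m → pointCode A l ≡ pointCode B m → xnum A ≡ xnum B and xden A ≡ xden B
    pointCode-injective A B l m e =
      let s , t = combine-injective (code (xnum A) (xl A l)) (code (xden A) (zl A l)) (code (xnum B) (xl B m)) (code (xden B) (zl B m)) e
      in code-injective (xnum A) (xnum B) (xl A l) (xl B m) s , code-injective (xden A) (xden B) (zl A l) (zl B m) t

  -- Northcott's argument: there are fewer than `K + 1` abscissas of height below β, so among the
  -- first `K + 1` multiples two would agree up to sign and P would be torsion.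
  large-multiple : ∀ {P} → (∀ n → 1 ≤ n → n × P ≢ O) → ∀ β → ∃ λ k → 1 ≤ k and β ≤ h (k × P)
  large-multiple {P} nt β = decide (FinP.any? (λ (i : Fin (suc K)) → β ℕ.≤? h (suc (toℕ i) × P)))
    where
    b K : ℕ
    b = 2 ^ β
    K = 2 * b * (2 * b)
    open Northcott b
    decide : Dec (∃ λ (i : Fin (suc K)) → β ≤ h (suc (toℕ i) × P)) → ∃ λ k → 1 ≤ k and β ≤ h (k × P)
    decide (yes (i , l)) = suc (toℕ i) , s≤s z≤n , l
    decide (no none) =
      let i , j , i<j , e = pigeonhole (n<1+n K) (λ i → pointCode (suc (toℕ i) × P) (small i))
      in ⊥-elim (multiples-distinct nt (s≤s z≤n) (s≤s i<j)
           (pointCode-injective (suc (toℕ i) × P) (suc (toℕ j) × P) (small i) (small j) e))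
      where
      small : ∀ i → H (suc (toℕ i) × P) < b
      small i = ≤-trans (<2^lg (H (suc (toℕ i) × P))) (2^-mono (≰⇒> (λ l → none (i , l))))

  -- Substitute for the canonical height. For P itself the error in the parallelogram law may exceed
  -- the gain, so a multiple kP of height at least `c₃ + 2` is taken as step; along each residue
  -- class modulo k the second differences are then at least 2. The maximum `B` of the initial
  -- values makes `n₀` the same for all classes.
  growth : ∀ {P} Q → (∀ n → 1 ≤ n → n × P ≢ O) → ∃ λ c → ∃ λ n₀ → ∀ n → n₀ ≤ n → n * n ≤ c * h (n × P ⊕ Q)
  growth {P} Q nt = 8 * (k * k) , k * (2 * suc B) + k , bound
    where
    k : ℕ
    k = proj₁ (large-multiple nt (c₃ + 2))

    1≤k : 1 ≤ k
    1≤k = proj₁ (proj₂ (large-multiple nt (c₃ + 2)))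

    l : c₃ + 2 ≤ h (k × P)
    l = proj₂ (proj₂ (large-multiple nt (c₃ + 2)))

    instance
      k≢0 : ℕ.NonZero k
      k≢0 = ℕ.>-nonZero 1≤k

    R : ℕ → Point
    R n = n × P ⊕ Q

    maximum : ℕ → ℕ
    maximum zero = 0
    maximum (suc r) = maximum r ⊔ h (R r)

    ≤-maximum : ∀ {r} k → r < k → h (R r) ≤ maximum k
    ≤-maximum {r} (suc k) (s≤s r≤k) with m≤n⇒m<n∨m≡n r≤k
    ... | inj₁ r<k = ≤-trans (≤-maximum k r<k) (m≤m⊔n (maximum k) (h (R k)))
    ... | inj₂ refl = m≤n⊔m (maximum r) (h (R r))

    B = maximum k

    R+k : ∀ n → R n ⊕ k × P ≡ R (k + n)
    R+k n = begin
      (n × P ⊕ Q) ⊕ k × P ≡⟨ comm (n × P ⊕ Q) (k × P) ⟩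
      k × P ⊕ (n × P ⊕ Q) ≡⟨ sym (assoc (k × P) (n × P) Q) ⟩
      (k × P ⊕ n × P) ⊕ Q ≡⟨ cong (_⊕ Q) (sym (×-homo-+ P k n)) ⟩
      R (k + n) ∎
      where open ≡-Reasoning

    convex : ∀ n → 2 * h (R (k + n)) + 2 ≤ h (R (k + (k + n))) + h (R n)
    convex n = +-cancelʳ-≤ (c₃ + (2 * c₃ + 2)) _ _ (begin
      2 * h (R (k + n)) + 2 + (c₃ + (2 * c₃ + 2)) ≤⟨ m≤m+n _ 0 ⟩
      2 * h (R (k + n)) + 2 + (c₃ + (2 * c₃ + 2)) + 0 ≡⟨ id₁ (h (R (k + n))) c₃ ⟩
      2 * h (R (k + n)) + 2 * (c₃ + 2) + c₃ ≤⟨ +-monoˡ-≤ c₃ (+-monoʳ-≤ (2 * h (R (k + n))) (*-monoʳ-≤ 2 l)) ⟩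
      2 * h (R (k + n)) + 2 * h (k × P) + c₃ ≤⟨ +-monoˡ-≤ c₃ par ⟩
      h (R (k + (k + n))) + h (R n) + c₃ + c₃ ≤⟨ m≤m+n _ (c₃ + 2) ⟩
      h (R (k + (k + n))) + h (R n) + c₃ + c₃ + (c₃ + 2) ≡⟨ id₂ (h (R (k + (k + n)))) (h (R n)) c₃ ⟩
      h (R (k + (k + n))) + h (R n) + (c₃ + (2 * c₃ + 2)) ∎)
      where
      open ≤-Reasoning
      par : 2 * h (R (k + n)) + 2 * h (k × P) ≤ h (R (k + (k + n))) + h (R n) + c₃
      par = subst₂ (λ A A′ → 2 * h (R (k + n)) + 2 * h (k × P) ≤ h A + h A′ + c₃) (R+k (k + n)) (move-⊖ {R (k + n)} {k × P} {R n} (R+k n))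
        (parallelogram-≥ (R (k + n)) (k × P))
      id₁ : ∀ a c → 2 * a + 2 + (c + (2 * c + 2)) + 0 ≡ 2 * a + 2 * (c + 2) + c
      id₁ = solve-∀
      id₂ : ∀ a b c → a + b + c + c + (c + 2) ≡ a + b + (c + (2 * c + 2))
      id₂ = solve-∀

    bound : ∀ n → k * (2 * suc B) + k ≤ n → n * n ≤ 8 * (k * k) * h (R n)
    bound n n≥ = begin
      n * n ≤⟨ *-mono-≤ n≤ n≤ ⟩
      2 * k * t * (2 * k * t) ≡⟨ id₁ k t ⟩
      4 * (k * k) * (t * t) ≤⟨ *-monoʳ-≤ (4 * (k * k)) tt≤ ⟩
      4 * (k * k) * (2 * h (R n)) ≡⟨ id₂ (k * k) (h (R n)) ⟩
      8 * (k * k) * h (R n) ∎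
      where
      open ≤-Reasoning
      r t : ℕ
      r = n % k
      t = n / k
      r<k : r < k
      r<k = m%n<n n k
      n≡ : n ≡ r + t * k
      n≡ = m≡m%n+[m/n]*n n k
      -- With this the linear loss `t * (1 + f 0)` is at most half of t².
      t≥ : 2 * suc B ≤ t
      t≥ = ≤-pred (*-cancelˡ-< k (2 * suc B) (suc t) (begin-strict
        k * (2 * suc B) ≤⟨ +-cancelʳ-≤ k _ _ (≤-trans n≥ (≤-trans (≤-reflexive n≡) (≤-trans (+-monoˡ-≤ (t * k) (<⇒≤ r<k)) (≤-reflexive (+-comm k (t * k)))))) ⟩
        t * k <⟨ m<n+m (t * k) 1≤k ⟩
        suc t * k ≡⟨ *-comm (suc t) k ⟩
        k * suc t ∎))
      n≤ : n ≤ 2 * k * t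
      n≤ = begin
        n ≡⟨ n≡ ⟩
        r + t * k ≤⟨ +-monoˡ-≤ (t * k) (<⇒≤ r<k) ⟩
        k + t * k ≤⟨ +-monoˡ-≤ (t * k) (m≤n*m k t {{ℕ.>-nonZero (≤-trans (s≤s z≤n) t≥)}}) ⟩
        t * k + t * k ≡⟨ id₃ t k ⟩
        2 * k * t ∎
        where
        id₃ : ∀ t k → t * k + t * k ≡ 2 * k * t
        id₃ = solve-∀
      f : ℕ → ℕ
      f m = h (R (r + m * k))
      f-convex : ∀ m → 2 * f (1 + m) + 2 ≤ f (2 + m) + f m
      f-convex m = subst₂ (λ u v → 2 * h (R u) + 2 ≤ h (R v) + f m) (id₄ k r m) (id₅ k r m) (convex (r + m * k))
        where
        id₄ : ∀ k r m → k + (r + m * k) ≡ r + (1 + m) * k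
        id₄ = solve-∀
        id₅ : ∀ k r m → k + (k + (r + m * k)) ≡ r + (2 + m) * k
        id₅ = solve-∀
      f0≤B : f 0 ≤ B
      f0≤B = subst (λ m → h (R m) ≤ B) (sym (+-identityʳ r)) (≤-maximum k r<k)
      tt≤ : t * t ≤ 2 * h (R n)
      tt≤ = +-cancelʳ-≤ (t * t) _ _ (begin
        t * t + t * t ≡⟨ id₆ (t * t) ⟩
        2 * (t * t) ≤⟨ *-monoʳ-≤ 2 (quadratic-lower f f-convex t) ⟩
        2 * (f t + t * (1 + f 0)) ≡⟨ id₇ (f t) t (1 + f 0) ⟩
        2 * f t + t * (2 * (1 + f 0)) ≤⟨ +-mono-≤ (≤-reflexive (cong (λ m → 2 * h (R m)) (sym n≡))) (*-monoʳ-≤ t (≤-trans (*-monoʳ-≤ 2 (s≤s f0≤B)) t≥)) ⟩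
        2 * h (R n) + t * t ∎)
        where
        id₆ : ∀ x → x + x ≡ 2 * x
        id₆ = solve-∀
        id₇ : ∀ a t b → 2 * (a + t * b) ≡ 2 * a + t * (2 * b)
        id₇ = solve-∀
      id₁ : ∀ k t → 2 * k * t * (2 * k * t) ≡ 4 * (k * k) * (t * t)
      id₁ = solve-∀
      id₂ : ∀ k x → 4 * k * (2 * x) ≡ 8 * k * x
      id₂ = solve-∀

-- Pivot columns of integer matrices

module LinearAlgebra where
  open import Data.Nat using (ℕ; zero; suc; _≤_; z≤n; s≤s)
  import Data.Nat.Properties as ℕP
  open import Data.Integer using (ℤ; +_; _+_; _-_; _*_; -_; _≟_)
  import Data.Integer as ℤ
  import Data.Integer.Properties as ℤP
  open import Data.Integer.Tactic.RingSolver using (solve-∀)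
  open import Data.List using (List; []; _∷_; map; length)
  open import Data.List.Properties using (length-map)
  open import Data.List.Relation.Unary.Any using (Any; here; there; any?)
  open import Data.List.Relation.Unary.All using ([]; _∷_)
  open import Data.List.Membership.Propositional using (_∈_; find; lose)
  open import Data.Product using (_,_)
  open import Data.Empty using (⊥-elim)
  open import Relation.Nullary using (¬_; Dec; yes; no)
  open import Relation.Nullary.Decidable using (¬?)
  open import Relation.Binary.PropositionalEquality

  dot : List ℤ → List (ℕ → ℤ) → ℕ → ℤ
  dot (k ∷ ks) (r ∷ rs) p = k * r p + dot ks rs p
  dot _ _ p = + 0

  -- Fraction-free elimination: the new row vanishes at the pivot column `p₀`.
  eliminate : (ℕ → ℤ) → ℕ → (ℕ → ℤ) → ℕ → ℤ
  eliminate r p₀ f p = r p₀ * f p - f p₀ * r p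

  dot-eliminate : ∀ r p₀ ks rs p → dot ks (map (eliminate r p₀) rs) p ≡ r p₀ * dot ks rs p - dot ks rs p₀ * r p
  dot-eliminate r p₀ [] [] p = id (r p₀) (r p)
    where
    id : ∀ a b → + 0 ≡ a * + 0 - + 0 * b
    id = solve-∀
  dot-eliminate r p₀ [] (f ∷ rs) p = id (r p₀) (r p)
    where
    id : ∀ a b → + 0 ≡ a * + 0 - + 0 * b
    id = solve-∀
  dot-eliminate r p₀ (k ∷ ks) [] p = id (r p₀) (r p)
    where
    id : ∀ a b → + 0 ≡ a * + 0 - + 0 * b
    id = solve-∀
  dot-eliminate r p₀ (k ∷ ks) (f ∷ rs) p = trans (cong (λ z → k * eliminate r p₀ f p + z) (dot-eliminate r p₀ ks rs p))
    (id k (r p₀) (f p) (f p₀) (r p) (dot ks rs p) (dot ks rs p₀))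
    where
    id : ∀ k a b c d e g → k * (a * b - c * d) + (a * e - g * d) ≡ a * (k * b + e) - (k * c + g) * d
    id = solve-∀

  Nonzero : (ℕ → ℤ) → ℕ → Set
  Nonzero r p = ¬ r p ≡ + 0

  nonzero? : ∀ r X → Dec (Any (Nonzero r) X)
  nonzero? r = any? (λ p → ¬? (r p ≟ + 0))

  -- Pivot columns: they detect every nonzero linear combination of the rows.
  basis : ℕ → List (ℕ → ℤ) → List ℕ → List ℕ
  basis zero rows X = []
  basis (suc m) [] X = []
  basis (suc m) (r ∷ rs) X with nonzero? r X
  ... | no _ = basis m rs X
  ... | yes a = let p₀ , _ = find a in p₀ ∷ basis m (map (eliminate r p₀) rs) X

  length-basis : ∀ m rows X → length (basis m rows X) ≤ m
  length-basis zero rows X = z≤n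
  length-basis (suc m) [] X = z≤n
  length-basis (suc m) (r ∷ rs) X with nonzero? r X
  ... | no _ = ℕP.m≤n⇒m≤1+n (length-basis m rs X)
  ... | yes a = s≤s (length-basis m _ X)

  basis-⊆ : ∀ m rows X {p} → p ∈ basis m rows X → p ∈ X
  basis-⊆ (suc m) (r ∷ rs) X p∈ with nonzero? r X
  basis-⊆ (suc m) (r ∷ rs) X p∈ | no _ = basis-⊆ m rs X p∈
  basis-⊆ (suc m) (r ∷ rs) X (here refl) | yes a = let _ , p₀∈X , _ = find a in p₀∈X
  basis-⊆ (suc m) (r ∷ rs) X (there p∈) | yes a = basis-⊆ m _ X p∈

  -- If a combination vanishes at `p₀`, its multiple by the pivot `r p₀` is the combination of the
  -- eliminated rows with the same coefficients `ks`. Thus the induction carries one coefficient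
  -- vector through, while the pivots are computed from the rows alone.
  basis-spans : ∀ m ks rows X → length rows ≤ m →
    (∀ {p} → p ∈ basis m rows X → dot ks rows p ≡ + 0) → ∀ {p} → p ∈ X → dot ks rows p ≡ + 0
  basis-spans m [] rows X l h p∈X = refl
  basis-spans m (k ∷ ks) [] X l h p∈X = refl
  basis-spans (suc m) (k ∷ ks) (r ∷ rs) X (s≤s l) h {p} p∈X with nonzero? r X
  ... | no none = trans (drop p p∈X) (basis-spans m ks rs X l (λ {q} q∈ → trans (sym (drop q (basis-⊆ m rs X q∈))) (h q∈)) p∈X)
    where
    drop : ∀ q → q ∈ X → k * r q + dot ks rs q ≡ dot ks rs q
    drop q q∈X with r q ≟ + 0
    ... | yes e = trans (cong (λ z → k * z + dot ks rs q) e) (id k (dot ks rs q))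
      where
      id : ∀ k d → k * + 0 + d ≡ d
      id = solve-∀
    ... | no ne = ⊥-elim (none (lose q∈X ne))
  ... | yes a with find a
  ...   | p₀ , p₀∈X , rp₀≢0 = ℤP.*-cancelˡ-≡ (r p₀) _ _ {{ℤ.≢-nonZero rp₀≢0}}
      (trans (scaled p) (trans (basis-spans m ks (map (eliminate r p₀) rs) X (subst (_≤ m) (sym (length-map (eliminate r p₀) rs)) l)
        (λ {q} q∈ → trans (sym (scaled q)) (trans (cong (r p₀ *_) (h (there q∈))) (ℤP.*-zeroʳ (r p₀)))) p∈X) (sym (ℤP.*-zeroʳ (r p₀)))))
    where
    scaled : ∀ q → r p₀ * (k * r q + dot ks rs q) ≡ dot ks (map (eliminate r p₀) rs) q
    scaled q = trans (id k (r p₀) (r q) (dot ks rs q) (dot ks rs p₀) )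
      (trans (cong (λ z → z * r q + (r p₀ * dot ks rs q - dot ks rs p₀ * r q)) (h (here refl)))
        (trans (id₂ (r q) (r p₀ * dot ks rs q - dot ks rs p₀ * r q)) (sym (dot-eliminate r p₀ ks rs q))))
      where
      id : ∀ k a b d e → a * (k * b + d) ≡ (k * a + e) * b + (a * d - e * b)
      id = solve-∀
      id₂ : ∀ b x → + 0 * b + x ≡ x
      id₂ = solve-∀

-- Enumeration of the tuples satisfying a relation with full support

module Cover where
  open LinearAlgebra
  open import Data.Nat as ℕ using (ℕ; zero; suc; _≤_; z≤n; s≤s)
  import Data.Nat.Properties as ℕP
  import Data.Nat.Tactic.RingSolver as ℕ-Solver
  open import Data.Integer using (ℤ; +_; _+_; _*_; _≟_)
  import Data.Integer.Properties as ℤP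
  open import Data.Integer.Tactic.RingSolver using (solve-∀)
  open import Data.List using (List; []; _∷_; map; length; concatMap; _++_)
  open import Data.List.Properties using (length-map; length-++)
  open import Data.List.Relation.Unary.Any using (Any; here; there; any?)
  open import Data.List.Relation.Unary.All using (All; []; _∷_)
  open import Data.List.Membership.Propositional using (_∈_; find; lose)
  open import Data.List.Membership.Propositional.Properties using (∈-concatMap⁺; ∈-++⁺ˡ; ∈-++⁺ʳ; ∈-++⁻; ∈-map⁺)
  open import Data.Sum using (_⊎_; inj₁; inj₂)
  open import Data.Product using (∃; _×_; _,_; proj₁)
  open import Data.Empty using (⊥; ⊥-elim)
  open import Relation.Nullary using (¬_; Dec; yes; no)
  open import Relation.Nullary.Decidable using (¬?)
  open import Relation.Binary.PropositionalEquality

  concatMap-length : ∀ {A B : Set} (f : A → List B) {m n} xs → length xs ≤ m → (∀ {x} → x ∈ xs → length (f x) ≤ n) →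
    length (concatMap f xs) ≤ m ℕ.* n
  concatMap-length f [] l h = z≤n
  concatMap-length f {suc m} {n} (x ∷ xs) (s≤s l) h = ℕP.≤-trans (ℕP.≤-reflexive (length-++ (f x)))
    (ℕP.+-mono-≤ (h (here refl)) (concatMap-length f xs l (λ x∈ → h (there x∈))))

  ∈-concatMap : ∀ {A B : Set} (f : A → List B) {x y xs} → x ∈ xs → y ∈ f x → y ∈ concatMap f xs
  ∈-concatMap f x∈ y∈ = ∈-concatMap⁺ f (lose x∈ y∈)

  pick : ∀ {A : Set} → List A → List (A × List A)
  pick [] = []
  pick (x ∷ xs) = (x , xs) ∷ map (λ (y , ys) → y , x ∷ ys) (pick xs)

  length-pick : ∀ {A : Set} (xs : List A) → length (pick xs) ≡ length xs
  length-pick [] = refl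
  length-pick (x ∷ xs) = cong suc (trans (length-map _ (pick xs)) (length-pick xs))

  pick-length : ∀ {A : Set} (xs : List A) {y ys} → (y , ys) ∈ pick xs → length xs ≡ suc (length ys)
  pick-length (x ∷ xs) (here refl) = refl
  pick-length (x ∷ xs) (there h) = go (pick xs) (pick-length xs) h
    where
    go : ∀ zs {y ys} → (∀ {y ys} → (y , ys) ∈ zs → length xs ≡ suc (length ys)) →
      (y , ys) ∈ map (λ (y , ys) → y , x ∷ ys) zs → suc (length xs) ≡ suc (length ys)
    go (_ ∷ zs) f (here refl) = cong suc (f (here refl))
    go (_ ∷ zs) f (there h) = go zs (λ z → f (there z)) h

  pick-split : ∀ {I : Set} (rem : List I) {i j js} → (j , js) ∈ pick rem → i ∈ rem → i ≡ j ⊎ i ∈ js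
  pick-split (x ∷ rem) (here refl) (here e) = inj₁ e
  pick-split (x ∷ rem) (here refl) (there r) = inj₂ r
  pick-split (x ∷ rem) {i} (there h) r = go (pick rem) (λ h′ → pick-split rem h′) h r
    where
    go : ∀ zs {j js} → (∀ {j js} → (j , js) ∈ zs → i ∈ rem → i ≡ j ⊎ i ∈ js) →
      (j , js) ∈ map (λ (y , ys) → y , x ∷ ys) zs → i ∈ x ∷ rem → i ≡ j ⊎ i ∈ js
    go (_ ∷ zs) g (here refl) (here e) = inj₂ (here e)
    go (_ ∷ zs) g (here refl) (there r) with g (here refl) r
    ... | inj₁ e = inj₁ e
    ... | inj₂ m = inj₂ (there m)
    go (_ ∷ zs) g (there h) r = go zs (λ z → g (there z)) h r

  ∈-pick : ∀ {A : Set} {x : A} {xs} → x ∈ xs → ∃ λ ys → (x , ys) ∈ pick xs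
  ∈-pick (here refl) = _ , here refl
  ∈-pick {xs = y ∷ xs} (there h) with ∈-pick h
  ... | ys , m = y ∷ ys , there (∈-map⁺ _ m)

  module _ {I : Set} where
    total : (I → ℤ) → List I → ℤ
    total f [] = + 0
    total f (i ∷ is) = f i + total f is

    total-pick : ∀ (f : I → ℤ) is {j js} → (j , js) ∈ pick is → total f is ≡ f j + total f js
    total-pick f (i ∷ is) (here refl) = refl
    total-pick f (i ∷ is) (there h) = go (pick is) (λ z → total-pick f is z) h
      where
      go : ∀ zs {y ys} → (∀ {y ys} → (y , ys) ∈ zs → total f is ≡ f y + total f ys) →
        (y , ys) ∈ map (λ (y , ys) → y , i ∷ ys) zs → f i + total f is ≡ f y + total f ys
      go ((y , ys) ∷ zs) g (here refl) = trans (cong (λ z → f i + z) (g (here refl))) (id (f i) (f y) (total f ys))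
        where
        id : ∀ a b c → a + (b + c) ≡ b + (a + c)
        id = solve-∀
      go (_ ∷ zs) g (there h) = go zs (λ z → g (there z)) h

    total-nonzero : ∀ (f : I → ℤ) is → total f is ≢ + 0 → ∃ λ j → ∃ λ js → (j , js) ∈ pick is × f j ≢ + 0
    total-nonzero f [] h = ⊥-elim (h refl)
    total-nonzero f (i ∷ is) h with f i ≟ + 0
    ... | no ne = i , is , here refl , ne
    ... | yes e with total-nonzero f is (λ z → h (trans (cong₂ _+_ e z) refl))
    ...   | j , js , m , ne = j , i ∷ js , there (∈-map⁺ _ m) , ne

    total-zero : ∀ (f : I → ℤ) is → (∀ i → f i ≡ + 0) → total f is ≡ + 0
    total-zero f [] h = refl
    total-zero f (i ∷ is) h = cong₂ _+_ (h i) (total-zero f is h)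

  -- Number of assignments of u indices if free choices (a) and restricted choices (b) alternate,
  -- ending with a restricted one: `a^⌊u/2⌋ * b^⌈u/2⌉`.
  φ : ℕ → ℕ → ℕ → ℕ
  φ a b zero = 1
  φ a b (suc zero) = b
  φ a b (suc (suc u)) = a ℕ.* b ℕ.* φ a b u

  b*φ≤φ : ∀ {a b} → b ≤ a → ∀ u → b ℕ.* φ a b u ≤ φ a b (suc u)
  b*φ≤φ {a} {b} b≤a zero = ℕP.≤-reflexive (ℕP.*-identityʳ b)
  b*φ≤φ {a} {b} b≤a (suc zero) = ℕP.≤-trans (ℕP.*-monoˡ-≤ b b≤a) (ℕP.≤-reflexive (sym (ℕP.*-identityʳ (a ℕ.* b))))
  b*φ≤φ {a} {b} b≤a (suc (suc u)) = ℕP.≤-trans (ℕP.≤-reflexive (id b (a ℕ.* b) (φ a b u))) (ℕP.*-monoʳ-≤ (a ℕ.* b) (b*φ≤φ b≤a u))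
    where
    id : ∀ b c x → b ℕ.* (c ℕ.* x) ≡ c ℕ.* (b ℕ.* x)
    id = ℕ-Solver.solve-∀

  module Search {I : Set} (v : I → ℕ → ℕ → ℤ) (supp : I → ℕ → List ℕ) (box : List ℕ) (hits : I → ℕ → List ℕ) where
    support : List (I × ℕ) → List ℕ
    support = concatMap (λ (i , x) → supp i x)

    support-good : ∀ {Typical : ℕ → Set} → (∀ {i x p} → p ∈ supp i x → Typical p) → ∀ cur {p} → p ∈ support cur → Typical p
    support-good supp-good ((i , x) ∷ cur) h with ∈-++⁻ (supp i x) h
    ... | inj₁ m = supp-good m
    ... | inj₂ m = support-good supp-good cur m

    row : I × ℕ → ℕ → ℤ
    row (i , x) = v i x

    columns : List (I × ℕ) → List ℕ
    columns cur = basis (length cur) (map row cur) (support cur)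

    -- `fresh` assigns an arbitrary value to some remaining index; `forward` assigns
    -- to some remaining index a value sharing a prime with the current component.
    fresh : ℕ → List I → List (I × ℕ) → List (List (I × ℕ))
    forward : ℕ → List I → List (I × ℕ) → List (I × ℕ) → List (List (I × ℕ))
    fresh zero rem done = done ∷ []
    fresh (suc u) rem done = concatMap (λ (j , rem′) → concatMap (λ x →
      forward u rem′ ((j , x) ∷ done) ((j , x) ∷ [])) box) (pick rem)
    -- A partial sum that is nonzero at some typical prime, with no index left to cancel it,
    -- contradicts the relation.
    forward zero rem done cur = []
    forward (suc u) rem done cur = concatMap (λ p → concatMap (λ (j , rem′) → concatMap (λ x →
      fresh u rem′ ((j , x) ∷ done) ++ forward u rem′ ((j , x) ∷ done) ((j , x) ∷ cur)) (hits j p)) (pick rem)) (columns cur)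

    module _ (a b s : ℕ) (b≤a : b ≤ a) (box≤ : length box ≤ a) (Typical : ℕ → Set)
      (supp-good : ∀ {i x p} → p ∈ supp i x → Typical p) (hits≤ : ∀ {i p} → Typical p → length (hits i p) ≤ b) where

      -- Overhead per revealed coordinate: at most s pivots, at most s indices, and two
      -- continuations.
      S : ℕ
      S = 2 ℕ.* (s ℕ.* s)

      -- The bound for `forward`, whose next choice is always restricted. The value 0 at 0 is what
      -- rules out a free choice in last place.
      γ : ℕ → ℕ
      γ zero = 0
      γ (suc u) = b ℕ.* φ a b u

      γ≤φ : ∀ u → γ u ≤ φ a b u
      γ≤φ zero = z≤n
      γ≤φ (suc u) = b*φ≤φ b≤a u

      open ℕP.≤-Reasoning

      fresh-length : ∀ u rem done → length rem ≡ u → u ≤ s →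
        length (fresh u rem done) ≤ S ℕ.^ u ℕ.* φ a b u
      forward-length : ∀ u rem done cur → length rem ≡ u → length cur ℕ.+ u ≤ s →
        length (forward u rem done cur) ≤ S ℕ.^ u ℕ.* γ u

      fresh-length zero rem done e l = ℕP.≤-refl
      fresh-length (suc u) rem done e l = begin
        length (fresh (suc u) rem done)
          ≤⟨ concatMap-length _ (pick rem) (ℕP.≤-reflexive (trans (length-pick rem) e)) (λ {x} x∈ → concatMap-length _ box box≤
               (λ _ → forward-length u _ _ _ (ℕP.suc-injective (trans (sym (pick-length rem x∈)) e)) l)) ⟩
        suc u ℕ.* (a ℕ.* (S ℕ.^ u ℕ.* γ u)) ≤⟨ ℕP.*-mono-≤ u≤S (step u) ⟩
        S ℕ.* (S ℕ.^ u ℕ.* φ a b (suc u)) ≡⟨ sym (ℕP.*-assoc S (S ℕ.^ u) (φ a b (suc u))) ⟩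
        S ℕ.^ suc u ℕ.* φ a b (suc u) ∎
        where
        u≤S : suc u ≤ S
        u≤S = ℕP.≤-trans l (ℕP.≤-trans (ℕP.m≤m*n s s {{ℕ.>-nonZero (ℕP.≤-trans (s≤s z≤n) l)}}) (ℕP.m≤n*m (s ℕ.* s) 2))
        step : ∀ u → a ℕ.* (S ℕ.^ u ℕ.* γ u) ≤ S ℕ.^ u ℕ.* φ a b (suc u)
        step zero = ℕP.≤-trans (ℕP.≤-reflexive (ℕP.*-zeroʳ a)) z≤n
        step (suc u) = ℕP.≤-reflexive (id a (S ℕ.^ suc u) b (φ a b u))
          where
          id : ∀ a t b x → a ℕ.* (t ℕ.* (b ℕ.* x)) ≡ t ℕ.* (a ℕ.* b ℕ.* x)
          id = ℕ-Solver.solve-∀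

      forward-length zero rem done cur e l = z≤n
      forward-length (suc u) rem done cur e l = begin
        length (forward (suc u) rem done cur)
          ≤⟨ concatMap-length _ (columns cur) (ℕP.≤-trans (length-basis (length cur) (map row cur) (support cur)) (ℕP.≤-trans (ℕP.m≤m+n (length cur) (suc u)) l)) (λ {p} p∈ →
             concatMap-length _ (pick rem) (ℕP.≤-trans (ℕP.≤-reflexive (trans (length-pick rem) e)) (ℕP.≤-trans (ℕP.m≤n+m (suc u) (length cur)) l)) (λ {x} x∈ →
             concatMap-length _ (hits (proj₁ x) p) (hits≤ (support-good (λ {i} {x} → supp-good {i} {x}) cur (basis-⊆ (length cur) (map row cur) (support cur) p∈))) (λ {y} _ →
               both y (ℕP.suc-injective (trans (sym (pick-length rem x∈)) e))))) ⟩
        s ℕ.* (s ℕ.* (b ℕ.* (S ℕ.^ u ℕ.* φ a b u ℕ.+ S ℕ.^ u ℕ.* φ a b u))) ≡⟨ id s b (S ℕ.^ u) (φ a b u) ⟩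
        S ℕ.^ suc u ℕ.* γ (suc u) ∎
        where
        both : ∀ {j rem′} y → length rem′ ≡ u →
          length (fresh u rem′ ((j , y) ∷ done) ++ forward u rem′ ((j , y) ∷ done) ((j , y) ∷ cur)) ≤ S ℕ.^ u ℕ.* φ a b u ℕ.+ S ℕ.^ u ℕ.* φ a b u
        both {j} {rem′} y e′ = ℕP.≤-trans (ℕP.≤-reflexive (length-++ (fresh u rem′ ((j , y) ∷ done))))
          (ℕP.+-mono-≤ (fresh-length u rem′ ((j , y) ∷ done) e′ (ℕP.≤-trans (ℕP.n≤1+n u) (ℕP.≤-trans (ℕP.m≤n+m (suc u) (length cur)) l)))
            (ℕP.≤-trans (forward-length u rem′ _ _ e′ (ℕP.≤-trans (ℕP.≤-reflexive (sym (ℕP.+-suc (length cur) u))) l)) (ℕP.*-monoʳ-≤ (S ℕ.^ u) (γ≤φ u))))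
        id : ∀ s b t x → s ℕ.* (s ℕ.* (b ℕ.* (t ℕ.* x ℕ.+ t ℕ.* x))) ≡ 2 ℕ.* (s ℕ.* s) ℕ.* t ℕ.* (b ℕ.* x)
        id = ℕ-Solver.solve-∀

    module Complete (Typical : ℕ → Set) (n : I → ℕ) (k : I → ℤ) (k≢0 : ∀ i → k i ≢ + 0)
      (in-box : ∀ i → n i ∈ box) (nonunit : ∀ i → ∃ λ p → Typical p × v i (n i) p ≢ + 0)
      (in-supp : ∀ {i p} → Typical p → v i (n i) p ≢ + 0 → p ∈ supp i (n i))
      (in-hits : ∀ {i p} → Typical p → v i (n i) p ≢ + 0 → n i ∈ hits i p)
      (supp-good : ∀ {i x p} → p ∈ supp i x → Typical p) where

      Agrees : List (I × ℕ) → Set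
      Agrees = All (λ (i , x) → n i ≡ x)

      weight : ℕ → I → ℤ
      weight p i = k i * v i (n i) p

      current : List (I × ℕ) → ℕ → ℤ
      current cur = dot (map (λ (i , _) → k i) cur) (map row cur)

      Nontrivial : List (I × ℕ) → ℕ → Set
      Nontrivial cur p = ¬ current cur p ≡ + 0

      nontrivial? : ∀ cur X → Dec (Any (Nontrivial cur) X)
      nontrivial? cur = any? (λ p → ¬? (current cur p ≟ + 0))

      Indices : List (I × ℕ) → List I
      Indices = map proj₁

      -- At typical primes outside the support all valuations of the component are zero, so a finite
      -- check decides the vanishing everywhere.
      trivial⇒zero : ∀ cur → Agrees cur → ¬ Any (Nontrivial cur) (support cur) → ∀ p → Typical p → current cur p ≡ + 0
      trivial⇒zero cur ag none p gp with current cur p ≟ + 0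
      ... | yes e = e
      ... | no ne = ⊥-elim (none (lose (in-support cur ag ne) ne))
        where
        in-support : ∀ cur → Agrees cur → current cur p ≢ + 0 → p ∈ support cur
        in-support [] [] ne = ⊥-elim (ne refl)
        in-support ((i , x) ∷ cur) (refl ∷ ag) ne with v i x p ≟ + 0
        ... | no ne′ = ∈-++⁺ˡ (in-supp gp ne′)
        ... | yes e = ∈-++⁺ʳ (supp i x) (in-support cur ag (λ z → ne (trans (cong₂ (λ u w → k i * u + w) e z) (id (k i)))))
          where
          id : ∀ a → a * + 0 + + 0 ≡ + 0
          id = solve-∀

      Found : List (List (I × ℕ)) → Set
      Found xs = ∃ λ σ → σ ∈ xs × Agrees σ × (∀ i → i ∈ Indices σ)

      Assigned : List I → List (I × ℕ) → Set
      Assigned rem done = ∀ i → i ∈ rem ⊎ i ∈ Indices done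

      assign : ∀ {rem done j js} → Assigned rem done → (j , js) ∈ pick rem → Assigned js ((j , n j) ∷ done)
      assign {rem} as h i with as i
      ... | inj₂ d = inj₂ (there d)
      ... | inj₁ r with pick-split rem h r
      ...   | inj₁ refl = inj₂ (here refl)
      ...   | inj₂ m = inj₁ m

      found-map : ∀ {xs ys} → (∀ {σ} → σ ∈ xs → σ ∈ ys) → Found xs → Found ys
      found-map f (σ , m , r) = σ , f m , r

      -- The given tuple steers the search: at each branching the branch that agrees with it is
      -- followed, and the relation guarantees that this branch was generated.
      fresh-complete : ∀ u rem done → length rem ≡ u → Agrees done → Assigned rem done →
        (∀ p → Typical p → total (weight p) rem ≡ + 0) → Found (fresh u rem done)
      forward-complete : ∀ u rem done cur → length rem ≡ u → Agrees done → Assigned rem done → Agrees cur →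
        (∀ p → Typical p → current cur p + total (weight p) rem ≡ + 0) → Any (Nontrivial cur) (support cur) →
        Found (forward u rem done cur)

      fresh-complete zero [] done e ag as z = done , here refl , ag , λ i → case (as i)
        where
        case : ∀ {i} → i ∈ [] ⊎ i ∈ Indices done → i ∈ Indices done
        case (inj₂ m) = m
      fresh-complete (suc u) (j ∷ js) done e ag as z = found-map
        (λ m → ∈-concatMap _ {xs = pick (j ∷ js)} (here refl) (∈-concatMap _ {xs = box} (in-box j) m))
        (forward-complete u js ((j , n j) ∷ done) ((j , n j) ∷ []) (ℕP.suc-injective e) (refl ∷ ag) (assign as (here refl)) (refl ∷ [])
          (λ p gp → trans (cong (λ w → w + total (weight p) js) (ℤP.+-identityʳ (weight p j))) (z p gp))
          -- A new component consists of one index and is nontrivial, because its value has a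
          -- nonzero valuation at some typical prime and its exponent is nonzero.
          (let p , gp , ne = nonunit j in lose (∈-++⁺ˡ (in-supp gp ne)) (λ e → nonzero ne (trans (sym (ℤP.+-identityʳ (weight p j))) e))))
        where
        nonzero : ∀ {p} → v j (n j) p ≢ + 0 → weight p j ≢ + 0
        nonzero ne e with ℤP.i*j≡0⇒i≡0∨j≡0 (k j) e
        ... | inj₁ z = k≢0 j z
        ... | inj₂ z = ne z

      -- By `basis-spans` a component that is nonzero somewhere is nonzero at a pivot p. The total
      -- at p is zero, so some remaining index has nonzero weight there; it is the next one to be
      -- revealed.
      forward-complete u rem done cur e ag as agc z nt with nontrivial? cur (columns cur)
      ... | no none = ⊥-elim (contradict nt)
        where
        vanish : ∀ {p} → p ∈ columns cur → current cur p ≡ + 0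
        vanish {p} m with current cur p ≟ + 0
        ... | yes e = e
        ... | no ne = ⊥-elim (none (lose m ne))
        contradict : Any (Nontrivial cur) (support cur) → ⊥
        contradict a = let q , q∈ , ne = find a in ne (basis-spans (length cur) (map (λ (i , _) → k i) cur) (map row cur) (support cur)
          (ℕP.≤-reflexive (length-map row cur)) vanish q∈)
      ... | yes a with find a
      ...   | p , p∈ , ne with total-nonzero (weight p) rem (λ t → ne (trans (sym (ℤP.+-identityʳ _)) (trans (cong (λ w → current cur p + w) (sym t)) (z p gp))))
        where
        gp : Typical p
        gp = support-good (λ {i} {x} → supp-good {i} {x}) cur (basis-⊆ (length cur) (map row cur) (support cur) p∈)
      forward-complete zero [] done cur e ag as agc z nt | yes a | p , p∈ , ne | j , js , () , wj
      forward-complete (suc u) rem done cur e ag as agc z nt | yes a | p , p∈ , ne | j , js , h , wj = found-map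
        (λ m → ∈-concatMap _ {xs = columns cur} p∈ (∈-concatMap _ {xs = pick rem} h (∈-concatMap _ {xs = hits j p} (in-hits gp vj) m)))
        (continue (nontrivial? cur′ (support cur′)))
        where
        gp : Typical p
        gp = support-good (λ {i} {x} → supp-good {i} {x}) cur (basis-⊆ (length cur) (map row cur) (support cur) p∈)
        vj : v j (n j) p ≢ + 0
        vj t = wj (trans (cong (λ w → k j * w) t) (ℤP.*-zeroʳ (k j)))
        cur′ done′ : List (I × ℕ)
        cur′ = (j , n j) ∷ cur
        done′ = (j , n j) ∷ done
        e′ : length js ≡ u
        e′ = ℕP.suc-injective (trans (sym (pick-length rem h)) e)
        z′ : ∀ q → Typical q → current cur′ q + total (weight q) js ≡ + 0
        z′ q gq = trans (id (weight q j) (current cur q) (total (weight q) js)) (trans (cong (λ w → current cur q + w) (sym (total-pick (weight q) rem h))) (z q gq))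
          where
          id : ∀ a b c → a + b + c ≡ b + (a + c)
          id = solve-∀
        continue : Dec (Any (Nontrivial cur′) (support cur′)) → Found (fresh u js done′ ++ forward u js done′ cur′)
        continue (yes nt′) = found-map (∈-++⁺ʳ (fresh u js done′)) (forward-complete u js done′ cur′ e′ (refl ∷ ag) (assign as h) (refl ∷ agc) z′ nt′)
        continue (no none) = found-map ∈-++⁺ˡ (fresh-complete u js done′ e′ (refl ∷ ag) (assign as h)
          (λ q gq → trans (sym (ℤP.+-identityˡ (total (weight q) js))) (trans (cong (λ w → w + total (weight q) js) (sym (trivial⇒zero cur′ (refl ∷ agc) none q gq))) (z′ q gq))))

-- p-adic valuations of natural numbers

module Valuation where
  open PrimeDivisors
  open import Data.Nat
  open import Data.Nat.Properties
  open import Data.Nat.Divisibility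
  open import Data.Nat.Primality using (Prime; euclidsLemma; prime⇒nonTrivial; prime⇒nonZero)
  open import Data.Nat.Tactic.RingSolver using (solve-∀)
  open import Data.List using (List; []; _∷_; map)
  open import Data.Nat.ListAction using (product)
  open import Data.List.Relation.Unary.Any using (here; there)
  open import Data.List.Relation.Unary.All using (All; []; _∷_)
  open import Data.List.Membership.Propositional using (_∈_)
  open import Data.Sum using (inj₁; inj₂)
  open import Data.Empty using (⊥-elim)
  open import Relation.Nullary using (¬_; yes; no)
  open import Relation.Binary.PropositionalEquality

  search : ℕ → ℕ → ℕ → ℕ
  search p m zero = 0
  search p m (suc e) with p ^ suc e ∣? m
  ... | yes _ = suc e
  ... | no _ = search p m e

  -- For positive m and p ≥ 2, searching the exponents up to m suffices because `e < p ^ e`. The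
  -- value at m = 0 is 0.
  v : ℕ → ℕ → ℕ
  v p m = search p m m

  search-∣ : ∀ p m e → p ^ search p m e ∣ m
  search-∣ p m zero = 1∣ m
  search-∣ p m (suc e) with p ^ suc e ∣? m
  ... | yes d = d
  ... | no _ = search-∣ p m e

  v-∣ : ∀ p m → p ^ v p m ∣ m
  v-∣ p m = search-∣ p m m

  search-max : ∀ p m e {i} → i ≤ e → p ^ i ∣ m → i ≤ search p m e
  search-max p m zero i≤ d = i≤
  search-max p m (suc e) i≤ d with p ^ suc e ∣? m
  ... | yes _ = i≤
  ... | no nd with m≤n⇒m<n∨m≡n i≤
  ...   | inj₁ (s≤s i≤e) = search-max p m e i≤e d
  ...   | inj₂ refl = ⊥-elim (nd d)

  e<p^e : ∀ {p} → 2 ≤ p → ∀ e → e < p ^ e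
  e<p^e 2≤p zero = s≤s z≤n
  e<p^e {p} 2≤p (suc e) = begin-strict
    suc e ≤⟨ e<p^e 2≤p e ⟩
    p ^ e <⟨ m<m*n (p ^ e) p {{>-nonZero (≤-trans (s≤s z≤n) (e<p^e 2≤p e))}} 2≤p ⟩
    p ^ e * p ≡⟨ *-comm (p ^ e) p ⟩
    p ^ suc e ∎
    where open ≤-Reasoning

  v-max : ∀ {p m e} → 2 ≤ p → 1 ≤ m → p ^ e ∣ m → e ≤ v p m
  v-max {p} {m} {e} 2≤p 1≤m d = search-max p m m (≤-trans (<⇒≤ (e<p^e 2≤p e)) (∣⇒≤ {{>-nonZero 1≤m}} d)) d

  v-mono : ∀ {p m n} → 2 ≤ p → 1 ≤ n → m ∣ n → v p m ≤ v p n
  v-mono {p} {m} {n} 2≤p 1≤n d = v-max 2≤p 1≤n (∣-trans (v-∣ p m) d)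

  prime≥2 : ∀ {p} → Prime p → 2 ≤ p
  prime≥2 {p} pp = nonTrivial⇒n>1 p {{prime⇒nonTrivial pp}}

  p∣⇒1≤v : ∀ {p m} → Prime p → 1 ≤ m → p ∣ m → 1 ≤ v p m
  p∣⇒1≤v {p} pp 1≤m d = v-max (prime≥2 pp) 1≤m (subst (_∣ _) (sym (*-identityʳ p)) d)

  1≤v⇒p∣ : ∀ {p m} → 1 ≤ v p m → p ∣ m
  1≤v⇒p∣ {p} {m} h with v p m | v-∣ p m
  ... | suc e | d = ∣-trans (m∣m*n (p ^ e)) d
  1≤v⇒p∣ {p} {m} () | zero | d

  cofactor : ∀ p m → ℕ
  cofactor p m = quotient (v-∣ p m)

  cofactor-≡ : ∀ p m → m ≡ p ^ v p m * cofactor p m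
  cofactor-≡ p m = trans (_∣_.equality (v-∣ p m)) (*-comm (cofactor p m) (p ^ v p m))

  1≤cofactor : ∀ p m → 1 ≤ m → 1 ≤ cofactor p m
  1≤cofactor p m 1≤m with cofactor p m in eq
  ... | suc _ = s≤s z≤n
  ... | zero = ⊥-elim (1+n≰n (subst (1 ≤_) (trans (cofactor-≡ p m) (trans (cong (p ^ v p m *_) eq) (*-zeroʳ (p ^ v p m)))) 1≤m))

  p∤cofactor : ∀ {p m} → 2 ≤ p → 1 ≤ m → ¬ p ∣ cofactor p m
  p∤cofactor {p} {m} 2≤p 1≤m d = 1+n≰n (v-max 2≤p 1≤m (subst (p ^ suc (v p m) ∣_) (sym (cofactor-≡ p m))
    (subst (_∣ p ^ v p m * cofactor p m) (*-comm (p ^ v p m) p) (*-monoʳ-∣ (p ^ v p m) d))))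

  v-* : ∀ {p m n} → Prime p → 1 ≤ m → 1 ≤ n → v p (m * n) ≡ v p m + v p n
  v-* {p} {m} {n} pp 1≤m 1≤n = ≤-antisym upper (v-max 2≤p 1≤mn (subst (_∣ m * n) (sym (^-distribˡ-+-* p (v p m) (v p n))) (*-pres-∣ (v-∣ p m) (v-∣ p n))))
    where
    2≤p = prime≥2 pp
    1≤mn : 1 ≤ m * n
    1≤mn = *-mono-≤ 1≤m 1≤n
    a = v p m + v p n
    mn≡ : m * n ≡ p ^ a * (cofactor p m * cofactor p n)
    mn≡ = trans (cong₂ _*_ (cofactor-≡ p m) (cofactor-≡ p n)) (trans (id (p ^ v p m) (cofactor p m) (p ^ v p n) (cofactor p n))
      (cong (_* (cofactor p m * cofactor p n)) (sym (^-distribˡ-+-* p (v p m) (v p n)))))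
      where
      id : ∀ a b c d → a * b * (c * d) ≡ a * c * (b * d)
      id = solve-∀
    upper : v p (m * n) ≤ a
    upper with v p (m * n) ≤? a
    ... | yes l = l
    ... | no nl with euclidsLemma (cofactor p m) (cofactor p n) pp (*-cancelˡ-∣ (p ^ a) {{m^n≢0 p a {{prime⇒nonZero pp}}}}
            (subst₂ _∣_ (*-comm p (p ^ a)) mn≡ (∣-trans (p^-∣ (≰⇒> nl)) (v-∣ p (m * n)))))
      where
      p^-∣ : ∀ {i j} → i ≤ j → p ^ i ∣ p ^ j
      p^-∣ {i} {j} l = divides (p ^ (j ∸ i)) (trans (cong (p ^_) (sym (m∸n+n≡m l))) (^-distribˡ-+-* p (j ∸ i) i))
    ...   | inj₁ d = ⊥-elim (p∤cofactor 2≤p 1≤m d)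
    ...   | inj₂ d = ⊥-elim (p∤cofactor 2≤p 1≤n d)

  -- The p-part of m is split off and the cofactor, free of p, is treated with the rest of the list.
  -- Only an inequality holds, since `W` may list a prime several times.
  smooth-≤ : ∀ W {m} → All (2 ≤_) W → 1 ≤ m → (∀ {q} → Prime q → q ∣ m → q ∈ W) → m ≤ product (map (λ p → p ^ v p m) W)
  smooth-≤ [] {m} _ 1≤m h = ≤-reflexive (no-prime-divisor (λ { refl → 1+n≰n 1≤m }) (λ p pp d → none (h pp d)))
    where
    open import Data.Empty using (⊥)
    none : ∀ {p} → p ∈ [] → ⊥
    none ()
  smooth-≤ (p ∷ W) {m} (2≤p ∷ 2≤W) 1≤m h = begin
    m ≡⟨ cofactor-≡ p m ⟩
    p ^ v p m * cofactor p m ≤⟨ *-monoʳ-≤ (p ^ v p m) (≤-trans (smooth-≤ W 2≤W (1≤cofactor p m 1≤m) primes) (mono W 2≤W)) ⟩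
    p ^ v p m * product (map (λ q → q ^ v q m) W) ∎
    where
    open ≤-Reasoning
    c∣m : cofactor p m ∣ m
    c∣m = quotient-∣ (v-∣ p m)
    primes : ∀ {q} → Prime q → q ∣ cofactor p m → q ∈ W
    primes pq d with h pq (∣-trans d c∣m)
    ... | here refl = ⊥-elim (p∤cofactor 2≤p 1≤m d)
    ... | there q∈ = q∈
    mono : ∀ W → All (2 ≤_) W → product (map (λ q → q ^ v q (cofactor p m)) W) ≤ product (map (λ q → q ^ v q m) W)
    mono [] [] = ≤-refl
    mono (q ∷ W) (2≤q ∷ 2≤W) = *-mono-≤ (^-monoʳ-≤ q {{>-nonZero (≤-trans (s≤s z≤n) 2≤q)}} (v-mono 2≤q 1≤m c∣m)) (mono W 2≤W)

-- Valuations of rational numbers and of multiplicative relations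

module RationalValuation where
  open Valuation
  open RationalField using (zero-product)
  open import Data.Nat as ℕ using (ℕ; zero; suc; _≤_; z≤n; s≤s)
  import Data.Nat.Properties as ℕP
  open import Data.Nat.Primality using (Prime; ¬prime[1])
  import Data.Nat.Divisibility as ℕD
  open import Data.Integer using (ℤ; +_; -[1+_]; _+_; _-_; _*_; -_; ∣_∣)
  import Data.Integer.Properties as ℤP
  open import Data.Integer.Tactic.RingSolver using (solve-∀)
  open import Data.Rational as ℚ using (ℚ; 0ℚ; 1ℚ; ↥_; ↧_; ↧ₙ_; NonZero; 1/_; toℚᵘ)
  import Data.Rational.Properties as ℚP
  open import Data.Rational.Unnormalised as ℚᵘ using (*≡*)
  open import Data.Fin as Fin using (Fin; punchIn; punchOut)
  open import Data.Fin.Properties as FinP using (punchIn-injective; punchIn-mono-≤; punchIn-punchOut)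
  open import Data.Product using (∃; _×_; _,_)
  open import Data.Sum using (inj₁; inj₂)
  open import Data.Empty using (⊥-elim)
  open import Relation.Nullary using (yes; no)
  open import Relation.Binary.PropositionalEquality

  vℚ : ℕ → ℚ → ℤ
  vℚ p x = + v p ∣ ↥ x ∣ - + v p (↧ₙ x)

  nonZero⇒≢0 : ∀ {x} → NonZero x → x ≢ 0ℚ
  nonZero⇒≢0 nz refl = ℕ.≢-nonZero⁻¹ 0 {{nz}} refl

  1≤abs : ∀ {z} → z ≢ + 0 → 1 ≤ ∣ z ∣
  1≤abs {z} h with ∣ z ∣ in eq
  ... | zero = ⊥-elim (h (ℤP.∣i∣≡0⇒i≡0 eq))
  ... | suc _ = s≤s z≤n

  1≤↥ : ∀ {x} → x ≢ 0ℚ → 1 ≤ ∣ ↥ x ∣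
  1≤↥ {x} h = 1≤abs (λ e → h (ℚP.↥p≡0⇒p≡0 x e))

  1≤↧ : ∀ x → 1 ≤ ↧ₙ x
  1≤↧ (ℚ.mkℚ _ _ _) = s≤s z≤n

  numerators-* : ∀ x y → ∣ ↥ (x ℚ.* y) ∣ ℕ.* (↧ₙ x ℕ.* ↧ₙ y) ≡ ∣ ↥ x ∣ ℕ.* ∣ ↥ y ∣ ℕ.* ↧ₙ (x ℚ.* y)
  numerators-* x@record{} y@record{} with ℚP.toℚᵘ-homo-* x y
  ... | *≡* e = trans (sym (trans (ℤP.abs-* (↥ (x ℚ.* y)) (↧ x * ↧ y)) (cong (∣ ↥ (x ℚ.* y) ∣ ℕ.*_) (ℤP.abs-* (↧ x) (↧ y)))))
    (trans (cong ∣_∣ e′) (trans (ℤP.abs-* (↥ x * ↥ y) (↧ (x ℚ.* y))) (cong (ℕ._* ↧ₙ (x ℚ.* y)) (ℤP.abs-* (↥ x) (↥ y)))))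
    where
    e′ : ↥ (x ℚ.* y) * (↧ x * ↧ y) ≡ ↥ x * ↥ y * ↧ (x ℚ.* y)
    e′ = subst₂ (λ n d → n * (↧ x * ↧ y) ≡ ↥ x * ↥ y * d) (ℚP.↥ᵘ-toℚᵘ (x ℚ.* y)) (ℚP.↧ᵘ-toℚᵘ (x ℚ.* y)) (trans (cong (λ d → ℚᵘ.↥ (toℚᵘ (x ℚ.* y)) * d) (sym (ℤP.pos-* (↧ₙ x) (↧ₙ y)))) e)

  ≢0-* : ∀ {x y} → x ≢ 0ℚ → y ≢ 0ℚ → x ℚ.* y ≢ 0ℚ
  ≢0-* {x} {y} x≢0 y≢0 e with zero-product {x} {y} e
  ... | inj₁ z = x≢0 z
  ... | inj₂ z = y≢0 z

  module _ {p : ℕ} (pp : Prime p) where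
    vℚ-* : ∀ x y → x ≢ 0ℚ → y ≢ 0ℚ → vℚ p (x ℚ.* y) ≡ vℚ p x + vℚ p y
    vℚ-* x y x≢0 y≢0 = trans (rearrange (+ v p ∣ ↥ (x ℚ.* y) ∣) (+ v p (↧ₙ x)) (+ v p (↧ₙ y)) (+ v p (↧ₙ (x ℚ.* y))))
      (trans (cong (λ z → z - + v p (↧ₙ (x ℚ.* y)) - (+ v p (↧ₙ x) + + v p (↧ₙ y))) total)
        (collect (+ v p ∣ ↥ x ∣) (+ v p ∣ ↥ y ∣) (+ v p (↧ₙ x)) (+ v p (↧ₙ y)) (+ v p (↧ₙ (x ℚ.* y)))))
      where
      rearrange : ∀ a b c d → a - d ≡ a + (b + c) - d - (b + c)
      rearrange = solve-∀
      collect : ∀ a b c d e → a + b + e - e - (c + d) ≡ a - c + (b - d)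
      collect = solve-∀
      numer : v p (∣ ↥ (x ℚ.* y) ∣ ℕ.* (↧ₙ x ℕ.* ↧ₙ y)) ≡ v p ∣ ↥ (x ℚ.* y) ∣ ℕ.+ (v p (↧ₙ x) ℕ.+ v p (↧ₙ y))
      numer = trans (v-* pp (1≤↥ (≢0-* x≢0 y≢0)) (ℕP.*-mono-≤ (1≤↧ x) (1≤↧ y))) (cong (v p ∣ ↥ (x ℚ.* y) ∣ ℕ.+_) (v-* pp (1≤↧ x) (1≤↧ y)))
      denom : v p (∣ ↥ x ∣ ℕ.* ∣ ↥ y ∣ ℕ.* ↧ₙ (x ℚ.* y)) ≡ v p ∣ ↥ x ∣ ℕ.+ v p ∣ ↥ y ∣ ℕ.+ v p (↧ₙ (x ℚ.* y))
      denom = trans (v-* pp (ℕP.*-mono-≤ (1≤↥ x≢0) (1≤↥ y≢0)) (1≤↧ (x ℚ.* y))) (cong (ℕ._+ v p (↧ₙ (x ℚ.* y))) (v-* pp (1≤↥ x≢0) (1≤↥ y≢0)))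
      total : + v p ∣ ↥ (x ℚ.* y) ∣ + (+ v p (↧ₙ x) + + v p (↧ₙ y)) ≡ + v p ∣ ↥ x ∣ + + v p ∣ ↥ y ∣ + + v p (↧ₙ (x ℚ.* y))
      total = cong +_ (trans (sym numer) (trans (cong (v p) (numerators-* x y)) denom))

    v-1 : v p 1 ≡ 0
    v-1 with p ℕ.^ 1 ℕD.∣? 1
    ... | no _ = refl
    ... | yes d = ⊥-elim (¬prime[1] (subst Prime (trans (sym (ℕP.*-identityʳ p)) (ℕD.∣1⇒≡1 d)) pp))

    vℚ-1 : vℚ p 1ℚ ≡ + 0
    vℚ-1 rewrite v-1 = refl

    pow≢0 : ∀ x n → x ≢ 0ℚ → pow x n ≢ 0ℚ
    pow≢0 x zero h ()
    pow≢0 x (suc n) h = ≢0-* h (pow≢0 x n h)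

    vℚ-pow : ∀ x n → x ≢ 0ℚ → vℚ p (pow x n) ≡ + n * vℚ p x
    vℚ-pow x zero h = vℚ-1
    vℚ-pow x (suc n) h = trans (vℚ-* x (pow x n) h (pow≢0 x n h)) (trans (cong (λ z → vℚ p x + z) (vℚ-pow x n h))
      (trans (id (+ n) (vℚ p x)) (cong (_* vℚ p x) (sym (ℤP.pos-+ 1 n)))))
      where
      id : ∀ n x → x + n * x ≡ (+ 1 + n) * x
      id = solve-∀

    1/≢0 : ∀ x .{{_ : NonZero x}} → x ≢ 0ℚ → 1/ x ≢ 0ℚ
    1/≢0 x h e = contra (trans (sym (ℚP.*-inverseˡ x)) (trans (cong (ℚ._* x) e) (ℚP.*-zeroˡ x)))
      where
      contra : 1ℚ ≢ 0ℚ
      contra ()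

    vℚ-1/ : ∀ x .{{_ : NonZero x}} → x ≢ 0ℚ → vℚ p (1/ x) ≡ - vℚ p x
    vℚ-1/ x h = trans (id (vℚ p (1/ x)) (vℚ p x)) (trans (cong (_- vℚ p x) sum≡0) (ℤP.+-identityˡ (- vℚ p x)))
      where
      id : ∀ a b → a ≡ a + b - b
      id = solve-∀
      sum≡0 : vℚ p (1/ x) + vℚ p x ≡ + 0
      sum≡0 = trans (sym (vℚ-* (1/ x) x (1/≢0 x h) h)) (trans (cong (vℚ p) (ℚP.*-inverseˡ x)) vℚ-1)

    zpow≢0 : ∀ x .{{_ : NonZero x}} → x ≢ 0ℚ → ∀ k → zpow x k ≢ 0ℚ
    zpow≢0 x h (+ n) = pow≢0 x n h
    zpow≢0 x h -[1+ n ] = pow≢0 (1/ x) (suc n) (1/≢0 x h)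

    vℚ-zpow : ∀ x .{{_ : NonZero x}} → x ≢ 0ℚ → ∀ k → vℚ p (zpow x k) ≡ k * vℚ p x
    vℚ-zpow x h (+ n) = vℚ-pow x n h
    vℚ-zpow x h -[1+ n ] = trans (vℚ-pow (1/ x) (suc n) (1/≢0 x h)) (trans (cong (+ suc n *_) (vℚ-1/ x h)) (id (+ suc n) (vℚ p x)))
      where
      id : ∀ a b → a * - b ≡ - a * b
      id = solve-∀

  sumFin : ∀ {m} → (Fin m → ℤ) → ℤ
  sumFin {zero} f = + 0
  sumFin {suc m} f = f Fin.zero + sumFin (λ i → f (Fin.suc i))

  sumFin-cong : ∀ {m} {f g : Fin m → ℤ} → (∀ i → f i ≡ g i) → sumFin f ≡ sumFin g
  sumFin-cong {zero} h = refl
  sumFin-cong {suc m} h = cong₂ _+_ (h Fin.zero) (sumFin-cong (λ i → h (Fin.suc i)))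

  prod≢0 : ∀ {m} (f : Fin m → ℚ) → (∀ i → f i ≢ 0ℚ) → prod f ≢ 0ℚ
  prod≢0 {zero} f h ()
  prod≢0 {suc m} f h = ≢0-* (h Fin.zero) (prod≢0 _ (λ i → h (Fin.suc i)))

  vℚ-prod : ∀ {p} → Prime p → ∀ {m} (f : Fin m → ℚ) → (∀ i → f i ≢ 0ℚ) → vℚ p (prod f) ≡ sumFin (λ i → vℚ p (f i))
  vℚ-prod pp {zero} f h = vℚ-1 pp
  vℚ-prod {p} pp {suc m} f h = trans (vℚ-* pp (f Fin.zero) _ (h Fin.zero) (prod≢0 _ (λ i → h (Fin.suc i))))
    (cong (λ z → vℚ p (f Fin.zero) + z) (vℚ-prod pp (λ i → f (Fin.suc i)) (λ i → h (Fin.suc i))))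

  relation : ∀ {m} (γ : Fin m → ℚ) (nz : ∀ i → NonZero (γ i)) (k : Fin m → ℤ) →
    prod (λ i → zpow (γ i) {{nz i}} (k i)) ≡ 1ℚ → ∀ {p} → Prime p → sumFin (λ i → k i * vℚ p (γ i)) ≡ + 0
  relation γ nz k e {p} pp = trans (sumFin-cong (λ i → sym (vℚ-zpow pp (γ i) {{nz i}} (≢0 i) (k i))))
    (trans (sym (vℚ-prod pp _ (λ i → zpow≢0 pp (γ i) {{nz i}} (≢0 i) (k i)))) (trans (cong (vℚ p) e) (vℚ-1 pp)))
    where
    ≢0 : ∀ i → γ i ≢ 0ℚ
    ≢0 i = nonZero⇒≢0 (nz i)

  prod-punchIn : ∀ {m} (f : Fin (suc m) → ℚ) i → prod f ≡ f i ℚ.* prod (λ j → f (punchIn i j))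
  prod-punchIn f Fin.zero = refl
  prod-punchIn {suc m} f (Fin.suc i) = trans (cong (f Fin.zero ℚ.*_) (prod-punchIn (λ j → f (Fin.suc j)) i))
    (trans (sym (ℚP.*-assoc (f Fin.zero) (f (Fin.suc i)) rest)) (trans (cong (ℚ._* rest) (ℚP.*-comm (f Fin.zero) (f (Fin.suc i)))) (ℚP.*-assoc (f (Fin.suc i)) (f Fin.zero) rest)))
    where
    rest = prod (λ j → f (Fin.suc (punchIn i j)))

  -- A vanishing exponent would leave a dependent proper sub-tuple.
  full-support : ∀ {s} (γ : Fin s → ℚ) (nz : ∀ i → NonZero (γ i)) → MaxRankDep γ nz →
    ∃ λ (k : Fin s → ℤ) → (∀ i → k i ≢ + 0) × prod (λ i → zpow (γ i) {{nz i}} (k i)) ≡ 1ℚ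
  full-support {zero} γ nz ((k , (() , _) , _) , _)
  full-support {suc s} γ nz ((k , (i₀ , ki₀≢0) , e) , minimal) = k , nonzero , e
    where
    nonzero : ∀ i → k i ≢ + 0
    nonzero i ki≡0 = minimal s (ℕP.n<1+n s) (punchIn i) mono ((λ j → k (punchIn i j)) , (punchOut i≢i₀ , λ z → ki₀≢0 (trans (cong k (sym (punchIn-punchOut i≢i₀))) z)) , sub)
      where
      i≢i₀ : i ≢ i₀
      i≢i₀ refl = ki₀≢0 ki≡0
      mono : StrictMono (punchIn i)
      mono j l j<l = ℕP.≤∧≢⇒< (punchIn-mono-≤ i j l (ℕP.<⇒≤ j<l)) (λ z → ℕP.<⇒≢ j<l (cong Fin.toℕ (punchIn-injective i j l (FinP.toℕ-injective z))))
      sub : prod (λ j → zpow (γ (punchIn i j)) {{nz (punchIn i j)}} (k (punchIn i j))) ≡ 1ℚ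
      sub = trans (sym (ℚP.*-identityˡ _)) (trans (cong (λ z → zpow (γ i) {{nz i}} z ℚ.* prod (λ j → zpow (γ (punchIn i j)) {{nz (punchIn i j)}} (k (punchIn i j)))) (sym ki≡0))
        (trans (sym (prod-punchIn (λ j → zpow (γ j) {{nz j}} (k j)) i)) e))

-- Sparse sets in intervals

module Ranges where
  open import Data.Nat
  open import Data.Nat.Properties
  open import Data.List using (List; []; _∷_; _++_; length; filter)
  open import Data.List.Properties using (filter-++; length-++)
  open import Data.List.Relation.Unary.Any using (here; there)
  open import Data.List.Relation.Unary.All as All using (All; []; _∷_)
  open import Data.List.Relation.Unary.All.Properties as AllP using (all-filter)
  open import Data.List.Relation.Unary.AllPairs using (AllPairs; []; _∷_)
  import Data.List.Relation.Unary.AllPairs.Properties as AllPairsP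
  open import Data.List.Membership.Propositional using (_∈_)
  open import Data.Empty using (⊥; ⊥-elim)
  open import Data.Sum using (inj₁; inj₂)
  open import Relation.Nullary using (yes; no)
  open import Relation.Unary using (Decidable)
  open import Relation.Binary.PropositionalEquality

  range : ℕ → ℕ → List ℕ
  range u zero = []
  range u (suc n) = u ∷ range (suc u) n

  length-range : ∀ u n → length (range u n) ≡ n
  length-range u zero = refl
  length-range u (suc n) = cong suc (length-range (suc u) n)

  ∈-range : ∀ {x} u n → u ≤ x → x < u + n → x ∈ range u n
  ∈-range {x} u zero l h = ⊥-elim (<⇒≱ h (≤-trans (≤-reflexive (+-identityʳ u)) l))
  ∈-range {x} u (suc n) l h with m≤n⇒m<n∨m≡n l
  ... | inj₂ refl = here refl
  ... | inj₁ u<x = there (∈-range (suc u) n u<x (≤-trans h (≤-reflexive (+-suc u n))))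

  range-≥ : ∀ u n → All (u ≤_) (range u n)
  range-≥ u zero = []
  range-≥ u (suc n) = ≤-refl ∷ All.map (λ h → ≤-trans (n≤1+n u) h) (range-≥ (suc u) n)

  range-< : ∀ u n → All (_< u + n) (range u n)
  range-< u zero = []
  range-< u (suc n) = m<m+n u (s≤s z≤n) ∷ subst (λ k → All (_< k) (range (suc u) n)) (sym (+-suc u n)) (range-< (suc u) n)

  range-sorted : ∀ u n → AllPairs _<_ (range u n)
  range-sorted u zero = []
  range-sorted u (suc n) = range-≥ (suc u) n ∷ range-sorted (suc u) n

  range-++ : ∀ u m n → range u (m + n) ≡ range u m ++ range (u + m) n
  range-++ u zero n = cong (λ k → range k n) (sym (+-identityʳ u))
  range-++ u (suc m) n = cong (u ∷_) (trans (range-++ (suc u) m n) (cong (λ k → range (suc u) m ++ range k n) (sym (+-suc u m))))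

  module _ {P : ℕ → Set} (P? : Decidable P) (T : ℕ)
    (sparse : ∀ {a b c d} → a < b → b < c → c < d → d < a + T → P a → P b → P c → P d → ⊥) where

    window : ∀ u n → n ≤ T → length (filter P? (range u n)) ≤ 3
    window u n n≤T with filter P? (range u n) | AllPairsP.filter⁺ P? (range-sorted u n) | all-filter P? (range u n)
      | AllP.filter⁺ P? (range-≥ u n) | AllP.filter⁺ P? (range-< u n)
    ... | [] | _ | _ | _ | _ = z≤n
    ... | _ ∷ [] | _ | _ | _ | _ = s≤s z≤n
    ... | _ ∷ _ ∷ [] | _ | _ | _ | _ = s≤s (s≤s z≤n)
    ... | _ ∷ _ ∷ _ ∷ [] | _ | _ | _ | _ = ≤-refl
    ... | a ∷ b ∷ c ∷ d ∷ _ | (a<b ∷ _) ∷ (b<c ∷ _) ∷ (c<d ∷ _) ∷ _ | pa ∷ pb ∷ pc ∷ pd ∷ _ | u≤a ∷ _ | _ ∷ _ ∷ _ ∷ d< ∷ _ =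
      ⊥-elim (sparse a<b b<c c<d (≤-trans d< (+-mono-≤ u≤a n≤T)) pa pb pc pd)

    windows : ∀ q u n → n ≤ q * T → length (filter P? (range u n)) ≤ q * 3
    windows zero u .zero z≤n = z≤n
    windows (suc q) u n n≤ with n ≤? T
    ... | yes l = ≤-trans (window u n l) (m≤m+n 3 (q * 3))
    ... | no nl = begin
      length (filter P? (range u n)) ≡⟨ cong (λ k → length (filter P? (range u k))) (sym (m+[n∸m]≡n (<⇒≤ (≰⇒> nl)))) ⟩
      length (filter P? (range u (T + (n ∸ T)))) ≡⟨ cong (λ xs → length (filter P? xs)) (range-++ u T (n ∸ T)) ⟩
      length (filter P? (range u T ++ range (u + T) (n ∸ T))) ≡⟨ cong length (filter-++ P? (range u T) _) ⟩
      length (filter P? (range u T) ++ filter P? (range (u + T) (n ∸ T))) ≡⟨ length-++ (filter P? (range u T)) ⟩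
      length (filter P? (range u T)) + length (filter P? (range (u + T) (n ∸ T))) ≤⟨ +-mono-≤ (window u T ≤-refl) (windows q (u + T) (n ∸ T) (m≤n+o⇒m∸n≤o n T n≤)) ⟩
      3 + q * 3 ∎
      where open ≤-Reasoning

-- Separated functions on dyadic blocks

module Blocks where
  open import Data.Nat
  open import Data.Nat.Properties
  open import Data.Nat.Tactic.RingSolver using (solve-∀)
  open import Data.List using (List; []; _∷_; _++_; length; filter; map)
  open import Data.List.Relation.Unary.Any using (here)
  open import Data.List.Relation.Unary.All as All using (All; []; _∷_)
  open import Data.List.Membership.Propositional using (_∈_)
  open import Data.List.Membership.Propositional.Properties using (∈-++⁺ˡ; ∈-++⁺ʳ; ∈-filter⁺)
  open import Data.Product using (∃; _×_; _,_)
  open import Data.Sum using (inj₁; inj₂)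
  open import Relation.Nullary using (yes; no)
  open import Relation.Unary using (Decidable)
  open import Relation.Binary.PropositionalEquality
  open ≤-Reasoning

  total : (ℕ → ℕ) → List ℕ → ℕ
  total f [] = 0
  total f (x ∷ xs) = f x + total f xs

  total-++ : ∀ f xs ys → total f (xs ++ ys) ≡ total f xs + total f ys
  total-++ f [] ys = refl
  total-++ f (x ∷ xs) ys = trans (cong (f x +_) (total-++ f xs ys)) (sym (+-assoc (f x) (total f xs) (total f ys)))

  block : ℕ → ℕ → List ℕ
  block u zero = u ∷ []
  block u (suc j) = block u j ++ block (u + 2 ^ j) j

  2^suc : ∀ j → 2 ^ suc j ≡ 2 ^ j + 2 ^ j
  2^suc j = cong (2 ^ j +_) (+-identityʳ (2 ^ j))

  ∈-block : ∀ {x} j u → u ≤ x → x < u + 2 ^ j → x ∈ block u j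
  ∈-block {x} zero u l h = here (≤-antisym (≤-pred (≤-trans h (≤-reflexive (+-comm u 1)))) l)
  ∈-block {x} (suc j) u l h with x <? u + 2 ^ j
  ... | yes p = ∈-++⁺ˡ (∈-block j u l p)
  ... | no q = ∈-++⁺ʳ (block u j) (∈-block j (u + 2 ^ j) (≮⇒≥ q) (≤-trans h (≤-reflexive (trans (cong (u +_) (2^suc j)) (sym (+-assoc u (2 ^ j) (2 ^ j)))))))

  -- Here `z n` is to be read as the logarithmic proximity to O of the n-th point at one place; the
  -- minimum expresses that both points are close.
  Close : ℕ → (ℕ → ℕ) → Set
  Close c z = ∀ m n → m < n → z m ⊓ z n ≤ c * ((n ∸ m) * (n ∸ m))

  -- Apart from its largest value, a function with this separation property has
  -- a quadratically bounded sum over a dyadic block.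
  halving : ∀ {c z} → Close c z → ∀ j u → ∃ λ n → u ≤ n × n < u + 2 ^ j × total z (block u j) ≤ z n + 2 * c * (2 ^ j * 2 ^ j)
  halving {c} {z} close zero u = u , ≤-refl , ≤-reflexive (+-comm 1 u) , ≤-trans (≤-reflexive (+-identityʳ (z u))) (m≤m+n (z u) _)
  halving {c} {z} close (suc j) u with halving {c} {z} close j u | halving {c} {z} close j (u + 2 ^ j)
  ... | m , u≤m , m< , hm | n , u≤n , n< , hn with ≤-total (z m) (z n)
  ...   | inj₁ zm≤zn = n , ≤-trans (m≤m+n u (2 ^ j)) u≤n , end , bound
    where
    end : n < u + 2 ^ suc j
    end = ≤-trans n< (≤-reflexive (trans (+-assoc u (2 ^ j) (2 ^ j)) (cong (u +_) (sym (2^suc j)))))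
    bound : total z (block u (suc j)) ≤ z n + 2 * c * (2 ^ suc j * 2 ^ suc j)
    bound = begin
      total z (block u (suc j)) ≡⟨ total-++ z (block u j) _ ⟩
      total z (block u j) + total z (block (u + 2 ^ j) j) ≤⟨ +-mono-≤ hm hn ⟩
      -- Of the two maximal values the smaller is absorbed by `close`. With q the half-length, the
      -- constant `2c` reproduces itself: `c(2q)² + 2 * 2cq² = 2c(2q)²`.
      z m + 2 * c * (2 ^ j * 2 ^ j) + (z n + 2 * c * (2 ^ j * 2 ^ j)) ≤⟨ +-monoˡ-≤ _ (+-monoˡ-≤ _ (≤-trans (≤-reflexive (sym (m≤n⇒m⊓n≡m zm≤zn))) (≤-trans (close m n (≤-trans m< u≤n)) (*-monoʳ-≤ c (*-mono-≤ dist dist))))) ⟩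
      c * ((2 ^ j + 2 ^ j) * (2 ^ j + 2 ^ j)) + 2 * c * (2 ^ j * 2 ^ j) + (z n + 2 * c * (2 ^ j * 2 ^ j)) ≡⟨ id c (2 ^ j) (z n) ⟩
      z n + 2 * c * ((2 ^ j + 2 ^ j) * (2 ^ j + 2 ^ j)) ≡⟨ cong (λ k → z n + 2 * c * (k * k)) (sym (2^suc j)) ⟩
      z n + 2 * c * (2 ^ suc j * 2 ^ suc j) ∎
      where
      dist : n ∸ m ≤ 2 ^ j + 2 ^ j
      dist = ≤-trans (∸-mono (<⇒≤ n<) u≤m) (≤-reflexive (trans (cong (_∸ u) (+-assoc u (2 ^ j) (2 ^ j))) (m+n∸m≡n u _)))
      id : ∀ c q y → c * ((q + q) * (q + q)) + 2 * c * (q * q) + (y + 2 * c * (q * q)) ≡ y + 2 * c * ((q + q) * (q + q))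
      id = solve-∀
  ...   | inj₂ zn≤zm = m , u≤m , ≤-trans m< (+-monoʳ-≤ u (≤-trans (m≤m+n (2 ^ j) (2 ^ j)) (≤-reflexive (sym (2^suc j))))) , bound
    where
    bound : total z (block u (suc j)) ≤ z m + 2 * c * (2 ^ suc j * 2 ^ suc j)
    bound = begin
      total z (block u (suc j)) ≡⟨ total-++ z (block u j) _ ⟩
      total z (block u j) + total z (block (u + 2 ^ j) j) ≤⟨ +-mono-≤ hm hn ⟩
      z m + 2 * c * (2 ^ j * 2 ^ j) + (z n + 2 * c * (2 ^ j * 2 ^ j)) ≤⟨ +-monoʳ-≤ (z m + 2 * c * (2 ^ j * 2 ^ j)) (+-monoˡ-≤ _ (≤-trans (≤-reflexive (sym (m≥n⇒m⊓n≡n zn≤zm))) (≤-trans (close m n (≤-trans m< u≤n)) (*-monoʳ-≤ c (*-mono-≤ dist dist))))) ⟩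
      z m + 2 * c * (2 ^ j * 2 ^ j) + (c * ((2 ^ j + 2 ^ j) * (2 ^ j + 2 ^ j)) + 2 * c * (2 ^ j * 2 ^ j)) ≡⟨ id c (2 ^ j) (z m) ⟩
      z m + 2 * c * ((2 ^ j + 2 ^ j) * (2 ^ j + 2 ^ j)) ≡⟨ cong (λ k → z m + 2 * c * (k * k)) (sym (2^suc j)) ⟩
      z m + 2 * c * (2 ^ suc j * 2 ^ suc j) ∎
      where
      dist : n ∸ m ≤ 2 ^ j + 2 ^ j
      dist = ≤-trans (∸-mono (<⇒≤ n<) u≤m) (≤-reflexive (trans (cong (_∸ u) (+-assoc u (2 ^ j) (2 ^ j))) (m+n∸m≡n u _)))
      id : ∀ c q y → y + 2 * c * (q * q) + (c * ((q + q) * (q + q)) + 2 * c * (q * q)) ≡ y + 2 * c * ((q + q) * (q + q))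
      id = solve-∀

  -- The largest value in a block is beyond control; truncation at M limits its share and preserves
  -- `Close`.
  truncated-sum : ∀ {c z} M → Close c z → ∀ j u → total (λ n → z n ⊓ M) (block u j) ≤ M + 2 * c * (2 ^ j * 2 ^ j)
  truncated-sum {c} {z} M close j u with halving {c} {λ n → z n ⊓ M} close′ j u
    where
    close′ : Close c (λ n → z n ⊓ M)
    close′ m n l = ≤-trans (⊓-mono-≤ (m⊓n≤m (z m) M) (m⊓n≤m (z n) M)) (close m n l)
  ... | n , _ , _ , h = ≤-trans h (+-monoˡ-≤ _ (m⊓n≤n (z n) M))

  energy : List (ℕ → ℕ) → ℕ → ℕ
  energy [] n = 0
  energy (z ∷ zs) n = z n + energy zs n

  truncate : ℕ → List (ℕ → ℕ) → List (ℕ → ℕ)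
  truncate M = map (λ z n → z n ⊓ M)

  truncate-energy : ∀ M zs n → M ⊓ energy zs n ≤ energy (truncate M zs) n
  truncate-energy M [] n = m⊓n≤n M 0
  truncate-energy M (z ∷ zs) n = ≤-trans (lemma (z n) (energy zs n)) (+-monoʳ-≤ (z n ⊓ M) (truncate-energy M zs n))
    where
    lemma : ∀ x y → M ⊓ (x + y) ≤ x ⊓ M + M ⊓ y
    lemma x y with ≤-total x M | ≤-total y M
    ... | inj₂ M≤x | _ = ≤-trans (m⊓n≤m M (x + y)) (≤-trans (≤-reflexive (sym (m≥n⇒m⊓n≡n M≤x))) (m≤m+n (x ⊓ M) (M ⊓ y)))
    ... | inj₁ _ | inj₂ M≤y = ≤-trans (m⊓n≤m M (x + y)) (≤-trans (≤-reflexive (sym (m≤n⇒m⊓n≡m M≤y))) (m≤n+m (M ⊓ y) (x ⊓ M)))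
    ... | inj₁ x≤M | inj₁ y≤M = ≤-trans (m⊓n≤n M (x + y)) (+-mono-≤ (≤-reflexive (sym (m≤n⇒m⊓n≡m x≤M))) (≤-reflexive (sym (m≥n⇒m⊓n≡n y≤M))))

  total-energy : ∀ {c} M zs → All (Close c) zs → ∀ j u → total (energy (truncate M zs)) (block u j) ≤ length zs * (M + 2 * c * (2 ^ j * 2 ^ j))
  total-energy M [] [] j u = ≤-reflexive (zeros (block u j))
    where
    zeros : ∀ xs → total (λ _ → 0) xs ≡ 0
    zeros [] = refl
    zeros (x ∷ xs) = zeros xs
  total-energy {c} M (z ∷ zs) (cz ∷ czs) j u = ≤-trans (≤-reflexive (split (block u j))) (+-mono-≤ (truncated-sum {c} {z} M cz j u) (total-energy {c} M zs czs j u))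
    where
    split : ∀ xs → total (λ n → z n ⊓ M + energy (truncate M zs) n) xs ≡ total (λ n → z n ⊓ M) xs + total (energy (truncate M zs)) xs
    split [] = refl
    split (x ∷ xs) = trans (cong (z x ⊓ M + energy (truncate M zs) x +_) (split xs)) (id (z x ⊓ M) (energy (truncate M zs) x) _ _)
      where
      id : ∀ a b c d → a + b + (c + d) ≡ a + c + (b + d)
      id = solve-∀

  module _ {c e : ℕ} (1≤e : 1 ≤ e) (zs : List (ℕ → ℕ)) (close : All (Close c) zs)
    {B : ℕ → Set} (B? : Decidable B) (large : ∀ n → B n → n * n ≤ e * energy zs n) where

    -- Truncation at `M = 4^j` balances two estimates: every n counted satisfies n² ≥ M and so has
    -- truncated energy at least M/e, while each place contributes at most `(1 + 2c) M` over the
    -- whole block. The quotient is independent of j.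
    block-count : ∀ j u → 2 ^ j ≤ u → length (filter B? (block u j)) ≤ e * (length zs * (1 + 2 * c))
    block-count j u 2^j≤u = *-cancelʳ-≤ _ _ M {{>-nonZero (*-mono-≤ (1≤2^ j) (1≤2^ j))}} (begin
      length (filter B? (block u j)) * M ≤⟨ count (block u j) (∈-block-≥ j u) ⟩
      e * total (energy (truncate M zs)) (block u j) ≤⟨ *-monoʳ-≤ e (total-energy {c} M zs close j u) ⟩
      e * (length zs * (M + 2 * c * M)) ≡⟨ id e (length zs) c M ⟩
      e * (length zs * (1 + 2 * c)) * M ∎)
      where
      open Log using (1≤2^)
      M = 2 ^ j * 2 ^ j
      id : ∀ e l c M → e * (l * (M + 2 * c * M)) ≡ e * (l * (1 + 2 * c)) * M
      id = solve-∀
      ∈-block-≥ : ∀ j u → All (u ≤_) (block u j)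
      ∈-block-≥ zero u = ≤-refl ∷ []
      ∈-block-≥ (suc j) u = AllP.++⁺ (∈-block-≥ j u) (All.map (≤-trans (m≤m+n u (2 ^ j))) (∈-block-≥ j (u + 2 ^ j)))
        where import Data.List.Relation.Unary.All.Properties as AllP
      each : ∀ {n} → u ≤ n → B n → M ≤ e * energy (truncate M zs) n
      each {n} u≤n b = ≤-trans min≤ (*-monoʳ-≤ e (truncate-energy M zs n))
        where
        min≤ : M ≤ e * (M ⊓ energy zs n)
        min≤ with ≤-total M (energy zs n)
        ... | inj₁ l = ≤-trans (m≤n*m M e {{>-nonZero 1≤e}}) (≤-reflexive (cong (e *_) (sym (m≤n⇒m⊓n≡m l))))
        ... | inj₂ l = ≤-trans (*-mono-≤ (≤-trans 2^j≤u u≤n) (≤-trans 2^j≤u u≤n)) (≤-trans (large n b) (≤-reflexive (cong (e *_) (sym (m≥n⇒m⊓n≡n l)))))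
      count : ∀ xs → All (u ≤_) xs → length (filter B? xs) * M ≤ e * total (energy (truncate M zs)) xs
      count [] [] = z≤n
      count (x ∷ xs) (u≤x ∷ h) with B? x
      ... | yes b = ≤-trans (+-mono-≤ (each u≤x b) (count xs h)) (≤-reflexive (sym (*-distribˡ-+ e _ _)))
      ... | no _ = ≤-trans (count xs h) (*-monoʳ-≤ e (m≤n+m _ _))

    dyadic : ℕ → List ℕ
    dyadic zero = []
    dyadic (suc j) = filter B? (block (2 ^ j) j) ++ dyadic j

    exceptional : ℕ → ℕ → List ℕ
    exceptional u J with 2 ^ J ≤? u
    ... | yes _ = filter B? (block u J)
    ... | no _ = dyadic (suc J)

    dyadic-length : ∀ j → length (dyadic j) ≤ j * (e * (length zs * (1 + 2 * c)))
    dyadic-length zero = z≤n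
    dyadic-length (suc j) = ≤-trans (≤-reflexive (length-++ (filter B? (block (2 ^ j) j)))) (+-mono-≤ (block-count j (2 ^ j) ≤-refl) (dyadic-length j))
      where open import Data.List.Properties using (length-++)

    exceptional-length : ∀ u J → length (exceptional u J) ≤ suc J * (e * (length zs * (1 + 2 * c)))
    exceptional-length u J with 2 ^ J ≤? u
    ... | yes l = ≤-trans (block-count J u l) (m≤m+n _ _)
    ... | no _ = dyadic-length (suc J)

    ∈-dyadic : ∀ {n} j → 1 ≤ n → n < 2 ^ j → B n → n ∈ dyadic j
    ∈-dyadic zero 1≤n (s≤s z≤n) b with () ← 1≤n
    ∈-dyadic {n} (suc j) 1≤n n< b with 2 ^ j ≤? n
    ... | yes l = ∈-++⁺ˡ (∈-filter⁺ B? (∈-block j (2 ^ j) l (≤-trans n< (≤-reflexive (2^suc j)))) b)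
    ... | no l = ∈-++⁺ʳ (filter B? (block (2 ^ j) j)) (∈-dyadic j 1≤n (≰⇒> l) b)

    ∈-exceptional : ∀ {n} u J → 1 ≤ u → u ≤ n → n < u + 2 ^ J → B n → n ∈ exceptional u J
    ∈-exceptional u J 1≤u l h b with 2 ^ J ≤? u
    ... | yes _ = ∈-filter⁺ B? (∈-block J u l h) b
    ... | no u<2^J = ∈-dyadic (suc J) (≤-trans 1≤u l) (≤-trans h (≤-trans (+-monoˡ-≤ (2 ^ J) (<⇒≤ (≰⇒> u<2^J))) (≤-reflexive (sym (2^suc J))))) b

-- The points nP + Q at the primes and at infinity

module Orbits (E : Curve) (G : XGroups.XGroup E) where
  open XGroups.XGroup G
  open Height E G
  open import Algebra.Properties.Monoid.Mult monoid using (_×_)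
  open import Data.Nat using (ℕ; _*_; _≤_)
  open import Data.Product using (proj₁; proj₂)
  open import Relation.Binary.PropositionalEquality

  record Orbit : Set where
    field
      P Q : Point
      nontorsion : ∀ n → 1 ≤ n → n × P ≢ O
      c-multiple c-growth n₀ : ℕ
      multiple : ∀ m → 1 ≤ m → h (m × P) ≤ c-multiple * (m * m)
      growing : ∀ n → n₀ ≤ n → n * n ≤ c-growth * h (n × P ⊕ Q)

  orbit : HeightConstants → ∀ P Q → (∀ n → 1 ≤ n → n × P ≢ O) → Orbit
  orbit constants P Q nontorsion = record
    { nontorsion = nontorsion
    ; c-multiple = proj₁ (height-multiple P)
    ; c-growth = proj₁ (growth Q nontorsion)
    ; n₀ = proj₁ (proj₂ (growth Q nontorsion))
    ; multiple = proj₂ (height-multiple P)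
    ; growing = proj₂ (proj₂ (growth Q nontorsion))
    }
    where open Growth E G constants

module OrbitFacts (E : Curve) (G : XGroups.XGroup E) (𝒪 : Orbits.Orbit E G) where
  open XGroups.XGroup G
  open Height E G
  open Orbits E G
  open Orbit 𝒪
  open import Algebra.Properties.Monoid.Mult monoid using (_×_; ×-homo-+)
  open KummerInteger E using (A′; B′; IntegralRel)
  open PrimeDivisors
  open Log
  open Valuation using (v; v-∣; smooth-≤; prime≥2)
  open Blocks using (Close; energy)
  open import Algebra.Structures using (IsAbelianGroup)
  open IsAbelianGroup isAbelianGroup using (assoc; comm)
  open import Data.Nat as ℕ using (ℕ; zero; suc; _+_; _*_; _^_; _∸_; _≤_; _<_; _⊓_; z≤n; s≤s; NonZero)
  open import Data.Nat.Properties
  open import Data.Nat.Divisibility as ℕD using () renaming (_∣_ to _dvd_)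
  open import Data.Nat.DivMod using (_/_; m/n*n≤m; m≡m%n+[m/n]*n; m%n<n)
  open import Data.Nat.Primality using (Prime)
  open import Data.Nat.ListAction using (product)
  open import Data.Nat.Tactic.RingSolver using (solve-∀)
  open import Data.Integer as ℤ using (ℤ; ∣_∣)
  import Data.Integer.Properties as ℤP
  open import Data.List using (List; []; _∷_; map)
  open import Data.List.Relation.Unary.All using (All; []; _∷_)
  open import Data.List.Membership.Propositional using (_∈_)
  open import Data.Product using (_,_; proj₁; proj₂) renaming (_×_ to _and_)
  open import Data.Sum using (_⊎_; inj₁; inj₂)
  open import Data.Empty using (⊥; ⊥-elim)
  open import Relation.Nullary using (¬_; Dec; yes; no)
  open import Relation.Binary.PropositionalEquality

  R : ℕ → Point
  R n = n × P ⊕ Q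

  X Z D : ℕ → ℕ
  X n = ∣ xnum (R n) ∣
  Z n = ∣ xden (R n) ∣
  D d = ∣ xden (d × P) ∣

  1≤D : ∀ {d} → 1 ≤ d → 1 ≤ D d
  1≤D {d} 1≤d with ∣ xden (d × P) ∣ in eq
  ... | suc _ = s≤s z≤n
  ... | zero = ⊥-elim (nontorsion d 1≤d (xden≡0⇒O (d × P) (ℤP.∣i∣≡0⇒i≡0 eq)))

  -- The successor absorbs the rounding in `H < 2 ^ suc h`.
  cD : ℕ
  cD = suc c-multiple

  H-multiple : ∀ {d} → 1 ≤ d → H (d × P) ≤ 2 ^ (cD * (d * d))
  H-multiple {d} 1≤d = ≤-trans (H<2^ (d × P)) (2^-mono (+-mono-≤ (*-mono-≤ 1≤d 1≤d) (multiple d 1≤d)))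

  D≤ : ∀ {d} → 1 ≤ d → D d ≤ 2 ^ (cD * (d * d))
  D≤ {d} 1≤d = ≤-trans (m≤n⊔m (∣ xnum (d × P) ∣) (D d)) (H-multiple 1≤d)

  R-difference : ∀ {m n} → m < n → R n ⊕ ⊖ R m ≡ (n ∸ m) × P
  R-difference {m} {n} m<n = move-⊖ (begin
    (n ∸ m) × P ⊕ (m × P ⊕ Q) ≡⟨ sym (assoc ((n ∸ m) × P) (m × P) Q) ⟩
    ((n ∸ m) × P ⊕ m × P) ⊕ Q ≡⟨ cong (_⊕ Q) (sym (×-homo-+ P (n ∸ m) m)) ⟩
    ((n ∸ m) + m) × P ⊕ Q ≡⟨ cong R (m∸n+n≡m (<⇒≤ m<n)) ⟩
    R n ∎)
    where open ≡-Reasoning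

  difference-kum : ∀ {m n} → m < n → IntegralRel (xnum (R n)) (xden (R n)) (xnum (R m)) (xden (R m))
    (xnum (R n ⊕ R m)) (xden (R n ⊕ R m)) (xnum ((n ∸ m) × P)) (xden ((n ∸ m) × P))
  difference-kum {m} {n} m<n = subst (λ A → IntegralRel (xnum (R n)) (xden (R n)) (xnum (R m)) (xden (R m))
    (xnum (R n ⊕ R m)) (xden (R n ⊕ R m)) (xnum A) (xden A)) (R-difference m<n) (kum (R n) (R m))

  common-denominator : ∀ {p m n} j → Prime p → m < n → p ^ j dvd Z m → p ^ j dvd Z n → p ^ j dvd D (n ∸ m)
  common-denominator {p} {m} {n} j pp m<n hm hn = ∣ℤ⇒∣ {p ^ j} {xden ((n ∸ m) × P)} (proj₂ (KummerLocal.denominators E (difference-kum m<n) j pp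
    (coprime (R n)) (coprime (R m)) (∣⇒∣ℤ {z = xden (R n)} hn) (∣⇒∣ℤ {z = xden (R m)} hm)))

  common-denominator₁ : ∀ {p m n} → Prime p → m < n → p dvd Z m → p dvd Z n → p dvd D (n ∸ m)
  common-denominator₁ {p} {m} {n} pp m<n hm hn = subst (_dvd D (n ∸ m)) (*-identityʳ p)
    (common-denominator 1 pp m<n (subst (_dvd Z m) (sym (*-identityʳ p)) hm) (subst (_dvd Z n) (sym (*-identityʳ p)) hn))

  -- The factor 2 excludes the prime 2, as `numerators` demands.
  disc : ℕ
  disc = 2 * ∣ (ℤ.+ 4 ℤ.* A′ ℤ.* A′ ℤ.* A′) ℤ.+ (ℤ.+ 27 ℤ.* B′ ℤ.* B′) ∣

  1≤disc : 1 ≤ disc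
  1≤disc with ∣ (ℤ.+ 4 ℤ.* A′ ℤ.* A′ ℤ.* A′) ℤ.+ (ℤ.+ 27 ℤ.* B′ ℤ.* B′) ∣ in eq
  ... | suc _ = s≤s z≤n
  ... | zero = ⊥-elim (Curve.nonsingular E (ℤP.∣i∣≡0⇒i≡0 eq))

  -- Modulo p a zero of the numerator means reduction to ±(0, √b); of three such
  -- reductions two coincide.
  common-numerator : ∀ {p a b c} → Prime p → ¬ p dvd disc → a < b → b < c → p dvd X a → p dvd X b → p dvd X c →
    p dvd D (b ∸ a) ⊎ p dvd D (c ∸ b) ⊎ p dvd D (c ∸ a)
  common-numerator {p} {a} {b} {c} pp p∤disc a<b b<c ha hb hc = combine (pair a<b ha hb) (pair b<c hb hc)
    where
    Δ : ℤ
    Δ = (ℤ.+ 4 ℤ.* A′ ℤ.* A′ ℤ.* A′) ℤ.+ (ℤ.+ 27 ℤ.* B′ ℤ.* B′)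
    p∤2 : ¬ p ∣ℤ ℤ.+ 2
    p∤2 h = p∤disc (ℕD.∣m⇒∣m*n (∣ Δ ∣) (∣ℤ⇒∣ {p} {ℤ.+ 2} h))
    p∤Δ : ¬ p ∣ℤ Δ
    p∤Δ h = p∤disc (ℕD.∣n⇒∣m*n 2 (∣ℤ⇒∣ {p} {Δ} h))
    pair : ∀ {m n} → m < n → p dvd X m → p dvd X n → p ∣ℤ xden (R n ⊕ R m) ⊎ p ∣ℤ xden ((n ∸ m) × P)
    pair {m} {n} m<n hm hn = KummerLocal.numerators E (difference-kum m<n) pp p∤2 p∤Δ (coprime (R n)) (coprime (R m))
      (∣⇒∣ℤ {z = xnum (R n)} hn) (∣⇒∣ℤ {z = xnum (R m)} hm)
    A₁ A₂ : Point
    A₁ = R c ⊕ R b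
    A₂ = R b ⊕ R a
    difference : A₁ ⊕ ⊖ A₂ ≡ (c ∸ a) × P
    difference = trans (move-⊖ {A₁} {A₂} {R c ⊕ ⊖ R a} (begin
      (R c ⊕ ⊖ R a) ⊕ (R b ⊕ R a) ≡⟨ cong ((R c ⊕ ⊖ R a) ⊕_) (comm (R b) (R a)) ⟩
      (R c ⊕ ⊖ R a) ⊕ (R a ⊕ R b) ≡⟨ sym (assoc (R c ⊕ ⊖ R a) (R a) (R b)) ⟩
      ((R c ⊕ ⊖ R a) ⊕ R a) ⊕ R b ≡⟨ cong (_⊕ R b) (⊖-⊕ (R c) (R a)) ⟩
      R c ⊕ R b ∎)) (R-difference (<-trans a<b b<c))
      where open ≡-Reasoning
    rel : IntegralRel (xnum A₁) (xden A₁) (xnum A₂) (xden A₂) (xnum (A₁ ⊕ A₂)) (xden (A₁ ⊕ A₂)) (xnum ((c ∸ a) × P)) (xden ((c ∸ a) × P))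
    rel = subst (λ A → IntegralRel (xnum A₁) (xden A₁) (xnum A₂) (xden A₂) (xnum (A₁ ⊕ A₂)) (xden (A₁ ⊕ A₂)) (xnum A) (xden A)) difference (kum A₁ A₂)
    one : ∀ {z} → p ∣ℤ z → p ^ 1 ∣ℤ z
    one {z} = subst (_∣ℤ z) (sym (*-identityʳ p))
    combine : p ∣ℤ xden A₂ ⊎ p ∣ℤ xden ((b ∸ a) × P) → p ∣ℤ xden A₁ ⊎ p ∣ℤ xden ((c ∸ b) × P) →
      (p dvd D (b ∸ a)) ⊎ (p dvd D (c ∸ b)) ⊎ (p dvd D (c ∸ a))
    combine (inj₂ h) _ = inj₁ (∣ℤ⇒∣ {p} {xden ((b ∸ a) × P)} h)
    combine (inj₁ _) (inj₂ h) = inj₂ (inj₁ (∣ℤ⇒∣ {p} {xden ((c ∸ b) × P)} h))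
    combine (inj₁ h) (inj₁ k) = inj₂ (inj₂ (∣ℤ⇒∣ {p} {xden ((c ∸ a) × P)} (subst (_∣ℤ xden ((c ∸ a) × P)) (*-identityʳ p)
      (proj₂ (KummerLocal.denominators E rel 1 pp (coprime A₁) (coprime A₂) (one {xden A₁} k) (one {xden A₂} h))))))

  -- In a window of length T the prime divides at most one denominator and at most two numerators,
  -- which excludes four indices; the cases distribute them over the two kinds.
  sparse : ∀ {p T} → Prime p → ¬ p dvd disc → (∀ {d} → 1 ≤ d → d ≤ T → ¬ p dvd D d) →
    ∀ {a b c d} → a < b → b < c → c < d → d < a + T →
    p dvd Z a ⊎ p dvd X a → p dvd Z b ⊎ p dvd X b → p dvd Z c ⊎ p dvd X c → p dvd Z d ⊎ p dvd X d → ⊥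
  sparse {p} {T} pp p∤disc p∤D {a} {b} {c} {d} a<b b<c c<d d<a+T = cases
    where
    near : ∀ {m n} → a ≤ m → m < n → n ≤ d → ¬ p dvd D (n ∸ m)
    near {m} {n} a≤m m<n n≤d = p∤D (m<n⇒0<n∸m m<n) (≤-trans (∸-mono n≤d a≤m) (≤-trans (∸-monoˡ-≤ a (<⇒≤ d<a+T)) (≤-reflexive (m+n∸m≡n a T))))
    a<c : a < c
    a<c = <-trans a<b b<c
    b<d : b < d
    b<d = <-trans b<c c<d
    a<d : a < d
    a<d = <-trans a<c c<d
    den : ∀ m n → a ≤ m → m < n → n ≤ d → p dvd Z m → p dvd Z n → ⊥
    den m n a≤m m<n n≤d hm hn = near {m} {n} a≤m m<n n≤d (common-denominator₁ {p} {m} {n} pp m<n hm hn)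
    num : ∀ l m n → a ≤ l → l < m → m < n → n ≤ d → p dvd X l → p dvd X m → p dvd X n → ⊥
    num l m n a≤l l<m m<n n≤d hl hm hn = split (common-numerator {p} {l} {m} {n} pp p∤disc l<m m<n hl hm hn)
      where
      split : (p dvd D (m ∸ l)) ⊎ (p dvd D (n ∸ m)) ⊎ (p dvd D (n ∸ l)) → ⊥
      split (inj₁ h) = near {l} {m} a≤l l<m (≤-trans (<⇒≤ m<n) n≤d) h
      split (inj₂ (inj₁ h)) = near {m} {n} (≤-trans a≤l (<⇒≤ l<m)) m<n n≤d h
      split (inj₂ (inj₂ h)) = near {l} {n} a≤l (<-trans l<m m<n) n≤d h
    cases : (p dvd Z a) ⊎ (p dvd X a) → (p dvd Z b) ⊎ (p dvd X b) → (p dvd Z c) ⊎ (p dvd X c) → (p dvd Z d) ⊎ (p dvd X d) → ⊥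
    cases (inj₁ i) (inj₁ j) _ _ = den a b ≤-refl a<b (<⇒≤ b<d) i j
    cases (inj₁ i) (inj₂ _) (inj₁ j) _ = den a c ≤-refl a<c (<⇒≤ c<d) i j
    cases (inj₁ i) (inj₂ _) (inj₂ _) (inj₁ j) = den a d ≤-refl a<d ≤-refl i j
    cases (inj₁ i) (inj₂ j) (inj₂ k) (inj₂ l) = num b c d (<⇒≤ a<b) b<c c<d ≤-refl j k l
    cases (inj₂ _) (inj₁ i) (inj₁ j) _ = den b c (<⇒≤ a<b) b<c (<⇒≤ c<d) i j
    cases (inj₂ _) (inj₁ i) (inj₂ _) (inj₁ j) = den b d (<⇒≤ a<b) b<d ≤-refl i j
    cases (inj₂ i) (inj₁ _) (inj₂ j) (inj₂ k) = num a c d ≤-refl a<c c<d ≤-refl i j k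
    cases (inj₂ _) (inj₂ _) (inj₁ i) (inj₁ j) = den c d (<⇒≤ a<c) c<d ≤-refl i j
    cases (inj₂ i) (inj₂ j) (inj₁ _) (inj₂ k) = num a b d ≤-refl a<b b<d ≤-refl i j k
    cases (inj₂ i) (inj₂ j) (inj₂ k) _ = num a b c ≤-refl a<b b<c (<⇒≤ c<d) i j k

  -- Rounded logarithm of the p-part of the denominator. For a prime p, `lg p ≥ 1`, so rounding
  -- costs at most a factor 2, the one found in `Exceptional`.
  zp : ℕ → ℕ → ℕ
  zp p n = v p (Z n) * lg p

  p^-∣ : ∀ p {i j m} → i ≤ j → p ^ j dvd m → p ^ i dvd m
  p^-∣ p {i} {j} l h = ℕD.∣-trans (ℕD.divides (p ^ (j ∸ i)) (trans (cong (p ^_) (sym (m∸n+n≡m l))) (^-distribˡ-+-* p (j ∸ i) i))) h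

  -- The smaller of the two p-parts divides both denominators, hence that of (n - m)P, whose size is
  -- known.
  zp-close : ∀ {p} → Prime p → Close cD (zp p)
  zp-close {p} pp m n m<n = begin
    (v p (Z m) * lg p) ⊓ (v p (Z n) * lg p) ≡⟨ sym (*-distribʳ-⊓ (lg p) (v p (Z m)) (v p (Z n))) ⟩
    w * lg p ≤⟨ 2^-cancel-≤ (begin
      2 ^ (w * lg p) ≡⟨ trans (cong (2 ^_) (*-comm w (lg p))) (sym (^-*-assoc 2 (lg p) w)) ⟩
      (2 ^ lg p) ^ w ≤⟨ ^-monoˡ-≤ w (2^lg≤ (≤-trans (s≤s z≤n) (prime≥2 pp))) ⟩
      p ^ w ≤⟨ ℕD.∣⇒≤ {{ℕ.>-nonZero (1≤D 1≤d)}} (common-denominator {p} {m} {n} w pp m<n (p^-∣ p {w} {v p (Z m)} (m⊓n≤m (v p (Z m)) (v p (Z n))) (v-∣ p (Z m))) (p^-∣ p {w} {v p (Z n)} (m⊓n≤n (v p (Z m)) (v p (Z n))) (v-∣ p (Z n)))) ⟩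
      D (n ∸ m) ≤⟨ D≤ 1≤d ⟩
      2 ^ (cD * ((n ∸ m) * (n ∸ m))) ∎) ⟩
    cD * ((n ∸ m) * (n ∸ m)) ∎
    where
    open ≤-Reasoning
    w = v p (Z m) ⊓ v p (Z n)
    1≤d : 1 ≤ n ∸ m
    1≤d = m<n⇒0<n∸m m<n

  -- Only meaningful for a nonzero denominator.
  _div_ : ℕ → ℕ → ℕ
  x div zero = 0
  x div suc z = x / suc z

  -- The real place, where proximity to O means a large abscissa.
  z∞ : ℕ → ℕ
  z∞ n = lg (X n div Z n)

  threshold c∞ : ℕ
  threshold = 8 * (1 + ∣ A′ ∣ + ∣ B′ ∣)
  c∞ = 8 + cD + threshold

  div-lower : ∀ x z w → 1 ≤ w → w ≤ lg (x div z) → 2 ^ w * z ≤ x and 1 ≤ x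
  div-lower x zero (suc _) _ ()
  div-lower x (suc z) w 1≤w w≤ with x / suc z in eq
  ... | zero = ⊥-elim (<⇒≱ (s≤s z≤n) (≤-trans 1≤w w≤))
  ... | q@(suc _) = l , ≤-trans (*-mono-≤ (1≤2^ w) (s≤s z≤n)) l
    where
    l : 2 ^ w * suc z ≤ x
    l = ≤-trans (*-monoˡ-≤ (suc z) (≤-trans (2^-mono w≤) (2^lg≤ {q} (s≤s z≤n)))) (≤-trans (≤-reflexive (cong (_* suc z) (sym eq))) (m/n*n≤m x (suc z)))

  -- Either the smaller exponent is below the threshold of `archimedean`, or that lemma makes the
  -- abscissa of (n - m)P large and the height of this point bounds the exponent. The constant 8
  -- comes from `192 ≤ 2 ^ 8`; all constants are multiplied by (n - m)² ≥ 1.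
  z∞-close : Close c∞ z∞
  z∞-close m n m<n = cases (threshold ℕ.≤? 2 ^ w)
    where
    open ≤-Reasoning
    d w : ℕ
    d = n ∸ m
    w = z∞ m ⊓ z∞ n
    1≤d : 1 ≤ d
    1≤d = m<n⇒0<n∸m m<n
    instance
      dd≢0 : NonZero (d * d)
      dd≢0 = ℕ.>-nonZero (*-mono-≤ 1≤d 1≤d)
    pos : ∀ w → threshold ≤ 2 ^ w → 1 ≤ w
    pos zero h = ⊥-elim (<⇒≱ (s≤s (s≤s z≤n)) (≤-trans (*-monoʳ-≤ 8 {1} (s≤s z≤n)) h))
    pos (suc w) _ = s≤s z≤n
    cases : Dec (threshold ≤ 2 ^ w) → w ≤ c∞ * (d * d)
    cases (no small) = begin
      w ≤⟨ <⇒≤ (2^-cancel-< (≤-trans (≰⇒> small) (<⇒≤ (n<2^n threshold)))) ⟩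
      threshold ≤⟨ m≤m*n threshold (d * d) ⟩
      threshold * (d * d) ≤⟨ *-monoˡ-≤ (d * d) (m≤n+m threshold (8 + cD)) ⟩
      c∞ * (d * d) ∎
    cases (yes large) = begin
      w ≤⟨ 2^-cancel-≤ (begin
        2 ^ w ≤⟨ m≤m*n (2 ^ w) (D d) {{ℕ.>-nonZero (1≤D 1≤d)}} ⟩
        2 ^ w * D d ≤⟨ KummerSize.archimedean E (difference-kum m<n) (2 ^ w) large (proj₂ ln) (proj₂ lm) (proj₁ ln) (proj₁ lm) ⟩
        192 * ∣ xnum (d × P) ∣ ≤⟨ *-mono-≤ {192} {2 ^ 8} (m≤m+n 192 64) (≤-trans (m≤m⊔n (∣ xnum (d × P) ∣) (D d)) (H-multiple 1≤d)) ⟩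
        2 ^ 8 * 2 ^ (cD * (d * d)) ≡⟨ sym (^-distribˡ-+-* 2 8 (cD * (d * d))) ⟩
        2 ^ (8 + cD * (d * d)) ∎) ⟩
      8 + cD * (d * d) ≤⟨ +-monoˡ-≤ (cD * (d * d)) (m≤m*n 8 (d * d)) ⟩
      8 * (d * d) + cD * (d * d) ≡⟨ sym (*-distribʳ-+ (d * d) 8 cD) ⟩
      (8 + cD) * (d * d) ≤⟨ *-monoˡ-≤ (d * d) (m≤m+n (8 + cD) threshold) ⟩
      c∞ * (d * d) ∎
      where
      lm : (2 ^ w * Z m ≤ X m) and (1 ≤ X m)
      lm = div-lower (X m) (Z m) w (pos w large) (m⊓n≤m (z∞ m) (z∞ n))
      ln : (2 ^ w * Z n ≤ X n) and (1 ≤ X n)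
      ln = div-lower (X n) (Z n) w (pos w large) (m⊓n≤n (z∞ m) (z∞ n))

  div-upper : ∀ x z → 1 ≤ z → x ≤ 2 ^ suc (lg (x div z)) * z
  div-upper x (suc z) _ = ≤-trans (≤-reflexive (m≡m%n+[m/n]*n x (suc z)))
    (≤-trans (+-monoˡ-≤ (x / suc z * suc z) (<⇒≤ (m%n<n x (suc z)))) (*-monoˡ-≤ (suc z) (<2^lg (x / suc z))))

  -- Chosen so that `n² ≤ c-growth * (1 + 2 * energy)` becomes homogeneous: for n at least
  -- `2 * c-growth` the additive term is absorbed by n². The leading 1 keeps `eB` positive.
  eB n₁ : ℕ
  eB = 1 + 4 * c-growth
  n₁ = n₀ + 2 * c-growth

  places : List ℕ → List (ℕ → ℕ)
  places W = z∞ ∷ map zp W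

  primeEnergy : List ℕ → ℕ → ℕ
  primeEnergy W = energy (map zp W)

  -- The condition that all primes of `Z n` lie in `W` is replaced by the size estimate it implies,
  -- which is decided by evaluation.
  record Exceptional (W : List ℕ) (n : ℕ) : Set where
    constructor exceptional-at
    field
      nonzero : 1 ≤ Z n
      large-index : n₁ ≤ n
      smooth : Z n ≤ 2 ^ (2 * primeEnergy W n)

  exceptional? : ∀ W n → Dec (Exceptional W n)
  exceptional? W n with 1 ℕ.≤? Z n | n₁ ℕ.≤? n | Z n ℕ.≤? 2 ^ (2 * primeEnergy W n)
  ... | yes p | yes q | yes r = yes (exceptional-at p q r)
  ... | no p | _ | _ = no (λ e → p (Exceptional.nonzero e))
  ... | yes _ | no q | _ = no (λ e → q (Exceptional.large-index e))
  ... | yes _ | yes _ | no r = no (λ e → r (Exceptional.smooth e))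

  -- The height is the total proximity to O over all places. For such a denominator the places of
  -- `W` and the real place carry all of it up to constants, and it grows like n².
  exceptional-energy : ∀ W n → Exceptional W n → n * n ≤ eB * energy (places W) n
  exceptional-energy W n (exceptional-at 1≤Z n₁≤n smooth) = ≤-trans (+-cancelʳ-≤ (2 * c-growth) (n * n) (4 * c-growth * en) (begin
    n * n + 2 * c-growth ≤⟨ +-monoʳ-≤ (n * n) 2c-growth≤ ⟩
    n * n + n * n ≤⟨ +-mono-≤ nn≤ nn≤ ⟩
    c-growth * h (R n) + c-growth * h (R n) ≤⟨ +-mono-≤ (*-monoʳ-≤ c-growth h≤) (*-monoʳ-≤ c-growth h≤) ⟩
    c-growth * (1 + 2 * en) + c-growth * (1 + 2 * en) ≡⟨ id c-growth en ⟩
    4 * c-growth * en + 2 * c-growth ∎)) (*-monoˡ-≤ en (n≤1+n (4 * c-growth)))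
    where
    open ≤-Reasoning
    en Σp : ℕ
    en = energy (places W) n
    Σp = primeEnergy W n
    id : ∀ c e → c * (1 + 2 * e) + c * (1 + 2 * e) ≡ 4 * c * e + 2 * c
    id = solve-∀
    nn≤ : n * n ≤ c-growth * h (R n)
    nn≤ = growing n (≤-trans (m≤m+n n₀ (2 * c-growth)) n₁≤n)
    2c-growth≤ : 2 * c-growth ≤ n * n
    2c-growth≤ = ≤-trans (≤-trans (m≤n+m (2 * c-growth) n₀) n₁≤n) (square n)
      where
      square : ∀ n → n ≤ n * n
      square zero = z≤n
      square (suc n) = m≤m*n (suc n) (suc n)
    h≤ : h (R n) ≤ 1 + 2 * en
    h≤ = lg≤ (1≤H (R n)) (begin
      H (R n) ≤⟨ ⊔-lub (div-upper (X n) (Z n) 1≤Z) (m≤n*m (Z n) (2 ^ suc (z∞ n)) {{ℕ.>-nonZero (1≤2^ (suc (z∞ n)))}}) ⟩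
      2 ^ suc (z∞ n) * Z n ≤⟨ *-monoʳ-≤ (2 ^ suc (z∞ n)) smooth ⟩
      2 ^ suc (z∞ n) * 2 ^ (2 * Σp) ≡⟨ sym (^-distribˡ-+-* 2 (suc (z∞ n)) (2 * Σp)) ⟩
      2 ^ suc (z∞ n + 2 * Σp) ≤⟨ 2^-mono (s≤s (≤-trans (+-monoˡ-≤ (2 * Σp) (m≤m+n (z∞ n) (z∞ n + 0))) (≤-reflexive (sym (*-distribˡ-+ 2 (z∞ n) Σp))))) ⟩
      2 ^ (1 + 2 * en) ∎)

  smooth⇒exceptional : ∀ W {n} → All Prime W → n₁ ≤ n → 1 ≤ Z n → (∀ {q} → Prime q → q dvd Z n → q ∈ W) → Exceptional W n
  smooth⇒exceptional W {n} WP n₁≤n 1≤Z h = exceptional-at 1≤Z n₁≤n (≤-trans (smooth-≤ W (twos WP) 1≤Z h) (bound W WP))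
    where
    twos : ∀ {W} → All Prime W → All (2 ≤_) W
    twos [] = []
    twos (p ∷ ps) = prime≥2 p ∷ twos ps
    bound : ∀ W → All Prime W → product (map (λ p → p ^ v p (Z n)) W) ≤ 2 ^ (2 * primeEnergy W n)
    bound [] [] = ≤-refl
    bound (p ∷ W) (pp ∷ WP) = begin
      p ^ v p (Z n) * product (map (λ p → p ^ v p (Z n)) W) ≤⟨ *-mono-≤ power (bound W WP) ⟩
      2 ^ (2 * zp p n) * 2 ^ (2 * primeEnergy W n) ≡⟨ sym (^-distribˡ-+-* 2 (2 * zp p n) (2 * primeEnergy W n)) ⟩
      2 ^ (2 * zp p n + 2 * primeEnergy W n) ≡⟨ cong (2 ^_) (sym (*-distribˡ-+ 2 (zp p n) (primeEnergy W n))) ⟩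
      2 ^ (2 * primeEnergy (p ∷ W) n) ∎
      where
      open ≤-Reasoning
      1≤lg : 1 ≤ lg p
      1≤lg = ≤-pred (2^-cancel-< (≤-trans (s≤s (prime≥2 pp)) (<2^lg p)))
      power : p ^ v p (Z n) ≤ 2 ^ (2 * zp p n)
      power = begin
        p ^ v p (Z n) ≤⟨ ^-monoˡ-≤ (v p (Z n)) (<⇒≤ (<2^lg p)) ⟩
        (2 ^ suc (lg p)) ^ v p (Z n) ≤⟨ ^-monoˡ-≤ (v p (Z n)) (2^-mono (+-monoˡ-≤ (lg p) 1≤lg)) ⟩
        (2 ^ (lg p + lg p)) ^ v p (Z n) ≡⟨ trans (^-*-assoc 2 (lg p + lg p) (v p (Z n))) (cong (2 ^_) (id′ (lg p) (v p (Z n)))) ⟩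
        2 ^ (2 * zp p n) ∎
        where
        id′ : ∀ l v → (l + l) * v ≡ 2 * (v * l)
        id′ = solve-∀

-- Finite products and the balance of exponents

module FinitaryLemmas where
  open import Data.Nat as ℕ using (ℕ; zero; suc; _+_; _*_; _^_; _∸_; _≤_; _<_; _⊔_; z≤n; s≤s)
  open import Data.Nat.Properties
  open import Data.Nat.Divisibility using (_∣_; ∣m⇒∣m*n; ∣n⇒∣m*n)
  open import Data.Nat.ListAction using (product)
  open import Data.Nat.Tactic.RingSolver using (solve-∀)
  open import Data.Fin as Fin using (Fin)
  open import Data.List using (List; []; _∷_; _++_; length; filter)
  open import Data.List.Properties using (length-++)
  open import Data.List.Relation.Unary.Any using (here; there)
  open import Data.List.Relation.Unary.All as All using (All; []; _∷_)
  open import Data.List.Relation.Unary.AllPairs using ([]; _∷_)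
  open import Data.List.Relation.Unary.Unique.Propositional using (Unique)
  open import Data.List.Membership.Propositional using (_∈_)
  open import Data.List.Membership.Propositional.Properties using (∈-∃++; ∈-++⁺ˡ; ∈-++⁺ʳ; ∈-++⁻)
  open import Data.Product using (∃; _×_; _,_)
  open import Data.Sum using (inj₁; inj₂)
  open import Data.Empty using (⊥-elim)
  open import Relation.Nullary using (yes; no)
  open import Relation.Unary using (Decidable)
  open import Relation.Binary.PropositionalEquality
  open Log using (lg; 2^lg≤; <2^lg; 2^-mono)

  unique-length : ∀ {A : Set} {xs ys : List A} → Unique xs → (∀ {x} → x ∈ xs → x ∈ ys) → length xs ≤ length ys
  unique-length {xs = []} _ _ = z≤n
  unique-length {xs = x ∷ xs} (x∉ ∷ u) sub with ∈-∃++ (sub (here refl))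
  ... | as , bs , refl = ≤-trans (s≤s (unique-length u sub′)) (≤-reflexive (trans (cong suc (length-++ as)) (sym (trans (length-++ as) (+-suc (length as) (length bs))))))
    where
    sub′ : ∀ {y} → y ∈ xs → y ∈ as ++ bs
    sub′ {y} y∈ with ∈-++⁻ as (sub (there y∈))
    ... | inj₁ m = ∈-++⁺ˡ m
    ... | inj₂ (here refl) = ⊥-elim (All.lookup x∉ y∈ refl)
    ... | inj₂ (there m) = ∈-++⁺ʳ as m

  sumℕ prodℕ : ∀ {s} → (Fin s → ℕ) → ℕ
  sumℕ {zero} f = 0
  sumℕ {suc s} f = f Fin.zero + sumℕ (λ i → f (Fin.suc i))
  prodℕ {zero} f = 1
  prodℕ {suc s} f = f Fin.zero * prodℕ (λ i → f (Fin.suc i))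

  ≤-sumℕ : ∀ {s} (f : Fin s → ℕ) i → f i ≤ sumℕ f
  ≤-sumℕ f Fin.zero = m≤m+n (f Fin.zero) _
  ≤-sumℕ f (Fin.suc i) = ≤-trans (≤-sumℕ (λ j → f (Fin.suc j)) i) (m≤n+m _ (f Fin.zero))

  ∣-prodℕ : ∀ {s} (f : Fin s → ℕ) {p} i → p ∣ f i → p ∣ prodℕ f
  ∣-prodℕ f Fin.zero h = ∣m⇒∣m*n _ h
  ∣-prodℕ f (Fin.suc i) h = ∣n⇒∣m*n (f Fin.zero) (∣-prodℕ (λ j → f (Fin.suc j)) i h)

  1≤prodℕ : ∀ {s} (f : Fin s → ℕ) → (∀ i → 1 ≤ f i) → 1 ≤ prodℕ f
  1≤prodℕ {zero} f h = ≤-refl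
  1≤prodℕ {suc s} f h = *-mono-≤ (h Fin.zero) (1≤prodℕ _ (λ i → h (Fin.suc i)))

  prodℕ-≤ : ∀ {s} (f g : Fin s → ℕ) t → (∀ i → f i ≤ 2 ^ (g i * t)) → prodℕ f ≤ 2 ^ (sumℕ g * t)
  prodℕ-≤ {zero} f g t h = ≤-refl
  prodℕ-≤ {suc s} f g t h = ≤-trans (*-mono-≤ (h Fin.zero) (prodℕ-≤ (λ i → f (Fin.suc i)) (λ i → g (Fin.suc i)) t (λ i → h (Fin.suc i))))
    (≤-reflexive (trans (sym (^-distribˡ-+-* 2 (g Fin.zero * t) _)) (cong (2 ^_) (sym (*-distribʳ-+ t (g Fin.zero) _)))))

  product-filter-≤ : ∀ {P : ℕ → Set} (P? : Decidable P) xs → All (1 ≤_) xs → product (filter P? xs) ≤ product xs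
  product-filter-≤ P? [] [] = ≤-refl
  product-filter-≤ P? (x ∷ xs) (1≤x ∷ h) with P? x
  ... | yes _ = *-monoʳ-≤ x (product-filter-≤ P? xs h)
  ... | no _ = ≤-trans (product-filter-≤ P? xs h) (m≤n*m (product xs) x {{ℕ.>-nonZero 1≤x}})

  power-≤-product : ∀ {b} xs → All (b ≤_) xs → b ^ length xs ≤ product xs
  power-≤-product [] [] = ≤-refl
  power-≤-product (x ∷ xs) (h ∷ hs) = *-mono-≤ h (power-≤-product xs hs)

  -- Supplies T as a power of two within a factor 2 of the m-th root of N, so that log T is exactly
  -- `ℓ`.
  root-scale : ∀ m N → 1 ≤ m → 1 ≤ N → ∃ λ ℓ → (2 ^ ℓ) ^ m ≤ N × N < 2 ^ (suc ℓ * m)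
  root-scale m@(suc _) N 1≤m 1≤N = ℓ , lower , upper
    where
    open import Data.Nat.DivMod using (_/_; m/n*n≤m; m≡m%n+[m/n]*n; m%n<n)
    ℓ = lg N / m
    lower : (2 ^ ℓ) ^ m ≤ N
    lower = ≤-trans (≤-reflexive (^-*-assoc 2 ℓ m)) (≤-trans (2^-mono (m/n*n≤m (lg N) m)) (2^lg≤ 1≤N))
    upper : N < 2 ^ (suc ℓ * m)
    upper = ≤-trans (<2^lg N) (2^-mono (≤-trans (s≤s (≤-reflexive (m≡m%n+[m/n]*n (lg N) m))) (+-monoˡ-≤ (ℓ * m) (m%n<n (lg N) m))))

  ^-distribʳ-* : ∀ m x y → (x * y) ^ m ≡ x ^ m * y ^ m
  ^-distribʳ-* zero x y = refl
  ^-distribʳ-* (suc m) x y = trans (cong (x * y *_) (^-distribʳ-* m x y)) (id x y (x ^ m) (y ^ m))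
    where
    id : ∀ a b c d → a * b * (c * d) ≡ a * c * (b * d)
    id = solve-∀

  power-sum : ∀ {x y A B Y} m → x ^ m ≤ A * Y → y ^ m ≤ B * Y → (x + y) ^ m ≤ 2 ^ m * (A + B) * Y
  power-sum {x} {y} {A} {B} {Y} m hx hy = begin
    (x + y) ^ m ≤⟨ ^-monoˡ-≤ m (+-mono-≤ (m≤m⊔n x y) (m≤n⊔m x y)) ⟩
    (x ⊔ y + (x ⊔ y)) ^ m ≡⟨ cong (_^ m) (id (x ⊔ y)) ⟩
    (2 * (x ⊔ y)) ^ m ≡⟨ ^-distribʳ-* m 2 (x ⊔ y) ⟩
    2 ^ m * (x ⊔ y) ^ m ≤⟨ *-monoʳ-≤ (2 ^ m) max≤ ⟩
    2 ^ m * ((A + B) * Y) ≡⟨ sym (*-assoc (2 ^ m) (A + B) Y) ⟩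
    2 ^ m * (A + B) * Y ∎
    where
    open ≤-Reasoning
    id : ∀ z → z + z ≡ 2 * z
    id = solve-∀
    max≤ : (x ⊔ y) ^ m ≤ (A + B) * Y
    max≤ with ⊔-sel x y
    ... | inj₁ e rewrite e = ≤-trans hx (*-monoˡ-≤ Y (m≤m+n A B))
    ... | inj₂ e rewrite e = ≤-trans hy (*-monoˡ-≤ Y (m≤n+m B A))

  open Cover using (φ)

  φ-closed : ∀ a b u → φ a b u ≡ a ^ ℕ.⌊ u /2⌋ * b ^ ℕ.⌈ u /2⌉
  φ-closed a b zero = refl
  φ-closed a b (suc zero) = sym (trans (*-identityˡ (b * 1)) (*-identityʳ b))
  φ-closed a b (suc (suc u)) = trans (cong (a * b *_) (φ-closed a b u)) (id a b (a ^ ℕ.⌊ u /2⌋) (b ^ ℕ.⌈ u /2⌉))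
    where
    id : ∀ a b x y → a * b * (x * y) ≡ a * x * (b * y)
    id = solve-∀

  -- Each of the k restricted choices saves a factor T, and m such savings are worth N up to a
  -- constant. Multiplying by `N ^ k` first avoids negative exponents.
  main-term : ∀ s N T b m → let k = ℕ.⌈ s /2⌉ in 1 ≤ N → b * T ≤ 6 * N → N ≤ (2 * T) ^ m → k ≤ s * m →
    φ (6 * N) b s ^ m ≤ 2 ^ (m * k) * 6 ^ (s * m) * N ^ (s * m ∸ k)
  main-term s N T b m 1≤N bT N≤ k≤ = *-cancelʳ-≤ _ _ (N ^ k) {{m^n≢0 N k {{ℕ.>-nonZero 1≤N}}}} (begin
    φ (6 * N) b s ^ m * N ^ k ≤⟨ *-monoʳ-≤ (φ (6 * N) b s ^ m) (^-monoˡ-≤ k N≤) ⟩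
    φ (6 * N) b s ^ m * ((2 * T) ^ m) ^ k ≡⟨ cong₂ (λ x y → x ^ m * y) (φ-closed (6 * N) b s) (trans (^-*-assoc (2 * T) m k) (trans (^-distribʳ-* (m * k) 2 T) (cong (λ e → 2 ^ (m * k) * T ^ e) (*-comm m k)))) ⟩
    ((6 * N) ^ f * b ^ k) ^ m * (2 ^ (m * k) * T ^ (k * m)) ≡⟨ cong (λ z → ((6 * N) ^ f * b ^ k) ^ m * (2 ^ (m * k) * z)) (sym (^-*-assoc T k m)) ⟩
    ((6 * N) ^ f * b ^ k) ^ m * (2 ^ (m * k) * (T ^ k) ^ m) ≡⟨ id (((6 * N) ^ f * b ^ k) ^ m) (2 ^ (m * k)) ((T ^ k) ^ m) ⟩
    2 ^ (m * k) * (((6 * N) ^ f * b ^ k) ^ m * (T ^ k) ^ m) ≡⟨ cong (2 ^ (m * k) *_) (sym (^-distribʳ-* m ((6 * N) ^ f * b ^ k) (T ^ k))) ⟩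
    2 ^ (m * k) * ((6 * N) ^ f * b ^ k * T ^ k) ^ m ≡⟨ cong (λ z → 2 ^ (m * k) * z ^ m) (trans (*-assoc ((6 * N) ^ f) (b ^ k) (T ^ k)) (cong ((6 * N) ^ f *_) (sym (^-distribʳ-* k b T)))) ⟩
    2 ^ (m * k) * ((6 * N) ^ f * (b * T) ^ k) ^ m ≤⟨ *-monoʳ-≤ (2 ^ (m * k)) (^-monoˡ-≤ m (*-monoʳ-≤ ((6 * N) ^ f) (^-monoˡ-≤ k bT))) ⟩
    2 ^ (m * k) * ((6 * N) ^ f * (6 * N) ^ k) ^ m ≡⟨ cong (λ z → 2 ^ (m * k) * z ^ m) (trans (sym (^-distribˡ-+-* (6 * N) f k)) (cong ((6 * N) ^_) (⌊n/2⌋+⌈n/2⌉≡n s))) ⟩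
    2 ^ (m * k) * ((6 * N) ^ s) ^ m ≡⟨ cong (2 ^ (m * k) *_) (trans (^-*-assoc (6 * N) s m) (^-distribʳ-* (s * m) 6 N)) ⟩
    2 ^ (m * k) * (6 ^ (s * m) * N ^ (s * m)) ≡⟨ cong (λ e → 2 ^ (m * k) * (6 ^ (s * m) * N ^ e)) (sym (m∸n+n≡m k≤)) ⟩
    2 ^ (m * k) * (6 ^ (s * m) * N ^ (s * m ∸ k + k)) ≡⟨ cong (λ z → 2 ^ (m * k) * (6 ^ (s * m) * z)) (^-distribˡ-+-* N (s * m ∸ k) k) ⟩
    2 ^ (m * k) * (6 ^ (s * m) * (N ^ (s * m ∸ k) * N ^ k)) ≡⟨ id₂ (2 ^ (m * k)) (6 ^ (s * m)) (N ^ (s * m ∸ k)) (N ^ k) ⟩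
    2 ^ (m * k) * 6 ^ (s * m) * N ^ (s * m ∸ k) * N ^ k ∎)
    where
    open ≤-Reasoning
    k f : ℕ
    k = ℕ.⌈ s /2⌉
    f = ℕ.⌊ s /2⌋
    id : ∀ a b c → a * (b * c) ≡ b * (a * c)
    id = solve-∀
    id₂ : ∀ a b c d → a * (b * (c * d)) ≡ a * b * c * d
    id₂ = solve-∀

  -- The loss T³ raised to the power `m = k + 3` is at most N³, and `3 + (s - 1) m = s m - k`. This
  -- equality with the exponent of `main-term` is what determines m.
  exceptional-term : ∀ s N T C k → 1 ≤ s → T ^ (k + 3) ≤ N →
    (C * (T * T * T) * N ^ (s ∸ 1)) ^ (k + 3) ≤ C ^ (k + 3) * N ^ (s * (k + 3) ∸ k)
  exceptional-term (suc s) N T C k 1≤s h = begin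
    (C * (T * T * T) * N ^ s) ^ m ≡⟨ trans (^-distribʳ-* m (C * (T * T * T)) (N ^ s)) (cong₂ _*_ (trans (^-distribʳ-* m C (T * T * T)) (cong (C ^ m *_) (trans (^-distribʳ-* m (T * T) T) (cong (_* T ^ m) (^-distribʳ-* m T T))))) (^-*-assoc N s m)) ⟩
    C ^ m * (T ^ m * T ^ m * T ^ m) * N ^ (s * m) ≤⟨ *-monoˡ-≤ (N ^ (s * m)) (*-monoʳ-≤ (C ^ m) (*-mono-≤ (*-mono-≤ h h) h)) ⟩
    C ^ m * (N * N * N) * N ^ (s * m) ≡⟨ id (C ^ m) N (N ^ (s * m)) ⟩
    C ^ m * N ^ (3 + s * m) ≡⟨ cong (λ e → C ^ m * N ^ e) (sym (trans (cong (_∸ k) (trans (cong (_+ s * m) (refl {x = k + 3})) (+-assoc k 3 (s * m)))) (m+n∸m≡n k (3 + s * m)))) ⟩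
    C ^ m * N ^ (suc s * m ∸ k) ∎
    where
    open ≤-Reasoning
    m = k + 3
    id : ∀ c n x → c * (n * n * n) * x ≡ c * (n * (n * (n * x)))
    id = solve-∀

-- Typical primes, exceptional indices and the total count

module Counting {s : ℕ} (E : Fin s → Curve) (G : ∀ i → XGroups.XGroup (E i))
  (𝒪 : ∀ i → Orbits.Orbit (E i) (G i)) where
  open FinitaryLemmas
  open XGroups
  open Log using (1≤2^; n<2^n; 2^-mono; 2^-cancel-≤)
  open Valuation using (v)
  open RationalValuation using (sumFin)
  open Ranges
  open Cover using (pick; total; φ; concatMap-length; ∈-concatMap; length-pick; pick-length)
  module F i = OrbitFacts (E i) (G i) (𝒪 i)
  open import Data.Nat as ℕ using (zero; suc; _+_; _*_; _^_; _∸_; _≤_; _<_; z≤n; s≤s)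
  open import Data.Nat.Properties
  open import Data.Nat.Divisibility using (_∣_; _∣?_; ∣m⇒∣m*n; ∣n⇒∣m*n; ∣⇒≤; ∣-refl)
  open import Data.Nat.DivMod using (_/_; m≡m%n+[m/n]*n; m%n<n; m/n*n≤m)
  open import Data.Nat.Primality using (Prime; prime?)
  open import Data.Nat.Primality.Factorisation using (factorise; factorisationHasAllPrimeFactors; module PrimeFactorisation)
  open import Data.Nat.ListAction using (product)
  open import Data.Nat.Tactic.RingSolver using (solve-∀)
  open import Data.Integer as ℤ using (ℤ)
  open import Data.List using (List; []; _∷_; _++_; length; map; filter; concatMap; allFin; upTo; tabulate)
  open import Data.List.Properties using (length-++; length-map; length-upTo; length-tabulate)
  open import Data.List.Relation.Unary.Any using (Any; here; there; any?)
  open import Data.List.Relation.Unary.All as All using (All; []; _∷_)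
  import Data.List.Relation.Unary.All.Properties as AllP
  open import Data.List.Relation.Unary.Unique.Propositional using (Unique)
  open import Data.List.Membership.Propositional using (_∈_; find; lose)
  open import Data.List.Membership.Propositional.Properties using (∈-++⁺ˡ; ∈-++⁺ʳ; ∈-filter⁺; ∈-filter⁻; ∈-map⁺; ∈-upTo⁺; ∈-allFin)
  open import Data.List.Membership.DecPropositional ℕ._≟_ using (_∈?_)
  open import Data.Vec as Vec using (Vec; lookup)
  open import Data.Vec.Properties using (tabulate-cong; tabulate∘lookup)
  import Data.Fin.Properties as FinP
  open import Data.Product using (∃; _×_; _,_; proj₁; proj₂)
  open import Data.Sum using (_⊎_; inj₁; inj₂)
  open import Data.Empty using (⊥-elim)
  open import Relation.Nullary using (¬_; Dec; yes; no)
  open import Relation.Nullary.Decidable using (¬?; _×-dec_)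
  open import Relation.Binary.PropositionalEquality

  vx : Fin s → ℕ → ℕ → ℤ
  vx i n p = ℤ.+ v p (F.X i n) ℤ.- ℤ.+ v p (F.Z i n)

  vx≢0 : ∀ i n p → vx i n p ≢ ℤ.+ 0 → (1 ≤ v p (F.Z i n)) ⊎ (1 ≤ v p (F.X i n))
  vx≢0 i n p ne = cases (v p (F.X i n)) (v p (F.Z i n)) ne
    where
    cases : ∀ a b → ℤ.+ a ℤ.- ℤ.+ b ≢ ℤ.+ 0 → (1 ≤ b) ⊎ (1 ≤ a)
    cases zero zero ne = ⊥-elim (ne refl)
    cases (suc a) b ne = inj₂ (s≤s z≤n)
    cases zero (suc b) ne = inj₁ (s≤s z≤n)

  κ : ℕ
  κ = sumℕ (λ i → F.disc i + F.cD i)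

  length-allFin : length (allFin s) ≡ s
  length-allFin = length-tabulate (λ i → i)

  -- The additive trace of multiplicative dependence on valuations; the first component says that no
  -- point is O.
  Related : Vec ℕ s → Set
  Related n = (∀ i → 1 ≤ F.Z i (lookup n i)) × ∃ λ (k : Fin s → ℤ) → (∀ i → k i ≢ ℤ.+ 0) ×
    (∀ {p} → Prime p → sumFin (λ i → k i ℤ.* vx i (lookup n i) p) ≡ ℤ.+ 0)

  -- Coprimality of numerator and denominator prevents the two valuations from cancelling.
  denominator-prime : ∀ i n {p} → Prime p → 1 ≤ F.Z i n → p ∣ F.Z i n → vx i n p ≢ ℤ.+ 0
  denominator-prime i n {p} pp 1≤Z d = nz (v p (F.X i n)) (v p (F.Z i n)) X≡0 (Valuation.p∣⇒1≤v pp 1≤Z d)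
    where
    X≡0 : v p (F.X i n) ≡ 0
    X≡0 with v p (F.X i n) in eq
    ... | zero = refl
    ... | suc e = ⊥-elim (PrimeDivisors.coprime-prime (XGroup.coprime (G i) (F.R i n)) pp
          (Valuation.1≤v⇒p∣ {p} {F.X i n} (subst (1 ≤_) (sym eq) (s≤s z≤n))) d)
    nz : ∀ a b → a ≡ 0 → 1 ≤ b → ℤ.+ a ℤ.- ℤ.+ b ≢ ℤ.+ 0
    nz .0 (suc b) refl _ ()

  Indices : List (Fin s × ℕ) → List (Fin s)
  Indices = map proj₁

  Agrees : Vec ℕ s → List (Fin s × ℕ) → Set
  Agrees n = All (λ (i , x) → lookup n i ≡ x)

  value : List (Fin s × ℕ) → Fin s → ℕ
  value [] i = 0
  value ((j , x) ∷ σ) i with i FinP.≟ j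
  ... | yes _ = x
  ... | no _ = value σ i

  toVec : List (Fin s × ℕ) → Vec ℕ s
  toVec σ = Vec.tabulate (value σ)

  value-agrees : ∀ n σ i → Agrees n σ → i ∈ Indices σ → value σ i ≡ lookup n i
  value-agrees n ((j , x) ∷ σ) i (e ∷ ag) m with i FinP.≟ j
  ... | yes refl = sym e
  value-agrees n ((j , x) ∷ σ) i (e ∷ ag) (here i≡j) | no ne = ⊥-elim (ne i≡j)
  value-agrees n ((j , x) ∷ σ) i (e ∷ ag) (there m) | no ne = value-agrees n σ i ag m

  toVec-agrees : ∀ n σ → Agrees n σ → (∀ i → i ∈ Indices σ) → toVec σ ≡ n
  toVec-agrees n σ ag all = trans (tabulate-cong (λ i → value-agrees n σ i ag (all i))) (tabulate∘lookup n)

  module Level (T : ℕ) where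
    D-product : Fin s → ℕ → ℕ
    D-product i zero = 1
    D-product i (suc t) = F.D i (suc t) * D-product i t

    D-product-∣ : ∀ i {p d} t → 1 ≤ d → d ≤ t → p ∣ F.D i d → p ∣ D-product i t
    D-product-∣ i zero 1≤d d≤0 h = ⊥-elim (<⇒≱ 1≤d d≤0)
    D-product-∣ i {p} {d} (suc t) 1≤d d≤ h with m≤n⇒m<n∨m≡n d≤
    ... | inj₁ (s≤s d≤t) = ∣n⇒∣m*n (F.D i (suc t)) (D-product-∣ i t 1≤d d≤t h)
    ... | inj₂ refl = ∣m⇒∣m*n (D-product i t) h

    1≤D-product : ∀ i t → 1 ≤ D-product i t
    1≤D-product i zero = ≤-refl
    1≤D-product i (suc t) = *-mono-≤ (F.1≤D i {suc t} (s≤s z≤n)) (1≤D-product i t)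

    D-product-≤ : ∀ i t → t ≤ T → D-product i t ≤ 2 ^ (t * (F.cD i * (T * T)))
    D-product-≤ i zero _ = ≤-refl
    D-product-≤ i (suc t) t≤T = ≤-trans (*-mono-≤ (≤-trans (F.D≤ i {suc t} (s≤s z≤n)) (2^-mono (*-monoʳ-≤ (F.cD i) (*-mono-≤ t≤T t≤T)))) (D-product-≤ i t (<⇒≤ t≤T)))
      (≤-reflexive (sym (^-distribˡ-+-* 2 (F.cD i * (T * T)) (t * (F.cD i * (T * T))))))

    badness : Fin s → ℕ
    badness i = F.disc i * D-product i T

    -- One integer carries all the divisibility conditions, so its size alone bounds how many large
    -- primes are excluded.
    Γ : ℕ
    Γ = prodℕ badness

    1≤Γ : 1 ≤ Γ
    1≤Γ = 1≤prodℕ badness (λ i → *-mono-≤ (F.1≤disc i) (1≤D-product i T))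

    Γ≤ : 1 ≤ T → Γ ≤ 2 ^ (κ * (T * T * T))
    Γ≤ 1≤T = prodℕ-≤ badness (λ i → F.disc i + F.cD i) (T * T * T) each
      where
      each : ∀ i → badness i ≤ 2 ^ ((F.disc i + F.cD i) * (T * T * T))
      each i = ≤-trans (*-mono-≤ (≤-trans (<⇒≤ (n<2^n (F.disc i))) (2^-mono (m≤m*n (F.disc i) (T * T * T) {{ℕ.>-nonZero (*-mono-≤ (*-mono-≤ 1≤T 1≤T) 1≤T)}})))
          (≤-trans (D-product-≤ i T ≤-refl) (≤-reflexive (cong (2 ^_) (id T (F.cD i))))))
        (≤-reflexive (trans (sym (^-distribˡ-+-* 2 (F.disc i * (T * T * T)) (F.cD i * (T * T * T)))) (cong (2 ^_) (sym (*-distribʳ-+ (T * T * T) (F.disc i) (F.cD i))))))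
        where
        id : ∀ t c → t * (c * (t * t)) ≡ c * (t * t * t)
        id = solve-∀

    Typical : ℕ → Set
    Typical p = Prime p × (T * T < p) × ¬ (p ∣ Γ)

    typical? : ∀ p → Dec (Typical p)
    typical? p = prime? p ×-dec ((T * T ℕ.<? p) ×-dec ¬? (p ∣? Γ))

    instance
      Γ≢0 : ℕ.NonZero Γ
      Γ≢0 = ℕ.>-nonZero 1≤Γ

    big-factors : List ℕ
    big-factors = filter (T * T ℕ.<?_) (PrimeFactorisation.factors (factorise Γ))

    -- The large factors of `Γ` are kept with multiplicity: their product still divides `Γ`, and
    -- `smooth-≤` tolerates repetitions.
    W : List ℕ
    W = filter prime? (range 0 (suc (T * T))) ++ big-factors

    W-prime : All Prime W
    W-prime = AllP.++⁺ (AllP.all-filter prime? (range 0 (suc (T * T)))) (AllP.filter⁺ (T * T ℕ.<?_) (PrimeFactorisation.factorsPrime (factorise Γ)))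

    not-typical⇒W : ∀ {q} → Prime q → ¬ Typical q → q ∈ W
    not-typical⇒W {q} pq ng with T * T ℕ.<? q
    ... | no small = ∈-++⁺ˡ (∈-filter⁺ prime? (∈-range 0 (suc (T * T)) z≤n (s≤s (≮⇒≥ small))) pq)
    ... | yes big with q ∣? Γ
    ...   | no nd = ⊥-elim (ng (pq , big , nd))
    ...   | yes d = ∈-++⁺ʳ (filter prime? (range 0 (suc (T * T)))) (∈-filter⁺ (T * T ℕ.<?_)
              (factorisationHasAllPrimeFactors pq (subst (q ∣_) (PrimeFactorisation.isFactorisation (factorise Γ)) d) (PrimeFactorisation.factorsPrime (factorise Γ))) big)

    -- From p > T² one gets p ≥ 2T, that is `2 ^ suc ℓ`. This weaker form keeps the estimate
    -- meaningful for `ℓ = 0`.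
    big-factors-≤ : ∀ ℓ → T ≡ 2 ^ ℓ → suc ℓ * length big-factors ≤ κ * (T * T * T)
    big-factors-≤ ℓ T≡ = 2^-cancel-≤ (begin
      2 ^ (suc ℓ * length big-factors) ≡⟨ sym (^-*-assoc 2 (suc ℓ) (length big-factors)) ⟩
      (2 ^ suc ℓ) ^ length big-factors ≤⟨ power-≤-product big-factors (All.map lower (AllP.all-filter (T * T ℕ.<?_) (PrimeFactorisation.factors (factorise Γ)))) ⟩
      product big-factors ≤⟨ product-filter-≤ (T * T ℕ.<?_) (PrimeFactorisation.factors (factorise Γ)) (All.map (λ pp → ≤-trans (s≤s z≤n) (Valuation.prime≥2 pp)) (PrimeFactorisation.factorsPrime (factorise Γ))) ⟩
      product (PrimeFactorisation.factors (factorise Γ)) ≡⟨ sym (PrimeFactorisation.isFactorisation (factorise Γ)) ⟩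
      Γ ≤⟨ Γ≤ 1≤T ⟩
      2 ^ (κ * (T * T * T)) ∎)
      where
      open ≤-Reasoning
      1≤T : 1 ≤ T
      1≤T = subst (1 ≤_) (sym T≡) (1≤2^ ℓ)
      square : ∀ t → 1 ≤ t → 2 * t ≤ suc (t * t)
      square (suc t) _ = ≤-trans (m≤m+n (2 * suc t) (t * t)) (≤-reflexive (id t))
        where
        id : ∀ t → 2 * (1 + t) + t * t ≡ 1 + (1 + t) * (1 + t)
        id = solve-∀
      lower : ∀ {p} → T * T < p → 2 ^ suc ℓ ≤ p
      lower h = ≤-trans (≤-reflexive (cong (2 *_) (sym T≡))) (≤-trans (square T 1≤T) h)

    -- The numbers up to T² fit in because `suc ℓ ≤ 2 ^ ℓ = T`. The successor of the length counts
    -- the real place.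
    W-length : ∀ ℓ → T ≡ 2 ^ ℓ → suc ℓ * suc (length W) ≤ (3 + κ) * (T * T * T)
    W-length ℓ T≡ = begin
      suc ℓ * suc (length W) ≤⟨ *-monoʳ-≤ (suc ℓ) (s≤s (≤-trans (≤-reflexive (length-++ (filter prime? (range 0 (suc (T * T)))))) (+-monoˡ-≤ (length big-factors) (≤-trans (length-filter prime? (range 0 (suc (T * T)))) (≤-reflexive (length-range 0 (suc (T * T)))))))) ⟩
      suc ℓ * (2 + T * T + length big-factors) ≡⟨ *-distribˡ-+ (suc ℓ) (2 + T * T) (length big-factors) ⟩
      suc ℓ * (2 + T * T) + suc ℓ * length big-factors ≤⟨ +-mono-≤ (*-mono-≤ ℓ<T (+-monoˡ-≤ (T * T) (*-monoʳ-≤ 2 1≤TT))) (big-factors-≤ ℓ T≡) ⟩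
      T * (2 * (T * T) + T * T) + κ * (T * T * T) ≡⟨ id T κ ⟩
      (3 + κ) * (T * T * T) ∎
      where
      open ≤-Reasoning
      open import Data.List.Properties using (length-filter)
      ℓ<T : suc ℓ ≤ T
      ℓ<T = subst (suc ℓ ≤_) (sym T≡) (n<2^n ℓ)
      1≤TT : 1 ≤ T * T
      1≤TT = *-mono-≤ (≤-trans (s≤s z≤n) ℓ<T) (≤-trans (s≤s z≤n) ℓ<T)
      id : ∀ t k → t * (2 * (t * t) + t * t) + k * (t * t * t) ≡ (3 + k) * (t * t * t)
      id = solve-∀

    typical∤disc : ∀ i {p} → Typical p → ¬ (p ∣ F.disc i)
    typical∤disc i (_ , _ , nd) h = nd (∣-prodℕ badness i (∣m⇒∣m*n (D-product i T) h))

    typical∤D : ∀ i {p} → Typical p → ∀ {d} → 1 ≤ d → d ≤ T → ¬ (p ∣ F.D i d)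
    typical∤D i (_ , _ , nd) 1≤d d≤T h = nd (∣-prodℕ badness i (∣n⇒∣m*n (F.disc i) (D-product-∣ i T 1≤d d≤T h)))

    supp : Fin s → ℕ → List ℕ
    supp i n = filter typical? (range 0 (suc (F.X i n + F.Z i n)))

    v≤ : ∀ {p m} → 1 ≤ v p m → p ≤ m
    v≤ {p} {zero} ()
    v≤ {p} {suc m} h = ∣⇒≤ (Valuation.1≤v⇒p∣ {p} {suc m} h)

    in-supp : ∀ {i n p} → Typical p → vx i n p ≢ ℤ.+ 0 → p ∈ supp i n
    in-supp {i} {n} {p} gp ne = ∈-filter⁺ typical? (∈-range 0 _ z≤n (s≤s (bound (vx≢0 i n p ne)))) gp
      where
      bound : (1 ≤ v p (F.Z i n)) ⊎ (1 ≤ v p (F.X i n)) → p ≤ F.X i n + F.Z i n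
      bound (inj₁ h) = ≤-trans (v≤ {p} h) (m≤n+m (F.Z i n) (F.X i n))
      bound (inj₂ h) = ≤-trans (v≤ {p} h) (m≤m+n (F.X i n) (F.Z i n))

    supp-typical : ∀ {i n p} → p ∈ supp i n → Typical p
    supp-typical {i} {n} h = proj₂ (∈-filter⁻ typical? {xs = range 0 (suc (F.X i n + F.Z i n))} h)

    module Box (M N : ℕ) where
      box : List ℕ
      box = range (suc M) N

      nonzero? : ∀ i p n → Dec (¬ (vx i n p ≡ ℤ.+ 0))
      nonzero? i p n = ¬? (vx i n p ℤ.≟ ℤ.+ 0)

      hits : Fin s → ℕ → List ℕ
      hits i p = filter (nonzero? i p) box

      hits-length : ∀ q {i p} → Typical p → N ≤ q * T → length (hits i p) ≤ q * 3
      hits-length q {i} {p} gp N≤ = windows (nonzero? i p) T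
        (λ {a} {b} {c} {d} a<b b<c c<d d< ha hb hc hd → F.sparse i {p} {T} (proj₁ gp) (typical∤disc i gp) (typical∤D i gp) {a} {b} {c} {d} a<b b<c c<d d<
          (divides a ha) (divides b hb) (divides c hc) (divides d hd)) q (suc M) N N≤
        where
        divides : ∀ n → ¬ (vx i n p ≡ ℤ.+ 0) → (p ∣ F.Z i n) ⊎ (p ∣ F.X i n)
        divides n h with vx≢0 i n p h
        ... | inj₁ l = inj₁ (Valuation.1≤v⇒p∣ {p} {F.Z i n} l)
        ... | inj₂ l = inj₂ (Valuation.1≤v⇒p∣ {p} {F.X i n} l)

      open Cover.Search vx supp box hits using (fresh; fresh-length; module Complete)

      fill : List (Fin s) → List (Fin s × ℕ) → List (List (Fin s × ℕ))
      fill [] done = done ∷ []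
      fill (j ∷ js) done = concatMap (λ x → fill js ((j , x) ∷ done)) box

      fill-length : ∀ rem done → length (fill rem done) ≤ N ^ length rem
      fill-length [] done = ≤-refl
      fill-length (j ∷ js) done = concatMap-length (λ x → fill js ((j , x) ∷ done)) box (≤-reflexive (length-range (suc M) N)) (λ {x} _ → fill-length js ((j , x) ∷ done))

      fill-complete : ∀ n → (∀ i → lookup n i ∈ box) → ∀ rem done → Agrees n done → (∀ i → i ∈ rem ⊎ i ∈ Indices done) →
        ∃ λ σ → σ ∈ fill rem done × Agrees n σ × (∀ i → i ∈ Indices σ)
      fill-complete n in-box [] done ag as = done , here refl , ag , λ i → done-index (as i)
        where
        done-index : ∀ {i} → i ∈ [] ⊎ i ∈ Indices done → i ∈ Indices done
        done-index (inj₂ m) = m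
      fill-complete n in-box (j ∷ js) done ag as =
        let σ , m , r = fill-complete n in-box js ((j , lookup n j) ∷ done) (refl ∷ ag) (λ i → step (as i))
        in σ , ∈-concatMap (λ x → fill js ((j , x) ∷ done)) (in-box j) m , r
        where
        step : ∀ {i} → i ∈ j ∷ js ⊎ i ∈ Indices done → i ∈ js ⊎ i ∈ Indices ((j , lookup n j) ∷ done)
        step (inj₁ (here e)) = inj₂ (here e)
        step (inj₁ (there m)) = inj₁ m
        step (inj₂ m) = inj₂ (there m)

      module Dyadic (J : ℕ) (N<2^J : N < 2 ^ J) where
        1≤eB : ∀ i → 1 ≤ F.eB i
        1≤eB i = s≤s z≤n

        close-mono : ∀ {c d z} → c ≤ d → Blocks.Close c z → Blocks.Close d z
        close-mono c≤d h m n m<n = ≤-trans (h m n m<n) (*-monoˡ-≤ _ c≤d)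

        places-close : ∀ i → All (Blocks.Close (F.c∞ i)) (F.places i W)
        places-close i = F.z∞-close i ∷ primes W W-prime
          where
          cD≤ : F.cD i ≤ F.c∞ i
          cD≤ = ≤-trans (m≤n+m (F.cD i) 8) (m≤m+n (8 + F.cD i) (F.threshold i))
          primes : ∀ W → All Prime W → All (Blocks.Close (F.c∞ i)) (map (F.zp i) W)
          primes [] [] = []
          primes (p ∷ W) (pp ∷ ps) = close-mono {F.cD i} {F.c∞ i} {F.zp i p} cD≤ (F.zp-close i pp) ∷ primes W ps

        exceptional : Fin s → List ℕ
        exceptional i = Blocks.exceptional {F.c∞ i} {F.eB i} (1≤eB i) (F.places i W) (places-close i) (F.exceptional? i W) (F.exceptional-energy i W) (suc M) J

        -- Below `n₁` the growth of the height is not yet effective, so those indices are given up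
        -- altogether.
        bad : Fin s → List ℕ
        bad i = upTo (F.n₁ i) ++ exceptional i

        bad-length : ∀ i → length (bad i) ≤ F.n₁ i + suc J * (F.eB i * (suc (length W) * (1 + 2 * F.c∞ i)))
        bad-length i = ≤-trans (≤-reflexive (length-++ (upTo (F.n₁ i)))) (+-mono-≤ (≤-reflexive (length-upTo (F.n₁ i)))
          (≤-trans (Blocks.exceptional-length {F.c∞ i} {F.eB i} (1≤eB i) (F.places i W) (places-close i) (F.exceptional? i W) (F.exceptional-energy i W) (suc M) J)
            (≤-reflexive (cong (λ l → suc J * (F.eB i * (suc l * (1 + 2 * F.c∞ i)))) (length-map (F.zp i) W)))))

        typical-prime : ∀ i n → suc M ≤ n → n < suc M + N → 1 ≤ F.Z i n → ¬ (n ∈ bad i) → ∃ λ p → Typical p × vx i n p ≢ ℤ.+ 0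
        typical-prime i n M<n n≤ 1≤Z ∉bad = decide (any? typical? factors)
          where
          instance
            Z≢0 : ℕ.NonZero (F.Z i n)
            Z≢0 = ℕ.>-nonZero 1≤Z
          factors : List ℕ
          factors = PrimeFactorisation.factors (factorise (F.Z i n))
          factors-prime : All Prime factors
          factors-prime = PrimeFactorisation.factorsPrime (factorise (F.Z i n))
          Z≡ : F.Z i n ≡ product factors
          Z≡ = PrimeFactorisation.isFactorisation (factorise (F.Z i n))
          ∈product : ∀ {p} xs → p ∈ xs → p ∣ product xs
          ∈product (x ∷ xs) (here refl) = ∣m⇒∣m*n (product xs) ∣-refl
          ∈product (x ∷ xs) (there m) = ∣n⇒∣m*n x (∈product xs m)
          n₁≤n : F.n₁ i ≤ n
          n₁≤n = ≮⇒≥ (λ l → ∉bad (∈-++⁺ˡ (∈-upTo⁺ l)))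
          decide : Dec (Any Typical factors) → ∃ λ p → Typical p × vx i n p ≢ ℤ.+ 0
          decide (yes a) = let p , p∈ , tp = find a in
            p , tp , denominator-prime i n (proj₁ tp) 1≤Z (subst (p ∣_) (sym Z≡) (∈product factors p∈))
          decide (no none) = ⊥-elim (∉bad (∈-++⁺ʳ (upTo (F.n₁ i))
            (Blocks.∈-exceptional {F.c∞ i} {F.eB i} (1≤eB i) (F.places i W) (places-close i) (F.exceptional? i W) (F.exceptional-energy i W) (suc M) J (s≤s z≤n) M<n
              (≤-trans n≤ (+-monoʳ-≤ (suc M) (<⇒≤ N<2^J)))
              (F.smooth⇒exceptional i W W-prime n₁≤n 1≤Z (λ {q} pq d → not-typical⇒W pq (λ tq → none (lose (factorisationHasAllPrimeFactors pq (subst (q ∣_) Z≡ d) factors-prime) tq)))))))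

        typical-tuples exceptional-tuples : List (Vec ℕ s)
        typical-tuples = map toVec (fresh s (allFin s) [])
        exceptional-tuples = concatMap (λ (i , rem) → concatMap (λ x → map toVec (fill rem ((i , x) ∷ []))) (bad i)) (pick (allFin s))

        total-tabulate : ∀ {m} (f : Fin s → ℤ) (g : Fin m → Fin s) → total f (tabulate g) ≡ sumFin (λ i → f (g i))
        total-tabulate {zero} f g = refl
        total-tabulate {suc m} f g = cong (λ z → f (g Fin.zero) ℤ.+ z) (total-tabulate f (λ i → g (Fin.suc i)))

        covered : ∀ n → InBox M N n → Related n → n ∈ typical-tuples ++ exceptional-tuples
        covered n in-range (1≤Z , k , k≢0 , relation) = decide (FinP.any? (λ i → lookup n i ∈? bad i))
          where
          in-box : ∀ i → lookup n i ∈ box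
          in-box i = ∈-range (suc M) N (proj₁ (in-range i)) (s≤s (proj₂ (in-range i)))
          decide : Dec (∃ λ i → lookup n i ∈ bad i) → n ∈ typical-tuples ++ exceptional-tuples
          decide (yes (i , m)) =
            let rem , picked = Cover.∈-pick (∈-allFin i)
                σ , σ∈ , ag , all = fill-complete n in-box rem ((i , lookup n i) ∷ []) (refl ∷ []) (λ j → step (Cover.pick-split (allFin s) picked (∈-allFin j)))
            in subst (_∈ typical-tuples ++ exceptional-tuples) (toVec-agrees n σ ag all)
              (∈-++⁺ʳ typical-tuples (∈-concatMap _ picked (∈-concatMap (λ x → map toVec (fill rem ((i , x) ∷ []))) m (∈-map⁺ toVec σ∈))))
            where
            step : ∀ {rem j} → j ≡ i ⊎ j ∈ rem → j ∈ rem ⊎ j ∈ Indices ((i , lookup n i) ∷ [])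
            step (inj₁ e) = inj₂ (here e)
            step (inj₂ r) = inj₁ r
          decide (no none) =
            let σ , σ∈ , ag , all = Complete.fresh-complete Typical (lookup n) k k≢0 in-box
                  (λ i → typical-prime i (lookup n i) (proj₁ (in-range i)) (s≤s (proj₂ (in-range i))) (1≤Z i) (λ m → none (i , m)))
                  (λ {i} {p} tp ne → in-supp {i} {lookup n i} {p} tp ne)
                  (λ {i} {p} tp ne → ∈-filter⁺ (nonzero? i p) (in-box i) ne)
                  (λ {i} {x} {p} → supp-typical {i} {x} {p})
                  s (allFin s) [] length-allFin [] (λ i → inj₁ (∈-allFin i))
                  (λ p tp → trans (total-tabulate _ (λ i → i)) (relation (proj₁ tp)))
            in subst (_∈ typical-tuples ++ exceptional-tuples) (toVec-agrees n σ ag all) (∈-++⁺ˡ (∈-map⁺ toVec σ∈))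

        exceptional-tuples-length : ∀ {B} → (∀ i → length (bad i) ≤ B) → length exceptional-tuples ≤ s * (B * N ^ (s ∸ 1))
        exceptional-tuples-length {B} h = concatMap-length (λ (i , rem) → concatMap (λ x → map toVec (fill rem ((i , x) ∷ []))) (bad i)) {s} {B * N ^ (s ∸ 1)} (pick (allFin s)) (≤-reflexive (trans (length-pick (allFin s)) length-allFin))
          (λ {x} x∈ → concatMap-length (λ y → map toVec (fill (proj₂ x) ((proj₁ x , y) ∷ []))) (bad (proj₁ x)) (h (proj₁ x)) (λ {y} _ → ≤-trans (≤-reflexive (length-map toVec (fill (proj₂ x) ((proj₁ x , y) ∷ []))))
            (≤-trans (fill-length (proj₂ x) ((proj₁ x , y) ∷ [])) (≤-reflexive (cong (N ^_) (cong (_∸ 1) (trans (sym (pick-length (allFin s) x∈)) length-allFin)))))))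

  module _ (m : ℕ) where
    bad-constant : Fin s → ℕ
    bad-constant i = F.n₁ i + suc m * (F.eB i * (1 + 2 * F.c∞ i)) * (3 + κ)

    bad-total : ℕ
    bad-total = sumℕ bad-constant

    -- The number of dyadic blocks is proportional to `suc ℓ`, which is exactly the factor gained in
    -- `W-length`; no logarithm remains.
    bad-length-≤ : ∀ ℓ M N N< → 1 ≤ m → ∀ i →
      length (Level.Box.Dyadic.bad (2 ^ ℓ) M N (suc ℓ * m) N< i) ≤ bad-total * (2 ^ ℓ * 2 ^ ℓ * 2 ^ ℓ)
    bad-length-≤ ℓ M N N< 1≤m i = begin
      length (Level.Box.Dyadic.bad T M N (suc ℓ * m) N< i) ≤⟨ Level.Box.Dyadic.bad-length T M N (suc ℓ * m) N< i ⟩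
      n₁ + suc (suc ℓ * m) * (e * (w * c)) ≤⟨ +-mono-≤ (m≤m*n n₁ (T * T * T) {{ℕ.>-nonZero 1≤TTT}}) (*-monoˡ-≤ (e * (w * c)) J≤) ⟩
      n₁ * (T * T * T) + suc ℓ * suc m * (e * (w * c)) ≡⟨ cong (n₁ * (T * T * T) +_) (id (suc ℓ) (suc m) e w c) ⟩
      n₁ * (T * T * T) + suc m * (e * c) * (suc ℓ * w) ≤⟨ +-monoʳ-≤ (n₁ * (T * T * T)) (*-monoʳ-≤ (suc m * (e * c)) (Level.W-length T ℓ refl)) ⟩
      n₁ * (T * T * T) + suc m * (e * c) * ((3 + κ) * (T * T * T)) ≡⟨ factor n₁ (suc m * (e * c)) (3 + κ) (T * T * T) ⟩
      bad-constant i * (T * T * T) ≤⟨ *-monoˡ-≤ (T * T * T) (≤-sumℕ bad-constant i) ⟩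
      bad-total * (T * T * T) ∎
      where
      open ≤-Reasoning
      T n₁ e c w : ℕ
      T = 2 ^ ℓ
      n₁ = F.n₁ i
      e = F.eB i
      c = 1 + 2 * F.c∞ i
      w = suc (length (Level.W T))
      1≤TTT : 1 ≤ T * T * T
      1≤TTT = *-mono-≤ (*-mono-≤ (1≤2^ ℓ) (1≤2^ ℓ)) (1≤2^ ℓ)
      J≤ : suc (suc ℓ * m) ≤ suc ℓ * suc m
      J≤ = ≤-trans (+-monoˡ-≤ (suc ℓ * m) (s≤s (z≤n {ℓ}))) (≤-reflexive (sym (*-suc (suc ℓ) m)))
      id : ∀ l m e w c → l * m * (e * (w * c)) ≡ m * (e * c) * (l * w)
      id = solve-∀
      factor : ∀ a b c t → a * t + b * (c * t) ≡ (a + b * c) * t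
      factor = solve-∀

  count : 1 ≤ s → ∃ λ C → ∀ M N → 1 ≤ N → (L : List (Vec ℕ s)) → Unique L →
    All (λ n → InBox M N n × Related n) L →
    length L ^ (ℕ.⌈ s /2⌉ + 3) ≤ C * N ^ (s * (ℕ.⌈ s /2⌉ + 3) ∸ ℕ.⌈ s /2⌉)
  count 1≤s = 2 ^ m * (C₁ + C₂) , bound
    where
    k m S C₁ C₂ : ℕ
    k = ℕ.⌈ s /2⌉
    m = k + 3
    S = 2 * (s * s)
    C₁ = (S ^ s) ^ m * (2 ^ (m * k) * 6 ^ (s * m))
    C₂ = (s * bad-total m) ^ m
    1≤m : 1 ≤ m
    1≤m = ≤-trans (s≤s z≤n) (m≤n+m 3 k)
    k≤sm : k ≤ s * m
    k≤sm = ≤-trans (m≤m+n k 3) (m≤n*m m s {{ℕ.>-nonZero 1≤s}})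
    bound : ∀ M N → 1 ≤ N → (L : List (Vec ℕ s)) → Unique L → All (λ n → InBox M N n × Related n) L →
      length L ^ m ≤ 2 ^ m * (C₁ + C₂) * N ^ (s * m ∸ k)
    bound M N 1≤N L unique all = scaled (root-scale m N 1≤m 1≤N)
      where
      open ≤-Reasoning
      scaled : (∃ λ ℓ → (2 ^ ℓ) ^ m ≤ N × N < 2 ^ (suc ℓ * m)) → length L ^ m ≤ 2 ^ m * (C₁ + C₂) * N ^ (s * m ∸ k)
      scaled (ℓ , T^m≤N , N<) = ≤-trans (^-monoˡ-≤ m L≤) (power-sum {length typical-tuples} {length exceptional-tuples} {C₁} {C₂} {N ^ (s * m ∸ k)} m typical≤ exceptional≤)
        where
        T : ℕ
        T = 2 ^ ℓ
        open Level T
        open Box M N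
        open Dyadic (suc ℓ * m) N<
        instance
          T≢0 : ℕ.NonZero T
          T≢0 = m^n≢0 2 ℓ
        L≤ : length L ≤ length typical-tuples + length exceptional-tuples
        L≤ = ≤-trans (unique-length unique (λ {n} n∈ → let in-range , related = All.lookup all n∈ in covered n in-range related)) (≤-reflexive (length-++ typical-tuples))
        T≤N : T ≤ N
        T≤N = ≤-trans (≤-trans (≤-reflexive (sym (^-identityʳ T))) (^-monoʳ-≤ T 1≤m)) T^m≤N
        -- `q` windows of length T cover the box and each contains at most three hits; since T ≤ N
        -- this gives `b * T ≤ 6 * N`.
        q b : ℕ
        q = suc (N / T)
        b = q * 3
        N≤qT : N ≤ q * T
        N≤qT = ≤-trans (≤-reflexive (m≡m%n+[m/n]*n N T)) (+-monoˡ-≤ (N / T * T) (<⇒≤ (m%n<n N T)))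
        bT≤ : b * T ≤ 6 * N
        bT≤ = begin
          q * 3 * T ≡⟨ id₁ (N / T) T ⟩
          3 * (T + N / T * T) ≤⟨ *-monoʳ-≤ 3 (+-mono-≤ T≤N (m/n*n≤m N T)) ⟩
          3 * (N + N) ≡⟨ id₂ N ⟩
          6 * N ∎
          where
          id₁ : ∀ x t → (1 + x) * 3 * t ≡ 3 * (t + x * t)
          id₁ = solve-∀
          id₂ : ∀ n → 3 * (n + n) ≡ 6 * n
          id₂ = solve-∀
        N≤2T : N ≤ (2 * T) ^ m
        N≤2T = ≤-trans (<⇒≤ N<) (≤-reflexive (sym (^-*-assoc 2 (suc ℓ) m)))
        typical≤ : length typical-tuples ^ m ≤ C₁ * N ^ (s * m ∸ k)
        typical≤ = begin
          length typical-tuples ^ m ≤⟨ ^-monoˡ-≤ m (≤-trans (≤-reflexive (length-map toVec (Cover.Search.fresh vx supp box hits s (allFin s) [])))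
            -- Free choices are bounded by `6 * N` instead of N, because the search requires `b ≤ a`
            -- and b may exceed N when T is small.
            (Cover.Search.fresh-length vx supp box hits (6 * N) b s (≤-trans (m≤m*n b T) bT≤) (≤-trans (≤-reflexive (length-range (suc M) N)) (m≤n*m N 6)) Typical
              (λ {i} {x} {p} → supp-typical {i} {x} {p}) (λ {i} {p} tp → hits-length q {i} {p} tp N≤qT) s (allFin s) [] length-allFin ≤-refl)) ⟩
          (S ^ s * φ (6 * N) b s) ^ m ≡⟨ ^-distribʳ-* m (S ^ s) (φ (6 * N) b s) ⟩
          (S ^ s) ^ m * φ (6 * N) b s ^ m ≤⟨ *-monoʳ-≤ ((S ^ s) ^ m) (main-term s N T b m 1≤N bT≤ N≤2T k≤sm) ⟩
          (S ^ s) ^ m * (2 ^ (m * k) * 6 ^ (s * m) * N ^ (s * m ∸ k)) ≡⟨ sym (*-assoc ((S ^ s) ^ m) (2 ^ (m * k) * 6 ^ (s * m)) (N ^ (s * m ∸ k))) ⟩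
          C₁ * N ^ (s * m ∸ k) ∎
        exceptional≤ : length exceptional-tuples ^ m ≤ C₂ * N ^ (s * m ∸ k)
        exceptional≤ = begin
          length exceptional-tuples ^ m ≤⟨ ^-monoˡ-≤ m (≤-trans (exceptional-tuples-length (bad-length-≤ m ℓ M N N< 1≤m)) (≤-reflexive (id (bad-total m) s (T * T * T) (N ^ (s ∸ 1))))) ⟩
          (s * bad-total m * (T * T * T) * N ^ (s ∸ 1)) ^ m ≤⟨ exceptional-term s N T (s * bad-total m) k 1≤s T^m≤N ⟩
          C₂ * N ^ (s * m ∸ k) ∎
          where
          id : ∀ b s t n → s * (b * t * n) ≡ s * b * t * n
          id = solve-∀

-- From multiplicative dependence of abscissas to relations between valuations

module EllipticCount where
  open GroupLaw
  open FinitaryLemmas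
  open XGroups
  open import Data.Nat as ℕ using (zero; suc; _≤_; _*_; _+_; _∸_; _^_)
  open import Data.Integer as ℤ using (ℤ; ∣_∣)
  open import Data.Rational using (↥_; ↧_)
  open import Data.Maybe using (just)
  open import Data.Vec using (Vec; lookup)
  open import Data.List using (List; length)
  open import Data.List.Relation.Unary.All as All using (All)
  open import Data.List.Relation.Unary.Unique.Propositional using (Unique)
  open import Data.Product using (∃; _×_; _,_; proj₁; proj₂)
  open import Relation.Binary.PropositionalEquality
  open RationalValuation using (relation; full-support; sumFin-cong; 1≤↧)

  module _ (E : Curve) where
    open EllipticXGroup E using (xgroup)
    open Height E xgroup using (monoid; heightConstants)
    open import Algebra.Properties.Monoid.Mult monoid using () renaming (_×_ to _·_)
    open Orbits E xgroup

    mul-≡ : ∀ n (P : Add.Point E) → proj₁ (n · P) ≡ mul E n (proj₁ P)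
    mul-≡ zero P = refl
    mul-≡ (suc n) P = cong (add E (proj₁ P)) (mul-≡ n P)

    orbit-of : ∀ P Q → OnCurve E P → OnCurve E Q → NonTorsion E P → Orbit
    orbit-of P Q cP cQ nt = orbit heightConstants (P , cP) (Q , cQ)
      (λ n 1≤n e → nt n 1≤n (trans (sym (mul-≡ n (P , cP))) (cong proj₁ e)))

  result : (s : ℕ) → 1 ≤ s → (E : Fin s → Curve) → (P Q : Fin s → Pt) →
    (∀ i → OnCurve (E i) (P i)) → (∀ i → OnCurve (E i) (Q i)) → (∀ i → NonTorsion (E i) (P i)) →
    ∃ λ C → ∀ M N → 1 ≤ N → (L : List (Vec ℕ s)) → Unique L →
      All (λ n → InBox M N n × Good E P Q n) L →
      length L ^ (ℕ.⌈ s /2⌉ + 3) ≤ C * N ^ (s * (ℕ.⌈ s /2⌉ + 3) ∸ ℕ.⌈ s /2⌉)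
  result s 1≤s E P Q cP cQ nt =
    let C , bound = count 1≤s
    in C , λ M N 1≤N L unique all → bound M N 1≤N L unique (All.map (λ {n} (b , g) → b , related n g) all)
    where
    G : ∀ i → XGroup (E i)
    G i = EllipticXGroup.xgroup (E i)
    𝒪 : ∀ i → Orbits.Orbit (E i) (G i)
    𝒪 i = orbit-of (E i) (P i) (Q i) (cP i) (cQ i) (nt i)
    open Counting E G 𝒪

    R-≡ : ∀ i n → proj₁ (F.R i n) ≡ add (E i) (mul (E i) n (P i)) (Q i)
    R-≡ i n = cong (λ A → add (E i) A (Q i)) (mul-≡ (E i) n (P i , cP i))

    abscissa : ∀ E A {γ} → xcoord A ≡ just γ → KummerInteger.xn E A ≡ ↥ γ × KummerInteger.xd E A ≡ ↧ γ
    abscissa E (aff x y) refl = refl , refl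

    related : ∀ n → Good E P Q n → Related n
    related n (γ , x≡ , nz , dependent) =
      (λ i → subst (1 ≤_) (sym (cong ∣_∣ (proj₂ (coords i)))) (1≤↧ (γ i))) ,
      proj₁ support , proj₁ (proj₂ support) ,
      (λ {p} pp → trans (sumFin-cong (λ i → cong (proj₁ support i ℤ.*_) (valuation i p))) (relation γ nz (proj₁ support) (proj₂ (proj₂ support)) pp))
      where
      support = full-support γ nz dependent
      coords : ∀ i → KummerInteger.xn (E i) (proj₁ (F.R i (lookup n i))) ≡ ↥ (γ i) × KummerInteger.xd (E i) (proj₁ (F.R i (lookup n i))) ≡ ↧ (γ i)
      coords i = abscissa (E i) _ (trans (cong xcoord (R-≡ i (lookup n i))) (x≡ i))
      valuation : ∀ i p → vx i (lookup n i) p ≡ RationalValuation.vℚ p (γ i)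
      valuation i p = cong₂ (λ u w → ℤ.+ Valuation.v p u ℤ.- ℤ.+ Valuation.v p w) (cong ∣_∣ (proj₁ (coords i))) (cong ∣_∣ (proj₂ (coords i)))

open import Data.Nat using (_≤_; _*_; _+_; _∸_; _^_; ⌈_/2⌉)
open import Data.Vec using (Vec)
open import Data.List using (List; length)
open import Data.List.Relation.Unary.All using (All)
open import Data.List.Relation.Unary.Unique.Propositional using (Unique)
open import Data.Product using (∃-syntax; _×_)

theorem2p4 : (s : ℕ) → 2 ≤ s →
    (E : Fin s → Curve) → (P Q : Fin s → Pt) →
    (∀ i → OnCurve (E i) (P i)) → (∀ i → OnCurve (E i) (Q i)) →
    (∀ i → NonTorsion (E i) (P i)) →
    ∃[ C ] (∀ (M N : ℕ) → 1 ≤ N → (L : List (Vec ℕ s)) → Unique L →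
    All (λ n → InBox M N n × Good E P Q n) L →
    length L ^ (⌈ s /2⌉ + 3) ≤ C * N ^ (s * (⌈ s /2⌉ + 3) ∸ ⌈ s /2⌉))
theorem2p4 s 2≤s = EllipticCount.result s (<⇒≤ 2≤s)
  where open import Data.Nat.Properties using (<⇒≤)
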